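{- Let $\hat F^{\star}_7$ be the $3$-graph with vertex set $\{a,b,c,d,x,y,z\}$ and edge set $\{abc, abd, acd, xab, xcd, yac, ybd, zad, zbc, xyz\}$. Then $\pi_{u}(\hat F^{\star}_7)=1/4$.
   Context: A $3$-graph is a pair $H=(V,E)$ with $E\subseteq [V]^3$; $abc$ denotes the edge $\{a,b,c\}$. $H$ is $F$-free if it contains no (not necessarily induced) copy of $F$. For $d\in[0,1]$, $\mu>0$, $H=(V,E)$ is $(d,\mu)$-dense if every $U\subseteq V$ satisfies $|[U]^3\cap E|\ge d\binom{|U|}{3}-\mu|V|^3$. The uniform Turán density is $\pi_{u}(F)=\sup\{d\in[0,1]:$ for every $\mu>0$ and $n_0\in\mathbb N$ there is an $F$-free $(d,\mu)$-dense $3$-graph $H$ with $|V(H)|\ge n_0\}$. -}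

module Defs where

open import Data.Nat using (ℕ; _<ᵇ_; _≥_; _^_)
open import Data.Nat.Combinatorics using (_C_)
open import Data.Bool using (Bool; true; false; _∧_; if_then_else_)
open import Data.Fin using (Fin; toℕ; zero; suc)
open import Data.Fin.Subset using (Subset; ∣_∣)
open import Data.Vec using (lookup)
open import Data.List using (List; []; _∷_; map; concatMap; allFin)
open import Data.Nat.ListAction using (sum)
open import Data.Integer using (+_)
open import Data.Rational using (ℚ; _/_; _*_; _-_; _≤_; _<_; 0ℚ)
open import Data.Product using (Σ; ∃; _×_; _,_)
open import Relation.Binary.PropositionalEquality using (_≡_)
open import Relation.Nullary using (¬_)
open import Function.Definitions using (Injective)

-- A 3-graph on the vertex set Fin n.  The edge indicator E is given on
-- ordered triples and required to be symmetric, so that it is really a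
-- predicate on 3-element sets {a,b,c}; its values on triples with a
-- repeated vertex are irrelevant (never used below).
record Graph3 (n : ℕ) : Set where
  field
    E      : Fin n → Fin n → Fin n → Bool
    sym₁₂  : ∀ a b c → E a b c ≡ E b a c
    sym₂₃  : ∀ a b c → E a b c ≡ E a c b
open Graph3 public

edgesIn : ∀ {n} → Graph3 n → Subset n → ℕ
edgesIn {n} H U =
  sum (concatMap (λ i → concatMap (λ j → map (λ k →
        if (toℕ i <ᵇ toℕ j) ∧ (toℕ j <ᵇ toℕ k)
             ∧ lookup U i ∧ lookup U j ∧ lookup U k ∧ E H i j k
        then 1 else 0)
      (allFin n)) (allFin n)) (allFin n))

ℕ→ℚ : ℕ → ℚ
ℕ→ℚ m = + m / 1

Dense : ∀ {n} → ℚ → ℚ → Graph3 n → Set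
Dense {n} d μ H =
  (U : Subset n) → d * ℕ→ℚ (∣ U ∣ C 3) - μ * ℕ→ℚ (n ^ 3) ≤ ℕ→ℚ (edgesIn H U)

vA : Fin 7
vB : Fin 7
vC : Fin 7
vD : Fin 7
vX : Fin 7
vY : Fin 7
vZ : Fin 7
vA = zero
vB = suc zero
vC = suc (suc zero)
vD = suc (suc (suc zero))
vX = suc (suc (suc (suc zero)))
vY = suc (suc (suc (suc (suc zero))))
vZ = suc (suc (suc (suc (suc (suc zero)))))

F7-edges : List (Fin 7 × Fin 7 × Fin 7)
F7-edges =
  (vA , vB , vC) ∷ (vA , vB , vD) ∷ (vA , vC , vD) ∷ (vX , vA , vB) ∷ (vX , vC , vD) ∷
  (vY , vA , vC) ∷ (vY , vB , vD) ∷ (vZ , vA , vD) ∷ (vZ , vB , vC) ∷ (vX , vY , vZ) ∷ []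

data _∈T_ {m : ℕ} (t : Fin m × Fin m × Fin m) : List (Fin m × Fin m × Fin m) → Set where
  here  : ∀ {ts} → t ∈T (t ∷ ts)
  there : ∀ {s ts} → t ∈T ts → t ∈T (s ∷ ts)

ContainsF7 : ∀ {n} → Graph3 n → Set
ContainsF7 {n} H =
  Σ (Fin 7 → Fin n) λ φ → Injective _≡_ _≡_ φ ×
    (∀ a b c → (a , b , c) ∈T F7-edges → E H (φ a) (φ b) (φ c) ≡ true)

F7-free : ∀ {n} → Graph3 n → Set
F7-free H = ¬ ContainsF7 H

-- d belongs to the set whose supremum is π_u(F̂⋆₇):
-- for every μ>0 and n₀ there is an F̂⋆₇-free (d,μ)-dense H with |V(H)| ≥ n₀
Achievable : ℚ → Set
Achievable d =
  (μ : ℚ) → 0ℚ < μ → (n₀ : ℕ) →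
  Σ ℕ λ n → n ≥ n₀ × Σ (Graph3 n) λ H → F7-free H × Dense d μ H

-- π_u(F̂⋆₇) = q, for a rational q, stated for the (downward closed) set
-- S = {d ∈ [0,1] : Achievable d}: every d ∈ [0,q) lies in S, no d ∈ (q,1] does.
πu-F7-is : ℚ → Set
πu-F7-is q =
  ((d : ℚ) → 0ℚ ≤ d → d < q → Achievable d) ×
  ((d : ℚ) → q < d → d ≤ + 1 / 1 → ¬ Achievable d)

{-# OPTIONS --safe #-}
module Submission where

-- Lower bound: a skew Hadamard matrix is the sign matrix of a tournament in which, because the matrix is
-- a multiple of an isometry, in- and out-degrees within any vertex set nearly balance, so that about a
-- quarter of the triples of the set are cyclic triangles.  If abc and abd are cyclic then acd is not, so
-- the 3-graph of cyclic triangles has no K₄⁻, hence no F̂⋆₇.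
--
-- Upper bound: colour the pairs of vertices and partition the vertices so that, up to small errors,
-- edges are distributed according to weights depending only on the colours of the three pairs and the
-- cells of the three vertices.  A random sample of vertices then carries a reduced hypergraph in which
-- F̂⋆₇, placed in the order a < y < z < b < x < c < d or in the reverse order, has tiny density.  By
-- Ramsey's theorem there is a large set of indices all of whose triples either have density below ¼ + ε
-- or all at least ¼ + ε.  In the second case the squared degrees Φ exceed ¼, possibly after reversing
-- the order.  Fix an index a and keep the pairs whose colours have, on average over many reference
-- indices, a large codegree.  In the link of a choose a colour p₀ whose neighbourhood has nearly maximal
-- measure S ≥ ½ in many classes.  A colour in this neighbourhood has degree at most 1 - S outside the
-- triangles through p₀ and the remaining ones have degree at most S, so squared degrees above ¼ force
-- triangles p₀ p q.  Each such triangle gives b, c, d and the colours of ab, ac, ad.  The vertices x, y,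
-- z are found among the other indices: as the Gram matrix of the codegree functions is nearly constant,
-- Bessel's inequality shows that all but boundedly many indices inherit a large codegree from the
-- reference average.  In the first case the sampled cells, weighted equally, span too few edges for H to
-- be (d , μ)-dense: the density condition extends from sets to [0,1]-valued weights because both sides
-- are multi-affine.

open import Data.Nat as ℕ using (ℕ; zero; suc)
open import Data.Fin using (Fin; zero; suc)
open import Data.Bool using (Bool; true; false; _∧_; _∨_; not)
open import Data.Product using (Σ; ∃; _×_; _,_; proj₁; proj₂)
open import Data.Sum using (_⊎_; inj₁; inj₂)
open import Data.Empty using (⊥; ⊥-elim)
open import Relation.Nullary using (¬_; yes; no)
open import Relation.Binary.PropositionalEquality
import Data.Nat.Properties as ℕₚ
import Data.Fin.Properties as Finₚ
import Data.Integer as ℤ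
import Data.Rational.Properties as Ratₚ

-- The value ¼ is the maximum of S (1 - S): without triangles through p₀, colours in its
-- neighbourhood, of measure S, have degree at most 1 - S and the others at most S, so the mean
-- squared degree is at most S (1 - S)² + (1 - S) S². Squares enter through 2fg ≤ f² + g²: a triple
-- density is nearly bounded by the mean product of a degree f from one side and a degree g from the
-- other, both of the colour of the longest pair; this is why the order may have to be reversed. The
-- obstacle is correlation. A triangle p₀ p q supplies the edges abc, abd, acd, but the pattern also
-- has zbc, ybd, xcd, and a single colour of bc must serve both abc and zbc. Densities of the two
-- edges separately do not give this; hence only colours with a large codegree into the references
-- are retained. The Gram values are made nearly constant by Ramsey's theorem for quadruples; then
-- any two long averages of codegree functions are close in L², so a test correlated with one is
-- correlated with the other. The regular partition and the sample are obtained only up to double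
-- negation, which suffices because the goal is a contradiction.

-- The rational field with opaque operations and a ring solver.

module Field where
  open import Data.Rational as Rat public using (ℚ; 0ℚ; 1ℚ; ½; _≤_; _<_)
  open import Data.Rational.Properties as Ratₚ public using (≤-refl; ≤-reflexive; ≤-trans; ≤-antisym; ≤-total; _≤?_; _<?_; <⇒≤; ≮⇒≥; ≰⇒>; <-irrefl; <-≤-trans; ≤-<-trans; <-trans)
  open import Algebra.Bundles using (CommutativeRing)
  open import Algebra.Structures using (IsCommutativeRing)
  open import Algebra.Solver.Ring.AlmostCommutativeRing using (AlmostCommutativeRing; fromCommutativeRing; _-Raw-AlmostCommutative⟶_)
  import Algebra.Solver.Ring as RingSolver
  open import Relation.Binary.Consequences using (dec⇒weaklyDec)
  open import Level using (0ℓ)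

  infixl 7 _*_
  infixl 6 _+_ _-_
  infix 8 -_

  -- The operations of ℚ are made opaque so that unification treats them as rigid.
  opaque
    _+_ : ℚ → ℚ → ℚ
    _+_ = Rat._+_

    _*_ : ℚ → ℚ → ℚ
    _*_ = Rat._*_

    -_ : ℚ → ℚ
    -_ = Rat.-_

    +-transparent : ∀ a b → a + b ≡ a Rat.+ b
    +-transparent a b = refl

    *-transparent : ∀ a b → a * b ≡ a Rat.* b
    *-transparent a b = refl

    neg-transparent : ∀ a → - a ≡ Rat.- a
    neg-transparent a = refl

    isRing : IsCommutativeRing _≡_ _+_ _*_ -_ 0ℚ 1ℚ
    isRing = Ratₚ.+-*-isCommutativeRing

    +-mono-≤ : ∀ {a b c d} → a ≤ b → c ≤ d → a + c ≤ b + d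
    +-mono-≤ = Ratₚ.+-mono-≤

    +-mono-<-≤ : ∀ {a b c d} → a < b → c ≤ d → a + c < b + d
    +-mono-<-≤ = Ratₚ.+-mono-<-≤

    0≤* : ∀ {a b} → 0ℚ ≤ a → 0ℚ ≤ b → 0ℚ ≤ a * b
    0≤* {a} {b} p q = Ratₚ.nonNegative⁻¹ (a * b)
      {{Ratₚ.nonNeg*nonNeg⇒nonNeg a {{Rat.nonNegative p}} b {{Rat.nonNegative q}}}}

    0<* : ∀ {a b} → 0ℚ < a → 0ℚ < b → 0ℚ < a * b
    0<* {a} {b} p q = Ratₚ.positive⁻¹ (a * b) {{Ratₚ.pos*pos⇒pos a {{Rat.positive p}} b {{Rat.positive q}}}}

    cancelˡ : ∀ {a b} c → 0ℚ < c → c * a ≤ c * b → a ≤ b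
    cancelˡ c h k = Ratₚ.*-cancelˡ-≤-pos c {{Rat.positive h}} k

    cancelˡ-< : ∀ {a b} c → 0ℚ ≤ c → c * a < c * b → a < b
    cancelˡ-< c h k = Ratₚ.*-cancelˡ-<-nonNeg c {{Rat.nonNegative h}} k

    inv : ∀ {a} → 0ℚ < a → ℚ
    inv {a} h = Rat.1/_ a {{Ratₚ.pos⇒nonZero a {{Rat.positive h}}}}

    inv-pos : ∀ {a} (h : 0ℚ < a) → 0ℚ < inv h
    inv-pos {a} h = Ratₚ.positive⁻¹ _ {{Ratₚ.1/pos⇒pos a {{Rat.positive h}}}}

    *-inv : ∀ {a} (h : 0ℚ < a) → a * inv h ≡ 1ℚ
    *-inv {a} h = Ratₚ.*-inverseʳ a {{Ratₚ.pos⇒nonZero a {{Rat.positive h}}}}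

  _-_ : ℚ → ℚ → ℚ
  a - b = a + - b

  open IsCommutativeRing isRing public using
    (+-assoc; +-comm; +-identityˡ; +-identityʳ; *-assoc; *-comm; *-identityˡ; *-identityʳ; distribˡ; distribʳ; zeroˡ; zeroʳ)
    renaming (-‿inverseʳ to +-inverseʳ)

  ringᶜ : CommutativeRing 0ℓ 0ℓ
  ringᶜ = record { isCommutativeRing = isRing }

  -- Coefficients live in the transparent ring, where constants compute, while the target ring is
  -- opaque; the identity map joins the two.
  idHom : CommutativeRing.rawRing Ratₚ.+-*-commutativeRing -Raw-AlmostCommutative⟶ fromCommutativeRing ringᶜ
  idHom = record { ⟦_⟧ = λ x → x ; +-homo = λ a b → sym (+-transparent a b) ; *-homo = λ a b → sym (*-transparent a b)
                 ; -‿homo = λ a → sym (neg-transparent a) ; 0-homo = refl ; 1-homo = refl }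

  open RingSolver _ _ idHom (dec⇒weaklyDec Ratₚ._≟_) public using (solve; _:+_; _:*_; _:-_; :-_; _:=_; con)

-- Ordered-field certificates, finite sums and weighted averages.

module Base where
  import Data.Rational as Rat
  open Field

  0<1 : 0ℚ < 1ℚ
  0<1 = Ratₚ.positive⁻¹ 1ℚ {{_}}

  0≤1 : 0ℚ ≤ 1ℚ
  0≤1 = <⇒≤ 0<1

  0≤+ : ∀ {a b} → 0ℚ ≤ a → 0ℚ ≤ b → 0ℚ ≤ a + b
  0≤+ {a} {b} p q = subst (_≤ a + b) (+-identityˡ 0ℚ) (+-mono-≤ p q)

  0<+ : ∀ {a b} → 0ℚ < a → 0ℚ ≤ b → 0ℚ < a + b
  0<+ {a} {b} p q = subst (_< a + b) (+-identityˡ 0ℚ) (+-mono-<-≤ p q)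

  +-monoˡ-≤ : ∀ {a b} c → a ≤ b → a + c ≤ b + c
  +-monoˡ-≤ c h = +-mono-≤ h ≤-refl

  +-monoʳ-≤ : ∀ {a b} c → a ≤ b → c + a ≤ c + b
  +-monoʳ-≤ c h = +-mono-≤ (≤-refl {c}) h

  diff : ∀ {a b} → a ≤ b → 0ℚ ≤ b - a
  diff {a} {b} h = subst (_≤ b - a) (+-inverseʳ a) (+-monoˡ-≤ (- a) h)

  diff< : ∀ {a b} → a < b → 0ℚ < b - a
  diff< {a} {b} h = subst (_< b - a) (+-inverseʳ a) (+-mono-<-≤ h ≤-refl)

  -- Certificate form: most estimates below exhibit the slack `c` as a sum of nonnegative products
  -- and leave the identity to the ring solver.
  le : ∀ {a b} c → 0ℚ ≤ c → b ≡ a + c → a ≤ b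
  le {a} c h refl = subst (_≤ a + c) (+-identityʳ a) (+-monoʳ-≤ a h)

  lt : ∀ {a b} c → 0ℚ < c → b ≡ a + c → a < b
  lt {a} c h refl = subst₂ _<_ (+-identityˡ a) (+-comm c a) (+-mono-<-≤ h (≤-refl {a}))

  undiff : ∀ {a b} → 0ℚ ≤ b - a → a ≤ b
  undiff {a} {b} h = le (b - a) h (lem a b)
    where
    lem : ∀ a b → b ≡ a + (b - a)
    lem = solve 2 (λ a b → b := a :+ (b :- a)) refl

  0≤sq : ∀ a → 0ℚ ≤ a * a
  0≤sq a with ≤-total 0ℚ a
  ... | inj₁ h = 0≤* h h
  ... | inj₂ h = subst (0ℚ ≤_) (lem a) (0≤* (diff h) (diff h))
    where
    lem : ∀ a → (0ℚ - a) * (0ℚ - a) ≡ a * a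
    lem = solve 1 (λ a → ((con 0ℚ) :- a) :* ((con 0ℚ) :- a) := a :* a) refl

  *-mono : ∀ {a b c d} → 0ℚ ≤ a → 0ℚ ≤ c → a ≤ b → c ≤ d → a * c ≤ b * d
  *-mono {a} {b} {c} {d} p q h k =
    le ((b - a) * c + b * (d - c)) (0≤+ (0≤* (diff h) q) (0≤* (≤-trans p h) (diff k)))
       (lem a b c d)
    where
    lem : ∀ a b c d → b * d ≡ a * c + ((b - a) * c + b * (d - c))
    lem = solve 4 (λ a b c d → b :* d := a :* c :+ ((b :- a) :* c :+ b :* (d :- c))) refl

  *-monoʳ : ∀ {a b} c → 0ℚ ≤ c → a ≤ b → c * a ≤ c * b
  *-monoʳ {a} {b} c h k = le (c * (b - a)) (0≤* h (diff k)) (lem a b c)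
    where
    lem : ∀ a b c → c * b ≡ c * a + c * (b - a)
    lem = solve 3 (λ a b c → c :* b := c :* a :+ c :* (b :- a)) refl

  *-monoˡ : ∀ {a b} c → 0ℚ ≤ c → a ≤ b → a * c ≤ b * c
  *-monoˡ {a} {b} c h k = subst₂ _≤_ (*-comm c a) (*-comm c b) (*-monoʳ c h k)

  ≤⊎> : ∀ a b → a ≤ b ⊎ b < a
  ≤⊎> a b with a ≤? b
  ... | yes h = inj₁ h
  ... | no h = inj₂ (≰⇒> h)

  no< : ∀ {a b} → a ≤ b → b < a → ⊥
  no< p q = <-irrefl refl (<-≤-trans q p)

  ⟦_⟧ : Bool → ℚ
  ⟦ true ⟧ = 1ℚ
  ⟦ false ⟧ = 0ℚ

  0≤⟦⟧ : ∀ b → 0ℚ ≤ ⟦ b ⟧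
  0≤⟦⟧ true = 0≤1
  0≤⟦⟧ false = ≤-refl

  ⟦⟧≤1 : ∀ b → ⟦ b ⟧ ≤ 1ℚ
  ⟦⟧≤1 true = ≤-refl
  ⟦⟧≤1 false = 0≤1

  ⟦∧⟧ : ∀ a b → ⟦ a ∧ b ⟧ ≡ ⟦ a ⟧ * ⟦ b ⟧
  ⟦∧⟧ true b = sym (*-identityˡ _)
  ⟦∧⟧ false b = sym (zeroˡ _)

  infix 5 _⊑_
  abstract
    -- Boolean, so that thresholds can stand inside sums as indicators; abstract, so that type
    -- checking never evaluates a comparison of rationals.
    _⊑_ : ℚ → ℚ → Bool
    a ⊑ b with a ≤? b
    ... | yes _ = true
    ... | no _ = false

    ⊑-true : ∀ {a b} → (a ⊑ b) ≡ true → a ≤ b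
    ⊑-true {a} {b} e with a ≤? b
    ... | yes h = h
    ⊑-true {a} {b} () | no _

    ⊑-false : ∀ {a b} → (a ⊑ b) ≡ false → b < a
    ⊑-false {a} {b} e with a ≤? b
    ... | no h = ≰⇒> h
    ⊑-false {a} {b} () | yes _

    ⊑-intro : ∀ {a b} → a ≤ b → (a ⊑ b) ≡ true
    ⊑-intro {a} {b} h with a ≤? b
    ... | yes _ = refl
    ... | no n = ⊥-elim (n h)

  Unit : ℚ → Set
  Unit a = 0ℚ ≤ a × a ≤ 1ℚ

  Unit⟦⟧ : ∀ b → Unit ⟦ b ⟧
  Unit⟦⟧ b = 0≤⟦⟧ b , ⟦⟧≤1 b

  Unit* : ∀ {a b} → Unit a → Unit b → Unit (a * b)
  Unit* {a} {b} (p , q) (r , s) = 0≤* p r , subst (a * b ≤_) (*-identityˡ 1ℚ) (*-mono p r q s)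

  opaque
    ∑ : ∀ {n} → (Fin n → ℚ) → ℚ
    ∑ {zero} f = 0ℚ
    ∑ {suc n} f = f zero + ∑ (λ i → f (suc i))

    ∑-cong : ∀ {n} {f g : Fin n → ℚ} → (∀ i → f i ≡ g i) → ∑ f ≡ ∑ g
    ∑-cong {zero} h = refl
    ∑-cong {suc n} h = cong₂ _+_ (h zero) (∑-cong (λ i → h (suc i)))

    ∑-mono : ∀ {n} {f g : Fin n → ℚ} → (∀ i → f i ≤ g i) → ∑ f ≤ ∑ g
    ∑-mono {zero} h = ≤-refl
    ∑-mono {suc n} h = +-mono-≤ (h zero) (∑-mono (λ i → h (suc i)))

    ∑-+ : ∀ {n} (f g : Fin n → ℚ) → ∑ (λ i → f i + g i) ≡ ∑ f + ∑ g
    ∑-+ {zero} f g = sym (+-identityˡ 0ℚ)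
    ∑-+ {suc n} f g = trans (cong ((f zero + g zero) +_) (∑-+ (λ i → f (suc i)) (λ i → g (suc i)))) (lem _ _ _ _)
      where
      lem : ∀ a b c d → a + b + (c + d) ≡ a + c + (b + d)
      lem = solve 4 (λ a b c d → a :+ b :+ (c :+ d) := a :+ c :+ (b :+ d)) refl

    ∑-*ˡ : ∀ {n} c (f : Fin n → ℚ) → ∑ (λ i → c * f i) ≡ c * ∑ f
    ∑-*ˡ {zero} c f = sym (zeroʳ c)
    ∑-*ˡ {suc n} c f = trans (cong (c * f zero +_) (∑-*ˡ c (λ i → f (suc i)))) (sym (distribˡ c _ _))

    ∑-*ʳ : ∀ {n} c (f : Fin n → ℚ) → ∑ (λ i → f i * c) ≡ ∑ f * c
    ∑-*ʳ c f = trans (∑-cong (λ i → *-comm (f i) c)) (trans (∑-*ˡ c f) (*-comm c _))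

    ∑-0 : ∀ {n} → ∑ {n} (λ _ → 0ℚ) ≡ 0ℚ
    ∑-0 {zero} = refl
    ∑-0 {suc n} = trans (+-identityˡ _) (∑-0 {n})

    ∑-nonneg : ∀ {n} {f : Fin n → ℚ} → (∀ i → 0ℚ ≤ f i) → 0ℚ ≤ ∑ f
    ∑-nonneg {n} {f} h = subst (_≤ ∑ f) (∑-0 {n}) (∑-mono h)

    ∑-neg : ∀ {n} (f : Fin n → ℚ) → ∑ (λ i → - f i) ≡ - ∑ f
    ∑-neg f = trans (∑-cong (λ i → lem (f i))) (trans (∑-*ˡ (- 1ℚ) f) (sym (lem (∑ f))))
      where
      lem : ∀ a → - a ≡ (- 1ℚ) * a
      lem = solve 1 (λ a → :- a := (:- (con 1ℚ)) :* a) refl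

    ∑-- : ∀ {n} (f g : Fin n → ℚ) → ∑ (λ i → f i - g i) ≡ ∑ f - ∑ g
    ∑-- f g = trans (∑-+ f (λ i → - g i)) (cong (∑ f +_) (∑-neg g))

    ∑-swap : ∀ {m n} (f : Fin m → Fin n → ℚ) → ∑ (λ i → ∑ (λ j → f i j)) ≡ ∑ (λ j → ∑ (λ i → f i j))
    ∑-swap {zero} {n} f = sym (∑-0 {n})
    ∑-swap {suc m} f = trans (cong (∑ (f zero) +_) (∑-swap (λ i → f (suc i)))) (sym (∑-+ (f zero) _))

    ∑-zero : (f : Fin 0 → ℚ) → ∑ f ≡ 0ℚ
    ∑-zero f = refl

    ∑-suc : ∀ {n} (f : Fin (suc n) → ℚ) → ∑ f ≡ f zero + ∑ (λ i → f (suc i))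
    ∑-suc f = refl

    term≤∑ : ∀ {n} {f : Fin n → ℚ} → (∀ i → 0ℚ ≤ f i) → ∀ i → f i ≤ ∑ f
    term≤∑ {suc n} {f} h zero = le _ (∑-nonneg (λ i → h (suc i))) refl
    term≤∑ {suc n} {f} h (suc i) = ≤-trans (term≤∑ (λ i → h (suc i)) i) (le _ (h zero) (+-comm (f zero) _))

    ∑-<⇒∃ : ∀ {n} {f g : Fin n → ℚ} → ∑ f < ∑ g → ∃ λ i → f i < g i
    ∑-<⇒∃ {zero} h = ⊥-elim (<-irrefl refl h)
    ∑-<⇒∃ {suc n} {f} {g} h with f zero <? g zero
    ... | yes k = zero , k
    ... | no k with ∑ (λ i → f (suc i)) <? ∑ (λ i → g (suc i))
    ...   | yes l = let i , q = ∑-<⇒∃ l in suc i , q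
    ...   | no l = ⊥-elim (no< (+-mono-≤ (≮⇒≥ k) (≮⇒≥ l)) h)

  ∑-∑* : ∀ {m n} (f : Fin m → ℚ) (g : Fin n → ℚ) → ∑ (λ i → ∑ (λ j → f i * g j)) ≡ ∑ f * ∑ g
  ∑-∑* f g = trans (∑-cong (λ i → ∑-*ˡ (f i) g)) (∑-*ʳ (∑ g) f)

  -- A sum of ones, so that counts and constant sums need no conversion; `nat-fromℕ` identifies it
  -- with the usual embedding.
  nat : ℕ → ℚ
  nat n = ∑ {n} (λ _ → 1ℚ)

  ∑-const : ∀ {n} c → ∑ {n} (λ _ → c) ≡ nat n * c
  ∑-const {n} c = trans (∑-cong {n} (λ _ → sym (*-identityˡ c))) (∑-*ʳ {n} c (λ _ → 1ℚ))

  opaque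
    unfolding ∑

    0≤nat : ∀ n → 0ℚ ≤ nat n
    0≤nat n = ∑-nonneg {n} (λ _ → 0≤1)

    0<nat : ∀ n → 0ℚ < nat (suc n)
    0<nat n = 0<+ 0<1 (0≤nat n)

    nat-+ : ∀ m n → nat (m ℕ.+ n) ≡ nat m + nat n
    nat-+ zero n = sym (+-identityˡ _)
    nat-+ (suc m) n = trans (cong (1ℚ +_) (nat-+ m n)) (sym (+-assoc 1ℚ (nat m) (nat n)))

    nat-* : ∀ m n → nat (m ℕ.* n) ≡ nat m * nat n
    nat-* zero n = sym (zeroˡ (nat n))
    nat-* (suc m) n = trans (nat-+ n (m ℕ.* n)) (trans (cong (nat n +_) (nat-* m n)) (lem (nat m) (nat n)))
      where
      lem : ∀ a b → b + a * b ≡ (1ℚ + a) * b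
      lem = solve 2 (λ a b → b :+ a :* b := ((con 1ℚ) :+ a) :* b) refl

    nat-mono : ∀ {m n} → m ℕ.≤ n → nat m ≤ nat n
    nat-mono {n = n} ℕ.z≤n = 0≤nat n
    nat-mono (ℕ.s≤s h) = +-monoʳ-≤ 1ℚ (nat-mono h)

  𝔼 : ∀ {k} → (Fin k → ℚ) → (Fin k → ℚ) → ℚ
  𝔼 w f = ∑ (λ i → w i * f i)

  record Dist {k} (w : Fin k → ℚ) : Set where
    field
      w≥0 : ∀ i → 0ℚ ≤ w i
      w∑1 : ∑ w ≡ 1ℚ
  open Dist public

  module _ {k} {w : Fin k → ℚ} where

    𝔼-cong : ∀ {f g} → (∀ i → f i ≡ g i) → 𝔼 w f ≡ 𝔼 w g
    𝔼-cong h = ∑-cong (λ i → cong (w i *_) (h i))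

    𝔼-+ : ∀ f g → 𝔼 w (λ i → f i + g i) ≡ 𝔼 w f + 𝔼 w g
    𝔼-+ f g = trans (∑-cong (λ i → distribˡ (w i) (f i) (g i))) (∑-+ _ _)

    𝔼-- : ∀ f g → 𝔼 w (λ i → f i - g i) ≡ 𝔼 w f - 𝔼 w g
    𝔼-- f g = trans (∑-cong (λ i → lem (w i) (f i) (g i))) (∑-- _ _)
      where
      lem : ∀ a b c → a * (b - c) ≡ a * b - a * c
      lem = solve 3 (λ a b c → a :* (b :- c) := a :* b :- a :* c) refl

    𝔼-*ˡ : ∀ c f → 𝔼 w (λ i → c * f i) ≡ c * 𝔼 w f
    𝔼-*ˡ c f = trans (∑-cong (λ i → lem (w i) c (f i))) (∑-*ˡ c _)
      where
      lem : ∀ a b c → a * (b * c) ≡ b * (a * c)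
      lem = solve 3 (λ a b c → a :* (b :* c) := b :* (a :* c)) refl

    𝔼-*ʳ : ∀ c f → 𝔼 w (λ i → f i * c) ≡ 𝔼 w f * c
    𝔼-*ʳ c f = trans (𝔼-cong (λ i → *-comm (f i) c)) (trans (𝔼-*ˡ c f) (*-comm c _))

    𝔼-swap-∑ : ∀ {n} (f : Fin n → Fin k → ℚ) → 𝔼 w (λ r → ∑ (λ i → f i r)) ≡ ∑ (λ i → 𝔼 w (f i))
    𝔼-swap-∑ f = trans (∑-cong (λ r → sym (∑-*ˡ (w r) (λ i → f i r)))) (∑-swap _)

    module _ (D : Dist w) where

      𝔼-mono : ∀ {f g} → (∀ i → f i ≤ g i) → 𝔼 w f ≤ 𝔼 w g
      𝔼-mono h = ∑-mono (λ i → *-monoʳ (w i) (w≥0 D i) (h i))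

      𝔼-const : ∀ c → 𝔼 w (λ _ → c) ≡ c
      𝔼-const c = trans (∑-*ʳ c w) (trans (cong (_* c) (w∑1 D)) (*-identityˡ c))

      𝔼-≤ : ∀ {f} c → (∀ i → f i ≤ c) → 𝔼 w f ≤ c
      𝔼-≤ c h = subst (_ ≤_) (𝔼-const c) (𝔼-mono h)

      𝔼-≥ : ∀ {f} c → (∀ i → c ≤ f i) → c ≤ 𝔼 w f
      𝔼-≥ c h = subst (_≤ _) (𝔼-const c) (𝔼-mono h)

      𝔼-Unit : ∀ {f} → (∀ i → Unit (f i)) → Unit (𝔼 w f)
      𝔼-Unit h = 𝔼-≥ 0ℚ (λ i → proj₁ (h i)) , 𝔼-≤ 1ℚ (λ i → proj₂ (h i))

  𝔼-swap : ∀ {k l} (w : Fin k → ℚ) (w' : Fin l → ℚ) (f : Fin k → Fin l → ℚ) →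
    𝔼 w (λ i → 𝔼 w' (f i)) ≡ 𝔼 w' (λ j → 𝔼 w (λ i → f i j))
  𝔼-swap w w' f = trans (𝔼-cong {w = w} (λ i → refl)) (trans (𝔼-swap-∑ {w = w} (λ j i → w' j * f i j))
    (∑-cong (λ j → 𝔼-*ˡ {w = w} (w' j) (λ i → f i j))))

  2ᵣ 4ᵣ 8ᵣ 16ᵣ 32ᵣ 64ᵣ ¼ : ℚ
  2ᵣ = ℤ.+ 2 Rat./ 1
  4ᵣ = ℤ.+ 4 Rat./ 1
  8ᵣ = ℤ.+ 8 Rat./ 1
  16ᵣ = ℤ.+ 16 Rat./ 1
  32ᵣ = ℤ.+ 32 Rat./ 1
  64ᵣ = ℤ.+ 64 Rat./ 1
  ¼ = ℤ.+ 1 Rat./ 4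

  0<½ : 0ℚ < ½
  0<½ = Ratₚ.positive⁻¹ ½ {{_}}

  0<¼ : 0ℚ < ¼
  0<¼ = Ratₚ.positive⁻¹ ¼ {{_}}

  0<2 : 0ℚ < 2ᵣ
  0<2 = Ratₚ.positive⁻¹ 2ᵣ {{_}}

  0<4 : 0ℚ < 4ᵣ
  0<4 = Ratₚ.positive⁻¹ 4ᵣ {{_}}

  0<8 : 0ℚ < 8ᵣ
  0<8 = Ratₚ.positive⁻¹ 8ᵣ {{_}}

  0<16 : 0ℚ < 16ᵣ
  0<16 = Ratₚ.positive⁻¹ 16ᵣ {{_}}

  0<32 : 0ℚ < 32ᵣ
  0<32 = Ratₚ.positive⁻¹ 32ᵣ {{_}}

  0<64 : 0ℚ < 64ᵣ
  0<64 = Ratₚ.positive⁻¹ 64ᵣ {{_}}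

  pow : ℚ → ℕ → ℚ
  pow c zero = 1ℚ
  pow c (suc K) = c * pow c K

  0<pow : ∀ {c} → 0ℚ < c → ∀ K → 0ℚ < pow c K
  0<pow h zero = 0<1
  0<pow h (suc K) = 0<* h (0<pow h K)

  pow≤1 : ∀ {c} → Unit c → ∀ K → Unit (pow c K)
  pow≤1 h zero = 0≤1 , ≤-refl
  pow≤1 h (suc K) = Unit* h (pow≤1 h K)

-- Counting in linearly ordered index sets.

module Count where
  open import Data.Nat using (_<ᵇ_)
  open import Data.Fin using (toℕ)
  open Field
  open Base

  infix 5 _≺_
  _≺_ : ∀ {n} → Fin n → Fin n → Bool
  x ≺ y = toℕ x <ᵇ toℕ y

  _≡ᶠ_ : ∀ {n} → Fin n → Fin n → Bool
  zero ≡ᶠ zero = true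
  zero ≡ᶠ suc y = false
  suc x ≡ᶠ zero = false
  suc x ≡ᶠ suc y = x ≡ᶠ y

  ∣_∣ : ∀ {n} → (Fin n → Bool) → ℚ
  ∣ A ∣ = ∑ (λ x → ⟦ A x ⟧)

  before : ∀ {n} → (Fin n → Bool) → Fin n → ℚ
  before A x = ∑ (λ y → ⟦ y ≺ x ⟧ * ⟦ A y ⟧)

  0≤before : ∀ {n} (A : Fin n → Bool) x → 0ℚ ≤ before A x
  0≤before A x = ∑-nonneg (λ y → 0≤* (0≤⟦⟧ (y ≺ x)) (0≤⟦⟧ (A y)))

  trichotomy : ∀ {n} (x y : Fin n) → ⟦ x ≺ y ⟧ + ⟦ y ≺ x ⟧ + ⟦ x ≡ᶠ y ⟧ ≡ 1ℚ
  trichotomy zero zero = trans (+-assoc _ _ _) (trans (+-identityˡ _) (+-identityˡ _))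
  trichotomy zero (suc y) = trans (+-identityʳ _) (+-identityʳ _)
  trichotomy (suc x) zero = trans (+-identityʳ _) (+-identityˡ _)
  trichotomy (suc x) (suc y) = trichotomy x y

  ∑-≡ᶠ : ∀ {n} (x : Fin n) (g : Fin n → ℚ) → ∑ (λ y → ⟦ x ≡ᶠ y ⟧ * g y) ≡ g x
  ∑-≡ᶠ zero g = trans (∑-suc _) (trans (cong₂ _+_ (*-identityˡ _)
    (trans (∑-cong (λ i → zeroˡ _)) ∑-0)) (+-identityʳ _))
  ∑-≡ᶠ (suc x) g = trans (∑-suc _) (trans (cong₂ _+_ (zeroˡ _) (∑-≡ᶠ x (λ i → g (suc i)))) (+-identityˡ _))

  before-suc : ∀ {n} (A : Fin (suc n) → Bool) x → before A (suc x) ≡ ⟦ A zero ⟧ + before (λ y → A (suc y)) x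
  before-suc A x = trans (∑-suc _) (cong (_+ before (λ y → A (suc y)) x) (*-identityˡ _))

  nat-suc : ∀ n → nat (suc n) ≡ 1ℚ + nat n
  nat-suc n = ∑-suc _

  nat-0 : nat 0 ≡ 0ℚ
  nat-0 = ∑-zero _

  -- The members counted are among the first `B` members of `A`. Every later demand for room below
  -- or between chosen indices is paid for by discarding such early members.
  early : ∀ {n} (A : Fin n → Bool) B → ∑ (λ x → ⟦ A x ⟧ * ⟦ not (nat B ⊑ before A x) ⟧) ≤ nat B
  early {zero} A B = subst (_≤ nat B) (sym (∑-zero _)) (0≤nat B)
  early {suc n} A zero = ≤-trans (∑-mono {g = λ _ → 0ℚ} bound) (≤-reflexive (trans ∑-0 (sym nat-0)))
    where
    bound : ∀ x → ⟦ A x ⟧ * ⟦ not (nat 0 ⊑ before A x) ⟧ ≤ 0ℚ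
    bound x with nat 0 ⊑ before A x in eq
    ... | true = ≤-reflexive (zeroʳ _)
    ... | false = ⊥-elim (no< (subst (_≤ before A x) (sym nat-0) (0≤before A x)) (⊑-false eq))
  early {suc n} A (suc B) = subst₂ _≤_ (sym (∑-suc _)) (sym (nat-suc B)) (go (A zero) refl)
    where
    A' : Fin n → Bool
    A' y = A (suc y)
    step : ∀ b → A zero ≡ b → ∀ x → nat B ≤ before A' x → b ≡ true → nat (suc B) ≤ before A (suc x)
    step b e x h refl = subst₂ _≤_ (sym (nat-suc B)) (sym (trans (before-suc A x) (cong (λ c → ⟦ c ⟧ + before A' x) e))) (+-monoʳ-≤ 1ℚ h)
    mono : ∀ b c {a} → (b ≡ true → c ≡ true) → ⟦ a ⟧ * ⟦ not c ⟧ ≤ ⟦ a ⟧ * ⟦ not b ⟧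
    mono false c {a} h = *-monoʳ _ (0≤⟦⟧ a) (⟦⟧≤1 (not c))
    mono true true h = ≤-refl
    mono true false h with () ← h refl
    go : ∀ b → A zero ≡ b →
      ⟦ A zero ⟧ * ⟦ not (nat (suc B) ⊑ before A zero) ⟧ + ∑ (λ x → ⟦ A (suc x) ⟧ * ⟦ not (nat (suc B) ⊑ before A (suc x)) ⟧)
      ≤ 1ℚ + nat B
    go true e = +-mono-≤ (proj₂ (Unit* (Unit⟦⟧ (A zero)) (Unit⟦⟧ (not (nat (suc B) ⊑ before A zero)))))
      (≤-trans (∑-mono (λ x → mono (nat B ⊑ before A' x) (nat (suc B) ⊑ before A (suc x)) {A (suc x)} (λ h → ⊑-intro (step true e x (⊑-true h) refl)))) (early A' B))
    go false e = subst (_≤ 1ℚ + nat B) (sym (trans (cong (_+ rest) (trans (cong (λ c → ⟦ c ⟧ * ⟦ not (nat (suc B) ⊑ before A zero) ⟧) e) (zeroˡ _))) (+-identityˡ rest)))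
      (≤-trans (∑-mono (λ x → mono (nat (suc B) ⊑ before A' x) (nat (suc B) ⊑ before A (suc x)) {A (suc x)}
          (λ h → ⊑-intro (subst (nat (suc B) ≤_) (sym (eq0 x)) (⊑-true h)))))
        (subst (∑ (λ x → ⟦ A' x ⟧ * ⟦ not (nat (suc B) ⊑ before A' x) ⟧) ≤_) (nat-suc B) (early A' (suc B))))
      where
      rest : ℚ
      rest = ∑ (λ x → ⟦ A (suc x) ⟧ * ⟦ not (nat (suc B) ⊑ before A (suc x)) ⟧)
      eq0 : ∀ x → before A (suc x) ≡ before A' x
      eq0 x = trans (before-suc A x) (trans (cong (λ c → ⟦ c ⟧ + before A' x) e) (+-identityˡ _))

  pick : ∀ {n} {A C : Fin n → Bool} → ∣ C ∣ < ∣ A ∣ → ∃ λ x → A x ≡ true × C x ≡ false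
  pick {n} {A} {C} h with ∑-<⇒∃ h
  ... | x , q with A x in eA | C x in eC
  ...   | true | false = x , eA , eC
  ...   | true | true = ⊥-elim (<-irrefl refl q)
  ...   | false | true = ⊥-elim (no< 0≤1 q)
  ...   | false | false = ⊥-elim (<-irrefl refl q)

  ∧-true : ∀ {a b} → (a ∧ b) ≡ true → a ≡ true × b ≡ true
  ∧-true {true} {true} h = refl , refl

  ≺-trans : ∀ {n} {x y z : Fin n} → (x ≺ y) ≡ true → (y ≺ z) ≡ true → (x ≺ z) ≡ true
  ≺-trans {x = zero} {suc y} {suc z} p q = refl
  ≺-trans {x = suc x} {suc y} {suc z} p q = ≺-trans {x = x} {y} {z} p q


  pair : ∀ {n} → (Fin n → Bool) → Fin n → Fin n → Bool
  pair Z x z = (x ≺ z) ∧ (Z x ∧ Z z)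

  ∑₂ : ∀ {n} → (Fin n → Fin n → ℚ) → ℚ
  ∑₂ f = ∑ (λ x → ∑ (λ z → f x z))

  ∑₂-mono : ∀ {n} {f g : Fin n → Fin n → ℚ} → (∀ x z → f x z ≤ g x z) → ∑₂ f ≤ ∑₂ g
  ∑₂-mono h = ∑-mono (λ x → ∑-mono (h x))

  ∑₂-cong : ∀ {n} {f g : Fin n → Fin n → ℚ} → (∀ x z → f x z ≡ g x z) → ∑₂ f ≡ ∑₂ g
  ∑₂-cong h = ∑-cong (λ x → ∑-cong (h x))

  ∑₂-+ : ∀ {n} (f g : Fin n → Fin n → ℚ) → ∑₂ (λ x z → f x z + g x z) ≡ ∑₂ f + ∑₂ g
  ∑₂-+ f g = trans (∑-cong (λ x → ∑-+ (f x) (g x))) (∑-+ _ _)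

  ∑₂-*ˡ : ∀ {n} c (f : Fin n → Fin n → ℚ) → ∑₂ (λ x z → c * f x z) ≡ c * ∑₂ f
  ∑₂-*ˡ c f = trans (∑-cong (λ x → ∑-*ˡ c (f x))) (∑-*ˡ c _)

  pairs : ∀ {n} → (Fin n → Bool) → ℚ
  pairs Z = ∑₂ (λ x z → ⟦ pair Z x z ⟧)

  private
    split : ∀ a b c → ⟦ a ∧ (b ∧ c) ⟧ ≡ ⟦ a ⟧ * (⟦ b ⟧ * ⟦ c ⟧)
    split a b c = trans (⟦∧⟧ a _) (cong (⟦ a ⟧ *_) (⟦∧⟧ b c))

  idem : ∀ b → ⟦ b ⟧ * ⟦ b ⟧ ≡ ⟦ b ⟧
  idem true = *-identityˡ _
  idem false = zeroˡ _

  pairs-count : ∀ {n} (Z : Fin n → Bool) → pairs Z + pairs Z + ∣ Z ∣ ≡ ∣ Z ∣ * ∣ Z ∣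
  pairs-count {n} Z = trans (cong₂ _+_ (cong (pairs Z +_) flip) diag) (trans (cong (_+ ∑₂ C) (sym (∑₂-+ A B)))
      (trans (sym (∑₂-+ _ C)) (trans (∑₂-cong total) (∑-∑* (λ x → ⟦ Z x ⟧) (λ z → ⟦ Z z ⟧)))))
    where
    A B C : Fin n → Fin n → ℚ
    A x z = ⟦ pair Z x z ⟧
    B x z = ⟦ pair Z z x ⟧
    C x z = ⟦ x ≡ᶠ z ⟧ * (⟦ Z x ⟧ * ⟦ Z z ⟧)
    flip : pairs Z ≡ ∑₂ B
    flip = ∑-swap _
    diag : ∣ Z ∣ ≡ ∑₂ C
    diag = ∑-cong (λ x → sym (trans (∑-≡ᶠ x (λ z → ⟦ Z x ⟧ * ⟦ Z z ⟧)) (idem (Z x))))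
    lem : ∀ a b c p q → a * (p * q) + b * (q * p) + c * (p * q) ≡ (a + b + c) * (p * q)
    lem = solve 5 (λ a b c p q → a :* (p :* q) :+ b :* (q :* p) :+ c :* (p :* q) := (a :+ b :+ c) :* (p :* q)) refl
    total : ∀ x z → A x z + B x z + C x z ≡ ⟦ Z x ⟧ * ⟦ Z z ⟧
    total x z = trans (cong₂ (λ u v → u + v + C x z) (split (x ≺ z) (Z x) (Z z)) (split (z ≺ x) (Z z) (Z x)))
      (trans (lem _ _ _ _ _) (trans (cong (_* (⟦ Z x ⟧ * ⟦ Z z ⟧)) (trichotomy x z)) (*-identityˡ _)))

-- Iterated choice of a colour with nearly maximal neighbourhoods.

module Extract where
  open import Data.Fin.Properties using (any?)
  import Data.Bool.Properties as Boolₚ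
  open import Relation.Nullary.Decidable using (_×-dec_)
  open Field
  open Base
  open Count

  ∣∣-mono : ∀ {n} {A C : Fin n → Bool} → (∀ x → A x ≡ true → C x ≡ true) → ∣ A ∣ ≤ ∣ C ∣
  ∣∣-mono {A = A} {C} h = ∑-mono (λ x → go x (A x) refl)
    where
    go : ∀ x a → A x ≡ a → ⟦ A x ⟧ ≤ ⟦ C x ⟧
    go x true e = subst₂ (λ a c → ⟦ a ⟧ ≤ ⟦ c ⟧) (sym e) (sym (h x e)) ≤-refl
    go x false e = subst (λ a → ⟦ a ⟧ ≤ ⟦ C x ⟧) (sym e) (0≤⟦⟧ (C x))

  0≤∣∣ : ∀ {n} (A : Fin n → Bool) → 0ℚ ≤ ∣ A ∣
  0≤∣∣ A = ∑-nonneg (λ x → 0≤⟦⟧ (A x))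

  module Link {N k : ℕ} (P : Fin N → Fin k → ℚ) (D : ∀ x → Dist (P x))
    (L : Fin N → Fin N → Fin k → Fin k → Bool) where

    f : Fin N → Fin N → Fin k → ℚ
    f x z q = 𝔼 (P x) (λ p → ⟦ L x z p q ⟧)

    f-Unit : ∀ x z q → Unit (f x z q)
    f-Unit x z q = 𝔼-Unit (D x) (λ p → Unit⟦⟧ (L x z p q))

    exceeds : ℚ → Fin N → Fin N → Fin k → Bool
    exceeds T x z q = not (f x z q ⊑ T)

    above : ℚ → Fin N → Fin N → ℚ
    above T x z = 𝔼 (P z) (λ q → ⟦ exceeds T x z q ⟧)

    Few : ℚ → ℚ → (Fin N → Bool) → Set
    Few c T Z = ∑₂ (λ x z → ⟦ pair Z x z ⟧ * above T x z) ≤ c * (∣ Z ∣ * ∣ Z ∣)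

    shrink : ℚ → (Fin N → Bool) → Fin N → Fin k → Fin N → Bool
    shrink T Z b q x = Z x ∧ ((x ≺ b) ∧ exceeds T x b q)

    exceeds-true : ∀ {T x z q} → exceeds T x z q ≡ true → T ≤ f x z q
    exceeds-true {T} {x} {z} {q} h with f x z q ⊑ T in eq
    exceeds-true h | false = <⇒≤ (⊑-false eq)

    exceeds-false : ∀ {T x z q} → exceeds T x z q ≡ false → f x z q ≤ T
    exceeds-false {T} {x} {z} {q} h with f x z q ⊑ T in eq
    exceeds-false h | true = ⊑-true eq

    -- `X` collects the colours that must not be chosen as p₀; in the application these are the
    -- colours through which too many copies of the pattern pass.
    module Search (X : Fin N → Fin k → Bool) (c : ℚ) (hc : Unit c)
      (hX : ∀ b → 𝔼 (P b) (λ q → ⟦ X b q ⟧) ≤ c) where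

      Hit : ℚ → (Fin N → Bool) → Fin N → Fin k → Set
      Hit T Z b q = Z b ≡ true × X b q ≡ false × c * ∣ Z ∣ ≤ ∣ shrink T Z b q ∣

      -- Averaging over the colours of a class: without a hit, every colour outside `X` exceeds `T`
      -- in fewer than `c ∣ Z ∣` classes, and the colours of `X` have mass at most `c`, so each
      -- class contributes at most `2c ∣ Z ∣`.
      step : ∀ T Z → Few (c + c) T Z ⊎ (∃ λ b → ∃ λ q → Hit T Z b q)
      step T Z with any? (λ b → any? (λ q → (Z b Boolₚ.≟ true) ×-dec ((X b q Boolₚ.≟ false) ×-dec (c * ∣ Z ∣ ≤? ∣ shrink T Z b q ∣))))
      ... | yes h = inj₂ h
      ... | no h = inj₁ (≤-trans (≤-reflexive rearrange) (≤-trans (∑-mono inner) (≤-reflexive total)))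
        where
        n : ℚ
        n = ∣ Z ∣
        rearrange : ∑₂ (λ x z → ⟦ pair Z x z ⟧ * above T x z)
          ≡ ∑ (λ z → 𝔼 (P z) (λ q → ∑ (λ x → ⟦ pair Z x z ⟧ * ⟦ exceeds T x z q ⟧)))
        rearrange = trans (∑-swap _) (∑-cong (λ z → trans (∑-cong (λ x → sym (𝔼-*ˡ {w = P z} ⟦ pair Z x z ⟧ (λ q → ⟦ exceeds T x z q ⟧))))
          (sym (𝔼-swap-∑ {w = P z} (λ x q → ⟦ pair Z x z ⟧ * ⟦ exceeds T x z q ⟧)))))
        split : ∀ a b c d → ⟦ a ∧ (b ∧ c) ⟧ * ⟦ d ⟧ ≡ ⟦ c ⟧ * ⟦ b ∧ (a ∧ d) ⟧
        split true true true d = refl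
        split true true false d = trans (zeroˡ _) (sym (zeroˡ _))
        split true false c d = trans (zeroˡ _) (sym (zeroʳ _))
        split false true c d = trans (zeroˡ _) (sym (zeroʳ _))
        split false false c d = trans (zeroˡ _) (sym (zeroʳ _))
        count : ∀ z q → ∑ (λ x → ⟦ pair Z x z ⟧ * ⟦ exceeds T x z q ⟧) ≡ ⟦ Z z ⟧ * ∣ shrink T Z z q ∣
        count z q = trans (∑-cong (λ x → split (x ≺ z) (Z x) (Z z) (exceeds T x z q))) (∑-*ˡ ⟦ Z z ⟧ _)
        sub : ∀ z q → ∣ shrink T Z z q ∣ ≤ n
        sub z q = ∣∣-mono {A = shrink T Z z q} {C = Z} (λ x e → proj₁ (∧-true e))
        bound : ∀ z q → ∑ (λ x → ⟦ pair Z x z ⟧ * ⟦ exceeds T x z q ⟧) ≤ ⟦ Z z ⟧ * (c * n + ⟦ X z q ⟧ * n)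
        bound z q = subst (_≤ ⟦ Z z ⟧ * (c * n + ⟦ X z q ⟧ * n)) (sym (count z q)) (go (Z z) (X z q) refl refl)
          where
          go : ∀ a b → Z z ≡ a → X z q ≡ b → ⟦ a ⟧ * ∣ shrink T Z z q ∣ ≤ ⟦ a ⟧ * (c * n + ⟦ b ⟧ * n)
          go false b e e' = ≤-reflexive (trans (zeroˡ _) (sym (zeroˡ _)))
          go true true e e' = *-monoʳ 1ℚ 0≤1 (≤-trans (sub z q)
            (le (c * n) (0≤* (proj₁ hc) (0≤∣∣ Z)) (lem c n)))
            where
            lem : ∀ c n → c * n + 1ℚ * n ≡ n + c * n
            lem = solve 2 (λ c n → c :* n :+ (con 1ℚ) :* n := n :+ c :* n) refl
          go true false e e' = *-monoʳ 1ℚ 0≤1 (le _ (diff (<⇒≤ (≰⇒> (λ l → h (z , q , e , e' , l))))) (lem (c * n) ∣ shrink T Z z q ∣ n))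
            where
            lem : ∀ c s n → c + 0ℚ * n ≡ s + (c - s)
            lem = solve 3 (λ c s n → c :+ (con 0ℚ) :* n := s :+ (c :- s)) refl
        inner : ∀ z → 𝔼 (P z) (λ q → ∑ (λ x → ⟦ pair Z x z ⟧ * ⟦ exceeds T x z q ⟧)) ≤ ⟦ Z z ⟧ * (c * n + c * n)
        inner z = ≤-trans (𝔼-mono (D z) (bound z)) (≤-trans (≤-reflexive (trans (𝔼-*ˡ ⟦ Z z ⟧ _)
          (cong (⟦ Z z ⟧ *_) (trans (𝔼-+ (λ _ → c * n) (λ q → ⟦ X z q ⟧ * n)) (cong₂ _+_ (𝔼-const (D z) (c * n)) (𝔼-*ʳ n _))))))
          (*-monoʳ _ (0≤⟦⟧ (Z z)) (+-monoʳ-≤ (c * n) (*-monoˡ n (0≤∣∣ Z) (hX z)))))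
        total : ∑ (λ z → ⟦ Z z ⟧ * (c * n + c * n)) ≡ (c + c) * (n * n)
        total = trans (∑-*ʳ (c * n + c * n) (λ z → ⟦ Z z ⟧)) (lem c n)
          where
          lem : ∀ c n → n * (c * n + c * n) ≡ (c + c) * (n * n)
          lem = solve 2 (λ c n → n :* (c :* n :+ c :* n) := (c :+ c) :* (n :* n)) refl

      -- The origin of the threshold: either it is still the initial ½, or `T - s` bounds from below
      -- the degrees of one colour into all remaining classes. Together with `Few` this makes the
      -- neighbourhoods of that colour maximal up to `s`.
      data Prev (s T : ℚ) (Z : Fin N → Bool) : Set where
        start : T ≡ ½ → Prev s T Z
        found : ∀ S b p₀ → T ≡ S + s → ½ ≤ S → X b p₀ ≡ false →
          (∀ x → Z x ≡ true → (x ≺ b) ≡ true × S ≤ f x b p₀) → Prev s T Z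

      -- Each hit raises the threshold by `s` and keeps at least a fraction `c` of the classes.
      -- Degrees are at most 1, so after `K` hits nothing can exceed the threshold any more.
      extract : ∀ s → 0ℚ ≤ s → ∀ K T Z → ½ ≤ T → 1ℚ ≤ T + nat K * s → Prev s T Z →
        ∃ λ T' → ∃ λ Z' → ½ ≤ T' × Few (c + c) T' Z' × pow c K * ∣ Z ∣ ≤ ∣ Z' ∣ × Prev s T' Z'
      extract s 0≤s zero T Z hT h1 pv = T , Z , hT , few , ≤-reflexive (*-identityˡ _) , pv
        where
        1≤T : 1ℚ ≤ T
        1≤T = subst (1ℚ ≤_) (trans (cong (λ m → T + m * s) nat-0) (lem T s)) h1
          where
          lem : ∀ T s → T + 0ℚ * s ≡ T
          lem = solve 2 (λ T s → T :+ (con 0ℚ) :* s := T) refl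
        none : ∀ x z q → ⟦ exceeds T x z q ⟧ ≡ 0ℚ
        none x z q = cong (λ b → ⟦ not b ⟧) (⊑-intro (≤-trans (proj₂ (f-Unit x z q)) 1≤T))
        few : Few (c + c) T Z
        few = ≤-trans (≤-reflexive (trans (∑₂-cong (λ x z → trans (cong (⟦ pair Z x z ⟧ *_) (trans (𝔼-cong (none x z)) (𝔼-const (D z) 0ℚ))) (zeroʳ _)))
          (trans (∑-cong (λ _ → ∑-0)) ∑-0))) (0≤* (0≤+ (proj₁ hc) (proj₁ hc)) (0≤* (0≤∣∣ Z) (0≤∣∣ Z)))
      extract s 0≤s (suc K) T Z hT h1 pv = go (step T Z)
        where
        Goal : Set
        Goal = ∃ λ T' → ∃ λ Z' → ½ ≤ T' × Few (c + c) T' Z' × pow c (suc K) * ∣ Z ∣ ≤ ∣ Z' ∣ × Prev s T' Z'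
        lem : ∀ T s m → T + (1ℚ + m) * s ≡ T + s + m * s
        lem = solve 3 (λ T s m → T :+ ((con 1ℚ) :+ m) :* s := T :+ s :+ m :* s) refl
        lem' : ∀ c d n → c * d * n ≡ d * (c * n)
        lem' = solve 3 (λ c d n → c :* d :* n := d :* (c :* n)) refl
        go : Few (c + c) T Z ⊎ (∃ λ b → ∃ λ q → Hit T Z b q) → Goal
        go (inj₁ few) = T , Z , hT , few , subst (pow c (suc K) * ∣ Z ∣ ≤_) (*-identityˡ _) (*-monoˡ ∣ Z ∣ (0≤∣∣ Z) (proj₂ (pow≤1 hc (suc K)))) , pv
        go (inj₂ (b , q , Zb , Xb , big)) = T' , Z' , hT' , few ,
            ≤-trans (≤-trans (≤-reflexive (lem' c (pow c K) ∣ Z ∣)) (*-monoʳ _ (proj₁ (pow≤1 hc K)) big)) size , pv'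
          where
          rec = extract s 0≤s K (T + s) (shrink T Z b q) (≤-trans hT (le s 0≤s refl))
            (subst (1ℚ ≤_) (trans (cong (λ m → T + m * s) (nat-suc K)) (lem T s (nat K))) h1)
            (found T b q refl hT Xb (λ x e → let _ , u = ∧-true {Z x} e ; v , w = ∧-true {x ≺ b} u in v , exceeds-true w))
          T' = proj₁ rec
          Z' = proj₁ (proj₂ rec)
          hT' = proj₁ (proj₂ (proj₂ rec))
          few = proj₁ (proj₂ (proj₂ (proj₂ rec)))
          size = proj₁ (proj₂ (proj₂ (proj₂ (proj₂ rec))))
          pv' = proj₂ (proj₂ (proj₂ (proj₂ (proj₂ rec))))

-- Squared degrees above ¼ force triangles through the chosen colour.

module Mantel where
  open Field
  open Base
  open Count
  open Extract

  quarter-n² : ∀ {N} (Z : Fin N → Bool) → 2ᵣ ≤ ∣ Z ∣ → ¼ * (∣ Z ∣ * ∣ Z ∣) ≤ pairs Z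
  quarter-n² Z h = le (¼ * (∣ Z ∣ * (∣ Z ∣ - 2ᵣ))) (0≤* (<⇒≤ 0<¼) (0≤* (0≤∣∣ Z) (diff h)))
    (trans (trans (half (pairs Z) ∣ Z ∣) (cong (λ e → ½ * (e - ∣ Z ∣)) (pairs-count Z))) (lem ∣ Z ∣))
    where
    half : ∀ p n → p ≡ ½ * ((p + p + n) - n)
    half = solve 2 (λ p n → p := con ½ :* ((p :+ p :+ n) :- n)) refl
    lem : ∀ n → ½ * (n * n - n) ≡ ¼ * (n * n) + ¼ * (n * (n - 2ᵣ))
    lem = solve 1 (λ n → con ½ :* (n :* n :- n) := con ¼ :* (n :* n) :+ (con ¼) :* (n :* (n :- (con 2ᵣ)))) refl

  pairs≤n² : ∀ {N} (Z : Fin N → Bool) → pairs Z ≤ ½ * (∣ Z ∣ * ∣ Z ∣)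
  pairs≤n² Z = le (½ * ∣ Z ∣) (0≤* (<⇒≤ 0<½) (0≤∣∣ Z)) (trans (cong (½ *_) (sym (pairs-count Z))) (lem (pairs Z) ∣ Z ∣))
    where
    lem : ∀ p n → ½ * (p + p + n) ≡ p + ½ * n
    lem = solve 2 (λ p n → con ½ :* (p :+ p :+ n) := p :+ (con ½) :* n) refl

  module Triangles {N k : ℕ} (P : Fin N → Fin k → ℚ) (D : ∀ x → Dist (P x))
    (L : Fin N → Fin N → Fin k → Fin k → Bool) where
    open Link P D L

    tri : Fin N → Fin k → Fin N → Fin N → Fin k → Fin k → ℚ
    tri b p₀ x z q p = ⟦ L x b p p₀ ⟧ * ⟦ L x z p q ⟧ * ⟦ L z b q p₀ ⟧

    τ : Fin N → Fin k → Fin N → Fin N → ℚ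
    τ b p₀ x z = 𝔼 (P z) (λ q → 𝔼 (P x) (λ p → tri b p₀ x z q p))

    -- The neighbourhood of p₀ has measure ≥ S in every class, so a member of it has
    -- degree ≤ 1 - S up to triangles, while all other degrees are ≤ S + s up to few exceptions.
    degree-square : ∀ s S b p₀ x z → Unit s → ½ ≤ S → S ≤ f x b p₀ → S ≤ f z b p₀ →
      𝔼 (P z) (λ q → f x z q * f x z q) ≤ (¼ + (s + ½ * s)) + above (S + s) x z + (τ b p₀ x z + τ b p₀ x z)
    degree-square s S b p₀ x z hs hS nx nz = ≤-trans (𝔼-mono (D z) pointwise) (≤-trans (≤-reflexive average) final)
      where
      T n : ℚ
      T = S + s
      n = f z b p₀
      t : Fin k → ℚ
      t q = 𝔼 (P x) (λ p → ⟦ L x b p p₀ ⟧ * ⟦ L x z p q ⟧)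
      0≤t : ∀ q → 0ℚ ≤ t q
      0≤t q = 𝔼-≥ (D x) 0ℚ (λ p → 0≤* (0≤⟦⟧ (L x b p p₀)) (0≤⟦⟧ (L x z p q)))
      -- A neighbour of `q` in class `x` lies either outside the neighbourhood of `p₀`, a set of
      -- measure at most `1 - S`, or in a triangle with `p₀`.
      f≤ : ∀ q → f x z q ≤ (1ℚ - S) + t q
      f≤ q = ≤-trans (𝔼-mono (D x) pt) (≤-trans (≤-reflexive (trans (𝔼-+ _ _) (cong (_+ t q) (trans (𝔼-- _ _) (cong (_- f x b p₀) (𝔼-const (D x) 1ℚ))))))
        (+-monoˡ-≤ (t q) (le (f x b p₀ - S) (diff nx) (lem S (f x b p₀)))))
        where
        lem : ∀ S f → 1ℚ - S ≡ 1ℚ - f + (f - S)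
        lem = solve 2 (λ S f → con 1ℚ :- S := con 1ℚ :- f :+ (f :- S)) refl
        pt : ∀ p → ⟦ L x z p q ⟧ ≤ (1ℚ - ⟦ L x b p p₀ ⟧) + ⟦ L x b p p₀ ⟧ * ⟦ L x z p q ⟧
        pt p = le ((1ℚ - ⟦ L x b p p₀ ⟧) * (1ℚ - ⟦ L x z p q ⟧)) (0≤* (diff (⟦⟧≤1 (L x b p p₀))) (diff (⟦⟧≤1 (L x z p q)))) (lem' ⟦ L x b p p₀ ⟧ ⟦ L x z p q ⟧)
          where
          lem' : ∀ a b → (1ℚ - a) + a * b ≡ b + (1ℚ - a) * (1ℚ - b)
          lem' = solve 2 (λ a b → ((con 1ℚ) :- a) :+ a :* b := b :+ ((con 1ℚ) :- a) :* ((con 1ℚ) :- b)) refl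
      R : Fin k → ℚ
      R q = ⟦ exceeds T x z q ⟧ + (T * T + ⟦ L z b q p₀ ⟧ * ((1ℚ - S) * (1ℚ - S) - T * T)) + (t q * ⟦ L z b q p₀ ⟧ + t q * ⟦ L z b q p₀ ⟧)
      pointwise : ∀ q → f x z q * f x z q ≤ R q
      pointwise q = go (L z b q p₀) refl (≤-total (f x z q) (1ℚ - S))
        where
        y = f x z q
        fu = f-Unit x z q
        e = ⟦ exceeds T x z q ⟧
        B : Bool → ℚ
        B l = e + (T * T + ⟦ l ⟧ * ((1ℚ - S) * (1ℚ - S) - T * T)) + (t q * ⟦ l ⟧ + t q * ⟦ l ⟧)
        l1 : ∀ e T S t → e + (T * T + 1ℚ * ((1ℚ - S) * (1ℚ - S) - T * T)) + (t * 1ℚ + t * 1ℚ) ≡ (1ℚ - S) * (1ℚ - S) + (e + (t + t))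
        l1 = solve 4 (λ e T S t →
          e :+ (T :* T :+ (con 1ℚ) :* (((con 1ℚ) :- S) :* ((con 1ℚ) :- S) :- T :* T)) :+ (t :* (con 1ℚ) :+ t :* (con 1ℚ))
          := ((con 1ℚ) :- S) :* ((con 1ℚ) :- S) :+ (e :+ (t :+ t))) refl
        l2 : ∀ e T S t y → e + (T * T + 1ℚ * ((1ℚ - S) * (1ℚ - S) - T * T)) + (t * 1ℚ + t * 1ℚ) ≡
             y * y + (e + (((1ℚ - S + t) - y) * (1ℚ + 1ℚ) + (y - (1ℚ - S)) * ((1ℚ - y) + S)))
        l2 = solve 5 (λ e T S t y →
          e :+ (T :* T :+ (con 1ℚ) :* (((con 1ℚ) :- S) :* ((con 1ℚ) :- S) :- T :* T)) :+ (t :* (con 1ℚ) :+ t :* (con 1ℚ))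
          := y :* y :+ (e :+ ((((con 1ℚ) :- S :+ t) :- y) :* ((con 1ℚ) :+ (con 1ℚ)) :+ (y :- ((con 1ℚ) :- S)) :* (((con 1ℚ) :- y) :+ S)))) refl
        l3 : ∀ e T S t → e + (T * T + 0ℚ * ((1ℚ - S) * (1ℚ - S) - T * T)) + (t * 0ℚ + t * 0ℚ) ≡ T * T + e
        l3 = solve 4 (λ e T S t →
          e :+ (T :* T :+ (con 0ℚ) :* (((con 1ℚ) :- S) :* ((con 1ℚ) :- S) :- T :* T)) :+ (t :* (con 0ℚ) :+ t :* (con 0ℚ))
          := T :* T :+ e) refl
        l4 : ∀ e T S t → e + (T * T + 0ℚ * ((1ℚ - S) * (1ℚ - S) - T * T)) + (t * 0ℚ + t * 0ℚ) ≡ e + T * T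
        l4 = solve 4 (λ e T S t →
          e :+ (T :* T :+ (con 0ℚ) :* (((con 1ℚ) :- S) :* ((con 1ℚ) :- S) :- T :* T)) :+ (t :* (con 0ℚ) :+ t :* (con 0ℚ))
          := e :+ T :* T) refl
        0≤e : 0ℚ ≤ e
        0≤e = 0≤⟦⟧ (exceeds T x z q)
        low : ∀ x' → exceeds T x z q ≡ x' → y * y ≤ B false
        low true e' = ≤-trans (subst (y * y ≤_) (*-identityˡ 1ℚ) (*-mono (proj₁ fu) (proj₁ fu) (proj₂ fu) (proj₂ fu)))
          (le (T * T) (0≤sq T) (trans (l4 e T S (t q)) (cong (λ b → ⟦ b ⟧ + T * T) e')))
        low false e' = ≤-trans (*-mono (proj₁ fu) (proj₁ fu) y≤T y≤T) (le e 0≤e (l3 e T S (t q)))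
          where
          y≤T : y ≤ T
          y≤T = exceeds-false {T} {x} {z} {q} e'
        go : ∀ l → L z b q p₀ ≡ l → (y ≤ 1ℚ - S) ⊎ (1ℚ - S ≤ y) → y * y ≤ R q
        go true e' (inj₁ h) = subst (λ l → y * y ≤ B l) (sym e') (≤-trans (*-mono (proj₁ fu) (proj₁ fu) h h)
          (le (e + (t q + t q)) (0≤+ 0≤e (0≤+ (0≤t q) (0≤t q))) (l1 e T S (t q))))
        go true e' (inj₂ h) = subst (λ l → y * y ≤ B l) (sym e') (le _ (0≤+ 0≤e (0≤+ (0≤* (diff (f≤ q)) (0≤+ 0≤1 0≤1))
          (0≤* (diff h) (0≤+ (diff (proj₂ fu)) (≤-trans (<⇒≤ 0<½) hS))))) (l2 e T S (t q) y))
        go false e' _ = subst (λ l → y * y ≤ B l) (sym e') (low _ refl)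
      κ : ℚ
      κ = (1ℚ - S) * (1ℚ - S) - T * T
      tz : ℚ
      tz = 𝔼 (P z) (λ q → t q * ⟦ L z b q p₀ ⟧)
      tz≡ : tz ≡ τ b p₀ x z
      tz≡ = 𝔼-cong (λ q → sym (𝔼-*ʳ ⟦ L z b q p₀ ⟧ _))
      average : 𝔼 (P z) R ≡ above T x z + (T * T + n * κ) + (τ b p₀ x z + τ b p₀ x z)
      average = trans (𝔼-+ _ _) (cong₂ _+_ (trans (𝔼-+ _ _) (cong (above T x z +_) (trans (𝔼-+ _ _) (cong₂ _+_ (𝔼-const (D z) (T * T)) (𝔼-*ʳ κ _)))))
        (trans (𝔼-+ _ _) (cong₂ _+_ tz≡ tz≡)))
      -- For s = 0 the main term is S² + n (1 - 2S); since S ≥ ½ and n ≥ S, it is at most S (1 - S)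
      -- ≤ ¼.
      final : above T x z + (T * T + n * κ) + (τ b p₀ x z + τ b p₀ x z) ≤ (¼ + (s + ½ * s)) + above T x z + (τ b p₀ x z + τ b p₀ x z)
      final = le _ (0≤+ (0≤+ (0≤* (diff nz) (0≤* (0≤+ 0≤1 (proj₁ hs)) (0≤+ (0≤+ (diff hS) (diff hS)) (proj₁ hs)))) (0≤sq (S - ½)))
         (0≤* (proj₁ hs) (0≤+ (0≤+ (diff (proj₂ hs)) (0≤* (proj₁ hs) (≤-trans (<⇒≤ 0<½) hS))) (0≤+ (0≤sq (S - ½)) (0≤sq (S - ½))))))
        (lem s S n (above T x z) (τ b p₀ x z))
        where
        lem : ∀ s S n a t → (¼ + (s + ½ * s)) + a + (t + t) ≡
          a + ((S + s) * (S + s) + n * ((1ℚ - S) * (1ℚ - S) - (S + s) * (S + s))) + (t + t) +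
          ((n - S) * ((1ℚ + s) * ((S - ½) + (S - ½) + s)) + (S - ½) * (S - ½) +
           s * ((1ℚ - s) + s * S + ((S - ½) * (S - ½) + (S - ½) * (S - ½))))
        lem = solve 5 (λ s S n a t →
          ((con ¼) :+ (s :+ (con ½) :* s)) :+ a :+ (t :+ t)
          := a :+ ((S :+ s) :* (S :+ s) :+ n :* (((con 1ℚ) :- S) :* ((con 1ℚ) :- S) :- (S :+ s) :* (S :+ s))) :+ (t :+ t) :+ ((n :- S) :* (((con 1ℚ) :+ s) :* ((S :- (con ½)) :+ (S :- (con ½)) :+ s)) :+ (S :- (con ½)) :* (S :- (con ½)) :+ s :* (((con 1ℚ) :- s) :+ s :* S :+ ((S :- (con ½)) :* (S :- (con ½)) :+ (S :- (con ½)) :* (S :- (con ½)))))) refl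

    -- The case in which no colour has been chosen: a degree up to ½ has square at most ¼, and each
    -- exceptional colour costs at most 1. The zeros stand in for the triangle term, so that `total`
    -- serves both cases.
    above-half : ∀ x z → 𝔼 (P z) (λ q → f x z q * f x z q) ≤ ¼ + above ½ x z + (0ℚ + 0ℚ)
    above-half x z = ≤-trans (𝔼-mono (D z) pt) (≤-reflexive (trans (𝔼-+ _ _) (trans (cong (_+ above ½ x z) (𝔼-const (D z) ¼)) (lem ¼ (above ½ x z)))))
      where
      lem : ∀ a b → a + b ≡ a + b + (0ℚ + 0ℚ)
      lem = solve 2 (λ a b → a :+ b := a :+ b :+ ((con 0ℚ) :+ (con 0ℚ))) refl
      pt : ∀ q → f x z q * f x z q ≤ ¼ + ⟦ exceeds ½ x z q ⟧
      pt q with f x z q ⊑ ½ in eq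
      ... | true = ≤-trans (*-mono (proj₁ (f-Unit x z q)) (proj₁ (f-Unit x z q)) (⊑-true eq) (⊑-true eq)) (≤-reflexive lem')
        where
        lem' : ½ * ½ ≡ ¼ + 0ℚ
        lem' = quarter 0ℚ
          where
          quarter : ∀ x → ½ * ½ ≡ ¼ + 0ℚ
          quarter = solve 1 (λ x → con ½ :* (con ½) := con ¼ :+ (con 0ℚ)) refl
      ... | false = ≤-trans (*-mono (proj₁ (f-Unit x z q)) (proj₁ (f-Unit x z q)) (proj₂ (f-Unit x z q)) (proj₂ (f-Unit x z q)))
         (le ¼ (<⇒≤ 0<¼) (lem'' 0ℚ))
        where
        lem'' : ∀ x → ¼ + 1ℚ ≡ 1ℚ * 1ℚ + ¼
        lem'' = solve 1 (λ x → con ¼ :+ (con 1ℚ) := con 1ℚ :* (con 1ℚ) :+ (con ¼)) refl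

    module _ (u : ℚ) (0<u : 0ℚ < u) (16u≤1 : 16ᵣ * u ≤ 1ℚ) (err : Fin N → Fin N → ℚ)
      (Φ : ∀ x z → (x ≺ z) ≡ true → ¼ + 64ᵣ * u ≤ 𝔼 (P z) (λ q → f x z q * f x z q) + err x z)
      (X : Fin N → Fin k → Bool) (hc : Unit u) (hX : ∀ b → 𝔼 (P b) (λ q → ⟦ X b q ⟧) ≤ u) where
      open Search X u hc hX

      private
        0≤u : 0ℚ ≤ u
        0≤u = <⇒≤ 0<u

      total : ∀ T Z c (w : Fin N → Fin N → ℚ) → Few (u + u) T Z → ∑₂ (λ x z → ⟦ x ≺ z ⟧ * err x z) ≤ (u + u) * (∣ Z ∣ * ∣ Z ∣) →
        (∀ x z → 0ℚ ≤ err x z) →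
        (∀ x z → pair Z x z ≡ true → 𝔼 (P z) (λ q → f x z q * f x z q) ≤ c + above T x z + (w x z + w x z)) →
        pairs Z * (¼ + 64ᵣ * u) ≤ pairs Z * c + 4ᵣ * u * (∣ Z ∣ * ∣ Z ∣) + 2ᵣ * ∑₂ (λ x z → ⟦ pair Z x z ⟧ * w x z)
      total T Z c w few herr err≥0 h = ≤-trans (≤-reflexive left) (≤-trans (∑₂-mono bound) (≤-trans (≤-reflexive right)
        (le _ (0≤+ (diff few) (diff herr)) (lem (pairs Z * c) u (∣ Z ∣ * ∣ Z ∣) A E W))))
        where
        A E W : ℚ
        A = ∑₂ (λ x z → ⟦ pair Z x z ⟧ * above T x z)
        E = ∑₂ (λ x z → ⟦ x ≺ z ⟧ * err x z)
        W = ∑₂ (λ x z → ⟦ pair Z x z ⟧ * w x z)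
        lem : ∀ p u m A E W → p + 4ᵣ * u * m + 2ᵣ * W ≡ (p + A) + (E + 2ᵣ * W) + (((u + u) * m - A) + ((u + u) * m - E))
        lem = solve 6 (λ p u m A E W →
          p :+ (con 4ᵣ) :* u :* m :+ (con 2ᵣ) :* W
          := (p :+ A) :+ (E :+ (con 2ᵣ) :* W) :+ (((u :+ u) :* m :- A) :+ ((u :+ u) :* m :- E))) refl
        left : pairs Z * (¼ + 64ᵣ * u) ≡ ∑₂ (λ x z → ⟦ pair Z x z ⟧ * (¼ + 64ᵣ * u))
        left = trans (*-comm _ _) (trans (sym (∑₂-*ˡ _ _)) (∑₂-cong (λ x z → *-comm _ _)))
        F : Fin N → Fin N → ℚ
        F x z = (c * ⟦ pair Z x z ⟧ + ⟦ pair Z x z ⟧ * above T x z) + (⟦ x ≺ z ⟧ * err x z + 2ᵣ * (⟦ pair Z x z ⟧ * w x z))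
        right : ∑₂ F ≡ (pairs Z * c + A) + (E + 2ᵣ * W)
        right = trans (∑₂-+ _ _) (cong₂ _+_ (trans (∑₂-+ _ _) (cong (_+ A) (trans (∑₂-*ˡ c _) (*-comm c _)))) (trans (∑₂-+ _ _) (cong (E +_) (∑₂-*ˡ 2ᵣ _))))
        bound : ∀ x z → ⟦ pair Z x z ⟧ * (¼ + 64ᵣ * u) ≤ F x z
        bound x z = go (pair Z x z) refl
          where
          l0 : ∀ c a e w → (c * 0ℚ + 0ℚ * a) + (e + 2ᵣ * (0ℚ * w)) ≡ 0ℚ + e
          l0 = solve 4 (λ c a e w →
            (c :* (con 0ℚ) :+ (con 0ℚ) :* a) :+ (e :+ (con 2ᵣ) :* ((con 0ℚ) :* w))
            := con 0ℚ :+ e) refl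
          l1 : ∀ c a e w → (c * 1ℚ + 1ℚ * a) + (1ℚ * e + 2ᵣ * (1ℚ * w)) ≡ (c + a + (w + w)) + e
          l1 = solve 4 (λ c a e w →
            (c :* (con 1ℚ) :+ (con 1ℚ) :* a) :+ ((con 1ℚ) :* e :+ (con 2ᵣ) :* ((con 1ℚ) :* w))
            := (c :+ a :+ (w :+ w)) :+ e) refl
          go : ∀ b → pair Z x z ≡ b → ⟦ b ⟧ * (¼ + 64ᵣ * u) ≤ (c * ⟦ b ⟧ + ⟦ b ⟧ * above T x z) + (⟦ x ≺ z ⟧ * err x z + 2ᵣ * (⟦ b ⟧ * w x z))
          go false e = ≤-trans (≤-reflexive (zeroˡ _)) (le _ (0≤* (0≤⟦⟧ (x ≺ z)) (err≥0 x z)) (l0 c (above T x z) _ (w x z)))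
          go true e = ≤-trans (≤-reflexive (*-identityˡ _)) (≤-trans (Φ x z (proj₁ (∧-true e)))
            (≤-trans (+-monoˡ-≤ (err x z) (h x z e)) (≤-reflexive (trans (sym (l1 c _ (err x z) (w x z)))
              (cong (λ o → (c * 1ℚ + 1ℚ * above T x z) + (⟦ o ⟧ * err x z + 2ᵣ * (1ℚ * w x z))) (sym (proj₁ (∧-true {x ≺ z} e))))))))

      -- The surplus `64u` on at least `¼ ∣ Z ∣²` pairs exceeds what exceptional colours, errors and
      -- the increment `4u` of the threshold can explain, so triangles supply the rest. At the
      -- initial threshold there is no triangle term, and the surplus is contradictory.
      dense-neighbourhood : ∀ T Z → Few (u + u) T Z → ∑₂ (λ x z → ⟦ x ≺ z ⟧ * err x z) ≤ (u + u) * (∣ Z ∣ * ∣ Z ∣) →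
        (∀ x z → 0ℚ ≤ err x z) → 2ᵣ ≤ ∣ Z ∣ → Prev (4ᵣ * u) T Z →
        ∃ λ b → ∃ λ p₀ → X b p₀ ≡ false × (∀ x → Z x ≡ true → (x ≺ b) ≡ true × ½ ≤ f x b p₀) ×
          4ᵣ * u * (∣ Z ∣ * ∣ Z ∣) ≤ ∑₂ (λ x z → ⟦ pair Z x z ⟧ * τ b p₀ x z)
      dense-neighbourhood T Z few herr err≥0 n≥2 (start refl) = ⊥-elim (no< imp pos)
        where
        m = ∣ Z ∣ * ∣ Z ∣
        t = total ½ Z ¼ (λ _ _ → 0ℚ) few herr err≥0 (λ x z _ → above-half x z)
        W0 : ∑₂ (λ x z → ⟦ pair Z x z ⟧ * 0ℚ) ≡ 0ℚ
        W0 = trans (∑₂-cong (λ x z → zeroʳ _)) (trans (∑-cong (λ _ → ∑-0)) ∑-0)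
        lem : ∀ p u m W → 0ℚ + 64ᵣ * u * (p - ¼ * m) + (p * ¼ + 4ᵣ * u * m + 2ᵣ * W - p * (¼ + 64ᵣ * u)) ≡ - (u * m * 4ᵣ * (1ℚ + 2ᵣ)) + 2ᵣ * W
        lem = solve 4 (λ p u m W →
          con 0ℚ :+ (con 64ᵣ) :* u :* (p :- (con ¼) :* m) :+ (p :* (con ¼) :+ (con 4ᵣ) :* u :* m :+ (con 2ᵣ) :* W :- p :* ((con ¼) :+ (con 64ᵣ) :* u))
          := :- (u :* m :* (con 4ᵣ) :* ((con 1ℚ) :+ (con 2ᵣ))) :+ (con 2ᵣ) :* W) refl
        imp : u * m * 4ᵣ * (1ℚ + 2ᵣ) ≤ 0ℚ
        imp = le _ (0≤+ (0≤+ ≤-refl (0≤* (0≤* (<⇒≤ 0<64) 0≤u) (diff (quarter-n² Z n≥2)))) (diff t))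
          (trans (lem' (u * m * 4ᵣ * (1ℚ + 2ᵣ))) (cong (u * m * 4ᵣ * (1ℚ + 2ᵣ) +_) (sym (trans (lem (pairs Z) u m _) (trans (cong (λ w → - (u * m * 4ᵣ * (1ℚ + 2ᵣ)) + 2ᵣ * w) W0) (lem'' (- (u * m * 4ᵣ * (1ℚ + 2ᵣ)))))))))
          where
          lem' : ∀ x → 0ℚ ≡ x + - x
          lem' = solve 1 (λ x → con 0ℚ := x :+ :- x) refl
          lem'' : ∀ x → x + 2ᵣ * 0ℚ ≡ x
          lem'' = solve 1 (λ x → x :+ (con 2ᵣ) :* (con 0ℚ) := x) refl
        0<n : 0ℚ < ∣ Z ∣
        0<n = <-≤-trans 0<2 n≥2
        pos : 0ℚ < u * m * 4ᵣ * (1ℚ + 2ᵣ)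
        pos = 0<* (0<* (0<* 0<u (0<* 0<n 0<n)) 0<4) (0<+ 0<1 (<⇒≤ 0<2))
      dense-neighbourhood T Z few herr err≥0 n≥2 (found S b p₀ refl hS Xb nbh) = b , p₀ , Xb , (λ x Zx → proj₁ (nbh x Zx) , ≤-trans hS (proj₂ (nbh x Zx))) , res
        where
        m = ∣ Z ∣ * ∣ Z ∣
        s = 4ᵣ * u
        hs : Unit s
        hs = 0≤* (<⇒≤ 0<4) 0≤u , ≤-trans (le ((1ℚ + 2ᵣ) * 4ᵣ * u) (0≤* (0≤* (0≤+ 0≤1 (<⇒≤ 0<2)) (<⇒≤ 0<4)) 0≤u) (l u)) 16u≤1
          where
          l : ∀ u → 16ᵣ * u ≡ 4ᵣ * u + (1ℚ + 2ᵣ) * 4ᵣ * u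
          l = solve 1 (λ u → con 16ᵣ :* u := con 4ᵣ :* u :+ ((con 1ℚ) :+ (con 2ᵣ)) :* (con 4ᵣ) :* u) refl
        W = ∑₂ (λ x z → ⟦ pair Z x z ⟧ * τ b p₀ x z)
        t = total (S + s) Z (¼ + (s + ½ * s)) (τ b p₀) few herr err≥0
              (λ x z e → let _ , e' = ∧-true {x ≺ z} e ; Zx , Zz = ∧-true {Z x} e' in degree-square s S b p₀ x z hs hS (proj₂ (nbh x Zx)) (proj₂ (nbh z Zz)))
        lem : ∀ p u m W → 2ᵣ * W ≡ 2ᵣ * (4ᵣ * u * m) + ((p * (¼ + (4ᵣ * u + ½ * (4ᵣ * u))) + 4ᵣ * u * m + 2ᵣ * W - p * (¼ + 64ᵣ * u)) + (u * (64ᵣ - 4ᵣ - 2ᵣ)) * (p - ¼ * m) + u * m * (2ᵣ + ½))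
        lem = solve 4 (λ p u m W →
          con 2ᵣ :* W
          := con 2ᵣ :* ((con 4ᵣ) :* u :* m) :+ ((p :* ((con ¼) :+ ((con 4ᵣ) :* u :+ (con ½) :* ((con 4ᵣ) :* u))) :+ (con 4ᵣ) :* u :* m :+ (con 2ᵣ) :* W :- p :* ((con ¼) :+ (con 64ᵣ) :* u)) :+ (u :* ((con 64ᵣ) :- (con 4ᵣ) :- (con 2ᵣ))) :* (p :- (con ¼) :* m) :+ u :* m :* ((con 2ᵣ) :+ (con ½)))) refl
        -- The increment takes `6u` of the surplus `64u`. On `m / 4` pairs the remaining `58u`
        -- amounts to `14.5 u m`; the errors take `4 u m`, and `8 u m` is needed for twice the
        -- claimed weight.
        res : 4ᵣ * u * m ≤ W
        res = cancelˡ 2ᵣ 0<2 (le _ (0≤+ (0≤+ (diff t) (0≤* (0≤* 0≤u (undiff' )) (diff (quarter-n² Z n≥2)))) (0≤* (0≤* 0≤u (0≤sq ∣ Z ∣)) (0≤+ (<⇒≤ 0<2) (<⇒≤ 0<½)))) (lem (pairs Z) u m W))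
          where
          undiff' : 0ℚ ≤ 64ᵣ - 4ᵣ - 2ᵣ
          undiff' = subst (0ℚ ≤_) (l 0ℚ) (0≤+ (<⇒≤ 0<32) (0≤+ (<⇒≤ 0<16) (0≤+ (<⇒≤ 0<8) 0<2'')))
            where
            0<2'' = <⇒≤ 0<2
            l : ∀ x → 32ᵣ + (16ᵣ + (8ᵣ + 2ᵣ)) ≡ 64ᵣ - 4ᵣ - 2ᵣ
            l = solve 1 (λ x → con 32ᵣ :+ ((con 16ᵣ) :+ ((con 8ᵣ) :+ (con 2ᵣ))) := con 64ᵣ :- (con 4ᵣ) :- (con 2ᵣ)) refl

-- Triangles with room for further vertices.

module Ranked where
  open Field
  open Base
  open Count
  open Extract
  open Mantel

  ∧-intro : ∀ {a b} → a ≡ true → b ≡ true → (a ∧ b) ≡ true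
  ∧-intro refl refl = refl

  ⊑-not : ∀ {a b} → not (a ⊑ b) ≡ false → a ≤ b
  ⊑-not {a} {b} h with a ⊑ b in eq
  ... | true = ⊑-true eq
  ⊑-not () | false

  module Triples {N k : ℕ} (P : Fin N → Fin k → ℚ) (D : ∀ x → Dist (P x))
    (L : Fin N → Fin N → Fin k → Fin k → Bool) (u : ℚ) (0<u : 0ℚ < u) (B : ℕ) (Z : Fin N → Bool) where
    open Link P D L
    open Triangles P D L

    private
      0≤u = <⇒≤ 0<u

    g : Fin N → Fin N → Fin k → ℚ
    g x x' p = 𝔼 (P x') (λ q → ⟦ L x x' p q ⟧)

    down up : Fin N → Fin k → Fin N → Bool
    down z q y = Z y ∧ ((y ≺ z) ∧ (u ⊑ f y z q))
    up x p x' = Z x' ∧ ((x ≺ x') ∧ (u ⊑ g x x' p))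

    -- Twice `B`, because two vertices of the pattern, y and z, are to be found below `x`, and each
    -- choice may have to avoid almost `B` exceptional classes. In `up` only one vertex is sought.
    late-down : Fin N → Fin k → Fin N → Bool
    late-down z q x = nat (B ℕ.+ B) ⊑ before (down z q) x

    late-up : Fin N → Fin k → Fin N → Bool
    late-up x p z = nat B ⊑ before (up x p) z

    -- triangles p₀ p q whose vertices q and p have many further neighbours below x, respectively between x and z
    rich : Fin N → Fin k → Fin N → Fin N → Fin k → Fin k → Bool
    rich b p₀ x z q p = (L x b p p₀ ∧ (L x z p q ∧ L z b q p₀)) ∧ (((u ⊑ f x z q) ∧ late-down z q x) ∧ ((u ⊑ g x z p) ∧ late-up x p z))

    private
      l1 l2 l3 l4 : Fin N → Fin N → Fin k → Fin k → ℚ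
      l1 x z q p = ⟦ L x z p q ⟧ * ⟦ not (u ⊑ f x z q) ⟧
      l2 x z q p = ⟦ u ⊑ f x z q ⟧ * ⟦ not (late-down z q x) ⟧
      l3 x z q p = ⟦ L x z p q ⟧ * ⟦ not (u ⊑ g x z p) ⟧
      l4 x z q p = ⟦ u ⊑ g x z p ⟧ * ⟦ not (late-up x p z) ⟧

      EE : Fin N → Fin N → (Fin k → Fin k → ℚ) → ℚ
      EE x z F = 𝔼 (P z) (λ q → 𝔼 (P x) (F q))

      EE-+ : ∀ x z F G → EE x z (λ q p → F q p + G q p) ≡ EE x z F + EE x z G
      EE-+ x z F G = trans (𝔼-cong (λ q → 𝔼-+ (F q) (G q))) (𝔼-+ _ _)

      EE-mono : ∀ x z {F G} → (∀ q p → F q p ≤ G q p) → EE x z F ≤ EE x z G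
      EE-mono x z h = 𝔼-mono (D z) (λ q → 𝔼-mono (D x) (h q))

      -- A triangle that is not rich has one of four defects, a low degree or an early rank on
      -- either side, and each summand is charged with one of them.
      bool : ∀ a b c d e h j → ⟦ a ⟧ * ⟦ b ⟧ * ⟦ c ⟧ ≤
        ⟦ (a ∧ (b ∧ c)) ∧ ((d ∧ e) ∧ (h ∧ j)) ⟧ + ((⟦ b ⟧ * ⟦ not d ⟧ + ⟦ d ⟧ * ⟦ not e ⟧) + (⟦ b ⟧ * ⟦ not h ⟧ + ⟦ h ⟧ * ⟦ not j ⟧))
      bool a b c d e h j = go a b c d e h j
        where
        nn : ∀ x y → 0ℚ ≤ ⟦ x ⟧ * ⟦ y ⟧
        nn x y = 0≤* (0≤⟦⟧ x) (0≤⟦⟧ y)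
        rest : ∀ b d e h j → 0ℚ ≤ (⟦ b ⟧ * ⟦ not d ⟧ + ⟦ d ⟧ * ⟦ not e ⟧) + (⟦ b ⟧ * ⟦ not h ⟧ + ⟦ h ⟧ * ⟦ not j ⟧)
        rest b d e h j = 0≤+ (0≤+ (nn b (not d)) (nn d (not e))) (0≤+ (nn b (not h)) (nn h (not j)))
        all : ∀ a b c d e h j → 0ℚ ≤ ⟦ (a ∧ (b ∧ c)) ∧ ((d ∧ e) ∧ (h ∧ j)) ⟧ + ((⟦ b ⟧ * ⟦ not d ⟧ + ⟦ d ⟧ * ⟦ not e ⟧) + (⟦ b ⟧ * ⟦ not h ⟧ + ⟦ h ⟧ * ⟦ not j ⟧))
        all a b c d e h j = 0≤+ (0≤⟦⟧ ((a ∧ (b ∧ c)) ∧ ((d ∧ e) ∧ (h ∧ j)))) (rest b d e h j)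
        one : ∀ {v} → 0ℚ ≤ v → ⟦ true ⟧ * ⟦ true ⟧ * ⟦ true ⟧ ≤ 1ℚ + v
        one {v} h = le v h (lem v)
          where
          lem : ∀ v → 1ℚ + v ≡ 1ℚ * 1ℚ * 1ℚ + v
          lem = solve 1 (λ v → con 1ℚ :+ v := con 1ℚ :* (con 1ℚ) :* (con 1ℚ) :+ v) refl
        t1 : ∀ x y → 1ℚ * 1ℚ * 1ℚ + (x + y) ≡ 0ℚ + ((1ℚ * 1ℚ + x) + y)
        t1 = solve 2 (λ x y →
          con 1ℚ :* (con 1ℚ) :* (con 1ℚ) :+ (x :+ y)
          := con 0ℚ :+ (((con 1ℚ) :* (con 1ℚ) :+ x) :+ y)) refl
        t2 : ∀ x y → 1ℚ * 1ℚ * 1ℚ + (x + y) ≡ 0ℚ + ((x + 1ℚ * 1ℚ) + y)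
        t2 = solve 2 (λ x y →
          con 1ℚ :* (con 1ℚ) :* (con 1ℚ) :+ (x :+ y)
          := con 0ℚ :+ ((x :+ (con 1ℚ) :* (con 1ℚ)) :+ y)) refl
        t3 : ∀ x y → 1ℚ * 1ℚ * 1ℚ + (x + y) ≡ 0ℚ + (x + (1ℚ * 1ℚ + y))
        t3 = solve 2 (λ x y →
          con 1ℚ :* (con 1ℚ) :* (con 1ℚ) :+ (x :+ y)
          := con 0ℚ :+ (x :+ ((con 1ℚ) :* (con 1ℚ) :+ y))) refl
        t4 : ∀ x y → 1ℚ * 1ℚ * 1ℚ + (x + y) ≡ 0ℚ + (x + (y + 1ℚ * 1ℚ))
        t4 = solve 2 (λ x y →
          con 1ℚ :* (con 1ℚ) :* (con 1ℚ) :+ (x :+ y)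
          := con 0ℚ :+ (x :+ (y :+ (con 1ℚ) :* (con 1ℚ)))) refl
        go : ∀ a b c d e h j → ⟦ a ⟧ * ⟦ b ⟧ * ⟦ c ⟧ ≤ ⟦ (a ∧ (b ∧ c)) ∧ ((d ∧ e) ∧ (h ∧ j)) ⟧ + ((⟦ b ⟧ * ⟦ not d ⟧ + ⟦ d ⟧ * ⟦ not e ⟧) + (⟦ b ⟧ * ⟦ not h ⟧ + ⟦ h ⟧ * ⟦ not j ⟧))
        go false b c d e h j = ≤-trans (≤-reflexive (trans (cong (_* ⟦ c ⟧) (zeroˡ ⟦ b ⟧)) (zeroˡ ⟦ c ⟧))) (all false b c d e h j)
        go true false c d e h j = ≤-trans (≤-reflexive (trans (cong (_* ⟦ c ⟧) (zeroʳ 1ℚ)) (zeroˡ ⟦ c ⟧))) (all true false c d e h j)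
        go true true false d e h j = ≤-trans (≤-reflexive (zeroʳ (1ℚ * 1ℚ))) (all true true false d e h j)
        go true true true true true true true = one (rest true true true true true)
        go true true true false e h j = le _ (0≤+ (nn false (not e)) (0≤+ (nn true (not h)) (nn h (not j)))) (sym (t1 (⟦ false ⟧ * ⟦ not e ⟧) _))
        go true true true true false h j = le _ (0≤+ (nn true false) (0≤+ (nn true (not h)) (nn h (not j)))) (sym (t2 (1ℚ * 0ℚ) _))
        go true true true true true false j = le _ (0≤+ (0≤+ (nn true false) (nn true false)) (nn false (not j))) (sym (t3 _ (0ℚ * ⟦ not j ⟧)))
        go true true true true true true false = le _ (0≤+ (0≤+ (nn true false) (nn true false)) (nn true false)) (sym (t4 _ (1ℚ * 0ℚ)))

      low-mass : ∀ c y → 0ℚ ≤ c → y * ⟦ not (c ⊑ y) ⟧ ≤ c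
      low-mass c y h with c ⊑ y in eq
      ... | true = ≤-trans (≤-reflexive (zeroʳ y)) h
      ... | false = ≤-trans (≤-reflexive (*-identityʳ y)) (<⇒≤ (⊑-false eq))

      pr : Fin N → Fin N → ℚ
      pr x z = ⟦ pair Z x z ⟧

      b1 : ∑₂ (λ x z → pr x z * EE x z (l1 x z)) ≤ u * pairs Z
      b1 = ≤-trans (∑₂-mono (λ x z → *-monoʳ (pr x z) (0≤⟦⟧ (pair Z x z)) (𝔼-≤ (D z) u (λ q →
        ≤-trans (≤-reflexive (𝔼-*ʳ ⟦ not (u ⊑ f x z q) ⟧ _)) (low-mass u (f x z q) 0≤u)))))
        (≤-reflexive (trans (∑₂-cong (λ x z → *-comm (pr x z) u)) (∑₂-*ˡ u pr)))

      b3 : ∑₂ (λ x z → pr x z * EE x z (l3 x z)) ≤ u * pairs Z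
      b3 = ≤-trans (∑₂-mono (λ x z → *-monoʳ (pr x z) (0≤⟦⟧ (pair Z x z)) (≤-trans (≤-reflexive (𝔼-swap (P z) (P x) _)) (𝔼-≤ (D x) u (λ p →
        ≤-trans (≤-reflexive (𝔼-*ʳ ⟦ not (u ⊑ g x z p) ⟧ _)) (low-mass u (g x z p) 0≤u))))))
        (≤-reflexive (trans (∑₂-cong (λ x z → *-comm (pr x z) u)) (∑₂-*ˡ u pr)))

      merge : ∀ a b c d e → ⟦ a ∧ (b ∧ c) ⟧ * (⟦ d ⟧ * ⟦ e ⟧) ≡ ⟦ c ⟧ * (⟦ b ∧ (a ∧ d) ⟧ * ⟦ e ⟧)
      merge true true true d e = refl
      merge true true false d e = trans (zeroˡ _) (sym (zeroˡ _))
      merge true false c d e = trans (zeroˡ _) (sym (trans (cong (⟦ c ⟧ *_) (zeroˡ _)) (zeroʳ _)))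
      merge false true c d e = trans (zeroˡ _) (sym (trans (cong (⟦ c ⟧ *_) (zeroˡ _)) (zeroʳ _)))
      merge false false c d e = trans (zeroˡ _) (sym (trans (cong (⟦ c ⟧ *_) (zeroˡ _)) (zeroʳ _)))

      merge' : ∀ a b c d e → ⟦ a ∧ (b ∧ c) ⟧ * (⟦ d ⟧ * ⟦ e ⟧) ≡ ⟦ b ⟧ * (⟦ c ∧ (a ∧ d) ⟧ * ⟦ e ⟧)
      merge' true true c d e = trans (cong (_* (⟦ d ⟧ * ⟦ e ⟧)) refl) (trans (sym (*-assoc _ _ _)) (trans (cong (_* ⟦ e ⟧) (sym (⟦∧⟧ c d))) (sym (*-identityˡ _))))
      merge' true false c d e = trans (zeroˡ _) (sym (zeroˡ _))
      merge' false b true d e = trans (zeroˡ _) (sym (trans (cong (⟦ b ⟧ *_) (zeroˡ _)) (zeroʳ _)))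
      merge' false b false d e = trans (zeroˡ _) (sym (trans (cong (⟦ b ⟧ *_) (zeroˡ _)) (zeroʳ _)))

      -- For fixed `z` and `q` the defect does not depend on `p`, and by `early` at most `2B`
      -- classes `x` have it.
      b2 : ∑₂ (λ x z → pr x z * EE x z (l2 x z)) ≤ ∣ Z ∣ * nat (B ℕ.+ B)
      b2 = ≤-trans (≤-reflexive (∑-swap _)) (≤-trans (∑-mono bound) (≤-reflexive (∑-*ʳ (nat (B ℕ.+ B)) (λ z → ⟦ Z z ⟧))))
        where
        bound : ∀ z → ∑ (λ x → pr x z * EE x z (l2 x z)) ≤ ⟦ Z z ⟧ * nat (B ℕ.+ B)
        bound z = ≤-trans (≤-reflexive (trans (∑-cong (λ x → trans (cong (pr x z *_) (𝔼-cong (λ q → 𝔼-const (D x) (l2 x z q q)))) (sym (𝔼-*ˡ (pr x z) (λ q → l2 x z q q)))))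
           (sym (𝔼-swap-∑ (λ x q → pr x z * l2 x z q q)))))
           (𝔼-≤ (D z) _ (λ q → ≤-trans (≤-reflexive (trans (∑-cong (λ x → merge (x ≺ z) (Z x) (Z z) (u ⊑ f x z q) (not (late-down z q x)))) (∑-*ˡ ⟦ Z z ⟧ _)))
             (*-monoʳ ⟦ Z z ⟧ (0≤⟦⟧ (Z z)) (early (down z q) (B ℕ.+ B)))))

      b4 : ∑₂ (λ x z → pr x z * EE x z (l4 x z)) ≤ ∣ Z ∣ * nat B
      b4 = ≤-trans (∑-mono bound) (≤-reflexive (∑-*ʳ (nat B) (λ x → ⟦ Z x ⟧)))
        where
        bound : ∀ x → ∑ (λ z → pr x z * EE x z (l4 x z)) ≤ ⟦ Z x ⟧ * nat B
        bound x = ≤-trans (≤-reflexive (trans (∑-cong (λ z → trans (cong (pr x z *_) (𝔼-const (D z) (𝔼 (P x) (λ p → l4 x z p p)))) (sym (𝔼-*ˡ (pr x z) (λ p → l4 x z p p)))))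
           (sym (𝔼-swap-∑ (λ z p → pr x z * l4 x z p p)))))
           (𝔼-≤ (D x) _ (λ p → ≤-trans (≤-reflexive (trans (∑-cong (λ z → merge' (x ≺ z) (Z x) (Z z) (u ⊑ g x z p) (not (late-up x p z)))) (∑-*ˡ ⟦ Z x ⟧ _)))
             (*-monoʳ ⟦ Z x ⟧ (0≤⟦⟧ (Z x)) (early (up x p) B))))

    rich-count : ∀ b p₀ → ∑₂ (λ x z → ⟦ pair Z x z ⟧ * τ b p₀ x z) ≤
      ∑₂ (λ x z → ⟦ pair Z x z ⟧ * 𝔼 (P z) (λ q → 𝔼 (P x) (λ p → ⟦ rich b p₀ x z q p ⟧))) +
        ((u * pairs Z + ∣ Z ∣ * nat (B ℕ.+ B)) + (u * pairs Z + ∣ Z ∣ * nat B))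
    rich-count b p₀ = ≤-trans (∑₂-mono (λ x z → ≤-trans (*-monoʳ (pr x z) (0≤⟦⟧ (pair Z x z)) (EE-mono x z (pt x z))) (≤-reflexive (expand x z))))
      (≤-trans (≤-reflexive (trans (∑₂-+ _ _) (cong (S0 +_) (trans (∑₂-+ _ _) (cong₂ _+_ (∑₂-+ _ _) (∑₂-+ _ _))))))
        (+-monoʳ-≤ S0 (+-mono-≤ (+-mono-≤ b1 b2) (+-mono-≤ b3 b4))))
      where
      S0 = ∑₂ (λ x z → ⟦ pair Z x z ⟧ * EE x z (λ q p → ⟦ rich b p₀ x z q p ⟧))
      pt : ∀ x z q p → tri b p₀ x z q p ≤ ⟦ rich b p₀ x z q p ⟧ + ((l1 x z q p + l2 x z q p) + (l3 x z q p + l4 x z q p))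
      pt x z q p = bool (L x b p p₀) (L x z p q) (L z b q p₀) (u ⊑ f x z q) (late-down z q x) (u ⊑ g x z p) (late-up x p z)
      expand : ∀ x z → pr x z * EE x z (λ q p → ⟦ rich b p₀ x z q p ⟧ + ((l1 x z q p + l2 x z q p) + (l3 x z q p + l4 x z q p))) ≡
        pr x z * EE x z (λ q p → ⟦ rich b p₀ x z q p ⟧) + ((pr x z * EE x z (l1 x z) + pr x z * EE x z (l2 x z)) + (pr x z * EE x z (l3 x z) + pr x z * EE x z (l4 x z)))
      expand x z = trans (cong (pr x z *_) (trans (EE-+ x z _ _) (cong (EE x z (λ q p → ⟦ rich b p₀ x z q p ⟧) +_) (trans (EE-+ x z _ _) (cong₂ _+_ (EE-+ x z _ _) (EE-+ x z _ _))))))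
        (lem (pr x z) _ _ _ _ _)
        where
        lem : ∀ c a b d e f → c * (a + ((b + d) + (e + f))) ≡ c * a + ((c * b + c * d) + (c * e + c * f))
        lem = solve 6 (λ c a b d e f →
          c :* (a :+ ((b :+ d) :+ (e :+ f)))
          := c :* a :+ ((c :* b :+ c :* d) :+ (c :* e :+ c :* f))) refl

    -- From the triangle weight `4u ∣ Z ∣²`, low degrees remove `2u` per pair, at most `u ∣ Z ∣²` in
    -- all, and early ranks at most another `u ∣ Z ∣²`. What remains exceeds `u` times the number of
    -- pairs.
    rich-pair : ∀ b p₀ → 4ᵣ * u * (∣ Z ∣ * ∣ Z ∣) ≤ ∑₂ (λ x z → ⟦ pair Z x z ⟧ * τ b p₀ x z) →
      nat (B ℕ.+ B) + nat B ≤ u * ∣ Z ∣ → 2ᵣ ≤ ∣ Z ∣ →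
      ∃ λ x → ∃ λ z → pair Z x z ≡ true × u ≤ 𝔼 (P z) (λ q → 𝔼 (P x) (λ p → ⟦ rich b p₀ x z q p ⟧))
    rich-pair b p₀ hτ hB h2 = x , z , is (pair Z x z) refl lt2
      where
      n = ∣ Z ∣
      R : Fin N → Fin N → ℚ
      R x z = 𝔼 (P z) (λ q → 𝔼 (P x) (λ p → ⟦ rich b p₀ x z q p ⟧))
      SR = ∑₂ (λ x z → ⟦ pair Z x z ⟧ * R x z)
      0<n : 0ℚ < n
      0<n = <-≤-trans 0<2 h2
      lem : ∀ u n p t s b2 b1 → s ≡ p * u + (u * (n * n) * ½ + ((t - 4ᵣ * u * (n * n)) + ((s + ((u * p + n * b2) + (u * p + n * b1))) - t) + n * (u * n - (b2 + b1)) + u * (½ * (n * n) - p) * (1ℚ + 2ᵣ) + u * (n * n)))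
      lem = solve 7 (λ u n p t s b2 b1 →
        s
        := p :* u :+ (u :* (n :* n) :* (con ½) :+ ((t :- (con 4ᵣ) :* u :* (n :* n)) :+ ((s :+ ((u :* p :+ n :* b2) :+ (u :* p :+ n :* b1))) :- t) :+ n :* (u :* n :- (b2 :+ b1)) :+ u :* ((con ½) :* (n :* n) :- p) :* ((con 1ℚ) :+ (con 2ᵣ)) :+ u :* (n :* n)))) refl
      strict : pairs Z * u < SR
      strict = lt _ (0<+ (0<* (0<* 0<u (0<* 0<n 0<n)) 0<½) (0≤+ (0≤+ (0≤+ (0≤+ (diff hτ) (diff (rich-count b p₀))) (0≤* (0≤∣∣ Z) (diff hB)))
        (0≤* (0≤* 0≤u (diff (pairs≤n² Z))) (0≤+ 0≤1 (<⇒≤ 0<2)))) (0≤* 0≤u (0≤sq n))))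
        (lem u n (pairs Z) (∑₂ (λ x z → ⟦ pair Z x z ⟧ * τ b p₀ x z)) SR (nat (B ℕ.+ B)) (nat B))
      e1 : ∃ λ x → ∑ (λ z → ⟦ pair Z x z ⟧ * u) < ∑ (λ z → ⟦ pair Z x z ⟧ * R x z)
      e1 = ∑-<⇒∃ (subst (_< SR) (trans (*-comm (pairs Z) u) (trans (sym (∑₂-*ˡ u pr)) (∑₂-cong (λ x z → *-comm u (pr x z))))) strict)
      x = proj₁ e1
      e2 = ∑-<⇒∃ (proj₂ e1)
      z = proj₁ e2
      lt2 = proj₂ e2
      is : ∀ b → pair Z x z ≡ b → ⟦ pair Z x z ⟧ * u < ⟦ pair Z x z ⟧ * R x z → pair Z x z ≡ true × u ≤ R x z
      is true e h = e , <⇒≤ (subst₂ _<_ (trans (cong (λ o → ⟦ o ⟧ * u) e) (*-identityˡ u)) (trans (cong (λ o → ⟦ o ⟧ * R x z) e) (*-identityˡ _)) h)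
      is false e h = ⊥-elim (<-irrefl refl (subst₂ _<_ (trans (cong (λ o → ⟦ o ⟧ * u) e) (zeroˡ u)) (trans (cong (λ o → ⟦ o ⟧ * R x z) e) (zeroˡ _)) h))

-- Reduced hypergraphs and the density of the pattern.

module Structure where
  open Field
  open Base

  -- A reduced hypergraph: the pair ij carries k colours with distribution d i j, and a triple ijl
  -- whose pairs ij, il, jl are coloured p, q, r is an edge with weight W i j l p q r.
  record Str (I : Set) (k : ℕ) : Set where
    field
      d : I → I → Fin k → ℚ
      W : I → I → I → Fin k → Fin k → Fin k → ℚ
      d-Dist : ∀ i j → Dist (d i j)
      W-Unit : ∀ i j l p q r → Unit (W i j l p q r)

  module Ops {I : Set} {k : ℕ} (S : Str I k) where
    open Str S

    κ : I → I → I → ℚ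
    κ i j l = 𝔼 (d i j) λ p → 𝔼 (d i l) λ q → 𝔼 (d j l) λ r → W i j l p q r

    thick : ℚ → I → I → I → Fin k → Fin k → Bool
    thick θ i j l p q = θ ⊑ 𝔼 (d j l) λ r → W i j l p q r

    degree : ℚ → I → I → I → Fin k → ℚ
    degree θ i j l q = 𝔼 (d i j) λ p → ⟦ thick θ i j l p q ⟧

    Φ : ℚ → I → I → I → ℚ
    Φ θ i j l = 𝔼 (d i l) λ q → degree θ i j l q * degree θ i j l q

    -- codegrees of a colour into a class lying below, between or above its two indices
    β : I → I → I → Fin k → ℚ
    β y i j r = 𝔼 (d y i) λ p → 𝔼 (d y j) λ q → W y i j p q r

    between : I → I → I → Fin k → ℚ
    between i y j q = 𝔼 (d i y) λ p → 𝔼 (d y j) λ r → W i y j p q r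

    beyond : I → I → I → Fin k → ℚ
    beyond i j y p = 𝔼 (d i y) λ q → 𝔼 (d j y) λ r → W i j y p q r

    Gram : I → I → I → I → ℚ
    Gram y y' i j = 𝔼 (d i j) λ r → β y i j r * β y' i j r

    -- One colour of the pair ij serves two edges at once, so the edge at `a` and the codegree into
    -- `y` are averaged jointly and not separately.
    Γ : I → I → I → Fin k → Fin k → I → ℚ
    Γ a i j p q y = 𝔼 (d i j) λ r → W a i j p q r * β y i j r

    -- Density of F̂⋆₇ with a, b, c, d, x, y, z in the classes a, i, l, m, x, y, z, ordered
    -- a < y < z < i < x < l < m, once the colours of the pairs ai, al, am are fixed.
    density : I → I → I → I → I → I → I → Fin k → Fin k → Fin k → ℚ
    density a y z i x l m p₀ q p =
      (beyond a i x p * (between a y l q * between a z m p₀)) *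
      (Γ a i l p q z * (Γ a i m p p₀ y * (Γ a l m q p₀ x * κ y z x)))

    density₀ : I → I → I → I → I → I → I → Fin k → ℚ
    density₀ a y z i x l m p₀ = 𝔼 (d a l) λ q → 𝔼 (d a i) λ p → density a y z i x l m p₀ q p

    F7-density : I → I → I → I → I → I → I → ℚ
    F7-density a y z i x l m = 𝔼 (d a m) λ p₀ → density₀ a y z i x l m p₀

    β-Unit : ∀ y i j r → Unit (β y i j r)
    β-Unit y i j r = 𝔼-Unit (d-Dist y i) λ p → 𝔼-Unit (d-Dist y j) λ q → W-Unit y i j p q r

    κ-Unit : ∀ i j l → Unit (κ i j l)
    κ-Unit i j l = 𝔼-Unit (d-Dist i j) λ p → 𝔼-Unit (d-Dist i l) λ q → 𝔼-Unit (d-Dist j l) λ r → W-Unit i j l p q r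

    density≥0 : ∀ a y z i x l m p₀ q p → 0ℚ ≤ density a y z i x l m p₀ q p
    density≥0 a y z i x l m p₀ q p = 0≤* (0≤* be (0≤* (bt y l q) (bt z m p₀)))
      (0≤* (ga i l p q z) (0≤* (ga i m p p₀ y) (0≤* (ga l m q p₀ x) (proj₁ (κ-Unit y z x)))))
      where
      be = 𝔼-≥ (d-Dist a x) 0ℚ λ q → 𝔼-≥ (d-Dist i x) 0ℚ λ r → proj₁ (W-Unit a i x p q r)
      bt : ∀ y l q → 0ℚ ≤ between a y l q
      bt y l q = 𝔼-≥ (d-Dist a y) 0ℚ λ p → 𝔼-≥ (d-Dist y l) 0ℚ λ r → proj₁ (W-Unit a y l p q r)
      ga : ∀ i l p q z → 0ℚ ≤ Γ a i l p q z
      ga i l p q z = 𝔼-≥ (d-Dist i l) 0ℚ λ r → 0≤* (proj₁ (W-Unit a i l p q r)) (proj₁ (β-Unit z i l r))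

    density₀≥0 : ∀ a y z i x l m p₀ → 0ℚ ≤ density₀ a y z i x l m p₀
    density₀≥0 a y z i x l m p₀ = 𝔼-≥ (d-Dist a l) 0ℚ λ q → 𝔼-≥ (d-Dist a i) 0ℚ λ p → density≥0 a y z i x l m p₀ q p

  -- Transposing all data turns statements about classes above into statements about classes below.
  reverse : ∀ {I k} → Str I k → Str I k
  reverse S = record
    { d = λ i j → d j i
    ; W = λ i j l p q r → W l j i r q p
    ; d-Dist = λ i j → d-Dist j i
    ; W-Unit = λ i j l p q r → W-Unit l j i r q p }
    where open Str S

  pullback : ∀ {I J k} → (J → I) → Str I k → Str J k
  pullback ι S = record
    { d = λ i j → d (ι i) (ι j)
    ; W = λ i j l → W (ι i) (ι j) (ι l)
    ; d-Dist = λ i j → d-Dist (ι i) (ι j)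
    ; W-Unit = λ i j l → W-Unit (ι i) (ι j) (ι l) }
    where open Str S

-- Copies of the pattern seen from one pivot class.

module Pivot where
  import Data.Sum
  open Field
  open Base
  open Count
  open Extract
  open Mantel
  open Ranked
  open Structure

  markov : ∀ {k} {w : Fin k → ℚ} (D : Dist w) (h : Fin k → ℚ) → (∀ r → 0ℚ ≤ h r) → ∀ {c} → 0ℚ ≤ c →
    c * 𝔼 w (λ r → ⟦ c ⊑ h r ⟧) ≤ 𝔼 w h
  markov {w = w} D h h≥0 {c} 0≤c = ≤-trans (≤-reflexive (sym (𝔼-*ˡ c _))) (𝔼-mono D pt)
    where
    pt : ∀ r → c * ⟦ c ⊑ h r ⟧ ≤ h r
    pt r with c ⊑ h r in eq
    ... | true = ≤-trans (≤-reflexive (*-identityʳ c)) (⊑-true eq)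
    ... | false = ≤-trans (≤-reflexive (zeroʳ c)) (h≥0 r)

  markov< : ∀ {k} {w : Fin k → ℚ} (D : Dist w) (h : Fin k → ℚ) → (∀ r → 0ℚ ≤ h r) → ∀ {c} → 0ℚ ≤ c →
    c * 𝔼 w (λ r → ⟦ not (h r ⊑ c) ⟧) ≤ 𝔼 w h
  markov< {w = w} D h h≥0 {c} 0≤c = ≤-trans (≤-reflexive (sym (𝔼-*ˡ c _))) (𝔼-mono D pt)
    where
    pt : ∀ r → c * ⟦ not (h r ⊑ c) ⟧ ≤ h r
    pt r with h r ⊑ c in eq
    ... | false = ≤-trans (≤-reflexive (*-identityʳ c)) (<⇒≤ (⊑-false eq))
    ... | true = ≤-trans (≤-reflexive (zeroʳ c)) (h≥0 r)

  -- `bR` stands for the codegree function averaged over the references; what is used of it is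
  -- nonnegativity, the property `Bessel` and the bound on the total `loss`.
  module At {I : Set} {N k : ℕ} (S : Str I k) (a : I) (ι : Fin N → I) (bR : I → I → Fin k → ℚ)
    (bR≥0 : ∀ i j r → 0ℚ ≤ bR i j r) (u δ' δ₄ ζ ζ₁ : ℚ) (B K : ℕ)
    (0<u : 0ℚ < u) (16u≤1 : 16ᵣ * u ≤ 1ℚ) (0≤δ' : 0ℚ ≤ δ') (0≤δ₄ : 0ℚ ≤ δ₄) where
    open Str S
    open Ops S

    P : Fin N → Fin k → ℚ
    P x = d a (ι x)

    DP : ∀ x → Dist (P x)
    DP x = d-Dist a (ι x)

    -- `δ₅` is a lower bound for `density` at a found copy: the edges abx, yac, zad contribute
    -- `δ u`, `δ u`, `δ ½`, the three correlations `δ₄` each, and the edge xyz contributes ¼. At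
    -- least `m` classes survive the extraction.
    δ δ₅ m : ℚ
    δ = 16ᵣ * u
    δ₅ = ((δ * u) * ((δ * u) * (δ * ½))) * (δ₄ * (δ₄ * (δ₄ * ¼)))
    m = pow u K * nat N

    0≤u : 0ℚ ≤ u
    0≤u = <⇒≤ 0<u
    0<δ : 0ℚ < δ
    0<δ = 0<* 0<16 0<u
    0≤δ = <⇒≤ 0<δ
    u≤1 : u ≤ 1ℚ
    u≤1 = ≤-trans (le ((16ᵣ - 1ℚ) * u) (0≤* 0≤15 0≤u) (lem u)) 16u≤1
      where
      lem : ∀ u → 16ᵣ * u ≡ u + (16ᵣ - 1ℚ) * u
      lem = solve 1 (λ u → con 16ᵣ :* u := u :+ ((con 16ᵣ) :- (con 1ℚ)) :* u) refl
      0≤15 : 0ℚ ≤ 16ᵣ - 1ℚ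
      0≤15 = subst (0ℚ ≤_) (l 0ℚ) (0≤+ (<⇒≤ 0<8) (0≤+ (<⇒≤ 0<4) (0≤+ (<⇒≤ 0<2) 0≤1)))
        where
        l : ∀ x → 8ᵣ + (4ᵣ + (2ᵣ + 1ℚ)) ≡ 16ᵣ - 1ℚ
        l = solve 1 (λ x → con 8ᵣ :+ ((con 4ᵣ) :+ ((con 2ᵣ) :+ (con 1ℚ))) := con 16ᵣ :- (con 1ℚ)) refl

    good : Fin N → Fin N → Fin k → Bool
    good i j r = δ' ⊑ bR (ι i) (ι j) r

    -- thick adjacency witnessed by colours with a large average codegree into the reference classes
    L : Fin N → Fin N → Fin k → Fin k → Bool
    L i j p q = δ ⊑ 𝔼 (d (ι i) (ι j)) λ r → W a (ι i) (ι j) p q r * ⟦ good i j r ⟧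

    Dropped : Fin N → Fin N → Fin k → Fin k → Bool
    Dropped i j p q = δ ⊑ 𝔼 (d (ι i) (ι j)) λ r → W a (ι i) (ι j) p q r * ⟦ not (good i j r) ⟧

    loss : Fin N → Fin N → ℚ
    loss i j = 𝔼 (P j) λ q → 𝔼 (P i) λ p → 𝔼 (d (ι i) (ι j)) λ r → W a (ι i) (ι j) p q r * ⟦ not (good i j r) ⟧

    open Link P DP L using (f; f-Unit)

    private
      W≥0 : ∀ i j p q r → 0ℚ ≤ W a (ι i) (ι j) p q r
      W≥0 i j p q r = proj₁ (W-Unit a (ι i) (ι j) p q r)

      dropped : Fin N → Fin N → ℚ
      dropped i j = 𝔼 (P j) λ q → 𝔼 (P i) λ p → ⟦ Dropped i j p q ⟧

      err : Fin N → Fin N → ℚ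
      err i j = 2ᵣ * dropped i j

      dropped-Unit : ∀ i j → Unit (dropped i j)
      dropped-Unit i j = 𝔼-Unit (DP j) λ q → 𝔼-Unit (DP i) λ p → Unit⟦⟧ (Dropped i j p q)

      err≥0 : ∀ i j → 0ℚ ≤ err i j
      err≥0 i j = 0≤* (<⇒≤ 0<2) (proj₁ (dropped-Unit i j))

      dropped≤loss : ∀ i j → δ * dropped i j ≤ loss i j
      dropped≤loss i j = ≤-trans (≤-reflexive (sym (𝔼-*ˡ δ _))) (𝔼-mono (DP j) λ q →
        markov (DP i) _ (λ p → 𝔼-≥ (d-Dist (ι i) (ι j)) 0ℚ λ r → 0≤* (W≥0 i j p q r) (0≤⟦⟧ (not (good i j r)))) 0≤δ)

      -- A codegree of at least `2δ` splits into parts from good and from other colours, one of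
      -- which is at least `δ`; hence the doubled threshold in `Φ`.
      thick⇒ : ∀ i j p q → ⟦ thick (δ + δ) a (ι i) (ι j) p q ⟧ ≤ ⟦ L i j p q ⟧ + ⟦ Dropped i j p q ⟧
      thick⇒ i j p q = go (thick (δ + δ) a (ι i) (ι j) p q) (L i j p q) (Dropped i j p q) refl refl refl
        where
        E₁ = 𝔼 (d (ι i) (ι j)) λ r → W a (ι i) (ι j) p q r * ⟦ good i j r ⟧
        E₂ = 𝔼 (d (ι i) (ι j)) λ r → W a (ι i) (ι j) p q r * ⟦ not (good i j r) ⟧
        parts : ∀ b w → w ≡ w * ⟦ b ⟧ + w * ⟦ not b ⟧
        parts true w = l w
          where
          l : ∀ w → w ≡ w * 1ℚ + w * 0ℚ
          l = solve 1 (λ w → w := w :* (con 1ℚ) :+ w :* (con 0ℚ)) refl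
        parts false w = l w
          where
          l : ∀ w → w ≡ w * 0ℚ + w * 1ℚ
          l = solve 1 (λ w → w := w :* (con 0ℚ) :+ w :* (con 1ℚ)) refl
        sum : 𝔼 (d (ι i) (ι j)) (λ r → W a (ι i) (ι j) p q r) ≡ E₁ + E₂
        sum = trans (𝔼-cong λ r → parts (good i j r) _) (𝔼-+ _ _)
        go : ∀ t l e → thick (δ + δ) a (ι i) (ι j) p q ≡ t → L i j p q ≡ l → Dropped i j p q ≡ e → ⟦ t ⟧ ≤ ⟦ l ⟧ + ⟦ e ⟧
        go false l e _ _ _ = 0≤+ (0≤⟦⟧ l) (0≤⟦⟧ e)
        go true true e _ _ _ = le ⟦ e ⟧ (0≤⟦⟧ e) refl
        go true false true _ _ _ = ≤-reflexive (sym (+-identityˡ 1ℚ))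
        go true false false et el ed = ⊥-elim (no< (⊑-true et) (subst (_< δ + δ) (sym sum) (+-mono-<-≤ (⊑-false el) (<⇒≤ (⊑-false ed)))))

      -- If a degree drops by at most `e` and both values are at most 1, the squares differ by at
      -- most `2e`; this is the factor 2 in `err`.
      Φ-clean : ∀ x z → Φ (δ + δ) a (ι x) (ι z) ≤ 𝔼 (P z) (λ q → f x z q * f x z q) + err x z
      Φ-clean x z = ≤-trans (𝔼-mono (DP z) pt) (≤-reflexive (trans (𝔼-+ _ _) (cong (𝔼 (P z) (λ q → f x z q * f x z q) +_) (𝔼-*ˡ 2ᵣ _))))
        where
        pt : ∀ q → degree (δ + δ) a (ι x) (ι z) q * degree (δ + δ) a (ι x) (ι z) q ≤ f x z q * f x z q + 2ᵣ * 𝔼 (P x) (λ p → ⟦ Dropped x z p q ⟧)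
        pt q = go (≤-total y g)
          where
          y = degree (δ + δ) a (ι x) (ι z) q
          g = f x z q
          e = 𝔼 (P x) (λ p → ⟦ Dropped x z p q ⟧)
          yu : Unit y
          yu = 𝔼-Unit (DP x) λ p → Unit⟦⟧ (thick (δ + δ) a (ι x) (ι z) p q)
          y≤ : y ≤ g + e
          y≤ = ≤-trans (𝔼-mono (DP x) λ p → thick⇒ x z p q) (≤-reflexive (𝔼-+ _ _))
          0≤e : 0ℚ ≤ e
          0≤e = 𝔼-≥ (DP x) 0ℚ λ p → 0≤⟦⟧ (Dropped x z p q)
          gu = f-Unit x z q
          go : y ≤ g Data.Sum.⊎ g ≤ y → y * y ≤ g * g + 2ᵣ * e
          go (Data.Sum.inj₁ h) = ≤-trans (*-mono (proj₁ yu) (proj₁ yu) h h) (le (2ᵣ * e) (0≤* (<⇒≤ 0<2) 0≤e) refl)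
          go (Data.Sum.inj₂ h) = le _ (0≤+ (0≤* (<⇒≤ 0<2) (diff y≤)) (0≤* (diff h) (0≤+ (diff (proj₂ yu)) (diff (proj₂ gu))))) (l y g e)
            where
            l : ∀ y g e → g * g + 2ᵣ * e ≡ y * y + (2ᵣ * (g + e - y) + (y - g) * ((1ℚ - y) + (1ℚ - g)))
            l = solve 3 (λ y g e →
              g :* g :+ (con 2ᵣ) :* e
              := y :* y :+ ((con 2ᵣ) :* (g :+ e :- y) :+ (y :- g) :* (((con 1ℚ) :- y) :+ ((con 1ℚ) :- g)))) refl

    -- From here on the classes `x`, `v`, `b` carry the pattern vertices b, c, d, while `x'` carries
    -- the pattern vertex x; `y` and `z` keep their names.
    order : Fin N → Fin N → Fin N → Fin N → Fin N → Fin N → Bool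
    order y z x x' v b = (y ≺ z) ∧ ((z ≺ x) ∧ ((x ≺ x') ∧ ((x' ≺ v) ∧ (v ≺ b))))

    dens : Fin N → Fin N → Fin N → Fin N → Fin N → Fin N → Fin k → ℚ
    dens y z x x' v b p₀ = density₀ a (ι y) (ι z) (ι x) (ι x') (ι v) (ι b) p₀

    -- The weight of all copies whose vertex d lies in class `b` and whose pair ad has colour `p₀`;
    -- the colours to be avoided are those where it is large.
    through : Fin N → Fin k → ℚ
    through b p₀ = ∑ λ x → ∑ λ v → ∑ λ y → ∑ λ z → ∑ λ x' → ⟦ order y z x x' v b ⟧ * dens y z x x' v b p₀

    Bessel : Set
    Bessel = ∀ i j → (i ≺ j) ≡ true → ∀ (w : Fin k → ℚ) → (∀ r → Unit (w r)) → δ * δ' ≤ 𝔼 (d (ι i) (ι j)) (λ r → w r * bR (ι i) (ι j) r) →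
        ∣ (λ y → (y ≺ i) ∧ not (δ₄ ⊑ 𝔼 (d (ι i) (ι j)) (λ r → w r * β (ι y) (ι i) (ι j) r))) ∣ < nat B

    Dense-triples : Set
    Dense-triples = ∀ i j l → (i ≺ j) ≡ true → (j ≺ l) ≡ true → ¼ ≤ κ (ι i) (ι j) (ι l)

    module Copies (bessel : Bessel) (hκ : Dense-triples) (Z : Fin N → Bool) (b : Fin N) (p₀ : Fin k)
      (nbh : ∀ x → Z x ≡ true → (x ≺ b) ≡ true × ½ ≤ f x b p₀) where
      open Triples P DP L u 0<u B Z

      pair-density : Fin N → Fin N → ℚ
      pair-density x v = ∑ λ y → ∑ λ z → ∑ λ x' → ⟦ order y z x x' v b ⟧ * dens y z x x' v b p₀

      δ₅≥0 : 0ℚ ≤ δ₅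
      δ₅≥0 = 0≤* (0≤* (0≤* 0≤δ 0≤u) (0≤* (0≤* 0≤δ 0≤u) (0≤* 0≤δ (<⇒≤ 0<½)))) (0≤* 0≤δ₄ (0≤* 0≤δ₄ (0≤* 0≤δ₄ (<⇒≤ 0<¼))))

      thick-codegree : ∀ i j p q → L i j p q ≡ true → δ ≤ 𝔼 (d (ι i) (ι j)) λ r → W a (ι i) (ι j) p q r
      thick-codegree i j p q h = ≤-trans (⊑-true h) (𝔼-mono (d-Dist (ι i) (ι j)) λ r →
        ≤-trans (*-monoʳ _ (W≥0 i j p q r) (⟦⟧≤1 (good i j r))) (≤-reflexive (*-identityʳ _)))

      scaled : ∀ l y → (l ≡ true → δ ≤ y) → 0ℚ ≤ y → δ * ⟦ l ⟧ ≤ y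
      scaled true y h _ = ≤-trans (≤-reflexive (*-identityʳ δ)) (h refl)
      scaled false y _ h = ≤-trans (≤-reflexive (zeroʳ δ)) h

      EW≥0 : ∀ i j p q → 0ℚ ≤ 𝔼 (d (ι i) (ι j)) λ r → W a (ι i) (ι j) p q r
      EW≥0 i j p q = 𝔼-≥ (d-Dist (ι i) (ι j)) 0ℚ (W≥0 i j p q)

      between≥ : ∀ y z q c → c ≤ f y z q → δ * c ≤ between a (ι y) (ι z) q
      between≥ y z q c h = ≤-trans (*-monoʳ δ 0≤δ h) (≤-trans (≤-reflexive (sym (𝔼-*ˡ δ _))) (𝔼-mono (DP y) λ p →
        scaled (L y z p q) _ (thick-codegree y z p q) (EW≥0 y z p q)))

      beyond≥ : ∀ x y p c → c ≤ g x y p → δ * c ≤ beyond a (ι x) (ι y) p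
      beyond≥ x y p c h = ≤-trans (*-monoʳ δ 0≤δ h) (≤-trans (≤-reflexive (sym (𝔼-*ˡ δ _))) (𝔼-mono (DP y) λ q →
        scaled (L x y p q) _ (thick-codegree x y p q) (EW≥0 x y p q)))

      exceptional : Fin N → Fin N → Fin k → Fin k → Fin N → Bool
      exceptional i j p q y = (y ≺ i) ∧ not (δ₄ ⊑ Γ a (ι i) (ι j) p q (ι y))

      -- Adjacency in `L` is witnessed by weight `δ` on good colours, on each of which the reference
      -- codegree is at least `δ'`. So the edge weight at the pivot is an admissible test for
      -- `Bessel`.
      few-exceptional : ∀ i j p q → (i ≺ j) ≡ true → L i j p q ≡ true → ∣ exceptional i j p q ∣ < nat B
      few-exceptional i j p q ij h = bessel i j ij (W a (ι i) (ι j) p q) (W-Unit a (ι i) (ι j) p q)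
        (≤-trans (≤-trans (*-monoˡ δ' 0≤δ' (⊑-true h)) (≤-reflexive (sym (𝔼-*ʳ δ' _)))) (𝔼-mono (d-Dist (ι i) (ι j)) pt))
        where
        pt : ∀ r → W a (ι i) (ι j) p q r * ⟦ good i j r ⟧ * δ' ≤ W a (ι i) (ι j) p q r * bR (ι i) (ι j) r
        pt r with δ' ⊑ bR (ι i) (ι j) r in eq
        ... | true = ≤-trans (≤-reflexive (cong (_* δ') (*-identityʳ _))) (*-monoʳ _ (W≥0 i j p q r) (⊑-true eq))
        ... | false = ≤-trans (≤-reflexive (trans (cong (_* δ') (zeroʳ _)) (zeroˡ δ'))) (0≤* (W≥0 i j p q r) (bR≥0 (ι i) (ι j) r))

      unexceptional : ∀ {i j p q y} → (y ≺ i) ≡ true → exceptional i j p q y ≡ false → δ₄ ≤ Γ a (ι i) (ι j) p q (ι y)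
      unexceptional {i} {j} {p} {q} {y} h e = ⊑-not (subst (λ o → (o ∧ not (δ₄ ⊑ Γ a (ι i) (ι j) p q (ι y))) ≡ false) h e)

      module _ (x v : Fin N) (pxv : pair Z x v ≡ true) where
        private
          xv = proj₁ (∧-true {x ≺ v} pxv)
          Zx = proj₁ (∧-true {Z x} (proj₂ (∧-true {x ≺ v} pxv)))
          Zv = proj₂ (∧-true {Z x} (proj₂ (∧-true {x ≺ v} pxv)))
          xb = proj₁ (nbh x Zx)
          vb = proj₁ (nbh v Zv)

        -- z is taken from `down v q` below `x`, late enough to leave `B` members below it, and y
        -- from among those; x' comes from `up x p` below `v`. Each choice has to avoid the
        -- exceptional classes of one pair only: xv for z, xb for y, vb for x'.
        found-copy : ∀ q p → rich b p₀ x v q p ≡ true → ∃ λ y → ∃ λ z → ∃ λ x' →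
          order y z x x' v b ≡ true × δ₅ ≤ density a (ι y) (ι z) (ι x) (ι x') (ι v) (ι b) p₀ q p
        found-copy q p h = y , z , x' , ∧-intro yz (∧-intro zx (∧-intro xx' (∧-intro x'v vb))) , bound
          where
          tris = proj₁ (∧-true h)
          ranks = proj₂ (∧-true {L x b p p₀ ∧ (L x v p q ∧ L v b q p₀)} h)
          Lxb = proj₁ (∧-true tris)
          Lxv = proj₁ (∧-true (proj₂ (∧-true {L x b p p₀} tris)))
          Lvb = proj₂ (∧-true {L x v p q} (proj₂ (∧-true {L x b p p₀} tris)))
          lateD : nat (B ℕ.+ B) ≤ before (down v q) x
          lateD = ⊑-true (proj₂ (∧-true {u ⊑ f x v q} (proj₁ (∧-true ranks))))
          lateU : nat B ≤ before (up x p) v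
          lateU = ⊑-true (proj₂ (∧-true {u ⊑ g x v p} (proj₂ (∧-true {(u ⊑ f x v q) ∧ late-down v q x} ranks))))

          A₁ : Fin N → Bool
          A₁ z = (down v q z ∧ (z ≺ x)) ∧ (nat B ⊑ before (down v q) z)
          -- At least `2B` members of `down v q` lie below `x`, and at most `B` of them have fewer
          -- than `B` predecessors.
          countA₁ : nat B ≤ ∣ A₁ ∣
          countA₁ = le ((∣ A₁ ∣ + E - before (down v q) x) + ((nat B - E) + (before (down v q) x - nat (B ℕ.+ B))))
              (0≤+ (diff split) (0≤+ (diff (early (down v q) B)) (diff lateD)))
              (trans (l ∣ A₁ ∣ E (nat B) (before (down v q) x) (nat B + nat B)) (cong (λ o → nat B + ((∣ A₁ ∣ + E - before (down v q) x) + ((nat B - E) + (before (down v q) x - o)))) (sym (nat-+ B B))))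
            where
            E = ∑ λ z → ⟦ down v q z ⟧ * ⟦ not (nat B ⊑ before (down v q) z) ⟧
            l : ∀ A E n b o → A ≡ n + ((A + E - b) + ((n - E) + (b - (n + n))))
            l = solve 5 (λ A E n b o → A := n :+ ((A :+ E :- b) :+ ((n :- E) :+ (b :- (n :+ n))))) refl
            pt : ∀ o d e → ⟦ o ⟧ * ⟦ d ⟧ ≤ ⟦ (d ∧ o) ∧ e ⟧ + ⟦ d ⟧ * ⟦ not e ⟧
            pt false d e = ≤-trans (≤-reflexive (zeroˡ _)) (0≤+ (0≤⟦⟧ ((d ∧ false) ∧ e)) (0≤* (0≤⟦⟧ d) (0≤⟦⟧ (not e))))
            pt true false e = ≤-trans (≤-reflexive (zeroʳ _)) (0≤+ ≤-refl (0≤* ≤-refl (0≤⟦⟧ (not e))))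
            pt true true true = ≤-reflexive (l' 0ℚ)
              where
              l' : ∀ x → 1ℚ * 1ℚ ≡ 1ℚ + 1ℚ * 0ℚ
              l' = solve 1 (λ x → con 1ℚ :* (con 1ℚ) := con 1ℚ :+ (con 1ℚ) :* (con 0ℚ)) refl
            pt true true false = ≤-reflexive (sym (+-identityˡ _))
            split : before (down v q) x ≤ ∣ A₁ ∣ + E
            split = ≤-trans (∑-mono λ z → pt (z ≺ x) (down v q z) (nat B ⊑ before (down v q) z)) (≤-reflexive (∑-+ _ _))

          pz = pick {A = A₁} {C = exceptional x v p q} (<-≤-trans (few-exceptional x v p q xv Lxv) countA₁)
          z = proj₁ pz
          A₁z = proj₁ (proj₂ pz)
          dz = proj₁ (∧-true (proj₁ (∧-true A₁z)))
          zx = proj₂ (∧-true {down v q z} (proj₁ (∧-true A₁z)))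
          bz : nat B ≤ before (down v q) z
          bz = ⊑-true (proj₂ (∧-true {down v q z ∧ (z ≺ x)} A₁z))
          Γz = unexceptional {x} {v} {p} {q} zx (proj₂ (proj₂ pz))

          below : (Fin N → Bool) → Fin N → Fin N → Bool
          below A x y = (y ≺ x) ∧ A y
          below-count : ∀ A x → ∣ below A x ∣ ≡ before A x
          below-count A x = ∑-cong λ y → ⟦∧⟧ (y ≺ x) (A y)

          py = pick {A = below (down v q) z} {C = exceptional x b p p₀} (<-≤-trans (few-exceptional x b p p₀ xb Lxb) (subst (nat B ≤_) (sym (below-count (down v q) z)) bz))
          y = proj₁ py
          yz = proj₁ (∧-true {y ≺ z} (proj₁ (proj₂ py)))
          dy = proj₂ (∧-true {y ≺ z} (proj₁ (proj₂ py)))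
          yx = ≺-trans {x = y} {z} {x} yz zx
          Γy = unexceptional {x} {b} {p} {p₀} yx (proj₂ (proj₂ py))

          px = pick {A = below (up x p) v} {C = exceptional v b q p₀} (<-≤-trans (few-exceptional v b q p₀ vb Lvb) (subst (nat B ≤_) (sym (below-count (up x p) v)) lateU))
          x' = proj₁ px
          x'v = proj₁ (∧-true {x' ≺ v} (proj₁ (proj₂ px)))
          ux' = proj₂ (∧-true {x' ≺ v} (proj₁ (proj₂ px)))
          xx' = proj₁ (∧-true {x ≺ x'} (proj₂ (∧-true {Z x'} ux')))
          Γx = unexceptional {v} {b} {q} {p₀} x'v (proj₂ (proj₂ px))

          be = beyond≥ x x' p u (⊑-true (proj₂ (∧-true {x ≺ x'} (proj₂ (∧-true {Z x'} ux')))))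
          bty = between≥ y v q u (⊑-true (proj₂ (∧-true {y ≺ v} (proj₂ (∧-true {Z y} dy)))))
          -- For the edge zad the degree comes from the extraction: z lies in `Z`, so the degree of
          -- `p₀` into its class is at least ½.
          btz = between≥ z b p₀ ½ (proj₂ (nbh z (proj₁ (∧-true {Z z} dz))))
          bound : δ₅ ≤ density a (ι y) (ι z) (ι x) (ι x') (ι v) (ι b) p₀ q p
          bound = *-mono (0≤* n₁ (0≤* n₁ n₂)) (0≤* 0≤δ₄ (0≤* 0≤δ₄ (0≤* 0≤δ₄ (<⇒≤ 0<¼))))
            (*-mono n₁ (0≤* n₁ n₂) be (*-mono n₁ n₂ bty btz))
            (*-mono 0≤δ₄ (0≤* 0≤δ₄ (0≤* 0≤δ₄ (<⇒≤ 0<¼))) Γz (*-mono 0≤δ₄ (0≤* 0≤δ₄ (<⇒≤ 0<¼)) Γy (*-mono 0≤δ₄ (<⇒≤ 0<¼) Γx (hκ y z x' yz (≺-trans {x = z} {x} {x'} zx xx')))))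
            where
            n₁ = 0≤* 0≤δ 0≤u
            n₂ = 0≤* 0≤δ (<⇒≤ 0<½)

        dens-qp : Fin N → Fin N → Fin N → Fin k → Fin k → ℚ
        dens-qp y z x' q p = ⟦ order y z x x' v b ⟧ * density a (ι y) (ι z) (ι x) (ι x') (ι v) (ι b) p₀ q p

        dens-qp≥0 : ∀ y z x' q p → 0ℚ ≤ dens-qp y z x' q p
        dens-qp≥0 y z x' q p = 0≤* (0≤⟦⟧ (order y z x x' v b)) (density≥0 a (ι y) (ι z) (ι x) (ι x') (ι v) (ι b) p₀ q p)

        pointwise : ∀ q p → δ₅ * ⟦ rich b p₀ x v q p ⟧ ≤ ∑ λ y → ∑ λ z → ∑ λ x' → dens-qp y z x' q p
        pointwise q p = go (rich b p₀ x v q p) refl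
          where
          go : ∀ o → rich b p₀ x v q p ≡ o → δ₅ * ⟦ o ⟧ ≤ ∑ λ y → ∑ λ z → ∑ λ x' → dens-qp y z x' q p
          go false e = ≤-trans (≤-reflexive (zeroʳ δ₅)) (∑-nonneg λ y → ∑-nonneg λ z → ∑-nonneg λ x' → dens-qp≥0 y z x' q p)
          go true e = let y , z , x' , o , h = found-copy q p e in
            ≤-trans (≤-reflexive (*-identityʳ δ₅)) (≤-trans h (≤-trans (≤-reflexive (sym (trans (cong (λ c → ⟦ c ⟧ * density a (ι y) (ι z) (ι x) (ι x') (ι v) (ι b) p₀ q p) o) (*-identityˡ _))))
              (≤-trans (term≤∑ (λ x' → dens-qp≥0 y z x' q p) x') (≤-trans (term≤∑ (λ z → ∑-nonneg λ x' → dens-qp≥0 y z x' q p) z)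
                (term≤∑ (λ y → ∑-nonneg λ z → ∑-nonneg λ x' → dens-qp≥0 y z x' q p) y)))))

        collect : 𝔼 (P v) (λ q → 𝔼 (P x) (λ p → ∑ λ y → ∑ λ z → ∑ λ x' → dens-qp y z x' q p)) ≡
          ∑ λ y → ∑ λ z → ∑ λ x' → ⟦ order y z x x' v b ⟧ * dens y z x x' v b p₀
        collect = trans (𝔼-cong λ q → trans (𝔼-swap-∑ _) (∑-cong λ y → trans (𝔼-swap-∑ _) (∑-cong λ z → trans (𝔼-swap-∑ _) (∑-cong λ x' → 𝔼-*ˡ _ _))))
          (trans (𝔼-swap-∑ _) (∑-cong λ y → trans (𝔼-swap-∑ _) (∑-cong λ z → trans (𝔼-swap-∑ _) (∑-cong λ x' → 𝔼-*ˡ _ _))))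

        rich⇒density : δ₅ * 𝔼 (P v) (λ q → 𝔼 (P x) (λ p → ⟦ rich b p₀ x v q p ⟧)) ≤ pair-density x v
        rich⇒density = ≤-trans (≤-reflexive (sym (trans (𝔼-cong λ q → 𝔼-*ˡ δ₅ _) (𝔼-*ˡ δ₅ _))))
          (≤-trans (𝔼-mono (DP v) λ q → 𝔼-mono (DP x) λ p → pointwise q p) (≤-reflexive collect))

    -- The mean of `through` over `p₀` is small, so by Markov's inequality the colours where it
    -- exceeds `ζ₁` have mass at most `u` and may be forbidden in the extraction. The colour found
    -- is thus poor in copies, although `rich-pair` exhibits weight `δ₅ u` through it.
    contradiction :
      1ℚ ≤ ½ + nat K * (4ᵣ * u) →
      nat (B ℕ.+ B) + nat B ≤ u * m → 2ᵣ ≤ m →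
      (∀ x z → (x ≺ z) ≡ true → ¼ + 64ᵣ * u ≤ Φ (δ + δ) a (ι x) (ι z)) →
      ∑₂ (λ x z → ⟦ x ≺ z ⟧ * loss x z) ≤ δ * (u * (m * m)) →
      Bessel → Dense-triples →
      (∀ y z x x' v b → order y z x x' v b ≡ true → F7-density a (ι y) (ι z) (ι x) (ι x') (ι v) (ι b) ≤ ζ) →
      0ℚ ≤ ζ → nat N * (nat N * (nat N * (nat N * (nat N * ζ)))) ≤ ζ₁ * u → 0ℚ < ζ₁ → ζ₁ < δ₅ * u → ⊥
    contradiction hK hB h2 hΦ hloss bessel hκ hF 0≤ζ hζ 0<ζ₁ hζ₁ = no< big hζ₁
      where
      X : Fin N → Fin k → Bool
      X b p₀ = not (through b p₀ ⊑ ζ₁)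
      term≥0 : ∀ x v y z x' b p₀ → 0ℚ ≤ ⟦ order y z x x' v b ⟧ * dens y z x x' v b p₀
      term≥0 x v y z x' b p₀ = 0≤* (0≤⟦⟧ (order y z x x' v b)) (density₀≥0 a (ι y) (ι z) (ι x) (ι x') (ι v) (ι b) p₀)
      s₃≥0 : ∀ b p₀ x v → 0ℚ ≤ ∑ λ y → ∑ λ z → ∑ λ x' → ⟦ order y z x x' v b ⟧ * dens y z x x' v b p₀
      s₃≥0 b p₀ x v = ∑-nonneg λ y → ∑-nonneg λ z → ∑-nonneg λ x' → term≥0 x v y z x' b p₀
      through≥0 : ∀ b p₀ → 0ℚ ≤ through b p₀
      through≥0 b p₀ = ∑-nonneg λ x → ∑-nonneg λ v → s₃≥0 b p₀ x v
      swap : ∀ {w : Fin k → ℚ} {n} {h : Fin n → Fin k → ℚ} {c} → (∀ i → 𝔼 w (h i) ≤ c) → 𝔼 w (λ r → ∑ λ i → h i r) ≤ nat n * c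
      swap {c = c} h = ≤-trans (≤-reflexive (𝔼-swap-∑ _)) (≤-trans (∑-mono h) (≤-reflexive (∑-const c)))
      term≤ζ : ∀ x v y z x' b → 𝔼 (P b) (λ p₀ → ⟦ order y z x x' v b ⟧ * dens y z x x' v b p₀) ≤ ζ
      term≤ζ x v y z x' b = ≤-trans (≤-reflexive (𝔼-*ˡ _ _)) (go (order y z x x' v b) refl)
        where
        go : ∀ o → order y z x x' v b ≡ o → ⟦ o ⟧ * 𝔼 (P b) (dens y z x x' v b) ≤ ζ
        go true e = ≤-trans (≤-reflexive (*-identityˡ _)) (hF y z x x' v b e)
        go false e = ≤-trans (≤-reflexive (zeroˡ _)) 0≤ζ
      hX : ∀ b → 𝔼 (P b) (λ p₀ → ⟦ X b p₀ ⟧) ≤ u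
      hX b = cancelˡ ζ₁ 0<ζ₁ (≤-trans (markov< (DP b) (through b) (through≥0 b) (<⇒≤ 0<ζ₁))
        (≤-trans (swap λ x → swap λ v → swap λ y → swap λ z → swap λ x' → term≤ζ x v y z x' b) hζ))
      uu : Unit u
      uu = 0≤u , u≤1
      open Link.Search P DP L X u uu hX
      all : Fin N → Bool
      all _ = true
      ex = extract (4ᵣ * u) (0≤* (<⇒≤ 0<4) 0≤u) K ½ all ≤-refl hK (start refl)
      T = proj₁ ex
      Z = proj₁ (proj₂ ex)
      few = proj₁ (proj₂ (proj₂ (proj₂ ex)))
      m≤n : m ≤ ∣ Z ∣
      m≤n = proj₁ (proj₂ (proj₂ (proj₂ (proj₂ ex))))
      prev = proj₂ (proj₂ (proj₂ (proj₂ (proj₂ ex))))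
      0≤m : 0ℚ ≤ m
      0≤m = 0≤* (<⇒≤ (0<pow 0<u K)) (0≤nat N)
      herr : ∑₂ (λ x z → ⟦ x ≺ z ⟧ * err x z) ≤ (u + u) * (∣ Z ∣ * ∣ Z ∣)
      herr = cancelˡ δ 0<δ (≤-trans (≤-reflexive (trans (sym (∑₂-*ˡ δ _)) (trans (∑₂-cong λ x z → l ⟦ x ≺ z ⟧ δ (dropped x z)) (∑₂-*ˡ 2ᵣ _))))
        (≤-trans (*-monoʳ 2ᵣ (<⇒≤ 0<2) (≤-trans (∑₂-mono λ x z → *-monoʳ ⟦ x ≺ z ⟧ (0≤⟦⟧ (x ≺ z)) (dropped≤loss x z)) hloss))
          (≤-trans (≤-reflexive (l' δ u (m * m))) (*-monoʳ δ 0≤δ (*-monoʳ (u + u) (0≤+ 0≤u 0≤u) (*-mono 0≤m 0≤m m≤n m≤n))))))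
        where
        l : ∀ o δ e → δ * (o * (2ᵣ * e)) ≡ 2ᵣ * (o * (δ * e))
        l = solve 3 (λ o δ e → δ :* (o :* ((con 2ᵣ) :* e)) := con 2ᵣ :* (o :* (δ :* e))) refl
        l' : ∀ δ u m → 2ᵣ * (δ * (u * m)) ≡ δ * ((u + u) * m)
        l' = solve 3 (λ δ u m → con 2ᵣ :* (δ :* (u :* m)) := δ :* ((u :+ u) :* m)) refl
      open Triangles P DP L
      n≥2 : 2ᵣ ≤ ∣ Z ∣
      n≥2 = ≤-trans h2 m≤n
      dn = dense-neighbourhood u 0<u 16u≤1 err (λ x z e → ≤-trans (hΦ x z e) (Φ-clean x z)) X uu hX T Z few herr err≥0 n≥2 prev
      b = proj₁ dn
      p₀ = proj₁ (proj₂ dn)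
      Xb : X b p₀ ≡ false
      Xb = proj₁ (proj₂ (proj₂ dn))
      nbh = proj₁ (proj₂ (proj₂ (proj₂ dn)))
      hτ = proj₂ (proj₂ (proj₂ (proj₂ dn)))
      open Copies bessel hκ Z b p₀ nbh
      rp = Triples.rich-pair P DP L u 0<u B Z b p₀ hτ (≤-trans hB (*-monoʳ u 0≤u m≤n)) n≥2
      x = proj₁ rp
      v = proj₁ (proj₂ rp)
      big : δ₅ * u ≤ ζ₁
      big = ≤-trans (*-monoʳ δ₅ δ₅≥0 (proj₂ (proj₂ (proj₂ rp)))) (≤-trans (rich⇒density x v (proj₁ (proj₂ (proj₂ rp))))
        (≤-trans (term≤∑ (s₃≥0 b p₀ x) v) (≤-trans (term≤∑ (λ x → ∑-nonneg λ v → s₃≥0 b p₀ x v) x) (⊑-not Xb))))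

-- Reference averages and the Bessel argument.

module Spread where
  open import Data.Fin using (_↑ˡ_; _↑ʳ_)
  open import Data.Fin.Properties using (any?)
  import Data.Sum
  open Field
  open Base
  open Count
  open Extract
  open Structure

  ∑-≤⇒∃ : ∀ {n} {f g : Fin (suc n) → ℚ} → ∑ f ≤ ∑ g → ∃ λ i → f i ≤ g i
  ∑-≤⇒∃ {n} {f} {g} h with any? (λ i → f i ≤? g i)
  ... | yes e = e
  ... | no e = ⊥-elim (no< h (subst₂ _<_ (sym (∑-suc g)) (sym (∑-suc f)) (+-mono-<-≤ (g<f zero) (∑-mono (λ i → <⇒≤ (g<f (suc i)))))))
    where
    g<f : ∀ i → g i < f i
    g<f i = ≰⇒> (λ l → e (i , l))

  avg : ∀ {n k} → (Fin n → ℚ) → (Fin n → Fin k → ℚ) → Fin k → ℚ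
  avg u b r = ∑ λ y → u y * b y r

  avg-linear : ∀ {n k} {w : Fin k → ℚ} (u : Fin n → ℚ) (b : Fin n → Fin k → ℚ) (g : Fin k → ℚ) →
    𝔼 w (λ r → g r * avg u b r) ≡ ∑ λ y → u y * 𝔼 w (λ r → g r * b y r)
  avg-linear {w = w} u b g = trans (𝔼-cong λ r → trans (sym (∑-*ˡ (g r) _)) (∑-cong λ y → lem (g r) (u y) (b y r)))
    (trans (𝔼-swap-∑ _) (∑-cong λ y → 𝔼-*ˡ (u y) _))
    where
    lem : ∀ a b c → a * (b * c) ≡ b * (a * c)
    lem = solve 3 (λ a b c → a :* (b :* c) := b :* (a :* c)) refl

  avg-product : ∀ {m n k} {w : Fin k → ℚ} (u : Fin m → ℚ) (b : Fin m → Fin k → ℚ) (v : Fin n → ℚ) (c : Fin n → Fin k → ℚ) →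
    𝔼 w (λ r → avg u b r * avg v c r) ≡ ∑ λ y → ∑ λ z → u y * v z * 𝔼 w (λ r → b y r * c z r)
  avg-product {w = w} u b v c = trans (avg-linear v c (avg u b)) (trans (∑-cong λ z → trans (cong (v z *_) (trans (𝔼-cong λ r → *-comm _ _) (trans (avg-linear u b (c z)) (∑-cong λ y → cong (u y *_) (𝔼-cong λ r → *-comm _ _)))))
    (trans (sym (∑-*ˡ (v z) _)) (∑-cong λ y → lem (v z) (u y) _))) (∑-swap _))
    where
    lem : ∀ a b c → a * (b * c) ≡ b * a * c
    lem = solve 3 (λ a b c → a :* (b :* c) := b :* a :* c) refl

  module _ {k : ℕ} {w : Fin k → ℚ} (D : Dist w) where

    -- Off the diagonal the inner products are at most `γ`. A diagonal entry may exceed this by 1,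
    -- but the diagonal has weight at most `c` when no single weight exceeds `c`.
    average-square : ∀ {n} (u : Fin n → ℚ) (b : Fin n → Fin k → ℚ) {γ c : ℚ} → ∑ u ≡ 1ℚ → (∀ y → 0ℚ ≤ u y) → (∀ y → u y ≤ c) →
      (∀ y z → u y * u z * 𝔼 w (λ r → b y r * b z r) ≤ u y * u z * (γ + ⟦ y ≡ᶠ z ⟧)) →
      𝔼 w (λ r → avg u b r * avg u b r) ≤ γ + c
    average-square u b {γ} {c} ∑u u≥0 u≤c h = ≤-trans (≤-reflexive (avg-product u b u b)) (≤-trans (∑₂-mono h)
      (≤-trans (≤-reflexive (trans (∑₂-cong λ y z → lem (u y) (u z) γ ⟦ y ≡ᶠ z ⟧) (trans (∑₂-+ _ _) (cong₂ _+_
         (trans (∑₂-cong λ y z → *-comm (u y * u z) γ) (trans (∑₂-*ˡ γ _) (trans (cong (γ *_) (trans (∑-∑* u u) (trans (cong₂ _*_ ∑u ∑u) (*-identityˡ 1ℚ)))) (*-identityʳ γ))))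
         (∑-cong λ y → ∑-≡ᶠ y (λ z → u y * u z))))))
        (+-monoʳ-≤ γ (≤-trans (∑-mono λ y → *-monoʳ (u y) (u≥0 y) (u≤c y)) (≤-reflexive (trans (∑-*ʳ c u) (trans (cong (_* c) ∑u) (*-identityˡ c))))))))
      where
      lem : ∀ a b c e → a * b * (c + e) ≡ a * b * c + e * (a * b)
      lem = solve 4 (λ a b c e → a :* b :* (c :+ e) := a :* b :* c :+ e :* (a :* b)) refl

    average-cross : ∀ {m n} (u : Fin m → ℚ) (b : Fin m → Fin k → ℚ) (v : Fin n → ℚ) (c : Fin n → Fin k → ℚ) {γ : ℚ} → ∑ u ≡ 1ℚ → ∑ v ≡ 1ℚ →
      (∀ y z → u y * v z * γ ≤ u y * v z * 𝔼 w (λ r → b y r * c z r)) →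
      γ ≤ 𝔼 w (λ r → avg u b r * avg v c r)
    average-cross u b v c {γ} ∑u ∑v h = ≤-trans (≤-reflexive (sym (trans (∑-cong λ y → ∑-*ʳ γ (λ z → u y * v z)) (trans (∑-*ʳ γ _)
       (trans (cong (_* γ) (trans (∑-∑* u v) (trans (cong₂ _*_ ∑u ∑v) (*-identityˡ 1ℚ)))) (*-identityˡ γ))))))
      (≤-trans (∑-mono λ y → ∑-mono λ z → h y z) (≤-reflexive (sym (avg-product u b v c))))

    -- AM-GM: g (x - y) ≤ t + (x - y)² / (4 t)
    small-difference : ∀ (g x y : Fin k → ℚ) {t} → (∀ r → Unit (g r)) → 0ℚ < t →
      𝔼 w (λ r → (x r - y r) * (x r - y r)) < 4ᵣ * (t * t) → 𝔼 w (λ r → g r * x r) < 𝔼 w (λ r → g r * y r) + (t + t)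
    small-difference g x y {t} gu 0<t hs = cancelˡ-< (4ᵣ * t) (<⇒≤ 0<4t) (≤-<-trans upper (lt _ (diff< hs) (l2 t S Y)))
      where
      S = 𝔼 w (λ r → (x r - y r) * (x r - y r))
      Y = 𝔼 w (λ r → g r * y r)
      0<4t : 0ℚ < 4ᵣ * t
      0<4t = 0<* 0<4 0<t
      l2 : ∀ t S Y → 4ᵣ * t * (Y + (t + t)) ≡ 4ᵣ * t * Y + (4ᵣ * (t * t) + S) + (4ᵣ * (t * t) - S)
      l2 = solve 3 (λ t S Y →
        con 4ᵣ :* t :* (Y :+ (t :+ t))
        := con 4ᵣ :* t :* Y :+ ((con 4ᵣ) :* (t :* t) :+ S) :+ ((con 4ᵣ) :* (t :* t) :- S)) refl
      pt : ∀ r → 4ᵣ * t * (g r * x r) ≤ 4ᵣ * t * (g r * y r) + (4ᵣ * (t * t) + (x r - y r) * (x r - y r))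
      pt r = le _ (0≤+ (0≤sq (2ᵣ * t - g r * (x r - y r))) (0≤* (0≤sq (x r - y r)) (diff (proj₂ (Unit* (gu r) (gu r)))))) (l (g r) (x r) (y r) t)
        where
        l : ∀ g x y t → 4ᵣ * t * (g * y) + (4ᵣ * (t * t) + (x - y) * (x - y)) ≡ 4ᵣ * t * (g * x) + ((2ᵣ * t - g * (x - y)) * (2ᵣ * t - g * (x - y)) + (x - y) * (x - y) * (1ℚ - g * g))
        l = solve 4 (λ g x y t →
          con 4ᵣ :* t :* (g :* y) :+ ((con 4ᵣ) :* (t :* t) :+ (x :- y) :* (x :- y))
          := con 4ᵣ :* t :* (g :* x) :+ (((con 2ᵣ) :* t :- g :* (x :- y)) :* ((con 2ᵣ) :* t :- g :* (x :- y)) :+ (x :- y) :* (x :- y) :* ((con 1ℚ) :- g :* g))) refl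
      upper : 4ᵣ * t * 𝔼 w (λ r → g r * x r) ≤ 4ᵣ * t * Y + (4ᵣ * (t * t) + S)
      upper = ≤-trans (≤-reflexive (sym (𝔼-*ˡ (4ᵣ * t) _))) (≤-trans (𝔼-mono D pt) (≤-reflexive (trans (𝔼-+ _ _) (cong₂ _+_ (𝔼-*ˡ (4ᵣ * t) _) (trans (𝔼-+ _ _) (cong (_+ S) (𝔼-const D _)))))))

  -- The first `B` indices are the references, among which the pivot is also chosen; the remaining
  -- `N` carry the link argument, so every reference lies below every class.
  module Up {k N B' : ℕ} (S : Str (Fin (suc B' ℕ.+ N)) k) (u δ' ζ ζ₁ γ ρ : ℚ) (K : ℕ)
    (0<u : 0ℚ < u) (16u≤1 : 16ᵣ * u ≤ 1ℚ) (0<δ' : 0ℚ < δ') where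
    open Str S
    open Ops S

    B : ℕ
    B = suc B'

    I : Set
    I = Fin (B ℕ.+ N)

    ref : Fin B → I
    ref s = s ↑ˡ N

    ι : Fin N → I
    ι x = B ↑ʳ x

    1/B : ℚ
    1/B = inv (0<nat B')

    0≤1/B : 0ℚ ≤ 1/B
    0≤1/B = <⇒≤ (inv-pos (0<nat B'))

    even : Fin B → ℚ
    even _ = 1/B

    ∑even : ∑ even ≡ 1ℚ
    ∑even = trans (∑-const {B} 1/B) (*-inv (0<nat B'))

    bR : I → I → Fin k → ℚ
    bR i j = avg even (λ s → β (ref s) i j)

    bR≥0 : ∀ i j r → 0ℚ ≤ bR i j r
    bR≥0 i j r = ∑-nonneg λ s → 0≤* 0≤1/B (proj₁ (β-Unit (ref s) i j r))

    -- `4t` is the correlation `δ δ'` known for the reference average; half of it, `δ₄ = 2t`, is to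
    -- survive at individual classes.
    δ t : ℚ
    δ = 16ᵣ * u
    t = ¼ * (δ * δ')

    0<δ : 0ℚ < δ
    0<δ = 0<* 0<16 0<u

    0<t : 0ℚ < t
    0<t = 0<* 0<¼ (0<* 0<δ 0<δ')

    ref≺ι : ∀ {n} (s : Fin n) {N} (x : Fin N) → (_≺_ {n ℕ.+ N} (s ↑ˡ N) (n ↑ʳ x)) ≡ true
    ref≺ι zero x = refl
    ref≺ι (suc s) x = ref≺ι s x

    ι≺ : ∀ n {N} (x y : Fin N) → (_≺_ {n ℕ.+ N} (n ↑ʳ x) (n ↑ʳ y)) ≡ (x ≺ y)
    ι≺ zero x y = refl
    ι≺ (suc n) x y = ι≺ n x y

    ↑ʳ-≡ᶠ : ∀ n {N} (x y : Fin N) → (_≡ᶠ_ {n ℕ.+ N} (n ↑ʳ x) (n ↑ʳ y)) ≡ (x ≡ᶠ y)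
    ↑ʳ-≡ᶠ zero x y = refl
    ↑ʳ-≡ᶠ (suc n) x y = ↑ʳ-≡ᶠ n x y

    ↑ˡ-≡ᶠ : ∀ {n} N (x y : Fin n) → (_≡ᶠ_ {n ℕ.+ N} (x ↑ˡ N) (y ↑ˡ N)) ≡ (x ≡ᶠ y)
    ↑ˡ-≡ᶠ N zero zero = refl
    ↑ˡ-≡ᶠ N zero (suc y) = refl
    ↑ˡ-≡ᶠ N (suc x) zero = refl
    ↑ˡ-≡ᶠ N (suc x) (suc y) = ↑ˡ-≡ᶠ N x y

    Gram-upper Gram-lower : Set
    Gram-upper = ∀ y z i j → (y ≺ i) ≡ true → (z ≺ i) ≡ true → (i ≺ j) ≡ true → Gram y z i j ≤ (γ + ρ) + ⟦ y ≡ᶠ z ⟧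
    Gram-lower = ∀ y z i j → (y ≺ z) ≡ true → (z ≺ i) ≡ true → (i ≺ j) ≡ true → γ ≤ Gram y z i j

    δ₄ : ℚ
    δ₄ = t + t

    module AtPivot (a : I) where
      open Pivot.At S a ι bR bR≥0 u δ' δ₄ ζ ζ₁ B K 0<u 16u≤1 (<⇒≤ 0<δ') (0≤+ (<⇒≤ 0<t) (<⇒≤ 0<t)) public using (Bessel; loss; contradiction; m; δ₅; good)

    -- Suppose there were `B` exceptional classes. Their average codegree function and the reference
    -- average have square norm at most `γ + ρ + 1/B` and inner product at least `γ`, hence are
    -- close in L². A test with correlation `4t` against the latter has correlation above `2t`
    -- against the former, although every exceptional class gives at most `2t`.
    bessel : Gram-upper → Gram-lower → (ρ + ρ) + (1/B + 1/B) < 4ᵣ * (t * t) → ∀ a → AtPivot.Bessel a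
    bessel hu hl hρ a i j ij w wu hw = go (≤⊎> (nat B) ∣ Y ∣)
      where
      i' = ι i
      j' = ι j
      D = d-Dist i' j'
      Y : Fin N → Bool
      Y y = (y ≺ i) ∧ not (δ₄ ⊑ 𝔼 (d i' j') (λ r → w r * β (ι y) i' j' r))
      i'j' : (i' ≺ j') ≡ true
      i'j' = trans (ι≺ B i j) ij
      go : nat B ≤ ∣ Y ∣ Data.Sum.⊎ ∣ Y ∣ < nat B → ∣ Y ∣ < nat B
      go (Data.Sum.inj₂ h) = h
      go (Data.Sum.inj₁ h) = ⊥-elim (no< (≤-trans (≤-trans (+-monoˡ-≤ (t + t) exceptional-average) (≤-reflexive (four u δ'))) hw) close)
        where
        0<Y : 0ℚ < ∣ Y ∣
        0<Y = <-≤-trans (0<nat B') h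
        c : ℚ
        c = inv 0<Y
        0≤c = <⇒≤ (inv-pos 0<Y)
        c≤ : c ≤ 1/B
        c≤ = le _ (0≤* (diff h) (0≤* 0≤c 0≤1/B)) (trans (sym (*-identityʳ 1/B)) (trans (cong (1/B *_) (sym (*-inv 0<Y)))
          (trans (l ∣ Y ∣ c 1/B (nat B)) (cong (_+ (∣ Y ∣ - nat B) * (c * 1/B)) (trans (cong (_* c) (*-inv (0<nat B'))) (*-identityˡ c))))))
          where
          l : ∀ Y c b n → b * (Y * c) ≡ n * b * c + (Y - n) * (c * b)
          l = solve 4 (λ Y c b n → b :* (Y :* c) := n :* b :* c :+ (Y :- n) :* (c :* b)) refl
        v : Fin N → ℚ
        v y = ⟦ Y y ⟧ * c
        v≥0 : ∀ y → 0ℚ ≤ v y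
        v≥0 y = 0≤* (0≤⟦⟧ (Y y)) 0≤c
        v≤ : ∀ y → v y ≤ 1/B
        v≤ y = ≤-trans (*-monoˡ c 0≤c (⟦⟧≤1 (Y y))) (≤-trans (≤-reflexive (*-identityˡ c)) c≤)
        ∑v : ∑ v ≡ 1ℚ
        ∑v = trans (∑-*ʳ c _) (*-inv 0<Y)
        bY : Fin k → ℚ
        bY = avg v (λ y → β (ι y) i' j')
        when : ∀ y {x z} → (Y y ≡ true → x ≤ z) → ∀ e → 0ℚ ≤ e → e * v y * x ≤ e * v y * z
        when y {x} {z} hyp e 0≤e = cases (Y y) refl
          where
          cases : ∀ o → Y y ≡ o → e * (⟦ o ⟧ * c) * x ≤ e * (⟦ o ⟧ * c) * z
          cases true eq = *-monoʳ _ (0≤* 0≤e (0≤* 0≤1 0≤c)) (hyp eq)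
          cases false eq = ≤-reflexive (trans (l e c x) (sym (l e c z)))
            where
            l : ∀ e c x → e * (0ℚ * c) * x ≡ 0ℚ
            l = solve 3 (λ e c x → e :* ((con 0ℚ) :* c) :* x := con 0ℚ) refl
        below : ∀ {y} → Y y ≡ true → (ι y ≺ i') ≡ true
        below {y} e = trans (ι≺ B y i) (proj₁ (∧-true {y ≺ i} e))
        squareR : 𝔼 (d i' j') (λ r → bR i' j' r * bR i' j' r) ≤ (γ + ρ) + 1/B
        squareR = average-square D even _ ∑even (λ _ → 0≤1/B) (λ _ → ≤-refl) λ y z → *-monoʳ _ (0≤* 0≤1/B 0≤1/B)
          (≤-trans (hu (ref y) (ref z) i' j' (ref≺ι y i) (ref≺ι z i) i'j') (≤-reflexive (cong (λ o → (γ + ρ) + ⟦ o ⟧) (↑ˡ-≡ᶠ N y z))))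
        squareY : 𝔼 (d i' j') (λ r → bY r * bY r) ≤ (γ + ρ) + 1/B
        squareY = average-square D v _ ∑v v≥0 v≤ λ y z → cases y z (Y y) refl
          where
          cases : ∀ y z o → Y y ≡ o → v y * v z * Gram (ι y) (ι z) i' j' ≤ v y * v z * ((γ + ρ) + ⟦ y ≡ᶠ z ⟧)
          cases y z true e = when z (λ e' → ≤-trans (hu (ι y) (ι z) i' j' (below e) (below e') i'j') (≤-reflexive (cong (λ o → (γ + ρ) + ⟦ o ⟧) (↑ʳ-≡ᶠ B y z)))) (v y) (v≥0 y)
          cases y z false e = ≤-reflexive (trans (cong (λ o → ⟦ o ⟧ * c * v z * Gram (ι y) (ι z) i' j') e) (trans (l c (v z) _) (sym (trans (cong (λ o → ⟦ o ⟧ * c * v z * ((γ + ρ) + ⟦ y ≡ᶠ z ⟧)) e) (l c (v z) _)))))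
            where
            l : ∀ c v x → 0ℚ * c * v * x ≡ 0ℚ
            l = solve 3 (λ c v x → con 0ℚ :* c :* v :* x := con 0ℚ) refl
        cross : γ ≤ 𝔼 (d i' j') (λ r → bR i' j' r * bY r)
        cross = average-cross D even _ v _ ∑even ∑v λ s y → when y (λ e → hl (ref s) (ι y) i' j' (ref≺ι s y) (below e) i'j') 1/B 0≤1/B
        square : 𝔼 (d i' j') (λ r → (bR i' j' r - bY r) * (bR i' j' r - bY r)) < 4ᵣ * (t * t)
        square = ≤-<-trans (le _ (0≤+ (0≤+ (diff squareR) (diff squareY)) (0≤* (<⇒≤ 0<2) (diff cross))) (sym (trans (cong (_+ ((((γ + ρ) + 1/B) - RR) + (((γ + ρ) + 1/B) - YY) + 2ᵣ * (RY - γ))) expand) (l RR YY RY γ ρ 1/B)))) hρ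
          where
          RR = 𝔼 (d i' j') (λ r → bR i' j' r * bR i' j' r)
          YY = 𝔼 (d i' j') (λ r → bY r * bY r)
          RY = 𝔼 (d i' j') (λ r → bR i' j' r * bY r)
          e₁ : ∀ x y → (x - y) * (x - y) ≡ (x * x + y * y) - 2ᵣ * (x * y)
          e₁ = solve 2 (λ x y → (x :- y) :* (x :- y) := (x :* x :+ y :* y) :- (con 2ᵣ) :* (x :* y)) refl
          expand : 𝔼 (d i' j') (λ r → (bR i' j' r - bY r) * (bR i' j' r - bY r)) ≡ (RR + YY) - 2ᵣ * RY
          expand = trans (𝔼-cong λ r → e₁ _ _) (trans (𝔼-- _ _) (cong₂ _-_ (𝔼-+ _ _) (𝔼-*ˡ 2ᵣ _)))
          l : ∀ RR YY RY γ ρ b → (RR + YY) - 2ᵣ * RY + ((((γ + ρ) + b) - RR) + (((γ + ρ) + b) - YY) + 2ᵣ * (RY - γ)) ≡ (ρ + ρ) + (b + b)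
          l = solve 6 (λ RR YY RY γ ρ b →
            (RR :+ YY) :- (con 2ᵣ) :* RY :+ ((((γ :+ ρ) :+ b) :- RR) :+ (((γ :+ ρ) :+ b) :- YY) :+ (con 2ᵣ) :* (RY :- γ))
            := (ρ :+ ρ) :+ (b :+ b)) refl
        close : 𝔼 (d i' j') (λ r → w r * bR i' j' r) < 𝔼 (d i' j') (λ r → w r * bY r) + (t + t)
        close = small-difference D w (bR i' j') bY wu 0<t square
        exceptional-average : 𝔼 (d i' j') (λ r → w r * bY r) ≤ δ₄
        exceptional-average = ≤-trans (≤-reflexive (avg-linear v _ w)) (≤-trans (∑-mono λ y → bound y (Y y) refl) (≤-reflexive (trans (∑-*ʳ δ₄ v) (trans (cong (_* δ₄) ∑v) (*-identityˡ δ₄)))))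
          where
          bound : ∀ y o → Y y ≡ o → v y * 𝔼 (d i' j') (λ r → w r * β (ι y) i' j' r) ≤ v y * δ₄
          bound y true e = *-monoʳ (v y) (v≥0 y) (f (proj₂ (∧-true {y ≺ i} e)))
            where
            f : not (δ₄ ⊑ 𝔼 (d i' j') (λ r → w r * β (ι y) i' j' r)) ≡ true → 𝔼 (d i' j') (λ r → w r * β (ι y) i' j' r) ≤ δ₄
            f h with δ₄ ⊑ 𝔼 (d i' j') (λ r → w r * β (ι y) i' j' r) in eq
            ... | false = <⇒≤ (⊑-false eq)
            f () | true
          bound y false e = ≤-reflexive (trans (cong (λ o → ⟦ o ⟧ * c * 𝔼 (d i' j') (λ r → w r * β (ι y) i' j' r)) e) (trans (l c _) (sym (trans (cong (λ o → ⟦ o ⟧ * c * δ₄) e) (l c δ₄)))))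
            where
            l : ∀ c x → 0ℚ * c * x ≡ 0ℚ
            l = solve 2 (λ c x → con 0ℚ :* c :* x := con 0ℚ) refl
        four : ∀ u δ' → ¼ * (16ᵣ * u * δ') + ¼ * (16ᵣ * u * δ') + (¼ * (16ᵣ * u * δ') + ¼ * (16ᵣ * u * δ')) ≡ 16ᵣ * u * δ'
        four = solve 2 (λ u δ' →
          con ¼ :* ((con 16ᵣ) :* u :* δ') :+ (con ¼) :* ((con 16ᵣ) :* u :* δ') :+ ((con ¼) :* ((con 16ᵣ) :* u :* δ') :+ (con ¼) :* ((con 16ᵣ) :* u :* δ'))
          := con 16ᵣ :* u :* δ') refl

    -- Averaged over all pivots among the reference classes, the loss of the pair ij is E [ β̄ 1(β̄ < δ') ] ≤ δ'.
    good-pivot : ∃ λ s → ∑₂ (λ x z → ⟦ x ≺ z ⟧ * AtPivot.loss (ref s) x z) ≤ nat N * (nat N * δ')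
    good-pivot = ∑-≤⇒∃ (≤-trans (≤-reflexive outer) (≤-trans (∑₂-mono bound) (≤-reflexive (trans (∑-cong λ x → ∑-const (nat B * δ')) (trans (∑-const (nat N * (nat B * δ'))) (trans (l (nat N) (nat B) δ') (sym (∑-const {B} _))))))))
      where
      l : ∀ n b e → n * (n * (b * e)) ≡ b * (n * (n * e))
      l = solve 3 (λ n b e → n :* (n :* (b :* e)) := b :* (n :* (n :* e))) refl
      outer : ∑ (λ s → ∑₂ λ x z → ⟦ x ≺ z ⟧ * AtPivot.loss (ref s) x z) ≡ ∑₂ λ x z → ⟦ x ≺ z ⟧ * ∑ (λ s → AtPivot.loss (ref s) x z)
      outer = trans (∑-swap _) (∑-cong λ x → trans (∑-swap _) (∑-cong λ z → ∑-*ˡ ⟦ x ≺ z ⟧ _))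
      module _ (x z : Fin N) where
        D = d-Dist (ι x) (ι z)
        e : Fin k → Fin k → ℚ
        e = λ _ _ → 0ℚ
        bad : Fin k → ℚ
        bad r = ⟦ not (δ' ⊑ bR (ι x) (ι z) r) ⟧
        as-β : ∀ s → AtPivot.loss (ref s) x z ≡ 𝔼 (d (ι x) (ι z)) λ r → β (ref s) (ι x) (ι z) r * bad r
        as-β s = trans (𝔼-swap (d (ref s) (ι z)) (d (ref s) (ι x)) _) (trans (𝔼-cong λ p → 𝔼-swap (d (ref s) (ι z)) (d (ι x) (ι z)) _)
          (trans (𝔼-swap (d (ref s) (ι x)) (d (ι x) (ι z)) _) (𝔼-cong λ r → trans (𝔼-cong λ p → 𝔼-*ʳ (bad r) _) (𝔼-*ʳ (bad r) _))))
        pt : ∀ r → bad r * bR (ι x) (ι z) r ≤ δ'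
        pt r with δ' ⊑ bR (ι x) (ι z) r in eq
        ... | true = ≤-trans (≤-reflexive (zeroˡ _)) (<⇒≤ 0<δ')
        ... | false = ≤-trans (≤-reflexive (*-identityˡ _)) (<⇒≤ (⊑-false eq))
        summed : ∑ (λ s → AtPivot.loss (ref s) x z) ≡ nat B * 𝔼 (d (ι x) (ι z)) (λ r → bad r * bR (ι x) (ι z) r)
        summed = trans (∑-cong λ s → trans (as-β s) (𝔼-cong λ r → *-comm _ _)) (sym (trans (cong (nat B *_) (trans (avg-linear even _ bad) (∑-*ˡ 1/B _)))
          (trans (sym (*-assoc _ _ _)) (trans (cong (_* ∑ (λ s → 𝔼 (d (ι x) (ι z)) (λ r → bad r * β (ref s) (ι x) (ι z) r))) (*-inv (0<nat B'))) (*-identityˡ _)))))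
        bound : ⟦ x ≺ z ⟧ * ∑ (λ s → AtPivot.loss (ref s) x z) ≤ nat B * δ'
        bound = ≤-trans (*-monoˡ _ (≤-trans (0≤* (0≤nat B) (𝔼-≥ D 0ℚ λ r → 0≤* (0≤⟦⟧ (not (δ' ⊑ bR (ι x) (ι z) r))) (bR≥0 (ι x) (ι z) r))) (≤-reflexive (sym summed))) (⟦⟧≤1 (x ≺ z)))
          (≤-trans (≤-reflexive (trans (*-identityˡ _) summed)) (*-monoʳ (nat B) (0≤nat B) (𝔼-≤ D δ' pt)))

    -- The loss at the good pivot is at most `N² δ'`; the bound on `δ'`, with the square of
    -- `pow u K`, makes it negligible even on the pairs of the few classes that survive the
    -- extraction.
    no-structure :
      1ℚ ≤ ½ + nat K * (4ᵣ * u) →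
      nat (B ℕ.+ B) + nat B ≤ u * (pow u K * nat N) → 2ᵣ ≤ pow u K * nat N →
      δ' ≤ δ * u * (pow u K * pow u K) → (ρ + ρ) + (1/B + 1/B) < 4ᵣ * (t * t) →
      (∀ i j l → (i ≺ j) ≡ true → (j ≺ l) ≡ true → ¼ + 64ᵣ * u ≤ Φ (δ + δ) i j l) →
      Gram-upper → Gram-lower →
      (∀ i j l → (i ≺ j) ≡ true → (j ≺ l) ≡ true → ¼ ≤ κ i j l) →
      (∀ a y z i x l m → (a ≺ y) ≡ true → (y ≺ z) ≡ true → (z ≺ i) ≡ true → (i ≺ x) ≡ true → (x ≺ l) ≡ true → (l ≺ m) ≡ true → F7-density a y z i x l m ≤ ζ) →
      0ℚ ≤ ζ → nat N * (nat N * (nat N * (nat N * (nat N * ζ)))) ≤ ζ₁ * u → 0ℚ < ζ₁ → ζ₁ < AtPivot.δ₅ (ref zero) * u → ⊥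
    no-structure hK hB h2 hδ' hρ hΦ hu hl hκ hF 0≤ζ hζ 0<ζ₁ hζ₁ = AtPivot.contradiction (ref s) hK hB h2
      (λ x z e → hΦ (ref s) (ι x) (ι z) (ref≺ι s x) (trans (ι≺ B x z) e))
      (≤-trans (proj₂ good-pivot) (≤-trans (*-monoʳ _ (0≤nat N) (*-monoʳ _ (0≤nat N) hδ')) (≤-reflexive (l (nat N) u (pow u K)))))
      (bessel hu hl hρ (ref s))
      (λ i j l ij jl → hκ (ι i) (ι j) (ι l) (trans (ι≺ B i j) ij) (trans (ι≺ B j l) jl))
      (λ y z x x' v b o → let yz , o₁ = ∧-true {y ≺ z} o ; zx , o₂ = ∧-true {z ≺ x} o₁ ; xx' , o₃ = ∧-true {x ≺ x'} o₂ ; x'v , vb = ∧-true {x' ≺ v} o₃ in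
        hF (ref s) (ι y) (ι z) (ι x) (ι x') (ι v) (ι b) (ref≺ι s y) (trans (ι≺ B y z) yz) (trans (ι≺ B z x) zx) (trans (ι≺ B x x') xx') (trans (ι≺ B x' v) x'v) (trans (ι≺ B v b) vb))
      0≤ζ hζ 0<ζ₁ hζ₁
      where
      s = proj₁ good-pivot
      l : ∀ n u c → n * (n * (16ᵣ * u * u * (c * c))) ≡ 16ᵣ * u * (u * (c * n * (c * n)))
      l = solve 3 (λ n u c →
        n :* (n :* ((con 16ᵣ) :* u :* u :* (c :* c)))
        := con 16ᵣ :* u :* (u :* (c :* n :* (c :* n)))) refl

-- Order embeddings and Ramsey's theorem.

module Thin where
  open Count using (_≺_)

  -- increasing injections Fin r → Fin n
  data Thin : ℕ → ℕ → Set where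
    done : Thin 0 0
    keep : ∀ {r n} → Thin r n → Thin (suc r) (suc n)
    drop : ∀ {r n} → Thin r n → Thin r (suc n)

  embed : ∀ {r n} → Thin r n → Fin r → Fin n
  embed (keep θ) zero = zero
  embed (keep θ) (suc i) = suc (embed θ i)
  embed (drop θ) i = suc (embed θ i)

  embed-≺ : ∀ {r n} (θ : Thin r n) {i j} → (i ≺ j) ≡ true → (embed θ i ≺ embed θ j) ≡ true
  embed-≺ (keep θ) {zero} {suc j} h = refl
  embed-≺ (keep θ) {suc i} {suc j} h = embed-≺ θ {i} {j} h
  embed-≺ (drop θ) {i} {j} h = embed-≺ θ {i} {j} h

  idᵗ : ∀ {n} → Thin n n
  idᵗ {zero} = done
  idᵗ {suc n} = keep idᵗ

  none : ∀ {n} → Thin 0 n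
  none {zero} = done
  none {suc n} = drop none

  none-unique : ∀ {n} (θ : Thin 0 n) → θ ≡ none
  none-unique done = refl
  none-unique (drop θ) = cong drop (none-unique θ)

  infixr 6 _⨟_
  _⨟_ : ∀ {r n m} → Thin r n → Thin n m → Thin r m
  φ ⨟ drop θ = drop (φ ⨟ θ)
  done ⨟ done = done
  keep φ ⨟ keep θ = keep (φ ⨟ θ)
  drop φ ⨟ keep θ = drop (φ ⨟ θ)

  embed-⨟ : ∀ {r n m} (φ : Thin r n) (θ : Thin n m) i → embed (φ ⨟ θ) i ≡ embed θ (embed φ i)
  embed-⨟ φ (drop θ) i = cong suc (embed-⨟ φ θ i)
  embed-⨟ (keep φ) (keep θ) zero = refl
  embed-⨟ (keep φ) (keep θ) (suc i) = cong suc (embed-⨟ φ θ i)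
  embed-⨟ (drop φ) (keep θ) i = cong suc (embed-⨟ φ θ i)
  embed-⨟ done done ()

  ⨟-assoc : ∀ {r n m l} (φ : Thin r n) (ψ : Thin n m) (θ : Thin m l) → (φ ⨟ ψ) ⨟ θ ≡ φ ⨟ (ψ ⨟ θ)
  ⨟-assoc φ ψ (drop θ) = cong drop (⨟-assoc φ ψ θ)
  ⨟-assoc φ (drop ψ) (keep θ) = cong drop (⨟-assoc φ ψ θ)
  ⨟-assoc (keep φ) (keep ψ) (keep θ) = cong keep (⨟-assoc φ ψ θ)
  ⨟-assoc (drop φ) (keep ψ) (keep θ) = cong drop (⨟-assoc φ ψ θ)
  ⨟-assoc done done done = refl

  shorten : ∀ {a b} → a ℕ.≤ b → Thin a b
  shorten ℕ.z≤n = none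
  shorten (ℕ.s≤s h) = keep (shorten h)

  insert : ∀ {r n} (i : Fin n) (θ : Thin r n) → (∀ s → (i ≺ embed θ s) ≡ true) →
    Σ (Thin (suc r) n) λ θ' → embed θ' zero ≡ i × (∀ s → embed θ' (suc s) ≡ embed θ s)
  insert zero (keep θ) h with () ← h zero
  insert zero (drop θ) h = keep θ , refl , λ s → refl
  insert (suc i) (keep θ) h with () ← h zero
  insert (suc i) (drop θ) h = let θ' , p , q = insert i θ h in drop θ' , cong suc p , λ s → cong suc (q s)

  -- Explicit increasing sequences; `from-chain` turns them into thinnings, so that hypotheses about
  -- all thinnings can be applied to chosen indices.
  data Chain {n : ℕ} : ∀ {r} → (Fin (suc r) → Fin n) → Set where
    last : {f : Fin 1 → Fin n} → Chain f
    step : ∀ {r} {f : Fin (suc (suc r)) → Fin n} → (f zero ≺ f (suc zero)) ≡ true → Chain (λ i → f (suc i)) → Chain f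

  private
    ≺-trans' : ∀ {n} (x y z : Fin n) → (x ≺ y) ≡ true → (y ≺ z) ≡ true → (x ≺ z) ≡ true
    ≺-trans' x y z = Count.≺-trans {x = x} {y} {z}

  chain-min : ∀ {n r} {f : Fin (suc r) → Fin n} → Chain f → ∀ s → (f zero ≺ f (suc s)) ≡ true
  chain-min last ()
  chain-min (step h c) zero = h
  chain-min {f = f} (step h c) (suc s) = ≺-trans' (f zero) (f (suc zero)) (f (suc (suc s))) h (chain-min c s)

  from-chain : ∀ {n r} {f : Fin (suc r) → Fin n} → Chain f → Σ (Thin (suc r) n) λ θ → ∀ s → embed θ s ≡ f s
  from-chain {f = f} last = let θ , p , _ = insert (f zero) none (λ ()) in θ , λ { zero → p }
  from-chain {f = f} (step h c) = let θ , e = from-chain c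
                                      θ' , p , q = insert (f zero) θ (λ s → subst (λ x → (f zero ≺ x) ≡ true) (sym (e s)) (chain-min {f = f} (step h c) s))
    in θ' , λ { zero → p ; (suc s) → trans (q s) (e s) }

  partition : ∀ {n} (p : Fin n → Bool) → ∃ λ a → ∃ λ b → Σ (Thin a n) λ φ → Σ (Thin b n) λ ψ →
    a ℕ.+ b ≡ n × (∀ i → p (embed φ i) ≡ true) × (∀ i → p (embed ψ i) ≡ false)
  partition {zero} p = 0 , 0 , done , done , refl , (λ ()) , (λ ())
  partition {suc n} p with partition (λ i → p (suc i)) | p zero in eq
  ... | a , b , φ , ψ , e , f , g | true = suc a , b , keep φ , drop ψ , cong suc e , (λ { zero → eq ; (suc i) → f i }) , g
  ... | a , b , φ , ψ , e , f , g | false = a , suc b , drop φ , keep ψ , trans (ℕₚ.+-suc a b) (cong suc e) , f , (λ { zero → eq ; (suc i) → g i })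

  isZero : ∀ {c} → Fin (suc c) → Bool
  isZero zero = true
  isZero (suc _) = false

  -- Induction on the colours: either the first colour class has `L` members, or its complement is
  -- large enough for the remaining colours.
  pigeonhole : ∀ c L → ∃ λ T → (f : Fin T → Fin (suc c)) → ∃ λ c₀ → Σ (Thin L T) λ ψ → ∀ i → f (embed ψ i) ≡ c₀
  pigeonhole zero L = L , λ f → zero , idᵗ , λ i → unit (f (embed idᵗ i))
    where
    unit : (x : Fin 1) → x ≡ zero
    unit zero = refl
  pigeonhole (suc c) L = L ℕ.+ T , go
    where
    T = proj₁ (pigeonhole c L)
    zero-case : ∀ {c} (x : Fin (suc c)) → isZero x ≡ true → x ≡ zero
    zero-case zero e = refl
    pred-case : ∀ {c} (x : Fin (suc (suc c))) → isZero x ≡ false → ∃ λ y → x ≡ suc y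
    pred-case (suc y) e = y , refl
    go : (f : Fin (L ℕ.+ T) → Fin (suc (suc c))) → ∃ λ c₀ → Σ (Thin L (L ℕ.+ T)) λ ψ → ∀ i → f (embed ψ i) ≡ c₀
    go f with partition (λ i → isZero (f i))
    ... | a , b , φ , ψ , e , h , g with L ℕ.≤? a
    ...   | yes L≤a = zero , shorten L≤a ⨟ φ , λ i → trans (cong f (embed-⨟ (shorten L≤a) φ i)) (zero-case _ (h _))
    ...   | no L≰a = suc (proj₁ rec) , (proj₁ (proj₂ rec) ⨟ χ) ,
              λ i → trans (cong f (embed-⨟ (proj₁ (proj₂ rec)) χ i)) (trans (proj₂ (low (embed (proj₁ (proj₂ rec)) i))) (cong suc (proj₂ (proj₂ rec) i)))
      where
      T≤b : T ℕ.≤ b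
      T≤b = ℕₚ.≮⇒≥ λ b<T → ℕₚ.<-irrefl e (ℕₚ.+-mono-< (ℕₚ.≰⇒> L≰a) b<T)
      χ : Thin T (L ℕ.+ T)
      χ = shorten T≤b ⨟ ψ
      low : ∀ i → ∃ λ y → f (embed χ i) ≡ suc y
      low i = pred-case _ (subst (λ x → isZero (f x) ≡ false) (sym (embed-⨟ (shorten T≤b) ψ i)) (g _))
      rec = proj₂ (pigeonhole c L) (λ i → proj₁ (low i))

  Homogeneous : ∀ {c r L M} → (Thin r M → Fin c) → Thin L M → Set
  Homogeneous χ θ = ∃ λ c₀ → ∀ φ → χ (φ ⨟ θ) ≡ c₀

  -- Induction on `r`. `minimum-coloured` finds a set on which the colour of an (r+1)-subset depends
  -- on its least element only, by making the colouring with that element fixed constant at every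
  -- stage. Pigeonhole on the least elements finishes the proof.
  ramsey-construction : ∀ c r L → ∃ λ M → (χ : Thin r M → Fin (suc c)) → Σ (Thin L M) λ θ → Homogeneous χ θ
  ramsey-construction c zero L = L , λ χ → idᵗ , χ none , λ φ → cong χ (none-unique _)
  ramsey-construction c (suc r) L = M , main
    where
    minimum-coloured : ∀ T → ∃ λ M → (χ : Thin (suc r) M → Fin (suc c)) → Σ (Thin T M) λ θ → Σ (Fin T → Fin (suc c)) λ f →
      ∀ φ → χ (φ ⨟ θ) ≡ f (embed φ zero)
    minimum-coloured zero = 0 , λ χ → done , (λ ()) , λ ()
    minimum-coloured (suc T) = suc M₂ , go
      where
      M₁ = proj₁ (minimum-coloured T)
      M₂ = proj₁ (ramsey-construction c r M₁)
      go : (χ : Thin (suc r) (suc M₂) → Fin (suc c)) → Σ (Thin (suc T) (suc M₂)) λ θ → Σ (Fin (suc T) → Fin (suc c)) λ f →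
        ∀ φ → χ (φ ⨟ θ) ≡ f (embed φ zero)
      go χ = keep (θ₂ ⨟ θ₁) , f' , check
        where
        h₁ = proj₂ (ramsey-construction c r M₁) (λ φ → χ (keep φ))
        θ₁ = proj₁ h₁
        h₂ = proj₂ (minimum-coloured T) (λ φ → χ (drop (φ ⨟ θ₁)))
        θ₂ = proj₁ h₂
        f' : Fin (suc T) → Fin (suc c)
        f' zero = proj₁ (proj₂ h₁)
        f' (suc i) = proj₁ (proj₂ h₂) i
        check : ∀ φ → χ (φ ⨟ keep (θ₂ ⨟ θ₁)) ≡ f' (embed φ zero)
        check (keep φ) = trans (cong (λ x → χ (keep x)) (sym (⨟-assoc φ θ₂ θ₁))) (proj₂ (proj₂ h₁) (φ ⨟ θ₂))
        check (drop φ) = trans (cong (λ x → χ (drop x)) (sym (⨟-assoc φ θ₂ θ₁))) (proj₂ (proj₂ h₂) φ)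
    T = proj₁ (pigeonhole c L)
    M = proj₁ (minimum-coloured T)
    main : (χ : Thin (suc r) M → Fin (suc c)) → Σ (Thin L M) λ θ → Homogeneous χ θ
    main χ = ψ ⨟ θ , c₀ , λ φ → trans (cong χ (sym (⨟-assoc φ ψ θ))) (trans (h (φ ⨟ ψ)) (trans (cong f (embed-⨟ φ ψ zero)) (e (embed φ zero))))
      where
      mc = proj₂ (minimum-coloured T) χ
      θ = proj₁ mc
      f = proj₁ (proj₂ mc)
      h = proj₂ (proj₂ mc)
      pg = proj₂ (pigeonhole c L) f
      c₀ = proj₁ pg
      ψ = proj₁ (proj₂ pg)
      e = proj₂ (proj₂ pg)

  opaque
    -- Sealed, because Ramsey numbers occur in types and must not be unfolded.
    ramsey : ∀ c r L → ∃ λ M → (χ : Thin r M → Fin (suc c)) → Σ (Thin L M) λ θ → Homogeneous χ θ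
    ramsey = ramsey-construction

-- The Archimedean property.

module Arith where
  import Data.Integer.Properties as ℤₚ
  import Data.Rational as Rat
  import Data.Rational.Unnormalised as ℚᵘ
  import Data.Rational.Unnormalised.Properties as ℚᵘₚ
  open Field
  open Base
  open Count using (nat-suc; nat-0)

  fromℕ : ℕ → ℚ
  fromℕ n = ℤ.+ n Rat./ 1

  private
    un : ∀ n → Rat.toℚᵘ (fromℕ n) ℚᵘ.≃ ℚᵘ.mkℚᵘ (ℤ.+ n) 0
    un n = Ratₚ.toℚᵘ-fromℚᵘ (ℚᵘ.mkℚᵘ (ℤ.+ n) 0)

    fromℕ-suc : ∀ n → fromℕ (suc n) ≡ 1ℚ Rat.+ fromℕ n
    fromℕ-suc n = Ratₚ.toℚᵘ-injective (ℚᵘₚ.≃-trans (un (suc n)) (ℚᵘₚ.≃-sym (ℚᵘₚ.≃-trans (Ratₚ.toℚᵘ-homo-+ 1ℚ (fromℕ n))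
      (ℚᵘₚ.≃-trans (ℚᵘₚ.+-congʳ ℚᵘ.1ℚᵘ (un n)) (ℚᵘ.*≡* (cong (ℤ._* ℤ.+ 1) (cong (λ x → ℤ.+ 1 ℤ.+ x) (ℤₚ.*-identityʳ (ℤ.+ n)))))))))

  nat-fromℕ : ∀ n → nat n ≡ fromℕ n
  nat-fromℕ zero = nat-0
  nat-fromℕ (suc n) = trans (nat-suc n) (trans (cong (1ℚ +_) (nat-fromℕ n)) (trans (+-transparent _ _) (sym (fromℕ-suc n))))

  -- The denominator is at least 1, so the absolute value of the numerator is an explicit integer
  -- bound.
  ≤-numerator : ∀ q → q ≤ nat ℤ.∣ Rat.↥ q ∣
  ≤-numerator q = subst (q ≤_) (sym (nat-fromℕ ℤ.∣ Rat.↥ q ∣)) (Ratₚ.toℚᵘ-cancel-≤ (ℚᵘₚ.≤-trans (go q) (ℚᵘₚ.≤-reflexive (ℚᵘₚ.≃-sym (un ℤ.∣ Rat.↥ q ∣)))))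
    where
    go : ∀ q → Rat.toℚᵘ q ℚᵘ.≤ ℚᵘ.mkℚᵘ (ℤ.+ ℤ.∣ Rat.↥ q ∣) 0
    go (Rat.mkℚ (ℤ.+ n) d _) = ℚᵘ.*≤* (subst₂ ℤ._≤_ (ℤₚ.pos-* n 1) (ℤₚ.pos-* n (suc d)) (ℤ.+≤+ (ℕₚ.*-monoʳ-≤ n (ℕ.s≤s ℕ.z≤n))))
    go (Rat.mkℚ (ℤ.-[1+ n ]) d _) = ℚᵘ.*≤* (subst₂ ℤ._≤_ (sym (ℤₚ.*-identityʳ (ℤ.-[1+ n ]))) (ℤₚ.pos-* (suc n) (suc d)) ℤ.-≤+)

  archimedean : ∀ {x} → 0ℚ < x → ∀ y → ∃ λ K → y ≤ nat K * x
  archimedean {x} h y = ℤ.∣ Rat.↥ (y * inv h) ∣ , ≤-trans (≤-reflexive (trans (sym (*-identityʳ y)) (trans (cong (y *_) (sym (*-inv h))) (lem y x (inv h)))))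
    (*-monoˡ x (<⇒≤ h) (≤-numerator (y * inv h)))
    where
    lem : ∀ y x i → y * (x * i) ≡ y * i * x
    lem = solve 3 (λ y x i → y :* (x :* i) := y :* i :* x) refl

-- Parameters, and the contradiction from a homogeneous structure.

module Reduced where
  open import Data.Fin using (toℕ; opposite)
  open import Data.Vec using ([]; _∷_; lookup)
  open import Data.Bool using (T)
  open import Data.Unit using (tt)
  open Field
  open Base
  open Count
  open Structure
  open Thin
  open Arith

  -- The index of the interval of length `h` that contains `v`, with all large values in the last
  -- interval; it serves as a Ramsey colour for real-valued data.
  bucket : ℚ → ∀ R → ℚ → Fin (suc R)
  bucket h zero v = zero
  bucket h (suc R) v with h ⊑ v
  ... | true = suc (bucket h R (v - h))
  ... | false = zero

  bucket-close : ∀ h R v v' → 0ℚ ≤ v' → v ≤ nat (suc R) * h → bucket h R v ≡ bucket h R v' → v ≤ v' + h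
  bucket-close h zero v v' 0≤v' hv e = ≤-trans hv (le v' 0≤v' (trans (lem v' h) (cong (λ m → m * h + v') (sym (trans (nat-suc 0) (trans (cong (1ℚ +_) nat-0) (+-identityʳ 1ℚ)))))))
    where
    lem : ∀ v h → v + h ≡ 1ℚ * h + v
    lem = solve 2 (λ v h → v :+ h := con 1ℚ :* h :+ v) refl
  bucket-close h (suc R) v v' 0≤v' hv e with h ⊑ v in eq | h ⊑ v' in eq'
  ... | true | true = undiff (subst (0ℚ ≤_) (lem v v' h) (diff (bucket-close h R (v - h) (v' - h) (diff (⊑-true eq'))
          (undiff (subst (0ℚ ≤_) (trans (cong (λ m → m * h - v) (nat-suc (suc R))) (lem' (nat (suc R)) h v)) (diff hv))) (Finₚ.suc-injective e))))
    where
    lem : ∀ v v' h → v' - h + h - (v - h) ≡ v' + h - v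
    lem = solve 3 (λ v v' h → v' :- h :+ h :- (v :- h) := v' :+ h :- v) refl
    lem' : ∀ m h v → (1ℚ + m) * h - v ≡ m * h - (v - h)
    lem' = solve 3 (λ m h v → ((con 1ℚ) :+ m) :* h :- v := m :* h :- (v :- h)) refl
  ... | false | false = ≤-trans (<⇒≤ (⊑-false eq)) (le v' 0≤v' (+-comm v' h))
  bucket-close h (suc R) v v' 0≤v' hv () | true | false
  bucket-close h (suc R) v v' 0≤v' hv () | false | true

  <ᵇ⇒≺ : ∀ {n} {i j : Fin n} → toℕ i ℕ.< toℕ j → (i ≺ j) ≡ true
  <ᵇ⇒≺ h = T-true (ℕₚ.<⇒<ᵇ h)
    where
    T-true : ∀ {b} → T b → b ≡ true
    T-true {true} _ = refl

  ≺⇒< : ∀ {n} {i j : Fin n} → (i ≺ j) ≡ true → toℕ i ℕ.< toℕ j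
  ≺⇒< {i = i} {j} h = ℕₚ.<ᵇ⇒< (toℕ i) (toℕ j) (subst T (sym h) tt)

  opposite-≺ : ∀ {n} {i j : Fin n} → (i ≺ j) ≡ true → (opposite j ≺ opposite i) ≡ true
  opposite-≺ {n} {i} {j} h = <ᵇ⇒≺ (subst₂ ℕ._<_ (sym (Finₚ.opposite-prop j)) (sym (Finₚ.opposite-prop i))
    (ℕₚ.∸-monoʳ-< (ℕ.s≤s (≺⇒< {i = i} {j} h)) (Finₚ.toℕ<n j)))

  pattern 0F = zero
  pattern 1F = suc zero
  pattern 2F = suc (suc zero)
  pattern 3F = suc (suc (suc zero))
  pattern 4F = suc (suc (suc (suc zero)))
  pattern 5F = suc (suc (suc (suc (suc zero))))
  pattern 6F = suc (suc (suc (suc (suc (suc zero)))))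

  -- For a fixed colour of the longest pair, the edge weight is at most the product of two thick
  -- adjacencies, one at each end, up to weight in thin pairs, whose mass is at most `θ` on either
  -- side. The mean of `f q * g q` is at most half the sum of the mean squares.
  Φ-or-Φ : ∀ {I k} (S : Str I k) θ i j m → 0ℚ ≤ θ →
    2ᵣ * Ops.κ S i j m ≤ Ops.Φ S θ i j m + Ops.Φ (reverse S) θ m j i + 4ᵣ * θ
  Φ-or-Φ S θ i j m 0≤θ = ≤-trans (*-monoʳ 2ᵣ (<⇒≤ 0<2) κ≤) (≤-trans (≤-reflexive (l₁ F θ)) (+-monoˡ-≤ (4ᵣ * θ) fg))
    where
    open Str S
    open Ops S
    top : Fin _ → Fin _ → Bool
    top q r = Ops.thick (reverse S) θ m j i r q
    f g : Fin _ → ℚ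
    f q = degree θ i j m q
    g q = Ops.degree (reverse S) θ m j i q
    F = 𝔼 (d i m) λ q → f q * g q
    l₁ : ∀ F θ → 2ᵣ * (F + (θ + θ)) ≡ 2ᵣ * F + 4ᵣ * θ
    l₁ = solve 2 (λ F θ → con 2ᵣ :* (F :+ (θ :+ θ)) := con 2ᵣ :* F :+ (con 4ᵣ) :* θ) refl
    pt : ∀ p q r → W i j m p q r ≤ ⟦ thick θ i j m p q ⟧ * ⟦ top q r ⟧ + (W i j m p q r * ⟦ not (thick θ i j m p q) ⟧ + W i j m p q r * ⟦ not (top q r) ⟧)
    pt p q r = go (thick θ i j m p q) (top q r) (W i j m p q r) (W-Unit i j m p q r)
      where
      go : ∀ a b w → Unit w → w ≤ ⟦ a ⟧ * ⟦ b ⟧ + (w * ⟦ not a ⟧ + w * ⟦ not b ⟧)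
      go true true w h = ≤-trans (proj₂ h) (≤-reflexive (l w))
        where
        l : ∀ w → 1ℚ ≡ 1ℚ * 1ℚ + (w * 0ℚ + w * 0ℚ)
        l = solve 1 (λ w → con 1ℚ := con 1ℚ :* (con 1ℚ) :+ (w :* (con 0ℚ) :+ w :* (con 0ℚ))) refl
      go true false w h = ≤-reflexive (l w)
        where
        l : ∀ w → w ≡ 1ℚ * 0ℚ + (w * 0ℚ + w * 1ℚ)
        l = solve 1 (λ w → w := con 1ℚ :* (con 0ℚ) :+ (w :* (con 0ℚ) :+ w :* (con 1ℚ))) refl
      go false b w h = le _ (0≤* (proj₁ h) (0≤⟦⟧ (not b))) (l w ⟦ b ⟧ ⟦ not b ⟧)
        where
        l : ∀ w b c → 0ℚ * b + (w * 1ℚ + w * c) ≡ w + w * c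
        l = solve 3 (λ w b c → con 0ℚ :* b :+ (w :* (con 1ℚ) :+ w :* c) := w :+ w :* c) refl
    thin-mass : ∀ {k} {w : Fin k → ℚ} (h : Fin k → ℚ) → 𝔼 w (λ r → h r * ⟦ not (θ ⊑ 𝔼 w h) ⟧) ≤ θ
    thin-mass {w = w} h = ≤-trans (≤-reflexive (𝔼-*ʳ _ h)) (c _ refl)
      where
      c : ∀ b → (θ ⊑ 𝔼 w h) ≡ b → 𝔼 w h * ⟦ not b ⟧ ≤ θ
      c true e = ≤-trans (≤-reflexive (zeroʳ _)) 0≤θ
      c false e = ≤-trans (≤-reflexive (*-identityʳ _)) (<⇒≤ (⊑-false e))
    κ≤ : κ i j m ≤ F + (θ + θ)
    κ≤ = ≤-trans (≤-reflexive (𝔼-swap (d i j) (d i m) _)) (≤-trans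
      (𝔼-mono (d-Dist i m) λ q → 𝔼-mono (d-Dist i j) λ p → 𝔼-mono (d-Dist j m) λ r → pt p q r)
      (≤-trans (≤-reflexive (trans (𝔼-cong λ q → trans (𝔼-cong λ p → trans (𝔼-+ _ _) (cong₂ _+_ (𝔼-*ˡ _ _) (𝔼-+ _ _))) (trans (𝔼-+ _ _) (cong₂ _+_ (𝔼-*ʳ _ _) (𝔼-+ _ _)))) (trans (𝔼-+ _ _) (cong (F +_) (𝔼-+ _ _)))))
        (+-monoʳ-≤ F (+-mono-≤
          (𝔼-≤ (d-Dist i m) θ λ q → 𝔼-≤ (d-Dist i j) θ λ p → thin-mass {w = d j m} (W i j m p q))
          (𝔼-≤ (d-Dist i m) θ λ q → ≤-trans (≤-reflexive (𝔼-swap (d i j) (d j m) _)) (𝔼-≤ (d-Dist j m) θ λ r → thin-mass {w = d i j} λ p → W i j m p q r))))))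
    fg : 2ᵣ * F ≤ Φ θ i j m + Ops.Φ (reverse S) θ m j i
    fg = ≤-trans (≤-reflexive (sym (𝔼-*ˡ 2ᵣ _))) (≤-trans (𝔼-mono (d-Dist i m) λ q → le ((f q - g q) * (f q - g q)) (0≤sq _) (l (f q) (g q))) (≤-reflexive (𝔼-+ _ _)))
      where
      l : ∀ f g → f * f + g * g ≡ 2ᵣ * (f * g) + (f - g) * (f - g)
      l = solve 2 (λ f g → f :* f :+ g :* g := con 2ᵣ :* (f :* g) :+ (f :- g) :* (f :- g)) refl

  -- The dependence is one-way: `u` fixes the number `K` of rounds, then the loss `δ'`, the accuracy
  -- `t`, the number of references and Gram intervals, the number `N` of classes, and last the
  -- admissible density `ζ`.
  module Constants (u : ℚ) (0<u : 0ℚ < u) (16u≤1 : 16ᵣ * u ≤ 1ℚ) where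
    0<4u : 0ℚ < 4ᵣ * u
    0<4u = 0<* 0<4 0<u
    K : ℕ
    K = proj₁ (archimedean 0<4u 1ℚ)
    c δ δ' t : ℚ
    c = pow u K
    δ = 16ᵣ * u
    δ' = δ * u * (c * c)
    t = ¼ * (δ * δ')
    0<c : 0ℚ < c
    0<c = 0<pow 0<u K
    0<δ : 0ℚ < δ
    0<δ = 0<* 0<16 0<u
    0<δ' : 0ℚ < δ'
    0<δ' = 0<* (0<* 0<δ 0<u) (0<* 0<c 0<c)
    0<t : 0ℚ < t
    0<t = 0<* 0<¼ (0<* 0<δ 0<δ')
    0<tt : 0ℚ < ½ * (t * t)
    0<tt = 0<* 0<½ (0<* 0<t 0<t)
    B' R' N : ℕ
    B' = proj₁ (archimedean 0<tt 1ℚ)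
    R' = proj₁ (archimedean 0<tt 1ℚ)
    0<uc : 0ℚ < u * c
    0<uc = 0<* 0<u 0<c
    need : ℚ
    need = nat (suc B' ℕ.+ suc B') + nat (suc B') + 2ᵣ
    -- The 4 guarantees an increasing quadruple, from which the base value of the Gram entries is
    -- read off.
    N = 4 ℕ.+ proj₁ (archimedean 0<uc need)
    hN : need ≤ nat N * (u * c)
    hN = ≤-trans (proj₂ (archimedean 0<uc need)) (*-monoˡ (u * c) (<⇒≤ 0<uc) (nat-mono (ℕₚ.m≤n+m _ 4)))
    1/N 1/B h ρ δ₅ ζ₁ ζ : ℚ
    1/N = inv (0<nat (3 ℕ.+ proj₁ (archimedean 0<uc need)))
    1/B = inv (0<nat B')
    h = inv (0<nat R')
    ρ = h + h
    δ₅ = ((δ * u) * ((δ * u) * (δ * ½))) * ((t + t) * ((t + t) * ((t + t) * ¼)))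
    ζ₁ = ½ * (δ₅ * u)
    ζ = ζ₁ * u * (1/N * (1/N * (1/N * (1/N * 1/N))))
    0<δ₅ : 0ℚ < δ₅
    0<δ₅ = 0<* (0<* (0<* 0<δ 0<u) (0<* (0<* 0<δ 0<u) (0<* 0<δ 0<½))) (0<* t₂ (0<* t₂ (0<* t₂ 0<¼)))
      where t₂ = 0<+ 0<t (<⇒≤ 0<t)
    0<ζ₁ : 0ℚ < ζ₁
    0<ζ₁ = 0<* 0<½ (0<* 0<δ₅ 0<u)
    0<1/N : 0ℚ < 1/N
    0<1/N = inv-pos _
    0<ζ : 0ℚ < ζ
    0<ζ = 0<* (0<* 0<ζ₁ 0<u) (0<* 0<1/N (0<* 0<1/N (0<* 0<1/N (0<* 0<1/N 0<1/N))))
    L : ℕ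
    L = suc B' ℕ.+ N

    small-inv : ∀ K {x} → 0ℚ < x → 1ℚ ≤ nat K * x → inv (0<nat K) ≤ x
    small-inv K {x} 0<x hK = le _ (0≤* (diff (≤-trans hK (*-monoˡ x (<⇒≤ 0<x) (nat-mono (ℕₚ.n≤1+n K))))) (<⇒≤ (inv-pos (0<nat K))))
      (trans (sym (*-identityʳ x)) (trans (cong (x *_) (sym (*-inv (0<nat K)))) (l x (nat (suc K)) (inv (0<nat K)))))
      where
      l : ∀ x n i → x * (n * i) ≡ i + (n * x - 1ℚ) * i
      l = solve 3 (λ x n i → x :* (n :* i) := i :+ (n :* x :- (con 1ℚ)) :* i) refl

    -- Since ρ = 2h and both h and 1/B are at most t²/2, the left side is at most 3t².
    hρ : (ρ + ρ) + (1/B + 1/B) < 4ᵣ * (t * t)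
    hρ = ≤-<-trans (+-mono-≤ (+-mono-≤ (+-mono-≤ hh hh) (+-mono-≤ hh hh)) (+-mono-≤ hb hb)) (lt (t * t) (0<* 0<t 0<t) (l (t * t)))
      where
      hh : h ≤ ½ * (t * t)
      hh = small-inv R' 0<tt (proj₂ (archimedean 0<tt 1ℚ))
      hb : 1/B ≤ ½ * (t * t)
      hb = small-inv B' 0<tt (proj₂ (archimedean 0<tt 1ℚ))
      l : ∀ s → 4ᵣ * s ≡ ½ * s + ½ * s + (½ * s + ½ * s) + (½ * s + ½ * s) + s
      l = solve 1 (λ s →
        con 4ᵣ :* s
        := con ½ :* s :+ (con ½) :* s :+ ((con ½) :* s :+ (con ½) :* s) :+ ((con ½) :* s :+ (con ½) :* s) :+ s) refl

    hζ : nat N * (nat N * (nat N * (nat N * (nat N * ζ)))) ≤ ζ₁ * u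
    hζ = ≤-reflexive (trans (l (nat N) (ζ₁ * u) 1/N) (trans (cong (λ x → ζ₁ * u * (x * (x * (x * (x * x))))) (*-inv _)) (l' (ζ₁ * u))))
      where
      l : ∀ n z i → n * (n * (n * (n * (n * (z * (i * (i * (i * (i * i))))))))) ≡ z * (n * i * (n * i * (n * i * (n * i * (n * i)))))
      l = solve 3 (λ n z i →
        n :* (n :* (n :* (n :* (n :* (z :* (i :* (i :* (i :* (i :* i)))))))))
        := z :* (n :* i :* (n :* i :* (n :* i :* (n :* i :* (n :* i)))))) refl
      l' : ∀ z → z * (1ℚ * (1ℚ * (1ℚ * (1ℚ * 1ℚ)))) ≡ z
      l' = solve 1 (λ z → z :* ((con 1ℚ) :* ((con 1ℚ) :* ((con 1ℚ) :* ((con 1ℚ) :* (con 1ℚ))))) := z) refl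

    hζ₁ : ζ₁ < δ₅ * u
    hζ₁ = lt ζ₁ 0<ζ₁ (l (δ₅ * u))
      where
      l : ∀ x → x ≡ ½ * x + ½ * x
      l = solve 1 (λ x → x := con ½ :* x :+ (con ½) :* x) refl

    Up-hypotheses : ∀ {k} → Str (Fin L) k → Set
    Up-hypotheses S =
      (∀ i j l → (i ≺ j) ≡ true → (j ≺ l) ≡ true → ¼ + 64ᵣ * u ≤ Ops.Φ S (δ + δ) i j l) ×
      (∀ i j l → (i ≺ j) ≡ true → (j ≺ l) ≡ true → ¼ ≤ Ops.κ S i j l) ×
      (∀ (χ : Thin 4 L) (χ' : Thin 4 L) → G χ ≤ G χ' + h) ×
      (∀ a y z i x l m → (a ≺ y) ≡ true → (y ≺ z) ≡ true → (z ≺ i) ≡ true → (i ≺ x) ≡ true → (x ≺ l) ≡ true → (l ≺ m) ≡ true →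
        Ops.F7-density S a y z i x l m ≤ ζ)
      where
      G : Thin 4 L → ℚ
      G χ = Ops.Gram S (embed χ 0F) (embed χ 1F) (embed χ 2F) (embed χ 3F)

    up-contradiction : ∀ {k} (S : Str (Fin L) k) → Up-hypotheses S → ⊥
    up-contradiction {k} S (hΦ , hκ , hG , hF) = no-structure hK h₁ h₂ ≤-refl hρ hΦ upper lower hκ hF (<⇒≤ 0<ζ) hζ 0<ζ₁ hζ₁
      where
      open Ops S using (Gram; β; β-Unit)
      open Str S
      G : Thin 4 L → ℚ
      G χ = Gram (embed χ 0F) (embed χ 1F) (embed χ 2F) (embed χ 3F)
      θ₀ : Thin 4 L
      θ₀ = shorten (ℕₚ.≤-trans (ℕₚ.m≤m+n 4 _) (ℕₚ.m≤n+m N (suc B')))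
      -- All Gram values are within `h` of the one at `θ₀`, so they lie between `γ` and `γ + ρ`.
      γ = G θ₀ - h
      open Spread.Up {k} {N} {B'} S u δ' ζ ζ₁ γ ρ K 0<u 16u≤1 0<δ'
      0≤h : 0ℚ ≤ h
      0≤h = <⇒≤ (inv-pos (0<nat R'))
      Gram≥0 : ∀ y z i j → 0ℚ ≤ Gram y z i j
      Gram≥0 y z i j = 𝔼-≥ (d-Dist i j) 0ℚ λ r → 0≤* (proj₁ (β-Unit y i j r)) (proj₁ (β-Unit z i j r))
      at : ∀ y z i j → (y ≺ z) ≡ true → (z ≺ i) ≡ true → (i ≺ j) ≡ true → ∃ λ χ → G χ ≡ Gram y z i j
      at y z i j yz zi ij = θ , cong₄ (e 0F) (e 1F) (e 2F) (e 3F)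
        where
        f : Fin 4 → Fin L
        f = lookup (y ∷ z ∷ i ∷ j ∷ [])
        fc = from-chain {f = f} (step yz (step zi (step ij last)))
        θ = proj₁ fc
        e = proj₂ fc
        cong₄ : ∀ {a b c d a' b' c' d'} → a ≡ a' → b ≡ b' → c ≡ c' → d ≡ d' → Gram a b c d ≡ Gram a' b' c' d'
        cong₄ refl refl refl refl = refl
      lower : Gram-lower
      lower y z i j yz zi ij = let χ , e = at y z i j yz zi ij in undiff (subst (0ℚ ≤_) (l (G θ₀) h (Gram y z i j)) (subst (λ g → 0ℚ ≤ g + h - G θ₀) e (diff (hG θ₀ χ))))
        where
        l : ∀ g h x → x + h - g ≡ x - (g - h)
        l = solve 3 (λ g h x → x :+ h :- g := x :- (g :- h)) refl
      below : ∀ y z i j → (y ≺ z) ≡ true → (z ≺ i) ≡ true → (i ≺ j) ≡ true → Gram y z i j ≤ γ + ρ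
      below y z i j yz zi ij = let χ , e = at y z i j yz zi ij in ≤-trans (subst (_≤ G θ₀ + h) e (hG χ θ₀)) (≤-reflexive (l (G θ₀) h))
        where
        l : ∀ g h → g + h ≡ g - h + (h + h)
        l = solve 2 (λ g h → g :+ h := g :- h :+ (h :+ h)) refl
      upper : Gram-upper
      upper y z i j yi zi ij = cases (y ≺ z) (z ≺ y) refl refl
        where
        sym-Gram : Gram y z i j ≡ Gram z y i j
        sym-Gram = 𝔼-cong λ r → *-comm _ _
        cases : ∀ a b → (y ≺ z) ≡ a → (z ≺ y) ≡ b → Gram y z i j ≤ (γ + ρ) + ⟦ y ≡ᶠ z ⟧
        cases true b e _ = ≤-trans (below y z i j e zi ij) (le _ (0≤⟦⟧ (y ≡ᶠ z)) refl)
        cases false true _ e = ≤-trans (≤-reflexive sym-Gram) (≤-trans (below z y i j e yi ij) (le _ (0≤⟦⟧ (y ≡ᶠ z)) refl))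
        -- Equal indices: the Gram entry is only known to be at most 1, and the indicator supplies
        -- exactly that.
        cases false false e e' = ≤-trans (𝔼-≤ (d-Dist i j) 1ℚ λ r → proj₂ (Unit* (β-Unit y i j r) (β-Unit z i j r)))
          (le (γ + ρ) (≤-trans (0≤+ (Gram≥0 _ _ _ _) 0≤h) (≤-reflexive (l (G θ₀) h))) (trans (cong (γ + ρ +_) one) (+-comm _ _)))
          where
          l : ∀ g h → g + h ≡ g - h + (h + h)
          l = solve 2 (λ g h → g :+ h := g :- h :+ (h :+ h)) refl
          one : ⟦ y ≡ᶠ z ⟧ ≡ 1ℚ
          one = trans (sym (trans (cong₂ (λ a b → ⟦ a ⟧ + ⟦ b ⟧ + ⟦ y ≡ᶠ z ⟧) e e') (l' ⟦ y ≡ᶠ z ⟧))) (trichotomy y z)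
            where
            l' : ∀ x → 0ℚ + 0ℚ + x ≡ x
            l' = solve 1 (λ x → con 0ℚ :+ (con 0ℚ) :+ x := x) refl
      hK : 1ℚ ≤ ½ + nat K * (4ᵣ * u)
      hK = ≤-trans (proj₂ (archimedean 0<4u 1ℚ)) (le ½ (<⇒≤ 0<½) (+-comm _ _))
      nB = nat (suc B' ℕ.+ suc B') + nat (suc B')
      0≤nB : 0ℚ ≤ nB
      0≤nB = 0≤+ (0≤nat (suc B' ℕ.+ suc B')) (0≤nat (suc B'))
      h₁ : nB ≤ u * (c * nat N)
      h₁ = ≤-trans (le 2ᵣ (<⇒≤ 0<2) refl) (≤-trans hN (≤-reflexive (l u c (nat N))))
        where
        l : ∀ u c n → n * (u * c) ≡ u * (c * n)
        l = solve 3 (λ u c n → n :* (u :* c) := u :* (c :* n)) refl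
      u≤1 : u ≤ 1ℚ
      u≤1 = cancelˡ 16ᵣ 0<16 (≤-trans 16u≤1 (≤-trans 1≤16 (≤-reflexive (sym (*-identityʳ 16ᵣ)))))
        where
        1≤16 : 1ℚ ≤ 16ᵣ
        1≤16 = le _ (0≤+ (<⇒≤ 0<8) (0≤+ (<⇒≤ 0<4) (0≤+ (<⇒≤ 0<2) 0≤1))) (l 0ℚ)
          where
          l : ∀ x → 16ᵣ ≡ 1ℚ + (8ᵣ + (4ᵣ + (2ᵣ + 1ℚ)))
          l = solve 1 (λ x → con 16ᵣ := con 1ℚ :+ ((con 8ᵣ) :+ ((con 4ᵣ) :+ ((con 2ᵣ) :+ (con 1ℚ))))) refl
      h₂ : 2ᵣ ≤ c * nat N
      h₂ = ≤-trans (le nB 0≤nB (+-comm nB 2ᵣ)) (≤-trans hN (≤-trans (≤-reflexive (l u c (nat N))) (≤-trans (*-monoˡ (c * nat N) (0≤* (<⇒≤ 0<c) (0≤nat N)) u≤1) (≤-reflexive (*-identityˡ _)))))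
        where
        l : ∀ u c n → n * (u * c) ≡ u * (c * n)
        l = solve 3 (λ u c n → n :* (u :* c) := u :* (c :* n)) refl

-- Homogeneous samples and the choice of direction.

module RamseyStep where
  open import Data.Fin using (opposite)
  open import Data.Vec using ([]; _∷_; lookup)
  open Field
  open Base
  open Count
  open Structure
  open Thin
  open Reduced

  κ-reverse : ∀ {I k} (S : Str I k) i j l → Ops.κ (reverse S) i j l ≡ Ops.κ S l j i
  κ-reverse S i j l = trans (𝔼-cong λ p → 𝔼-swap (d l i) (d l j) _) (trans (𝔼-swap (d j i) (d l j) _) (𝔼-cong λ r → 𝔼-swap (d j i) (d l i) _))
    where open Str S

  colour : Bool → Fin 2
  colour true = zero
  colour false = suc zero

  at₃ : ∀ {A : Set} {n} → (Fin n → Fin n → Fin n → A) → Thin 3 n → A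
  at₃ f θ = f (embed θ 0F) (embed θ 1F) (embed θ 2F)

  at₄ : ∀ {A : Set} {n} → (Fin n → Fin n → Fin n → Fin n → A) → Thin 4 n → A
  at₄ f θ = f (embed θ 0F) (embed θ 1F) (embed θ 2F) (embed θ 3F)

  at₇ : ∀ {A : Set} {n} → (Fin n → Fin n → Fin n → Fin n → Fin n → Fin n → Fin n → A) → Thin 7 n → A
  at₇ f θ = f (embed θ 0F) (embed θ 1F) (embed θ 2F) (embed θ 3F) (embed θ 4F) (embed θ 5F) (embed θ 6F)

  module _ {A : Set} {n : ℕ} where
    at₃-≡ : (f : Fin n → Fin n → Fin n → A) {θ : Thin 3 n} → ∀ {a b c} → embed θ 0F ≡ a → embed θ 1F ≡ b → embed θ 2F ≡ c → at₃ f θ ≡ f a b c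
    at₃-≡ f refl refl refl = refl

    at₄-≡ : (f : Fin n → Fin n → Fin n → Fin n → A) {θ : Thin 4 n} → ∀ {a b c d} →
      embed θ 0F ≡ a → embed θ 1F ≡ b → embed θ 2F ≡ c → embed θ 3F ≡ d → at₄ f θ ≡ f a b c d
    at₄-≡ f refl refl refl refl = refl

    at₇-≡ : (f : Fin n → Fin n → Fin n → Fin n → Fin n → Fin n → Fin n → A) {θ : Thin 7 n} → ∀ {a b c d e g h} →
      embed θ 0F ≡ a → embed θ 1F ≡ b → embed θ 2F ≡ c → embed θ 3F ≡ d → embed θ 4F ≡ e → embed θ 5F ≡ g → embed θ 6F ≡ h → at₇ f θ ≡ f a b c d e g h
    at₇-≡ f refl refl refl refl refl refl refl = refl

  sub : ∀ {m L r} (Θ : Thin L m) {f : Fin (suc r) → Fin L} → Chain f →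
    Σ (Thin (suc r) L) λ χ → ∀ s → embed (χ ⨟ Θ) s ≡ embed Θ (f s)
  sub Θ c = let χ , e = from-chain c in χ , λ s → trans (embed-⨟ χ Θ s) (cong (embed Θ) (e s))

  module Main (u : ℚ) (0<u : 0ℚ < u) (16u≤1 : 16ᵣ * u ≤ 1ℚ) where
    open Constants u 0<u 16u≤1

    -- Ramsey numbers to be used from the outside inwards: after the colouring by `κ` come the one
    -- by `Φ` and those by the two Gram functions, with codegrees from below and, for the reversed
    -- order, from above.
    M₅ M₄ M₃ : ℕ
    M₅ = proj₁ (ramsey R' 4 L)
    M₄ = proj₁ (ramsey R' 4 M₅)
    M₃ = proj₁ (ramsey 1 3 M₄)

    sample-size : ℕ → ℕ
    sample-size L₀ = proj₁ (ramsey 1 3 (L₀ ℕ.+ M₃))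

    F7-sparse : ∀ {m k} → Str (Fin m) k → Set
    F7-sparse {m} S = ∀ (θ : Thin 7 m) → at₇ (Ops.F7-density S) θ ≤ ζ × at₇ (λ a b c d e f g → Ops.F7-density (reverse S) g f e d c b a) θ ≤ ζ

    module _ {m k} (S : Str (Fin m) k) (sparse : F7-sparse S) where
      open Str S
      big-κ big-Φ : Thin 3 m → Bool
      big-κ = at₃ λ i j l → ¼ + 128u ⊑ Ops.κ S i j l
        where 128u = 64ᵣ * u + 64ᵣ * u
      big-Φ = at₃ λ i j l → ¼ + 64ᵣ * u ⊑ Ops.Φ S (δ + δ) i j l
      G₁ G₂ : Thin 4 m → ℚ
      G₁ = at₄ (Ops.Gram S)
      G₂ = at₄ λ a b c d → Ops.Gram (reverse S) d c b a

      -- If all `Φ` are large the contradiction applies directly. Otherwise all are small, so by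
      -- `Φ-or-Φ` the reversed ones are large, and the same contradiction applies to the reversed
      -- structure, reindexed by `opposite`.
      final : (Θ : Thin L m) → (∀ χ → big-κ (χ ⨟ Θ) ≡ true) → (∃ λ b → ∀ χ → big-Φ (χ ⨟ Θ) ≡ b) →
        (∀ χ χ' → bucket h R' (G₁ (χ ⨟ Θ)) ≡ bucket h R' (G₁ (χ' ⨟ Θ))) →
        (∀ χ χ' → bucket h R' (G₂ (χ ⨟ Θ)) ≡ bucket h R' (G₂ (χ' ⨟ Θ))) → ⊥
      final Θ hκ (b , hΦ) hG₁ hG₂ = cases b refl
        where
        0≤u = <⇒≤ 0<u
        0≤64u : 0ℚ ≤ 64ᵣ * u
        0≤64u = 0≤* (<⇒≤ 0<64) 0≤u
        θ : ℚ
        θ = δ + δ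
        E : Fin L → Fin m
        E = embed Θ
        module O = Ops S
        module R = Ops (reverse S)
        κ≥ : ∀ i j l → (i ≺ j) ≡ true → (j ≺ l) ≡ true → ¼ + (64ᵣ * u + 64ᵣ * u) ≤ O.κ (E i) (E j) (E l)
        κ≥ i j l ij jl = let χ , e = sub Θ {f = lookup (i ∷ j ∷ l ∷ [])} (step ij (step jl last)) in
          ⊑-true (trans (sym (at₃-≡ (λ i j l → ¼ + (64ᵣ * u + 64ᵣ * u) ⊑ O.κ i j l) {χ ⨟ Θ} (e 0F) (e 1F) (e 2F))) (hκ χ))
        Φ≡ : ∀ i j l → (i ≺ j) ≡ true → (j ≺ l) ≡ true → (¼ + 64ᵣ * u ⊑ O.Φ θ (E i) (E j) (E l)) ≡ b
        Φ≡ i j l ij jl = let χ , e = sub Θ {f = lookup (i ∷ j ∷ l ∷ [])} (step ij (step jl last)) in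
          trans (sym (at₃-≡ (λ i j l → ¼ + 64ᵣ * u ⊑ O.Φ θ i j l) {χ ⨟ Θ} (e 0F) (e 1F) (e 2F))) (hΦ χ)
        Gram-Unit : ∀ (T : Str (Fin m) k) y z i j → Unit (Ops.Gram T y z i j)
        Gram-Unit T y z i j = 𝔼-Unit (Str.d-Dist T i j) λ r → Unit* (Ops.β-Unit T y i j r) (Ops.β-Unit T z i j r)
        Rh : nat (suc R') * h ≡ 1ℚ
        Rh = *-inv (0<nat R')
        close : ∀ (T : Str (Fin m) k) {a b c d a' b' c' d'} → bucket h R' (Ops.Gram T a b c d) ≡ bucket h R' (Ops.Gram T a' b' c' d') →
          Ops.Gram T a b c d ≤ Ops.Gram T a' b' c' d' + h
        close T e = bucket-close h R' _ _ (proj₁ (Gram-Unit T _ _ _ _)) (≤-trans (proj₂ (Gram-Unit T _ _ _ _)) (≤-reflexive (sym Rh))) e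
        ¼≤ : ∀ {x} → ¼ + (64ᵣ * u + 64ᵣ * u) ≤ x → ¼ ≤ x
        ¼≤ h = ≤-trans (le _ (0≤+ 0≤64u 0≤64u) refl) h
        up : b ≡ true → Up-hypotheses (pullback E S)
        up refl = (λ i j l ij jl → ⊑-true (Φ≡ i j l ij jl)) , (λ i j l ij jl → ¼≤ (κ≥ i j l ij jl)) ,
          (λ χ χ' → close S (subst₂ (λ x y → bucket h R' x ≡ bucket h R' y) (ev χ) (ev χ') (hG₁ χ χ'))) ,
          λ a y z i x l v p₁ p₂ p₃ p₄ p₅ p₆ → let χ , e = sub Θ {f = lookup (a ∷ y ∷ z ∷ i ∷ x ∷ l ∷ v ∷ [])} (step p₁ (step p₂ (step p₃ (step p₄ (step p₅ (step p₆ last)))))) in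
            subst (_≤ ζ) (at₇-≡ O.F7-density {χ ⨟ Θ} (e 0F) (e 1F) (e 2F) (e 3F) (e 4F) (e 5F) (e 6F)) (proj₁ (sparse (χ ⨟ Θ)))
          where
          ev : ∀ χ → G₁ (χ ⨟ Θ) ≡ O.Gram (E (embed χ 0F)) (E (embed χ 1F)) (E (embed χ 2F)) (E (embed χ 3F))
          ev χ = at₄-≡ O.Gram {χ ⨟ Θ} (embed-⨟ χ Θ 0F) (embed-⨟ χ Θ 1F) (embed-⨟ χ Θ 2F) (embed-⨟ χ Θ 3F)
        op : Fin L → Fin L
        op = opposite
        op≺ : ∀ i j → (i ≺ j) ≡ true → (op j ≺ op i) ≡ true
        op≺ i j h = opposite-≺ {i = i} {j} h
        down : b ≡ false → Up-hypotheses (pullback (λ i → E (op i)) (reverse S))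
        down refl = Φ' , (λ i j l ij jl → ≤-trans (¼≤ (κ≥ (op l) (op j) (op i) (op≺ j l jl) (op≺ i j ij))) (≤-reflexive (sym (κ-reverse S _ _ _)))) ,
          (λ χ χ' → close (reverse S) (subst₂ (λ x y → bucket h R' x ≡ bucket h R' y) (ev χ) (ev χ') (hG₂ (proj₁ (rev χ)) (proj₁ (rev χ'))))) ,
          λ a y z i x l v p₁ p₂ p₃ p₄ p₅ p₆ → let χ , e = sub Θ {f = lookup (op v ∷ op l ∷ op x ∷ op i ∷ op z ∷ op y ∷ op a ∷ [])}
                                                         (step (op≺ l v p₆) (step (op≺ x l p₅) (step (op≺ i x p₄) (step (op≺ z i p₃) (step (op≺ y z p₂) (step (op≺ a y p₁) last)))))) in
            subst (_≤ ζ) (at₇-≡ (λ a b c d e f g → R.F7-density g f e d c b a) {χ ⨟ Θ} (e 0F) (e 1F) (e 2F) (e 3F) (e 4F) (e 5F) (e 6F)) (proj₂ (sparse (χ ⨟ Θ)))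
          where
          Φ' : ∀ i j l → (i ≺ j) ≡ true → (j ≺ l) ≡ true → ¼ + 64ᵣ * u ≤ R.Φ θ (E (op i)) (E (op j)) (E (op l))
          -- 2κ is at least ½ + 256u; subtracting the correction 4θ = 128u and Φ < ¼ + 64u leaves ¼
          -- + 64u.
          Φ' i j l ij jl = le _ (0≤+ (0≤+ (diff (Φ-or-Φ S θ x y z (0≤+ (<⇒≤ 0<δ) (<⇒≤ 0<δ)))) (0≤* (<⇒≤ 0<2) (diff (κ≥ _ _ _ p q)))) (diff (<⇒≤ (⊑-false (Φ≡ _ _ _ p q)))))
            (lem u (O.κ x y z) (O.Φ θ x y z) (R.Φ θ z y x))
            where
            x = E (op l)
            y = E (op j)
            z = E (op i)
            p = op≺ j l jl
            q = op≺ i j ij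
            lem : ∀ u κ F F' → F' ≡ ¼ + 64ᵣ * u + ((F + F' + 4ᵣ * (16ᵣ * u + 16ᵣ * u) - 2ᵣ * κ) + 2ᵣ * (κ - (¼ + (64ᵣ * u + 64ᵣ * u))) + (¼ + 64ᵣ * u - F))
            lem = solve 4 (λ u κ F F' →
              F'
              := con ¼ :+ (con 64ᵣ) :* u :+ ((F :+ F' :+ (con 4ᵣ) :* ((con 16ᵣ) :* u :+ (con 16ᵣ) :* u) :- (con 2ᵣ) :* κ) :+ (con 2ᵣ) :* (κ :- ((con ¼) :+ ((con 64ᵣ) :* u :+ (con 64ᵣ) :* u))) :+ ((con ¼) :+ (con 64ᵣ) :* u :- F))) refl
          rev : (χ : Thin 4 L) → Σ (Thin 4 L) λ χ' → ∀ s → embed (χ' ⨟ Θ) s ≡ embed Θ (lookup (op (embed χ 3F) ∷ op (embed χ 2F) ∷ op (embed χ 1F) ∷ op (embed χ 0F) ∷ []) s)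
          rev χ = sub Θ {f = lookup (op (embed χ 3F) ∷ op (embed χ 2F) ∷ op (embed χ 1F) ∷ op (embed χ 0F) ∷ [])}
            (step (op≺ (embed χ 2F) (embed χ 3F) (embed-≺ χ {2F} {3F} refl)) (step (op≺ (embed χ 1F) (embed χ 2F) (embed-≺ χ {1F} {2F} refl)) (step (op≺ (embed χ 0F) (embed χ 1F) (embed-≺ χ {0F} {1F} refl)) last)))
          ev : ∀ χ → G₂ (proj₁ (rev χ) ⨟ Θ) ≡ R.Gram (E (op (embed χ 0F))) (E (op (embed χ 1F))) (E (op (embed χ 2F))) (E (op (embed χ 3F)))
          ev χ = at₄-≡ (λ a b c d → R.Gram d c b a) {proj₁ (rev χ) ⨟ Θ} (proj₂ (rev χ) 0F) (proj₂ (rev χ) 1F) (proj₂ (rev χ) 2F) (proj₂ (rev χ) 3F)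
        cases : ∀ c → b ≡ c → ⊥
        cases true e = up-contradiction (pullback E S) (up e)
        cases false e = up-contradiction (pullback (λ i → E (op i)) (reverse S)) (down e)

    -- The homogeneous set has `L₀ + M₃` elements, since only its colour decides whether `L₀` of
    -- them are returned or `M₃` of them are fed to the contradiction.
    low-density : ∀ L₀ {k} (S : Str (Fin (sample-size L₀)) k) → F7-sparse S →
      Σ (Thin L₀ (sample-size L₀)) λ θ → ∀ χ → at₃ (Ops.κ S) (χ ⨟ θ) < ¼ + (64ᵣ * u + 64ᵣ * u)
    low-density L₀ {k} S sparse = go c₁ refl
      where
      M₂ = L₀ ℕ.+ M₃
      r₁ = proj₂ (ramsey 1 3 M₂) (λ θ → colour (big-κ S sparse θ))
      θ₁ = proj₁ r₁
      c₁ = proj₁ (proj₂ r₁)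
      h₁ = proj₂ (proj₂ r₁)
      colour-true : ∀ {b} → colour b ≡ zero → b ≡ true
      colour-true {true} _ = refl
      colour-false : ∀ {b} → colour b ≡ suc zero → b ≡ false
      colour-false {false} _ = refl
      uncolour : Fin 2 → Bool
      uncolour zero = true
      uncolour (suc _) = false
      uncolour-colour : ∀ b → uncolour (colour b) ≡ b
      uncolour-colour true = refl
      uncolour-colour false = refl
      go : ∀ c → c₁ ≡ c → Σ (Thin L₀ (sample-size L₀)) λ θ → ∀ χ → at₃ (Ops.κ S) (χ ⨟ θ) < ¼ + (64ᵣ * u + 64ᵣ * u)
      go (suc zero) e = shorten (ℕₚ.m≤m+n L₀ M₃) ⨟ θ₁ , λ χ → ⊑-false (colour-false (trans
        (cong (λ x → colour (big-κ S sparse x)) (sym (⨟-assoc χ (shorten (ℕₚ.m≤m+n L₀ M₃)) θ₁))) (trans (h₁ (χ ⨟ shorten (ℕₚ.m≤m+n L₀ M₃))) e)))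
      go zero e = ⊥-elim (final S sparse (θ₅ ⨟ (θ₄ ⨟ (θ₃ ⨟ θ₂)))
          (λ χ → colour-true (trans (along (λ x → colour (big-κ S sparse x)) χ) (trans (cong (λ x → colour (big-κ S sparse x)) (sym (⨟-assoc _ short θ₁))) (trans (h₁ _) e))))
          (uncolour (proj₁ (proj₂ r₃)) , λ χ → trans (sym (uncolour-colour _)) (cong uncolour (trans (along (λ x → colour (big-Φ S sparse x)) χ) (proj₂ (proj₂ r₃) _))))
          (λ χ χ' → trans (b₁ χ) (sym (b₁ χ')))
          (λ χ χ' → trans (b₂ χ) (sym (b₂ χ'))))
        where
        short : Thin M₃ M₂
        short = shorten (ℕₚ.m≤n+m M₃ L₀)
        θ₂ = short ⨟ θ₁
        r₃ = proj₂ (ramsey 1 3 M₄) (λ θ → colour (big-Φ S sparse (θ ⨟ θ₂)))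
        θ₃ = proj₁ r₃
        r₄ = proj₂ (ramsey R' 4 M₅) (λ θ → bucket h R' (G₁ S sparse (θ ⨟ (θ₃ ⨟ θ₂))))
        θ₄ = proj₁ r₄
        r₅ = proj₂ (ramsey R' 4 L) (λ θ → bucket h R' (G₂ S sparse (θ ⨟ (θ₄ ⨟ (θ₃ ⨟ θ₂)))))
        θ₅ = proj₁ r₅
        along : ∀ {A : Set} {r} (f : Thin r _ → A) χ → f (χ ⨟ (θ₅ ⨟ (θ₄ ⨟ (θ₃ ⨟ θ₂)))) ≡ f ((((χ ⨟ θ₅) ⨟ θ₄) ⨟ θ₃) ⨟ θ₂)
        along f χ = cong f (trans (sym (⨟-assoc χ θ₅ (θ₄ ⨟ (θ₃ ⨟ θ₂)))) (trans (sym (⨟-assoc (χ ⨟ θ₅) θ₄ (θ₃ ⨟ θ₂))) (sym (⨟-assoc ((χ ⨟ θ₅) ⨟ θ₄) θ₃ θ₂))))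
        b₁ : ∀ χ → bucket h R' (G₁ S sparse (χ ⨟ (θ₅ ⨟ (θ₄ ⨟ (θ₃ ⨟ θ₂))))) ≡ proj₁ (proj₂ r₄)
        b₁ χ = trans (cong (λ x → bucket h R' (G₁ S sparse x)) (trans (sym (⨟-assoc χ θ₅ (θ₄ ⨟ (θ₃ ⨟ θ₂)))) (sym (⨟-assoc (χ ⨟ θ₅) θ₄ (θ₃ ⨟ θ₂))))) (proj₂ (proj₂ r₄) _)
        b₂ : ∀ χ → bucket h R' (G₂ S sparse (χ ⨟ (θ₅ ⨟ (θ₄ ⨟ (θ₃ ⨟ θ₂))))) ≡ proj₁ (proj₂ r₅)
        b₂ χ = trans (cong (λ x → bucket h R' (G₂ S sparse x)) (sym (⨟-assoc χ θ₅ (θ₄ ⨟ (θ₃ ⨟ θ₂))))) (proj₂ (proj₂ r₅) _)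

-- Finite probability spaces, conditional expectation and energy.

module Spaces where
  open import Relation.Binary.Definitions using (DecidableEquality)
  open Field
  open Base

  record Linear {Ω : Set} (J : (Ω → ℚ) → ℚ) : Set where
    field
      J-cong : ∀ {f g} → (∀ ω → f ω ≡ g ω) → J f ≡ J g
      J-+ : ∀ f g → J (λ ω → f ω + g ω) ≡ J f + J g
      J-*ˡ : ∀ c f → J (λ ω → c * f ω) ≡ c * J f
  open Linear public

  -- finite probability spaces of full support
  record Space (Ω : Set) : Set₁ where
    field
      ∫ : (Ω → ℚ) → ℚ
      linear : Linear ∫
      ∫-mono : ∀ {f g} → (∀ ω → f ω ≤ g ω) → ∫ f ≤ ∫ g
      ∫-1 : ∫ (λ _ → 1ℚ) ≡ 1ℚ
      ∫-pos : ∀ {f} → (∀ ω → 0ℚ ≤ f ω) → ∀ ω → 0ℚ < f ω → 0ℚ < ∫ f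
      -- Fubini against any linear functional, which covers integrals, iterated integrals and finite
      -- sums alike.
      ∫-comm : ∀ {Ω' : Set} (J : (Ω' → ℚ) → ℚ) → Linear J → (f : Ω → Ω' → ℚ) → ∫ (λ a → J (f a)) ≡ J (λ b → ∫ (λ a → f a b))

    open Linear linear public renaming (J-cong to ∫-cong; J-+ to ∫-+; J-*ˡ to ∫-*ˡ)

    ∫-*ʳ : ∀ c f → ∫ (λ ω → f ω * c) ≡ ∫ f * c
    ∫-*ʳ c f = trans (∫-cong λ ω → *-comm (f ω) c) (trans (∫-*ˡ c f) (*-comm c _))

    ∫-const : ∀ c → ∫ (λ _ → c) ≡ c
    ∫-const c = trans (∫-cong λ _ → sym (*-identityʳ c)) (trans (∫-*ˡ c _) (trans (cong (c *_) ∫-1) (*-identityʳ c)))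

    ∫-- : ∀ f g → ∫ (λ ω → f ω - g ω) ≡ ∫ f - ∫ g
    ∫-- f g = trans (∫-+ f _) (cong (∫ f +_) (trans (∫-cong λ ω → neg (g ω)) (trans (∫-*ˡ (- 1ℚ) g) (sym (neg (∫ g))))))
      where
      neg : ∀ a → - a ≡ (- 1ℚ) * a
      neg = solve 1 (λ a → :- a := (:- (con 1ℚ)) :* a) refl

    ∫-≥ : ∀ {f} c → (∀ ω → c ≤ f ω) → c ≤ ∫ f
    ∫-≥ c h = ≤-trans (≤-reflexive (sym (∫-const c))) (∫-mono h)

    ∫-≤ : ∀ {f} c → (∀ ω → f ω ≤ c) → ∫ f ≤ c
    ∫-≤ c h = ≤-trans (∫-mono h) (≤-reflexive (∫-const c))

  opaque
    unfolding ∑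
    linear-∑ : ∀ {Ω : Set} {J : (Ω → ℚ) → ℚ} → Linear J → ∀ {n} (f : Fin n → Ω → ℚ) → ∑ (λ i → J (f i)) ≡ J (λ ω → ∑ (λ i → f i ω))
    linear-∑ L {zero} f = sym (trans (J-cong L λ ω → sym (zeroˡ 0ℚ)) (trans (J-*ˡ L 0ℚ _) (zeroˡ _)))
    linear-∑ {J = J} L {suc n} f = trans (cong (J (f zero) +_) (linear-∑ L (λ i → f (suc i)))) (sym (J-+ L _ _))

  uniform : ∀ n' → Space (Fin (suc n'))
  uniform n' = record
    { ∫ = 𝔼 w
    ; linear = record { J-cong = 𝔼-cong ; J-+ = 𝔼-+ ; J-*ˡ = 𝔼-*ˡ }
    ; ∫-mono = 𝔼-mono D
    ; ∫-1 = 𝔼-const D 1ℚ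
    ; ∫-pos = λ {f} f≥0 ω h → <-≤-trans (0<* c>0 h) (term≤∑ (λ i → 0≤* (<⇒≤ c>0) (f≥0 i)) ω)
    ; ∫-comm = λ J L f → trans (∑-cong λ a → sym (J-*ˡ L c (f a))) (linear-∑ L (λ a ω → c * f a ω)) }
    where
    c : ℚ
    c = inv (0<nat n')
    c>0 : 0ℚ < c
    c>0 = inv-pos (0<nat n')
    w : Fin (suc n') → ℚ
    w _ = c
    D : Dist w
    D = record { w≥0 = λ _ → <⇒≤ c>0 ; w∑1 = trans (∑-const c) (*-inv (0<nat n')) }

  infixr 5 _⊗_
  _⊗_ : ∀ {A B} → Space A → Space B → Space (A × B)
  μ ⊗ ν = record
    { ∫ = λ f → μ.∫ λ a → ν.∫ λ b → f (a , b)
    ; linear = record { J-cong = λ h → μ.∫-cong λ a → ν.∫-cong λ b → h (a , b)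
                      ; J-+ = λ f g → trans (μ.∫-cong λ a → ν.∫-+ _ _) (μ.∫-+ _ _)
                      ; J-*ˡ = λ c f → trans (μ.∫-cong λ a → ν.∫-*ˡ c _) (μ.∫-*ˡ c _) }
    ; ∫-mono = λ h → μ.∫-mono λ a → ν.∫-mono λ b → h (a , b)
    ; ∫-1 = trans (μ.∫-cong λ a → ν.∫-1) μ.∫-1
    ; ∫-pos = λ { h (a , b) p → μ.∫-pos (λ a' → ν.∫-≥ 0ℚ λ b' → h (a' , b')) a (ν.∫-pos (λ b' → h (a , b')) b p) }
    ; ∫-comm = λ J L f → trans (μ.∫-cong λ a → ν.∫-comm J L (λ b → f (a , b))) (μ.∫-comm J L (λ a b → ν.∫ λ b' → f (a , b') b)) }
    where
    module μ = Space μ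
    module ν = Space ν

  module Conditional {Ω : Set} (μ : Space Ω) where
    open Space μ

    module _ {C : Set} (_≟_ : DecidableEquality C) (c : Ω → C) (g : Ω → ℚ) where

      is : C → Ω → ℚ
      is j ω with c ω ≟ j
      ... | yes _ = 1ℚ
      ... | no _ = 0ℚ

      is≥0 : ∀ j ω → 0ℚ ≤ is j ω
      is≥0 j ω with c ω ≟ j
      ... | yes _ = 0≤1
      ... | no _ = ≤-refl

      is-refl : ∀ ω → is (c ω) ω ≡ 1ℚ
      is-refl ω with c ω ≟ c ω
      ... | yes _ = refl
      ... | no h = ⊥-elim (h refl)

      is-sym : ∀ (h : C → ℚ) ω ω' → is (c ω) ω' * h (c ω) ≡ is (c ω') ω * h (c ω')
      is-sym h ω ω' with c ω' ≟ c ω | c ω ≟ c ω'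
      ... | yes e | yes e' = cong (λ x → 1ℚ * h x) e'
      ... | no e | no e' = trans (zeroˡ _) (sym (zeroˡ _))
      ... | yes e | no e' = ⊥-elim (e' (sym e))
      ... | no e | yes e' = ⊥-elim (e (sym e'))

      mass : C → ℚ
      mass j = ∫ (is j)

      mass>0 : ∀ ω → 0ℚ < mass (c ω)
      mass>0 ω = ∫-pos (is≥0 (c ω)) ω (subst (0ℚ <_) (sym (is-refl ω)) 0<1)

      -- The default 0 occurs only for cells of mass zero; by full support these contain no point.
      1/mass : C → ℚ
      1/mass j with 0ℚ <? mass j
      ... | yes h = inv h
      ... | no _ = 0ℚ

      1/mass≥0 : ∀ j → 0ℚ ≤ 1/mass j
      1/mass≥0 j with 0ℚ <? mass j
      ... | yes h = <⇒≤ (inv-pos h)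
      ... | no _ = ≤-refl

      mass*1/mass≤1 : ∀ j → mass j * 1/mass j ≤ 1ℚ
      mass*1/mass≤1 j with 0ℚ <? mass j
      ... | yes h = ≤-reflexive (*-inv h)
      ... | no _ = ≤-trans (≤-reflexive (zeroʳ _)) 0≤1

      mass*1/mass : ∀ ω → mass (c ω) * 1/mass (c ω) ≡ 1ℚ
      mass*1/mass ω with 0ℚ <? mass (c ω)
      ... | yes h = *-inv h
      ... | no h = ⊥-elim (h (mass>0 ω))

      condexp : C → ℚ
      condexp j = ∫ (λ ω → g ω * is j ω) * 1/mass j

      condexp-Unit : (∀ ω → Unit (g ω)) → ∀ j → Unit (condexp j)
      condexp-Unit gu j = 0≤* (∫-≥ 0ℚ λ ω → 0≤* (proj₁ (gu ω)) (is≥0 j ω)) (1/mass≥0 j) ,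
        ≤-trans (*-monoˡ (1/mass j) (1/mass≥0 j) (∫-mono λ ω → ≤-trans (*-monoˡ (is j ω) (is≥0 j ω) (proj₂ (gu ω))) (≤-reflexive (*-identityˡ _)))) (mass*1/mass≤1 j)

      -- Written out, the left side is a double integral over two points in a common cell; this
      -- relation is symmetric, so the two integrals may be exchanged.
      condexp-≡ : ∀ (τ : C → ℚ) → ∫ (λ ω → condexp (c ω) * τ (c ω)) ≡ ∫ (λ ω → g ω * τ (c ω))
      condexp-≡ τ = trans (∫-cong λ ω → trans (lem₁ _ _ _) (trans (sym (∫-*ʳ (h (c ω)) _)) (∫-cong λ ω' → trans (*-assoc _ _ _) (cong (g ω' *_) (is-sym h ω ω')))))
        (trans (∫-comm ∫ linear _) (∫-cong λ ω' → trans (∫-cong λ ω → lem₂ (g ω') (is (c ω') ω) (h (c ω'))) (trans (∫-*ʳ (g ω' * h (c ω')) _) (lem₃ ω'))))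
        where
        h : C → ℚ
        h j = 1/mass j * τ j
        lem₁ : ∀ a b t → a * b * t ≡ a * (b * t)
        lem₁ = solve 3 (λ a b t → a :* b :* t := a :* (b :* t)) refl
        lem₂ : ∀ g i h → g * (i * h) ≡ i * (g * h)
        lem₂ = solve 3 (λ g i h → g :* (i :* h) := i :* (g :* h)) refl
        lem₄ : ∀ m g i t → m * (g * (i * t)) ≡ m * i * (g * t)
        lem₄ = solve 4 (λ m g i t → m :* (g :* (i :* t)) := m :* i :* (g :* t)) refl
        lem₃ : ∀ ω' → mass (c ω') * (g ω' * h (c ω')) ≡ g ω' * τ (c ω')
        lem₃ ω' = trans (lem₄ _ _ _ _) (trans (cong (_* (g ω' * τ (c ω'))) (mass*1/mass ω')) (*-identityˡ _))

      energy : ℚ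
      energy = ∫ (λ ω → condexp (c ω) * condexp (c ω))

      energy≤1 : (∀ ω → Unit (g ω)) → energy ≤ 1ℚ
      energy≤1 gu = ∫-≤ 1ℚ λ ω → proj₂ (Unit* (condexp-Unit gu (c ω)) (condexp-Unit gu (c ω)))

      energy≥0 : 0ℚ ≤ energy
      energy≥0 = ∫-≥ 0ℚ λ ω → 0≤sq _

    -- The two conditional expectations differ by some D orthogonal to the coarser one, so the
    -- energies differ by the mean of D². A test that is a function of the finer cells cannot tell D
    -- from the deviation of `g`, and 2εDs - ε² ≤ D² turns its correlation ε into ε².
    energy-increment : ∀ {C C' : Set} (≟ : DecidableEquality C) (≟' : DecidableEquality C') (c : Ω → C) (c' : Ω → C') (π : C' → C) → (∀ ω → π (c' ω) ≡ c ω) →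
      ∀ (g : Ω → ℚ) (σ : C' → ℚ) → (∀ j → σ j * σ j ≤ 1ℚ) → ∀ {ε} → 0ℚ ≤ ε → ε ≤ ∫ (λ ω → (g ω - condexp ≟ c g (c ω)) * σ (c' ω)) →
      energy ≟ c g + ε * ε ≤ energy ≟' c' g
    energy-increment ≟ ≟' c c' π hπ g σ hσ {ε} 0≤ε hε = ≤-trans (+-monoʳ-≤ (energy ≟ c g) main) (≤-reflexive (trans (cong (energy ≟ c g +_) pythagoras) (lem (energy ≟ c g) (energy ≟' c' g))))
      where
      γ γ' D s : Ω → ℚ
      γ ω = condexp ≟ c g (c ω)
      γ' ω = condexp ≟' c' g (c' ω)
      D ω = γ' ω - γ ω
      s ω = σ (c' ω)
      lem : ∀ a b → a + (b - a) ≡ b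
      lem = solve 2 (λ a b → a :+ (b :- a) := b) refl
      γγ' : ∫ (λ ω → γ' ω * γ ω) ≡ energy ≟ c g
      γγ' = trans (∫-cong λ ω → cong (λ x → γ' ω * condexp ≟ c g x) (sym (hπ ω))) (trans (condexp-≡ ≟' c' g (λ j → condexp ≟ c g (π j)))
        (trans (∫-cong λ ω → cong (λ x → g ω * condexp ≟ c g x) (hπ ω)) (sym (condexp-≡ ≟ c g (condexp ≟ c g)))))
      pythagoras : ∫ (λ ω → D ω * D ω) ≡ energy ≟' c' g - energy ≟ c g
      pythagoras = trans (∫-cong λ ω → sq (γ' ω) (γ ω)) (trans (∫-+ _ _) (trans (cong₂ _+_ refl (trans (∫-- _ _) (cong₂ _-_ refl (trans (∫-*ˡ 2ᵣ _) (cong (2ᵣ *_) γγ')))))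
        (fin (energy ≟' c' g) (energy ≟ c g))))
        where
        sq : ∀ a b → (a - b) * (a - b) ≡ a * a + (b * b - 2ᵣ * (a * b))
        sq = solve 2 (λ a b → (a :- b) :* (a :- b) := a :* a :+ (b :* b :- (con 2ᵣ) :* (a :* b))) refl
        fin : ∀ a b → a + (b - 2ᵣ * b) ≡ a - b
        fin = solve 2 (λ a b → a :+ (b :- (con 2ᵣ) :* b) := a :- b) refl
      same : ∫ (λ ω → D ω * s ω) ≡ ∫ (λ ω → (g ω - γ ω) * s ω)
      same = trans (trans (∫-cong λ ω → d (γ' ω) (γ ω) (s ω)) (∫-- _ _)) (trans (cong (_- ∫ (λ ω → γ ω * s ω)) (condexp-≡ ≟' c' g σ))
        (sym (trans (∫-cong λ ω → d (g ω) (γ ω) (s ω)) (∫-- _ _))))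
        where
        d : ∀ a b s → (a - b) * s ≡ a * s - b * s
        d = solve 3 (λ a b s → (a :- b) :* s := a :* s :- b :* s) refl
      main : ε * ε ≤ ∫ (λ ω → D ω * D ω)
      main = ≤-trans (le _ (0≤* (0≤+ 0≤ε 0≤ε) (diff (subst (ε ≤_) (sym same) hε))) (l₁ ε (∫ (λ ω → D ω * s ω))))
        (≤-trans (≤-reflexive (sym (trans (∫-- _ _) (cong₂ _-_ (∫-*ˡ (ε + ε) _) (∫-const (ε * ε)))))) (∫-mono pt))
        where
        l₁ : ∀ e x → (e + e) * x - e * e ≡ e * e + (e + e) * (x - e)
        l₁ = solve 2 (λ e x → (e :+ e) :* x :- e :* e := e :* e :+ (e :+ e) :* (x :- e)) refl
        pt : ∀ ω → (ε + ε) * (D ω * s ω) - ε * ε ≤ D ω * D ω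
        pt ω = le _ (0≤+ (0≤sq (D ω - ε * s ω)) (0≤* (0≤* 0≤ε 0≤ε) (diff (hσ (c' ω))))) (l₂ (D ω) ε (s ω))
          where
          l₂ : ∀ D e s → D * D ≡ (e + e) * (D * s) - e * e + ((D - e * s) * (D - e * s) + e * e * (1ℚ - s * s))
          l₂ = solve 3 (λ D e s →
            D :* D
            := (e :+ e) :* (D :* s) :- e :* e :+ ((D :- e :* s) :* (D :- e :* s) :+ e :* e :* ((con 1ℚ) :- s :* s))) refl

-- Weak regularity for pair colourings and vertex partitions.

module Regular where
  open import Data.Fin using (combine; remQuot)
  import Data.Product.Properties as Productₚ
  open import Relation.Binary.Definitions using (DecidableEquality)
  open Field
  open Base
  open Count
  open Arith
  open Spaces

  bit : Bool → Fin 2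
  bit true = zero
  bit false = suc zero

  unbit : Fin 2 → Bool
  unbit zero = true
  unbit (suc _) = false

  unbit-bit : ∀ b → unbit (bit b) ≡ b
  unbit-bit true = refl
  unbit-bit false = refl

  left : ∀ {m} n → Fin (m ℕ.* n) → Fin m
  left n i = proj₁ (remQuot n i)

  right : ∀ {m} n → Fin (m ℕ.* n) → Fin n
  right {m} n i = proj₂ (remQuot {m} n i)

  left-combine : ∀ {m n} (i : Fin m) (j : Fin n) → left n (combine i j) ≡ i
  left-combine i j = cong proj₁ (Finₚ.remQuot-combine i j)

  right-combine : ∀ {m n} (i : Fin m) (j : Fin n) → right {m} n (combine i j) ≡ j
  right-combine i j = cong proj₂ (Finₚ.remQuot-combine i j)

  grow : ℕ → ℕ → ℕ
  grow M zero = M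
  grow M (suc J) = grow (M ℕ.* 4) J

  grow-mono : ∀ {M M'} J → M ℕ.≤ M' → grow M J ℕ.≤ grow M' J
  grow-mono zero h = h
  grow-mono (suc J) h = grow-mono J (ℕₚ.*-monoˡ-≤ 4 h)

  ≤-grow : ∀ M J → M ℕ.≤ grow M J
  ≤-grow M zero = ℕₚ.≤-refl
  ≤-grow M (suc J) = ℕₚ.≤-trans (ℕₚ.m≤m*n M 4) (≤-grow (M ℕ.* 4) J)

  infix 4 _refines_
  _refines_ : ∀ {V : Set} {M M'} → (V → Fin M') → (V → Fin M) → Set
  _refines_ {M = M} {M'} Q' Q = Σ (Fin M' → Fin M) λ π → ∀ x → π (Q' x) ≡ Q x

  refines-trans : ∀ {V : Set} {a b c} {Q : V → Fin a} {Q' : V → Fin b} {Q'' : V → Fin c} → Q'' refines Q' → Q' refines Q → Q'' refines Q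
  refines-trans (π , h) (π' , h') = (λ i → π' (π i)) , λ x → trans (cong π' (h x)) (h' x)

  square≤1 : ∀ {x} → Unit x → x * x ≤ 1ℚ
  square≤1 h = proj₂ (Unit* h h)

  -- ε₂ k' is the accuracy demanded once there are suc k' colours; rounds k' bounds the number of refinements needed for it.
  module Bound (ε₂ : ℕ → ℚ) (0<ε₂ : ∀ k' → 0ℚ < ε₂ k') where
    rounds : ℕ → ℕ
    rounds k' = proj₁ (archimedean (0<* (0<ε₂ k') (0<ε₂ k')) (1ℚ + 1ℚ))

    -- Each of the `I` rounds multiplies the number `suc k'` of colours by 8 and then restores
    -- colour regularity. The bound depends on the accuracies only, so a lower bound for cell masses
    -- can be fixed before the hypergraph is given.
    cells : ℕ → ℕ → ℕ → ℕ
    cells zero k' M = M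
    cells (suc I) k' M = cells I (7 ℕ.+ k' ℕ.* 8) (grow M (rounds (7 ℕ.+ k' ℕ.* 8)))

    cells-mono : ∀ I k' {M M'} → M ℕ.≤ M' → cells I k' M ℕ.≤ cells I k' M'
    cells-mono zero k' h = h
    cells-mono (suc I) k' h = cells-mono I _ (grow-mono (rounds (7 ℕ.+ k' ℕ.* 8)) h)

    ≤-cells : ∀ I k' M → M ℕ.≤ cells I k' M
    ≤-cells zero k' M = ℕₚ.≤-refl
    ≤-cells (suc I) k' M = ℕₚ.≤-trans (≤-grow M (rounds (7 ℕ.+ k' ℕ.* 8))) (≤-cells I _ _)

    max-rounds : ∀ {ε₁} → 0ℚ < ε₁ → ℕ
    max-rounds 0<ε = proj₁ (archimedean (0<* 0<ε 0<ε) (1ℚ + 1ℚ))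

    max-cells : ∀ {ε₁} → 0ℚ < ε₁ → ℕ
    max-cells 0<ε = cells (max-rounds 0<ε) 0 (grow 1 (rounds 0))

  module _ (n' : ℕ) where

    V : Set
    V = Fin (suc n')

    μ : Space V
    μ = uniform n'

    module Colours {k' : ℕ} (P : V → V → Fin (suc k')) where

      space : Space (V × V × Fin (suc k'))
      space = μ ⊗ (μ ⊗ uniform k')

      open Space space
      open Conditional space

      has : V × V × Fin (suc k') → ℚ
      has (x , y , l) = ⟦ P x y ≡ᶠ l ⟧

      has-Unit : ∀ ω → Unit (has ω)
      has-Unit (x , y , l) = Unit⟦⟧ (P x y ≡ᶠ l)

      Cell : ℕ → Set
      Cell M = Fin M × Fin M × Fin (suc k')

      _≟_ : ∀ {M} → DecidableEquality (Cell M)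
      _≟_ = Productₚ.≡-dec Finₚ._≟_ (Productₚ.≡-dec Finₚ._≟_ Finₚ._≟_)

      cell : ∀ {M} → (V → Fin M) → V × V × Fin (suc k') → Cell M
      cell Q (x , y , l) = Q x , Q y , l

      d : ∀ {M} → (V → Fin M) → Cell M → ℚ
      d Q = condexp _≟_ (cell Q) has

      -- A cut-norm condition relative to the cells: on a rectangle of vertex sets, with any bounded
      -- weight on cells and colours, the colour indicators look like their conditional densities.
      -- Taking the colour as a coordinate treats all colours in one inequality.
      Colour-regular : ∀ {M} → ℚ → (V → Fin M) → Set
      Colour-regular {M} ε Q = ∀ (u v : V → Bool) (τ : Cell M → ℚ) → (∀ j → τ j * τ j ≤ 1ℚ) →
        ∫ (λ { ω@(x , y , l) → (has ω - d Q (cell Q ω)) * (⟦ u x ⟧ * ⟦ v y ⟧ * τ (cell Q ω)) }) ≤ ε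

      energyQ : ∀ {M} → (V → Fin M) → ℚ
      energyQ Q = energy _≟_ (cell Q) has

      split : ∀ {M} → (V → Fin M) → (u v : V → Bool) → V → Fin (M ℕ.* 4)
      split Q u v x = combine (Q x) (combine (bit (u x)) (bit (v x)))

      split-refines : ∀ {M} (Q : V → Fin M) u v → split Q u v refines Q
      split-refines Q u v = left 4 , λ x → left-combine (Q x) _

      split-energy : ∀ {M} (Q : V → Fin M) u v (τ : Cell M → ℚ) → (∀ j → τ j * τ j ≤ 1ℚ) → ∀ {ε} → 0ℚ ≤ ε →
        ε ≤ ∫ (λ { ω@(x , y , l) → (has ω - d Q (cell Q ω)) * (⟦ u x ⟧ * ⟦ v y ⟧ * τ (cell Q ω)) }) →
        energyQ Q + ε * ε ≤ energyQ (split Q u v)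
      split-energy {M} Q u v τ hτ {ε} 0≤ε h = energy-increment _≟_ _≟_ (cell Q) (cell (split Q u v)) π
        (λ { (x , y , l) → cong₂ (λ a b → a , b , l) (left-combine (Q x) _) (left-combine (Q y) _) }) has σ hσ 0≤ε
        (≤-trans h (≤-reflexive (∫-cong λ { (x , y , l) → cong ((has (x , y , l) - d Q (Q x , Q y , l)) *_) (sym (measurable x y l)) })))
        where
        π : Cell (M ℕ.* 4) → Cell M
        π (i , j , l) = left 4 i , left 4 j , l
        U W : Fin (M ℕ.* 4) → Bool
        U i = unbit (left {2} 2 (right {M} 4 i))
        W i = unbit (right {2} 2 (right {M} 4 i))
        σ : Cell (M ℕ.* 4) → ℚ
        σ (i , j , l) = ⟦ U i ⟧ * ⟦ W j ⟧ * τ (π (i , j , l))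
        U-eq : ∀ x → U (split Q u v x) ≡ u x
        U-eq x = trans (cong (λ i → unbit (left {2} 2 i)) (right-combine (Q x) _)) (trans (cong unbit (left-combine (bit (u x)) (bit (v x)))) (unbit-bit (u x)))
        W-eq : ∀ x → W (split Q u v x) ≡ v x
        W-eq x = trans (cong (λ i → unbit (right {2} 2 i)) (right-combine (Q x) _)) (trans (cong unbit (right-combine (bit (u x)) (bit (v x)))) (unbit-bit (v x)))
        measurable : ∀ x y l → σ (cell (split Q u v) (x , y , l)) ≡ ⟦ u x ⟧ * ⟦ v y ⟧ * τ (Q x , Q y , l)
        measurable x y l = cong₂ _*_ (cong₂ (λ a b → ⟦ a ⟧ * ⟦ b ⟧) (U-eq x) (W-eq y)) (cong₂ (λ a b → τ (a , b , l)) (left-combine (Q x) _) (left-combine (Q y) _))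
        hσ : ∀ j → σ j * σ j ≤ 1ℚ
        hσ (i , j , l) = ≤-trans (≤-reflexive (r (⟦ U i ⟧ * ⟦ W j ⟧) (τ (π (i , j , l))))) (≤-trans (*-mono (0≤sq _) (0≤sq _) (square≤1 (Unit* (Unit⟦⟧ (U i)) (Unit⟦⟧ (W j)))) (hτ (π (i , j , l)))) (≤-reflexive (*-identityˡ 1ℚ)))
          where
          r : ∀ a t → a * t * (a * t) ≡ a * a * (t * t)
          r = solve 2 (λ a t → a :* t :* (a :* t) := a :* a :* (t :* t)) refl

      -- Every violation adds ε² to the energy, which never exceeds 1. Regularity is not decided
      -- here, hence the double negation.
      refine : ∀ {ε} → 0ℚ < ε → ∀ J {M} (Q : V → Fin M) → 1ℚ < energyQ Q + nat J * (ε * ε) →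
        ¬ ¬ (∃ λ M' → Σ (V → Fin M') λ Q' → M' ℕ.≤ grow M J × Q' refines Q × Colour-regular ε Q')
      refine {ε} 0<ε zero {M} Q h _ = no< (energy≤1 _≟_ (cell Q) has has-Unit) (<-≤-trans h (≤-reflexive (trans (cong (λ m → energyQ Q + m * (ε * ε)) nat-0) (l (energyQ Q) (ε * ε)))))
        where
        l : ∀ a b → a + 0ℚ * b ≡ a
        l = solve 2 (λ a b → a :+ (con 0ℚ) :* b := a) refl
      refine {ε} 0<ε (suc J) {M} Q h k = k (M , Q , ≤-grow M (suc J) , ((λ i → i) , λ x → refl) , regular)
        where
        l : ∀ e n s → e + (1ℚ + n) * s ≡ e + s + n * s
        l = solve 3 (λ e n s → e :+ ((con 1ℚ) :+ n) :* s := e :+ s :+ n :* s) refl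
        regular : Colour-regular ε Q
        regular u v τ hτ = go (≤⊎> _ ε)
          where
          I = ∫ (λ { ω@(x , y , l) → (has ω - d Q (cell Q ω)) * (⟦ u x ⟧ * ⟦ v y ⟧ * τ (cell Q ω)) })
          go : I ≤ ε ⊎ ε < I → I ≤ ε
          go (inj₁ h) = h
          go (inj₂ viol) = ⊥-elim (refine 0<ε J (split Q u v)
            (<-≤-trans h (≤-trans (≤-reflexive (trans (cong (λ m → energyQ Q + m * (ε * ε)) (nat-suc J)) (l (energyQ Q) (nat J) (ε * ε)))) (+-monoˡ-≤ (nat J * (ε * ε)) (split-energy Q u v τ hτ (<⇒≤ 0<ε) (<⇒≤ viol)))))
            λ { (M' , Q' , b , r , reg) → k (M' , Q' , b , refines-trans r (split-refines Q u v) , reg) })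

    module Triples (g : V × V × V → ℚ) (gu : ∀ ω → Unit (g ω)) where

      space : Space (V × V × V)
      space = μ ⊗ (μ ⊗ μ)

      open Space space
      open Conditional space

      Atom : ℕ → ℕ → Set
      Atom k M = (Fin k × Fin k × Fin k) × (Fin M × Fin M × Fin M)

      _≟_ : ∀ {k M} → DecidableEquality (Atom k M)
      _≟_ = Productₚ.≡-dec (Productₚ.≡-dec Finₚ._≟_ (Productₚ.≡-dec Finₚ._≟_ Finₚ._≟_)) (Productₚ.≡-dec Finₚ._≟_ (Productₚ.≡-dec Finₚ._≟_ Finₚ._≟_))

      atom : ∀ {k M} → (V → V → Fin k) → (V → Fin M) → V × V × V → Atom k M
      atom P Q (x , y , z) = (P x y , P x z , P y z) , (Q x , Q y , Q z)

      W : ∀ {k M} → (V → V → Fin k) → (V → Fin M) → Atom k M → ℚ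
      W P Q = condexp _≟_ (atom P Q) g

      -- The tests are products of functions of pairs, as they arise when all but three vertices of
      -- the pattern are fixed. The condition is one-sided: exchanging weights for true edges loses
      -- little, which is the direction needed to bound the pattern density.
      Triangle-regular : ∀ {k M} → ℚ → (V → V → Fin k) → (V → Fin M) → Set
      Triangle-regular ε P Q = ∀ (u v w : V → V → Bool) →
        ∫ (λ { ω@(x , y , z) → (W P Q (atom P Q ω) - g ω) * (⟦ u x y ⟧ * ⟦ v x z ⟧ * ⟦ w y z ⟧) }) ≤ ε

      energyP : ∀ {k M} → (V → V → Fin k) → (V → Fin M) → ℚ
      energyP P Q = energy _≟_ (atom P Q) g

      split : ∀ {k} → (V → V → Fin k) → (u v w : V → V → Bool) → V → V → Fin (k ℕ.* 8)
      split P u v w x y = combine (P x y) (combine (bit (u x y)) (combine (bit (v x y)) (bit (w x y))))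

      split-energy : ∀ {k M M'} (P : V → V → Fin k) (Q : V → Fin M) (Q' : V → Fin M') → Q' refines Q → ∀ u v w {ε} → 0ℚ ≤ ε →
        ε ≤ ∫ (λ { ω@(x , y , z) → (W P Q (atom P Q ω) - g ω) * (⟦ u x y ⟧ * ⟦ v x z ⟧ * ⟦ w y z ⟧) }) →
        energyP P Q + ε * ε ≤ energyP (split P u v w) Q'
      split-energy {k} {M} {M'} P Q Q' (ρ , hρ) u v w {ε} 0≤ε h = energy-increment _≟_ _≟_ (atom P Q) (atom P' Q') π
        (λ { (x , y , z) → cong₂ _,_ (cong₃ (left-combine (P x y) _) (left-combine (P x z) _) (left-combine (P y z) _)) (cong₃ (hρ x) (hρ y) (hρ z)) }) g σ hσ 0≤ε
        (≤-trans h (≤-reflexive (∫-cong λ { (x , y , z) → trans (neg (W P Q (atom P Q (x , y , z))) (g (x , y , z)) _) (cong ((g (x , y , z) - W P Q (atom P Q (x , y , z))) *_) (cong -_ (sym (measurable x y z)))) })))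
        where
        P' = split P u v w
        cong₃ : ∀ {A : Set} {a b c a' b' c' : A} → a ≡ a' → b ≡ b' → c ≡ c' → (a , b , c) ≡ (a' , b' , c')
        cong₃ refl refl refl = refl
        neg : ∀ a b c → (a - b) * c ≡ (b - a) * (- c)
        neg = solve 3 (λ a b c → (a :- b) :* c := (b :- a) :* (:- c)) refl
        π : Atom (k ℕ.* 8) M' → Atom k M
        π ((p , q , r) , (a , b , c)) = (left 8 p , left 8 q , left 8 r) , (ρ a , ρ b , ρ c)
        B₁ B₂ B₃ : Fin (k ℕ.* 8) → Bool
        B₁ p = unbit (left {2} 4 (right {k} 8 p))
        B₂ p = unbit (left {2} 2 (right {2} 4 (right {k} 8 p)))
        B₃ p = unbit (right {2} 2 (right {2} 4 (right {k} 8 p)))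
        e₁ : ∀ x y → B₁ (P' x y) ≡ u x y
        e₁ x y = trans (cong (λ i → unbit (left {2} 4 i)) (right-combine (P x y) _)) (trans (cong unbit (left-combine (bit (u x y)) (combine (bit (v x y)) (bit (w x y))))) (unbit-bit (u x y)))
        e₂ : ∀ x y → B₂ (P' x y) ≡ v x y
        e₂ x y = trans (cong (λ i → unbit (left {2} 2 (right {2} 4 i))) (right-combine (P x y) _)) (trans (cong (λ i → unbit (left {2} 2 i)) (right-combine (bit (u x y)) _))
          (trans (cong unbit (left-combine (bit (v x y)) (bit (w x y)))) (unbit-bit (v x y))))
        e₃ : ∀ x y → B₃ (P' x y) ≡ w x y
        e₃ x y = trans (cong (λ i → unbit (right {2} 2 (right {2} 4 i))) (right-combine (P x y) _)) (trans (cong (λ i → unbit (right {2} 2 i)) (right-combine (bit (u x y)) _))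
          (trans (cong unbit (right-combine (bit (v x y)) (bit (w x y)))) (unbit-bit (w x y))))
        σ : Atom (k ℕ.* 8) M' → ℚ
        σ ((p , q , r) , _) = - (⟦ B₁ p ⟧ * ⟦ B₂ q ⟧ * ⟦ B₃ r ⟧)
        measurable : ∀ x y z → ⟦ B₁ (P' x y) ⟧ * ⟦ B₂ (P' x z) ⟧ * ⟦ B₃ (P' y z) ⟧ ≡ ⟦ u x y ⟧ * ⟦ v x z ⟧ * ⟦ w y z ⟧
        measurable x y z = cong₂ _*_ (cong₂ (λ a b → ⟦ a ⟧ * ⟦ b ⟧) (e₁ x y) (e₂ x z)) (cong ⟦_⟧ (e₃ y z))
        hσ : ∀ j → σ j * σ j ≤ 1ℚ
        hσ ((p , q , r) , _) = ≤-trans (≤-reflexive (l _)) (square≤1 (Unit* (Unit* (Unit⟦⟧ (B₁ p)) (Unit⟦⟧ (B₂ q))) (Unit⟦⟧ (B₃ r))))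
          where
          l : ∀ a → (- a) * (- a) ≡ a * a
          l = solve 1 (λ a → (:- a) :* (:- a) := a :* a) refl

      module _ (ε₂ : ℕ → ℚ) (0<ε₂ : ∀ k' → 0ℚ < ε₂ k') where
        open Bound ε₂ 0<ε₂

        refine-colours : ∀ {k' M} (P : V → V → Fin (suc k')) (Q : V → Fin M) →
          ¬ ¬ (∃ λ M' → Σ (V → Fin M') λ Q' → M' ℕ.≤ grow M (rounds k') × Q' refines Q × Colours.Colour-regular P (ε₂ k') Q')
        refine-colours {k'} P Q = Colours.refine P (0<ε₂ k') (rounds k') Q
          (<-≤-trans (lt 1ℚ 0<1 refl) (≤-trans (proj₂ (archimedean (0<* (0<ε₂ k') (0<ε₂ k')) (1ℚ + 1ℚ)))
            (≤-trans (≤-reflexive (sym (+-identityˡ _))) (+-mono-≤ (Conditional.energy≥0 (Colours.space P) (Colours._≟_ P) (Colours.cell P Q) (Colours.has P)) ≤-refl))))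

        Regularity : ℚ → ℕ → Set
        Regularity ε₁ bound = ∃ λ k' → ∃ λ M → M ℕ.≤ bound × Σ (V → V → Fin (suc k')) λ P → Σ (V → Fin M) λ Q →
          Colours.Colour-regular P (ε₂ k') Q × Triangle-regular ε₁ P Q

        -- A violating test is absorbed into the colouring of pairs. The new colouring needs a new
        -- colour-regular partition; as this refines the old one, the energy gained is kept.
        refine-triples : ∀ {ε₁} → 0ℚ < ε₁ → ∀ I {k' M} (P : V → V → Fin (suc k')) (Q : V → Fin M) → Colours.Colour-regular P (ε₂ k') Q →
          1ℚ < energyP P Q + nat I * (ε₁ * ε₁) → ¬ ¬ Regularity ε₁ (cells I k' M)
        refine-triples {ε₁} 0<ε zero P Q reg h _ = no< (energy≤1 _≟_ (atom P Q) g gu) (<-≤-trans h (≤-reflexive (trans (cong (λ m → energyP P Q + m * (ε₁ * ε₁)) nat-0) (l (energyP P Q) (ε₁ * ε₁)))))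
          where
          l : ∀ a b → a + 0ℚ * b ≡ a
          l = solve 2 (λ a b → a :+ (con 0ℚ) :* b := a) refl
        refine-triples {ε₁} 0<ε (suc I) {k'} {M} P Q reg h k = k (k' , M , ≤-cells (suc I) k' M , P , Q , reg , regular)
          where
          l : ∀ e n s → e + (1ℚ + n) * s ≡ e + s + n * s
          l = solve 3 (λ e n s → e :+ ((con 1ℚ) :+ n) :* s := e :+ s :+ n :* s) refl
          regular : Triangle-regular ε₁ P Q
          regular u v w = go (≤⊎> _ ε₁)
            where
            A = ∫ (λ { ω@(x , y , z) → (W P Q (atom P Q ω) - g ω) * (⟦ u x y ⟧ * ⟦ v x z ⟧ * ⟦ w y z ⟧) })
            go : A ≤ ε₁ ⊎ ε₁ < A → A ≤ ε₁
            go (inj₁ h) = h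
            go (inj₂ viol) = ⊥-elim (refine-colours (split P u v w) Q λ { (M' , Q' , b , r , reg') →
              refine-triples 0<ε I (split P u v w) Q' reg' (<-≤-trans h (≤-trans (≤-reflexive (trans (cong (λ m → energyP P Q + m * (ε₁ * ε₁)) (nat-suc I)) (l (energyP P Q) (nat I) (ε₁ * ε₁))))
                (+-monoˡ-≤ (nat I * (ε₁ * ε₁)) (split-energy P Q Q' r u v w (<⇒≤ 0<ε) (<⇒≤ viol)))))
                λ { (k'' , M'' , b' , rest) → k (k'' , M'' , ℕₚ.≤-trans b' (cells-mono I (7 ℕ.+ k' ℕ.* 8) b) , rest) } })

        regularity : ∀ {ε₁} (0<ε : 0ℚ < ε₁) → ¬ ¬ Regularity ε₁ (max-cells 0<ε)
        regularity 0<ε k = refine-colours {0} {1} (λ _ _ → zero) (λ _ → zero) λ { (M' , Q' , b , r , reg) →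
          refine-triples 0<ε (max-rounds 0<ε) (λ _ _ → zero) Q' reg
            (<-≤-trans (lt 1ℚ 0<1 refl) (≤-trans (proj₂ (archimedean (0<* 0<ε 0<ε) (1ℚ + 1ℚ)))
              (≤-trans (≤-reflexive (sym (+-identityˡ _))) (+-mono-≤ (energy≥0 _≟_ (atom (λ _ _ → zero) Q') g) ≤-refl))))
            λ { (k' , M'' , b' , rest) → k (k' , M'' , ℕₚ.≤-trans b' (cells-mono (max-rounds 0<ε) 0 b) , rest) } }

-- A counting lemma by replacing one edge at a time.

module Counting where
  open import Data.Vec using (Vec; []; _∷_; lookup; _[_]≔_; map)
  open import Data.Vec.Properties using (lookup∘update; lookup∘update′)
  open import Data.List as List using (List; []; _∷_)
  open import Data.Bool using (if_then_else_)
  open import Data.List.Relation.Unary.All using (All; []; _∷_)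
  open import Data.List.Relation.Unary.All.Properties using (++⁺)
  open Field
  open Base
  open Count
  open Spaces

  trivial : ∀ {A : Set} → Space (Vec A 0)
  trivial = record
    { ∫ = λ f → f []
    ; linear = record { J-cong = λ h → h [] ; J-+ = λ _ _ → refl ; J-*ˡ = λ _ _ → refl }
    ; ∫-mono = λ h → h [] ; ∫-1 = refl ; ∫-pos = λ { _ [] h → h } ; ∫-comm = λ _ _ _ → refl }

  image : ∀ {A B : Set} (f : A → B) (f⁻¹ : B → A) → (∀ b → f (f⁻¹ b) ≡ b) → Space A → Space B
  image f f⁻¹ inverse μ = record
    { ∫ = λ h → μ.∫ λ a → h (f a)
    ; linear = record { J-cong = λ h → μ.∫-cong λ a → h (f a) ; J-+ = λ _ _ → μ.∫-+ _ _ ; J-*ˡ = λ _ _ → μ.∫-*ˡ _ _ }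
    ; ∫-mono = λ h → μ.∫-mono λ a → h (f a)
    ; ∫-1 = μ.∫-1
    ; ∫-pos = λ {h} p b q → μ.∫-pos (λ a → p (f a)) (f⁻¹ b) (subst (λ b → 0ℚ < h b) (sym (inverse b)) q)
    ; ∫-comm = λ J L h → μ.∫-comm J L (λ a → h (f a)) }
    where module μ = Space μ

  tuples : ∀ {A : Set} → Space A → ∀ r → Space (Vec A r)
  tuples μ zero = trivial
  tuples μ (suc r) = image (λ { (x , v) → x ∷ v }) (λ { (x ∷ v) → x , v }) (λ { (x ∷ v) → refl }) (μ ⊗ tuples μ r)

  cong₃ : ∀ {A B C D : Set} (f : A → B → C → D) {a a' b b' c c'} → a ≡ a' → b ≡ b' → c ≡ c' → f a b c ≡ f a' b' c'
  cong₃ f refl refl refl = refl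

  ≡ᶠ-sound : ∀ {n} {i j : Fin n} → (i ≡ᶠ j) ≡ true → i ≡ j
  ≡ᶠ-sound {i = zero} {zero} h = refl
  ≡ᶠ-sound {i = suc i} {suc j} h = cong suc (≡ᶠ-sound h)

  ≡ᶠ-refl : ∀ {n} (i : Fin n) → (i ≡ᶠ i) ≡ true
  ≡ᶠ-refl zero = refl
  ≡ᶠ-refl (suc i) = ≡ᶠ-refl i

  ≡ᶠ-apart : ∀ {n} {i j : Fin n} → (i ≡ᶠ j) ≡ false → i ≢ j
  ≡ᶠ-apart {i = i} h refl with () ← trans (sym (≡ᶠ-refl i)) h

  ∨-false : ∀ {a b} → (a ∨ b) ≡ false → a ≡ false × b ≡ false
  ∨-false {false} {false} _ = refl , refl

  not-true : ∀ {a} → not a ≡ true → a ≡ false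
  not-true {false} _ = refl

  module Tuples {A : Set} (μ : Space A) where
    open Space μ

    module T r = Space (tuples μ r)

    ∫ᵛ : ∀ r → (Vec A r → ℚ) → ℚ
    ∫ᵛ r = T.∫ r

    resample : ∀ {r} (i : Fin r) (F : Vec A r → ℚ) → ∫ᵛ r F ≡ ∫ᵛ r (λ v → ∫ (λ x → F (v [ i ]≔ x)))
    resample {suc r} zero F = sym (trans (∫-const _) (sym (∫-comm (∫ᵛ r) (T.linear r) (λ x v → F (x ∷ v)))))
    resample {suc r} (suc i) F = ∫-cong λ y → resample i (λ v → F (y ∷ v))

    resample₂ : ∀ {r} (i j : Fin r) (F : Vec A r → ℚ) → ∫ᵛ r F ≡ ∫ᵛ r (λ v → ∫ (λ x → ∫ (λ y → F (v [ i ]≔ x [ j ]≔ y))))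
    resample₂ i j F = trans (resample j F) (resample i _)

    resample₃ : ∀ {r} (i j k : Fin r) (F : Vec A r → ℚ) →
      ∫ᵛ r F ≡ ∫ᵛ r (λ v → ∫ (λ x → ∫ (λ y → ∫ (λ z → F (v [ i ]≔ x [ j ]≔ y [ k ]≔ z)))))
    resample₃ i j k F = trans (resample₂ j k F) (resample i _)

    -- The integral is linear in each test, so its maximum over [0,1]-valued tests is attained at {0,1}-valued ones.
    module Extreme (h : A → A → A → ℚ) (ε : ℚ) where
      Bounded : (A → A → ℚ) → (A → A → ℚ) → (A → A → ℚ) → Set
      Bounded U V W = ∫ (λ x → ∫ λ y → ∫ λ z → h x y z * (U x y * V x z * W y z)) ≤ ε

      private
        positive : (A → A → ℚ) → A → A → Bool
        positive c x y = 0ℚ ⊑ c x y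

        push : ∀ (U c : A → A → ℚ) x y → Unit (U x y) → U x y * c x y ≤ ⟦ positive c x y ⟧ * c x y
        push U c x y (p , q) with 0ℚ ⊑ c x y in eq
        ... | true = *-monoˡ (c x y) (⊑-true eq) q
        ... | false = ≤-trans (le (U x y * (0ℚ - c x y)) (0≤* p (diff (<⇒≤ (⊑-false eq)))) (l (U x y) (c x y))) (≤-reflexive (sym (zeroˡ (c x y))))
          where
          l : ∀ u c → 0ℚ ≡ u * c + u * (0ℚ - c)
          l = solve 2 (λ u c → con 0ℚ := u :* c :+ u :* ((con 0ℚ) :- c)) refl

        sup : ∀ (U c : A → A → ℚ) → (∀ x y → Unit (U x y)) → ∫ (λ x → ∫ λ y → U x y * c x y) ≤ ∫ (λ x → ∫ λ y → ⟦ positive c x y ⟧ * c x y)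
        sup U c hU = ∫-mono λ x → ∫-mono λ y → push U c x y (hU x y)

        UnitV : (A → A → ℚ) → Set
        UnitV U = ∀ x y → Unit (U x y)

      extreme : (∀ (u v w : A → A → Bool) → Bounded (λ x y → ⟦ u x y ⟧) (λ x z → ⟦ v x z ⟧) (λ y z → ⟦ w y z ⟧)) →
        ∀ U V W → UnitV U → UnitV V → UnitV W → Bounded U V W
      extreme base U V W hU hV hW = step₃
        where
        l : ∀ h a b c → h * (a * b * c) ≡ a * (h * b * c)
        l = solve 4 (λ h a b c → h :* (a :* b :* c) := a :* (h :* b :* c)) refl
        l₂ : ∀ h a b c → h * (a * b * c) ≡ b * (h * a * c)
        l₂ = solve 4 (λ h a b c → h :* (a :* b :* c) := b :* (h :* a :* c)) refl
        l₃ : ∀ h a b c → h * (a * b * c) ≡ c * (h * a * b)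
        l₃ = solve 4 (λ h a b c → h :* (a :* b :* c) := c :* (h :* a :* b)) refl
        step₁ : ∀ (v w : A → A → Bool) → Bounded U (λ x z → ⟦ v x z ⟧) (λ y z → ⟦ w y z ⟧)
        step₁ v w = ≤-trans (≤-reflexive (eq U)) (≤-trans (sup U c hU) (≤-trans (≤-reflexive (sym (eq _))) (base (positive c) v w)))
          where
          c : A → A → ℚ
          c x y = ∫ λ z → h x y z * ⟦ v x z ⟧ * ⟦ w y z ⟧
          eq : ∀ (U : A → A → ℚ) → ∫ (λ x → ∫ λ y → ∫ λ z → h x y z * (U x y * ⟦ v x z ⟧ * ⟦ w y z ⟧)) ≡ ∫ (λ x → ∫ λ y → U x y * c x y)
          eq U = ∫-cong λ x → ∫-cong λ y → trans (∫-cong λ z → l (h x y z) (U x y) _ _) (∫-*ˡ (U x y) _)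
        step₂ : ∀ (w : A → A → Bool) → Bounded U V (λ y z → ⟦ w y z ⟧)
        step₂ w = ≤-trans (≤-reflexive (eq V)) (≤-trans (sup V c hV) (≤-trans (≤-reflexive (sym (eq _))) (step₁ (positive c) w)))
          where
          c : A → A → ℚ
          c x z = ∫ λ y → h x y z * U x y * ⟦ w y z ⟧
          eq : ∀ (V : A → A → ℚ) → ∫ (λ x → ∫ λ y → ∫ λ z → h x y z * (U x y * V x z * ⟦ w y z ⟧)) ≡ ∫ (λ x → ∫ λ z → V x z * c x z)
          eq V = ∫-cong λ x → trans (∫-comm ∫ linear _) (∫-cong λ z → trans (∫-cong λ y → l₂ (h x y z) _ (V x z) _) (∫-*ˡ (V x z) _))
        step₃ : Bounded U V W
        step₃ = ≤-trans (≤-reflexive (eq W)) (≤-trans (sup W c hW) (≤-trans (≤-reflexive (sym (eq _))) (step₂ (positive c))))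
          where
          c : A → A → ℚ
          c y z = ∫ λ x → h x y z * U x y * V x z
          eq : ∀ (W : A → A → ℚ) → ∫ (λ x → ∫ λ y → ∫ λ z → h x y z * (U x y * V x z * W y z)) ≡ ∫ (λ y → ∫ λ z → W y z * c y z)
          eq W = trans (∫-comm ∫ linear _) (∫-cong λ y → trans (∫-comm ∫ linear _) (∫-cong λ z → trans (∫-cong λ x → l₃ (h x y z) _ _ (W y z)) (∫-*ˡ (W y z) _)))

    module Hypergraphs (r : ℕ) where

      Edge : Set
      Edge = Fin r × Fin r × Fin r

      infix 5 _∈ᵉ_
      _∈ᵉ_ : Fin r → Edge → Bool
      p ∈ᵉ (a , b , c) = (p ≡ᶠ a) ∨ ((p ≡ᶠ b) ∨ (p ≡ᶠ c))

      apart : Edge → Edge → Bool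
      apart (i , j , k) e = not ((i ∈ᵉ e) ∧ ((j ∈ᵉ e) ∧ (k ∈ᵉ e)))

      proper : Edge → Bool
      proper (i , j , k) = not (i ≡ᶠ j) ∧ (not (i ≡ᶠ k) ∧ not (j ≡ᶠ k))

      Factor : Set
      Factor = Edge × (A → A → A → ℚ)

      val : Factor → Vec A r → ℚ
      val ((a , b , c) , h) v = h (lookup v a) (lookup v b) (lookup v c)

      product : List Factor → Vec A r → ℚ
      product [] v = 1ℚ
      product (f ∷ fs) v = val f v * product fs v

      UnitF : Factor → Set
      UnitF (e , h) = ∀ x y z → Unit (h x y z)

      allApart : Edge → List Factor → Bool
      allApart e [] = true
      allApart e ((e' , _) ∷ fs) = apart e e' ∧ allApart e fs

      val-agree : ∀ e h v w → (∀ p → (p ∈ᵉ e) ≡ true → lookup v p ≡ lookup w p) → val (e , h) v ≡ val (e , h) w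
      val-agree (a , b , c) h v w agree = trans (cong (λ x → h x (lookup v b) (lookup v c)) (agree a (or₁ (≡ᶠ-refl a))))
        (trans (cong (λ x → h (lookup w a) x (lookup v c)) (agree b (or₂ (b ≡ᶠ a) (or₁ (≡ᶠ-refl b))))) (cong (λ x → h (lookup w a) (lookup w b) x) (agree c (or₂ (c ≡ᶠ a) (or₂ (c ≡ᶠ b) (≡ᶠ-refl c))))))
        where
        or₁ : ∀ {x y} → x ≡ true → (x ∨ y) ≡ true
        or₁ refl = refl
        or₂ : ∀ x {y} → y ≡ true → (x ∨ y) ≡ true
        or₂ true _ = refl
        or₂ false h = h

      ∈-apart : ∀ {p q e} → (p ∈ᵉ e) ≡ true → (q ∈ᵉ e) ≡ false → p ≢ q
      ∈-apart h h' refl with () ← trans (sym h) h'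

      module _ (i j k : Fin r) (i≢j : i ≢ j) (i≢k : i ≢ k) (j≢k : j ≢ k) (v : Vec A r) where

        full : A → A → A → Vec A r
        full x y z = v [ i ]≔ x [ j ]≔ y [ k ]≔ z

        private
          v₁ : A → Vec A r
          v₁ x = v [ i ]≔ x
          v₂ : A → A → Vec A r
          v₂ x y = v [ i ]≔ x [ j ]≔ y

        at-k : ∀ x y z → lookup (full x y z) k ≡ z
        at-k x y z = lookup∘update k (v₂ x y) z
        at-j : ∀ x y z → lookup (full x y z) j ≡ y
        at-j x y z = trans (lookup∘update′ j≢k (v₂ x y) z) (lookup∘update j (v₁ x) y)
        at-i : ∀ x y z → lookup (full x y z) i ≡ x
        at-i x y z = trans (lookup∘update′ i≢k (v₂ x y) z) (trans (lookup∘update′ i≢j (v₁ x) y) (lookup∘update i v x))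

        without-k : ∀ {p} x y z → p ≢ k → lookup (full x y z) p ≡ lookup (v [ i ]≔ x [ j ]≔ y) p
        without-k x y z h = lookup∘update′ h (v₂ x y) z

        without-j : ∀ {p} x y z → p ≢ j → lookup (full x y z) p ≡ lookup (v [ i ]≔ x [ k ]≔ z) p
        without-j {p} x y z h with p Finₚ.≟ k
        ... | yes refl = trans (lookup∘update p (v₂ x y) z) (sym (lookup∘update p (v₁ x) z))
        ... | no p≢k = trans (lookup∘update′ p≢k (v₂ x y) z) (trans (lookup∘update′ h (v₁ x) y) (sym (lookup∘update′ p≢k (v₁ x) z)))

        without-i : ∀ {p} x y z → p ≢ i → lookup (full x y z) p ≡ lookup (v [ j ]≔ y [ k ]≔ z) p
        without-i {p} x y z h with p Finₚ.≟ k
        ... | yes refl = trans (lookup∘update p (v₂ x y) z) (sym (lookup∘update p (v [ j ]≔ y) z))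
        ... | no p≢k with p Finₚ.≟ j
        ...   | yes refl = trans (lookup∘update′ p≢k (v₂ x y) z) (trans (lookup∘update p (v₁ x) y) (sym (trans (lookup∘update′ p≢k (v [ p ]≔ y) z) (lookup∘update p v y))))
        ...   | no p≢j = trans (lookup∘update′ p≢k (v₂ x y) z) (trans (lookup∘update′ p≢j (v₁ x) y) (trans (lookup∘update′ h v x) (sym (trans (lookup∘update′ p≢k (v [ j ]≔ y) z) (lookup∘update′ p≢j v y)))))

        partU partV partW : List Factor → A → A → ℚ
        partU [] x y = 1ℚ
        partU (f@(e , _) ∷ fs) x y = (if k ∈ᵉ e then 1ℚ else val f (v [ i ]≔ x [ j ]≔ y)) * partU fs x y
        partV [] x z = 1ℚ
        partV (f@(e , _) ∷ fs) x z = (if k ∈ᵉ e then (if j ∈ᵉ e then 1ℚ else val f (v [ i ]≔ x [ k ]≔ z)) else 1ℚ) * partV fs x z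
        partW [] y z = 1ℚ
        partW (f@(e , _) ∷ fs) y z = (if k ∈ᵉ e then (if j ∈ᵉ e then val f (v [ j ]≔ y [ k ]≔ z) else 1ℚ) else 1ℚ) * partW fs y z

        -- A factor whose edge misses one of i, j, k depends on at most two of the resampled
        -- coordinates. It is assigned to the pair without k, failing that to the pair without j,
        -- and otherwise to the pair without i.
        factorise : ∀ fs → allApart (i , j , k) fs ≡ true → ∀ x y z → product fs (full x y z) ≡ partU fs x y * partV fs x z * partW fs y z
        factorise [] _ x y z = l 1ℚ
          where
          l : ∀ a → 1ℚ ≡ 1ℚ * 1ℚ * 1ℚ
          l = solve 1 (λ a → con 1ℚ := con 1ℚ :* (con 1ℚ) :* (con 1ℚ)) refl
        factorise (f@(e , h) ∷ fs) ap x y z = trans (cong (val f (full x y z) *_) (factorise fs (proj₂ (∧-true {apart (i , j , k) e} ap)) x y z)) (cases (k ∈ᵉ e) (j ∈ᵉ e) refl refl)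
          where
          U = partU fs x y
          V = partV fs x z
          W = partW fs y z
          a₁ : ∀ f u v w → f * (u * v * w) ≡ (f * u) * (1ℚ * v) * (1ℚ * w)
          a₁ = solve 4 (λ f u v w → f :* (u :* v :* w) := (f :* u) :* ((con 1ℚ) :* v) :* ((con 1ℚ) :* w)) refl
          a₂ : ∀ f u v w → f * (u * v * w) ≡ (1ℚ * u) * (f * v) * (1ℚ * w)
          a₂ = solve 4 (λ f u v w → f :* (u :* v :* w) := ((con 1ℚ) :* u) :* (f :* v) :* ((con 1ℚ) :* w)) refl
          a₃ : ∀ f u v w → f * (u * v * w) ≡ (1ℚ * u) * (1ℚ * v) * (f * w)
          a₃ = solve 4 (λ f u v w → f :* (u :* v :* w) := ((con 1ℚ) :* u) :* ((con 1ℚ) :* v) :* (f :* w)) refl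
          cases : ∀ b c → (k ∈ᵉ e) ≡ b → (j ∈ᵉ e) ≡ c → val f (full x y z) * (U * V * W) ≡
            ((if b then 1ℚ else val f (v [ i ]≔ x [ j ]≔ y)) * U) * ((if b then (if c then 1ℚ else val f (v [ i ]≔ x [ k ]≔ z)) else 1ℚ) * V) * ((if b then (if c then val f (v [ j ]≔ y [ k ]≔ z) else 1ℚ) else 1ℚ) * W)
          cases false c hk hj = trans (cong (_* (U * V * W)) (val-agree e h (full x y z) (v [ i ]≔ x [ j ]≔ y) λ p hp → without-k x y z (∈-apart {e = e} hp hk))) (a₁ _ U V W)
          cases true false hk hj = trans (cong (_* (U * V * W)) (val-agree e h (full x y z) (v [ i ]≔ x [ k ]≔ z) λ p hp → without-j x y z (∈-apart {e = e} hp hj))) (a₂ _ U V W)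
          cases true true hk hj = trans (cong (_* (U * V * W)) (val-agree e h (full x y z) (v [ j ]≔ y [ k ]≔ z) λ p hp → without-i x y z (∈-apart {e = e} hp hi))) (a₃ _ U V W)
            where
            hi : (i ∈ᵉ e) ≡ false
            hi = go (i ∈ᵉ e) refl
              where
              go : ∀ b → (i ∈ᵉ e) ≡ b → b ≡ false
              go false _ = refl
              go true h with () ← trans (sym (cong not (trans (cong₂ (λ a b → a ∧ (b ∧ (k ∈ᵉ e))) h hj) hk))) (proj₁ (∧-true {apart (i , j , k) e} ap))

        if-Unit : ∀ b {x y} → Unit x → Unit y → Unit (if b then x else y)
        if-Unit true p q = p
        if-Unit false p q = q

        1-Unit : Unit 1ℚ
        1-Unit = 0≤1 , ≤-refl

        partU-Unit : ∀ {fs} → All UnitF fs → ∀ x y → Unit (partU fs x y)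
        partU-Unit [] x y = 1-Unit
        partU-Unit {(e , h) ∷ fs} (u ∷ us) x y = Unit* (if-Unit (k ∈ᵉ e) 1-Unit (u _ _ _)) (partU-Unit us x y)

        partV-Unit : ∀ {fs} → All UnitF fs → ∀ x y → Unit (partV fs x y)
        partV-Unit [] x y = 1-Unit
        partV-Unit {(e , h) ∷ fs} (u ∷ us) x y = Unit* (if-Unit (k ∈ᵉ e) (if-Unit (j ∈ᵉ e) 1-Unit (u _ _ _)) 1-Unit) (partV-Unit us x y)

        partW-Unit : ∀ {fs} → All UnitF fs → ∀ x y → Unit (partW fs x y)
        partW-Unit [] x y = 1-Unit
        partW-Unit {(e , h) ∷ fs} (u ∷ us) x y = Unit* (if-Unit (k ∈ᵉ e) (if-Unit (j ∈ᵉ e) (u _ _ _) 1-Unit) 1-Unit) (partW-Unit us x y)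

      module Replace (w g : A → A → A → ℚ) (w-Unit : ∀ x y z → Unit (w x y z)) (g-Unit : ∀ x y z → Unit (g x y z)) (ε : ℚ) (0≤ε : 0ℚ ≤ ε)
        (bounded : ∀ U V W → (∀ x y → Unit (U x y)) → (∀ x y → Unit (V x y)) → (∀ x y → Unit (W x y)) → Extreme.Bounded (λ x y z → w x y z - g x y z) ε U V W) where

        tag : (A → A → A → ℚ) → List Edge → List Factor
        tag h = List.map (λ e → e , h)

        -- With all other vertices fixed, resampling the three vertices of the edge turns the
        -- remaining product into a test for triangle regularity.
        one-edge : ∀ e → proper e ≡ true → ∀ fs → All UnitF fs → allApart e fs ≡ true →
          ∫ᵛ r (λ v → val (e , λ x y z → w x y z - g x y z) v * product fs v) ≤ ε
        one-edge (i , j , k) pr fs us ap = ≤-trans (≤-reflexive (resample₃ i j k _)) (T.∫-≤ r ε λ v → ≤-trans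
          (≤-reflexive (∫-cong λ x → ∫-cong λ y → ∫-cong λ z → cong₂ _*_
            (cong₃ h (at-i i j k i≢j i≢k j≢k v x y z) (at-j i j k i≢j i≢k j≢k v x y z) (at-k i j k i≢j i≢k j≢k v x y z))
            (factorise i j k i≢j i≢k j≢k v fs ap x y z)))
          (bounded _ _ _ (partU-Unit i j k i≢j i≢k j≢k v us) (partV-Unit i j k i≢j i≢k j≢k v us) (partW-Unit i j k i≢j i≢k j≢k v us)))
          where
          h : A → A → A → ℚ
          h x y z = w x y z - g x y z
          p₁ = ∧-true {not (i ≡ᶠ j)} pr
          p₂ = ∧-true {not (i ≡ᶠ k)} (proj₂ p₁)
          i≢j = ≡ᶠ-apart (not-true (proj₁ p₁))
          i≢k = ≡ᶠ-apart (not-true (proj₁ p₂))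
          j≢k = ≡ᶠ-apart (not-true (proj₂ p₂))

        ready : List Edge → List Edge → Bool
        ready [] fs = true
        ready (e ∷ es) fs = proper e ∧ (allApart e (tag w es List.++ tag g fs) ∧ ready es (e ∷ fs))

        product-++ : ∀ fs gs v → product (fs List.++ gs) v ≡ product fs v * product gs v
        product-++ [] gs v = sym (*-identityˡ _)
        product-++ (f ∷ fs) gs v = trans (cong (val f v *_) (product-++ fs gs v)) (sym (*-assoc _ _ _))

        tagged : ∀ {h} → (∀ x y z → Unit (h x y z)) → ∀ es → All UnitF (tag h es)
        tagged hu [] = []
        tagged hu (e ∷ es) = hu ∷ tagged hu es

        -- Telescoping: factors already exchanged are tagged with `g`, the others with `w`, and
        -- every exchange costs at most `ε`.
        replace : ∀ es fs → ready es fs ≡ true →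
          ∫ᵛ r (λ v → product (tag w es) v * product (tag g fs) v) ≤ ∫ᵛ r (λ v → product (tag g (es List.ʳ++ fs)) v) + nat (List.length es) * ε
        replace [] fs _ = ≤-reflexive (trans (T.∫-cong r λ v → *-identityˡ _) (trans (sym (+-identityʳ _)) (cong (∫ᵛ r (λ v → product (tag g fs) v) +_) (sym (trans (cong (_* ε) nat-0) (zeroˡ ε))))))
        replace (e ∷ es) fs rd = ≤-trans (≤-reflexive (trans (T.∫-cong r λ v → l (val (e , w) v) (val (e , g) v) (product (tag w es) v) (product (tag g fs) v)) (T.∫-+ r _ _)))
          (≤-trans (+-mono-≤ (≤-trans (≤-reflexive (T.∫-cong r λ v → cong (val (e , λ x y z → w x y z - g x y z) v *_) (sym (product-++ (tag w es) (tag g fs) v))))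
              (one-edge e (proj₁ rd₁) (tag w es List.++ tag g fs) (++⁺ (tagged w-Unit es) (tagged g-Unit fs)) (proj₁ rd₂)))
            (replace es (e ∷ fs) (proj₂ rd₂)))
          (≤-reflexive (trans (l' ε _ (nat (List.length es))) (cong (λ m → ∫ᵛ r (λ v → product (tag g ((e ∷ es) List.ʳ++ fs)) v) + m * ε) (sym (nat-suc (List.length es)))))))
          where
          rd₁ = ∧-true {proper e} rd
          rd₂ = ∧-true {allApart e (tag w es List.++ tag g fs)} (proj₂ rd₁)
          l : ∀ a b p q → a * p * q ≡ (a - b) * (p * q) + p * (b * q)
          l = solve 4 (λ a b p q → a :* p :* q := (a :- b) :* (p :* q) :+ p :* (b :* q)) refl
          l' : ∀ e a n → e + (a + n * e) ≡ a + (1ℚ + n) * e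
          l' = solve 3 (λ e a n → e :+ (a :+ n :* e) := a :+ ((con 1ℚ) :+ n) :* e) refl

-- Independence of the colours of distinct pairs.

module ColourCount where
  open import Data.Vec using (Vec; []; _∷_; lookup; _[_]≔_; map)
  open import Data.Vec.Properties using (lookup∘update; lookup∘update′; map-[]≔; lookup-map)
  open import Data.Bool using (if_then_else_)
  open Field
  open Base
  open Count
  open Spaces
  open Counting

  ∑ᵛ : ∀ {k} s → (Vec (Fin k) s → ℚ) → ℚ
  ∑ᵛ zero H = H []
  ∑ᵛ (suc s) H = ∑ λ l → ∑ᵛ s λ ls → H (l ∷ ls)

  ∑ᵛ-linear : ∀ {k} s → Linear (∑ᵛ {k} s)
  ∑ᵛ-linear zero = record { J-cong = λ h → h [] ; J-+ = λ _ _ → refl ; J-*ˡ = λ _ _ → refl }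
  ∑ᵛ-linear (suc s) = record
    { J-cong = λ h → ∑-cong λ l → J-cong (∑ᵛ-linear s) λ ls → h (l ∷ ls)
    ; J-+ = λ f g → trans (∑-cong λ l → J-+ (∑ᵛ-linear s) _ _) (∑-+ _ _)
    ; J-*ˡ = λ c f → trans (∑-cong λ l → J-*ˡ (∑ᵛ-linear s) c _) (∑-*ˡ c _) }

  ∑ᵛ-mono : ∀ {k} s {f g : Vec (Fin k) s → ℚ} → (∀ ls → f ls ≤ g ls) → ∑ᵛ s f ≤ ∑ᵛ s g
  ∑ᵛ-mono zero h = h []
  ∑ᵛ-mono (suc s) h = ∑-mono λ l → ∑ᵛ-mono s λ ls → h (l ∷ ls)

  𝔼ᵛ : ∀ {k s} → Vec (Fin k → ℚ) s → (Vec (Fin k) s → ℚ) → ℚ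
  𝔼ᵛ [] G = G []
  𝔼ᵛ (w ∷ ws) G = 𝔼 w λ l → 𝔼ᵛ ws λ ls → G (l ∷ ls)

  weight : ∀ {k s} → Vec (Fin k → ℚ) s → Vec (Fin k) s → ℚ
  weight [] [] = 1ℚ
  weight (w ∷ ws) (l ∷ ls) = w l * weight ws ls

  𝔼ᵛ-∑ᵛ : ∀ {k s} (ws : Vec (Fin k → ℚ) s) (G : Vec (Fin k) s → ℚ) → 𝔼ᵛ ws G ≡ ∑ᵛ s λ ls → weight ws ls * G ls
  𝔼ᵛ-∑ᵛ [] G = sym (*-identityˡ _)
  𝔼ᵛ-∑ᵛ {s = suc s} (w ∷ ws) G = ∑-cong λ l → trans (cong (w l *_) (𝔼ᵛ-∑ᵛ ws _)) (trans (sym (J-*ˡ (∑ᵛ-linear s) (w l) _)) (J-cong (∑ᵛ-linear s) λ ls → sym (*-assoc _ _ _)))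

  -- Evaluation at the actual colours is an expectation for point masses, so it can be expanded over
  -- colour vectors in the same way as the expectation for densities.
  𝔼ᵛ-point : ∀ {k s} (λs : Vec (Fin k) s) (G : Vec (Fin k) s → ℚ) → 𝔼ᵛ (map (λ l l' → ⟦ l ≡ᶠ l' ⟧) λs) G ≡ G λs
  𝔼ᵛ-point [] G = refl
  𝔼ᵛ-point (l ∷ ls) G = trans (∑-≡ᶠ l _) (𝔼ᵛ-point ls λ ls → G (l ∷ ls))

  module Pairs {A : Set} (μ : Space A) {k M : ℕ} (P : A → A → Fin k) (Q : A → Fin M) (d : Fin M → Fin M → Fin k → ℚ)
    (d-Unit : ∀ a b l → Unit (d a b l)) (ε : ℚ)
    (regular : ∀ (u v : A → Bool) (τ : Fin M → Fin M → ℚ) → (∀ a b → τ a b * τ a b ≤ 1ℚ) → ∀ l →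
      Space.∫ μ (λ x → Space.∫ μ λ y → (⟦ P x y ≡ᶠ l ⟧ - d (Q x) (Q y) l) * (⟦ u x ⟧ * ⟦ v y ⟧ * τ (Q x) (Q y))) ≤ ε) (r : ℕ) where
    open Space μ
    open Tuples μ

    Pair : Set
    Pair = Fin r × Fin r

    test : Pair → Fin k → Vec A r → Bool
    test (a , b) l v = P (lookup v a) (lookup v b) ≡ᶠ l

    dens : Pair → Vec (Fin M) r → Fin k → ℚ
    dens (a , b) c = d (lookup c a) (lookup c b)

    infix 5 _∈ᵖ_
    _∈ᵖ_ : Fin r → Pair → Bool
    p ∈ᵖ (a , b) = (p ≡ᶠ a) ∨ (p ≡ᶠ b)

    tests : ∀ {s} → Vec Pair s → Vec (Fin k) s → Vec A r → Bool
    tests [] [] v = true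
    tests (p ∷ ps) (l ∷ ls) v = test p l v ∧ tests ps ls v

    denss : ∀ {s} → Vec Pair s → Vec (Fin k) s → Vec (Fin M) r → ℚ
    denss [] [] c = 1ℚ
    denss (p ∷ ps) (l ∷ ls) c = dens p c l * denss ps ls c

    separate : Pair → ∀ {s} → Vec Pair s → Bool
    separate (i , j) [] = true
    separate (i , j) (q ∷ ps) = not ((i ∈ᵖ q) ∧ (j ∈ᵖ q)) ∧ separate (i , j) ps

    distinct : ∀ {s} → Vec Pair s → Bool
    distinct [] = true
    distinct ((i , j) ∷ ps) = not (i ≡ᶠ j) ∧ (separate (i , j) ps ∧ distinct ps)

    ∈ᵖ-false : ∀ {p a b} → (p ∈ᵖ (a , b)) ≡ false → a ≢ p × b ≢ p
    ∈ᵖ-false h = let h₁ , h₂ = ∨-false h in (λ e → ≡ᶠ-apart h₁ (sym e)) , (λ e → ≡ᶠ-apart h₂ (sym e))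

    module _ (i j : Fin r) (i≢j : i ≢ j) (v : Vec A r) where

      side-i side-j : ∀ {s} → Vec Pair s → Vec (Fin k) s → A → Bool
      side-i [] [] x = true
      side-i (q ∷ ps) (l ∷ ls) x = (if j ∈ᵖ q then true else test q l (v [ i ]≔ x)) ∧ side-i ps ls x
      side-j [] [] y = true
      side-j (q ∷ ps) (l ∷ ls) y = (if j ∈ᵖ q then test q l (v [ j ]≔ y) else true) ∧ side-j ps ls y

      at-i : ∀ x y → lookup (v [ i ]≔ x [ j ]≔ y) i ≡ x
      at-i x y = trans (lookup∘update′ i≢j (v [ i ]≔ x) y) (lookup∘update i v x)

      at-j : ∀ x y → lookup (v [ i ]≔ x [ j ]≔ y) j ≡ y
      at-j x y = lookup∘update j (v [ i ]≔ x) y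

      without-j : ∀ {p} x y → p ≢ j → lookup (v [ i ]≔ x [ j ]≔ y) p ≡ lookup (v [ i ]≔ x) p
      without-j x y h = lookup∘update′ h (v [ i ]≔ x) y

      without-i : ∀ {p} x y → p ≢ i → lookup (v [ i ]≔ x [ j ]≔ y) p ≡ lookup (v [ j ]≔ y) p
      without-i {p} x y h with p Finₚ.≟ j
      ... | yes refl = trans (lookup∘update p (v [ i ]≔ x) y) (sym (lookup∘update p v y))
      ... | no p≢j = trans (lookup∘update′ p≢j (v [ i ]≔ x) y) (trans (lookup∘update′ h v x) (sym (lookup∘update′ p≢j v y)))

      test-agree : ∀ a b l {w w'} → lookup w a ≡ lookup w' a → lookup w b ≡ lookup w' b → test (a , b) l w ≡ test (a , b) l w'
      test-agree a b l e e' = cong₂ (λ x y → P x y ≡ᶠ l) e e'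

      tests-split : ∀ {s} (ps : Vec Pair s) ls → separate (i , j) ps ≡ true → ∀ x y →
        ⟦ tests ps ls (v [ i ]≔ x [ j ]≔ y) ⟧ ≡ ⟦ side-i ps ls x ⟧ * ⟦ side-j ps ls y ⟧
      tests-split [] [] _ x y = sym (*-identityˡ 1ℚ)
      tests-split (q@(a , b) ∷ ps) (l ∷ ls) sep x y = trans (⟦∧⟧ (test q l w) (tests ps ls w)) (trans (cong (⟦ test q l w ⟧ *_) (tests-split ps ls (proj₂ sep₁) x y))
        (trans (cases (j ∈ᵖ q) refl) (sym (cong₂ _*_ (⟦∧⟧ (if j ∈ᵖ q then true else test q l (v [ i ]≔ x)) (side-i ps ls x)) (⟦∧⟧ (if j ∈ᵖ q then test q l (v [ j ]≔ y) else true) (side-j ps ls y))))))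
        where
        w = v [ i ]≔ x [ j ]≔ y
        X = ⟦ side-i ps ls x ⟧
        Y = ⟦ side-j ps ls y ⟧
        sep₁ = ∧-true {not ((i ∈ᵖ q) ∧ (j ∈ᵖ q))} sep
        l₁ : ∀ t a b → t * (a * b) ≡ (1ℚ * a) * (t * b)
        l₁ = solve 3 (λ t a b → t :* (a :* b) := ((con 1ℚ) :* a) :* (t :* b)) refl
        l₂ : ∀ t a b → t * (a * b) ≡ (t * a) * (1ℚ * b)
        l₂ = solve 3 (λ t a b → t :* (a :* b) := (t :* a) :* ((con 1ℚ) :* b)) refl
        cases : ∀ c → (j ∈ᵖ q) ≡ c → ⟦ test q l w ⟧ * (X * Y) ≡
          (⟦ if c then true else test q l (v [ i ]≔ x) ⟧ * X) * (⟦ if c then test q l (v [ j ]≔ y) else true ⟧ * Y)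
        cases true e = trans (cong (λ t → ⟦ t ⟧ * (X * Y)) (test-agree a b l {w} {v [ j ]≔ y} (without-i x y (proj₁ ni)) (without-i x y (proj₂ ni)))) (l₁ _ X Y)
          where
          hi : (i ∈ᵖ q) ≡ false
          hi = go (i ∈ᵖ q) refl
            where
            go : ∀ c → (i ∈ᵖ q) ≡ c → c ≡ false
            go false _ = refl
            go true h with () ← trans (sym (cong not (trans (cong (_∧ (j ∈ᵖ q)) h) e))) (proj₁ sep₁)
          ni = ∈ᵖ-false {i} {a} {b} hi
        cases false e = trans (cong (λ t → ⟦ t ⟧ * (X * Y)) (test-agree a b l {w} {v [ i ]≔ x} (without-j x y (proj₁ nj)) (without-j x y (proj₂ nj)))) (l₂ _ X Y)
          where
          nj = ∈ᵖ-false {j} {a} {b} e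

    -- No other pair contains both i and j. With the remaining vertices fixed, the other colour
    -- tests therefore split into a function of vertex i and one of vertex j, as colour regularity
    -- requires.
    one-pair : ∀ i j → i ≢ j → ∀ l {s} (ps : Vec Pair s) ls → separate (i , j) ps ≡ true → (D : Vec (Fin M) r → ℚ) → (∀ c → D c * D c ≤ 1ℚ) →
      ∫ᵛ r (λ v → (⟦ test (i , j) l v ⟧ - dens (i , j) (map Q v) l) * (⟦ tests ps ls v ⟧ * D (map Q v))) ≤ ε
    one-pair i j i≢j l ps ls sep D hD = ≤-trans (≤-reflexive (resample₂ i j _)) (T.∫-≤ r ε λ v → ≤-trans
      (≤-reflexive (∫-cong λ x → ∫-cong λ y → cong₂ _*_
        (cong₂ _-_ (cong₂ (λ a b → ⟦ P a b ≡ᶠ l ⟧) (at-i i j i≢j v x y) (at-j i j i≢j v x y))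
                   (cong₂ (λ a b → d a b l) (trans (lookup-map i Q (v [ i ]≔ x [ j ]≔ y)) (cong Q (at-i i j i≢j v x y))) (trans (lookup-map j Q (v [ i ]≔ x [ j ]≔ y)) (cong Q (at-j i j i≢j v x y)))))
        (cong₂ _*_ (tests-split i j i≢j v ps ls sep x y) (cong D (trans (map-[]≔ Q (v [ i ]≔ x) j) (cong (_[ j ]≔ Q y) (map-[]≔ Q v i)))))))
      (regular (side-i i j i≢j v ps ls) (side-j i j i≢j v ps ls) (λ a b → D (map Q v [ i ]≔ a [ j ]≔ b)) (λ a b → hD _) l))

    replace-colours : ∀ {s} (ps : Vec Pair s) ls → distinct ps ≡ true → (D : Vec (Fin M) r → ℚ) → (∀ c → D c * D c ≤ 1ℚ) →
      ∫ᵛ r (λ v → ⟦ tests ps ls v ⟧ * D (map Q v)) ≤ ∫ᵛ r (λ v → denss ps ls (map Q v) * D (map Q v)) + nat s * ε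
    replace-colours [] [] _ D hD = ≤-reflexive (sym (trans (cong (∫ᵛ r (λ v → 1ℚ * D (map Q v)) +_) (trans (cong (_* ε) nat-0) (zeroˡ ε))) (+-identityʳ _)))
    replace-colours {suc s} ((i , j) ∷ ps) (l ∷ ls) dis D hD = ≤-trans (≤-reflexive (trans (T.∫-cong r λ v → trans (cong (_* D (map Q v)) (⟦∧⟧ (test (i , j) l v) (tests ps ls v)))
          (l₁ ⟦ test (i , j) l v ⟧ (dens (i , j) (map Q v) l) ⟦ tests ps ls v ⟧ (D (map Q v)))) (T.∫-+ r _ _)))
      (≤-trans (+-mono-≤ (one-pair i j (≡ᶠ-apart (not-true (proj₁ d₁))) l ps ls (proj₁ d₂) D hD) (replace-colours ps ls (proj₂ d₂) D' hD'))
        (≤-reflexive (trans (l₂ ε _ (nat s)) (cong₂ _+_ (T.∫-cong r λ v → l₃ _ _ _) (cong (_* ε) (sym (nat-suc s)))))))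
      where
      d₁ = ∧-true {not (i ≡ᶠ j)} dis
      d₂ = ∧-true {separate (i , j) ps} (proj₂ d₁)
      -- The density that replaces a colour indicator depends on the cells only, so it joins the
      -- cell function.
      D' : Vec (Fin M) r → ℚ
      D' c = dens (i , j) c l * D c
      hD' : ∀ c → D' c * D' c ≤ 1ℚ
      hD' c = ≤-trans (≤-reflexive (l₄ (dens (i , j) c l) (D c))) (≤-trans (*-mono (0≤sq _) (0≤sq _) (proj₂ (Unit* (d-Unit _ _ l) (d-Unit _ _ l))) (hD c)) (≤-reflexive (*-identityˡ 1ℚ)))
        where
        l₄ : ∀ a b → a * b * (a * b) ≡ a * a * (b * b)
        l₄ = solve 2 (λ a b → a :* b :* (a :* b) := a :* a :* (b :* b)) refl
      l₁ : ∀ t e a D → t * a * D ≡ (t - e) * (a * D) + a * (e * D)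
      l₁ = solve 4 (λ t e a D → t :* a :* D := (t :- e) :* (a :* D) :+ a :* (e :* D)) refl
      l₂ : ∀ e a n → e + (a + n * e) ≡ a + (1ℚ + n) * e
      l₂ = solve 3 (λ e a n → e :+ (a :+ n :* e) := a :+ ((con 1ℚ) :+ n) :* e) refl
      l₃ : ∀ a e D → a * (e * D) ≡ e * a * D
      l₃ = solve 3 (λ a e D → a :* (e :* D) := e :* a :* D) refl

    colours : ∀ {s} → Vec Pair s → Vec A r → Vec (Fin k) s
    colours ps v = map (λ { (a , b) → P (lookup v a) (lookup v b) }) ps

    densities : ∀ {s} → Vec Pair s → Vec (Fin M) r → Vec (Fin k → ℚ) s
    densities ps c = map (λ p → dens p c) ps

    private
      as-tests : ∀ {s} (ps : Vec Pair s) v ls → weight (map (λ l l' → ⟦ l ≡ᶠ l' ⟧) (colours ps v)) ls ≡ ⟦ tests ps ls v ⟧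
      as-tests [] v [] = refl
      as-tests (p ∷ ps) v (l ∷ ls) = trans (cong (⟦ test p l v ⟧ *_) (as-tests ps v ls)) (sym (⟦∧⟧ (test p l v) (tests ps ls v)))

      as-dens : ∀ {s} (ps : Vec Pair s) c ls → weight (densities ps c) ls ≡ denss ps ls c
      as-dens [] c [] = refl
      as-dens (p ∷ ps) c (l ∷ ls) = cong (dens p c l *_) (as-dens ps c ls)

    -- A crude sum over all vectors of `s` colours, each with `s` replacements.
    error : ℕ → ℚ
    error s = ∑ᵛ {k} s λ _ → nat s * ε

    -- The colours of distinct pairs behave as if they were chosen independently.
    independent : ∀ {s} (ps : Vec Pair s) → distinct ps ≡ true → (G : Vec (Fin k) s → Vec (Fin M) r → ℚ) → (∀ ls c → G ls c * G ls c ≤ 1ℚ) →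
      ∫ᵛ r (λ v → G (colours ps v) (map Q v)) ≤ ∫ᵛ r (λ v → 𝔼ᵛ (densities ps (map Q v)) λ ls → G ls (map Q v)) + error s
    independent {s} ps dis G hG = ≤-trans (≤-reflexive (trans (T.∫-cong r λ v → trans (sym (𝔼ᵛ-point (colours ps v) λ ls → G ls (map Q v))) (trans (𝔼ᵛ-∑ᵛ (map (λ l l' → ⟦ l ≡ᶠ l' ⟧) (colours ps v)) λ ls → G ls (map Q v)) (J-cong (∑ᵛ-linear s) λ ls → cong (_* G ls (map Q v)) (as-tests ps v ls))))
        (T.∫-comm r (∑ᵛ s) (∑ᵛ-linear s) _)))
      (≤-trans (∑ᵛ-mono s λ ls → replace-colours ps ls dis (G ls) (hG ls)) (≤-reflexive (trans (J-+ (∑ᵛ-linear s) _ _) (cong (_+ error s)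
        (trans (sym (T.∫-comm r (∑ᵛ s) (∑ᵛ-linear s) _)) (T.∫-cong r λ v → sym (trans (𝔼ᵛ-∑ᵛ (densities ps (map Q v)) λ ls → G ls (map Q v)) (J-cong (∑ᵛ-linear s) λ ls → cong (_* G ls (map Q v)) (as-dens ps (map Q v) ls)))))))))

-- The pattern density as a nested expectation.

module Nest where
  open import Data.Fin using (#_)
  open import Data.Vec using (Vec; []; _∷_; lookup; map)
  open import Data.List using (List; []; _∷_)
  open Field
  open Base
  open Structure
  open ColourCount using (𝔼ᵛ)

  𝔼₂ : ∀ {a b} → (Fin a → ℚ) → (Fin b → ℚ) → (Fin a → Fin b → ℚ) → ℚ
  𝔼₂ w w' f = 𝔼 w λ p → 𝔼 w' λ q → f p q

  𝔼₃ : ∀ {a b c} → (Fin a → ℚ) → (Fin b → ℚ) → (Fin c → ℚ) → (Fin a → Fin b → Fin c → ℚ) → ℚ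
  𝔼₃ w w' w'' f = 𝔼 w λ p → 𝔼 w' λ q → 𝔼 w'' λ r → f p q r

  module _ {a b : ℕ} {w : Fin a → ℚ} {w' : Fin b → ℚ} where
    cong₂ᴱ : ∀ {f g} → (∀ p q → f p q ≡ g p q) → 𝔼₂ w w' f ≡ 𝔼₂ w w' g
    cong₂ᴱ h = 𝔼-cong λ p → 𝔼-cong λ q → h p q

    pull₂ : ∀ c (A : Fin a → Fin b → ℚ) e → 𝔼₂ w w' (λ p q → c * A p q * e) ≡ c * (𝔼₂ w w' A * e)
    pull₂ c A e = trans (cong₂ᴱ λ p q → *-assoc c (A p q) e) (trans (𝔼-cong λ p → 𝔼-*ˡ c _) (trans (𝔼-*ˡ c _) (cong (c *_) (trans (𝔼-cong λ p → 𝔼-*ʳ e _) (𝔼-*ʳ e _)))))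

  module _ {a b c' : ℕ} {w : Fin a → ℚ} {w' : Fin b → ℚ} {w'' : Fin c' → ℚ} where
    cong₃ᴱ : ∀ {f g} → (∀ p q r → f p q r ≡ g p q r) → 𝔼₃ w w' w'' f ≡ 𝔼₃ w w' w'' g
    cong₃ᴱ h = 𝔼-cong λ p → 𝔼-cong λ q → 𝔼-cong λ r → h p q r

    pull₃ : ∀ c (A : Fin a → ℚ) (B : Fin a → Fin b → Fin c' → ℚ) e → 𝔼₃ w w' w'' (λ r p q → c * (A r * B r p q) * e) ≡ c * (𝔼 w (λ r → A r * 𝔼₂ w' w'' (B r)) * e)
    pull₃ c A B e = trans (𝔼-cong λ r → trans (cong₂ᴱ' r) (pull r)) (trans (𝔼-*ˡ c _) (cong (c *_) (𝔼-*ʳ e _)))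
      where
      l : ∀ c a b e → c * (a * b) * e ≡ (c * (a * e)) * b
      l = solve 4 (λ c a b e → c :* (a :* b) :* e := (c :* (a :* e)) :* b) refl
      l' : ∀ c a b e → (c * (a * e)) * b ≡ c * (a * b * e)
      l' = solve 4 (λ c a b e → (c :* (a :* e)) :* b := c :* (a :* b :* e)) refl
      cong₂ᴱ' : ∀ r → 𝔼 w' (λ p → 𝔼 w'' λ q → c * (A r * B r p q) * e) ≡ 𝔼 w' (λ p → 𝔼 w'' λ q → (c * (A r * e)) * B r p q)
      cong₂ᴱ' r = 𝔼-cong λ p → 𝔼-cong λ q → l c (A r) (B r p q) e
      pull : ∀ r → 𝔼 w' (λ p → 𝔼 w'' λ q → (c * (A r * e)) * B r p q) ≡ c * (A r * 𝔼 w' (λ p → 𝔼 w'' λ q → B r p q) * e)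
      pull r = trans (𝔼-cong λ p → 𝔼-*ˡ (c * (A r * e)) _) (trans (𝔼-*ˡ (c * (A r * e)) _) (l' c (A r) _ e))

    out₃ : ∀ c (A : Fin a → Fin b → Fin c' → ℚ) → 𝔼₃ w w' w'' (λ p q r → c * A p q r) ≡ c * 𝔼₃ w w' w'' A
    out₃ c A = trans (𝔼-cong λ p → trans (𝔼-cong λ q → 𝔼-*ˡ c _) (𝔼-*ˡ c _)) (𝔼-*ˡ c _)

  -- an edge of the pattern: its three positions and the places of the colours of its three pairs
  PatternEdge : Set
  PatternEdge = (Fin 7 × Fin 7 × Fin 7) × (Fin 21 × Fin 21 × Fin 21)

  -- positions 0,...,6 are a,y,z,b,x,c,d
  pattern-pairs : Vec (Fin 7 × Fin 7) 21
  pattern-pairs = (# 0 , # 6) ∷ (# 0 , # 5) ∷ (# 0 , # 3) ∷ (# 0 , # 4) ∷ (# 3 , # 4) ∷ (# 0 , # 1) ∷ (# 1 , # 5) ∷ (# 0 , # 2) ∷ (# 2 , # 6) ∷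
    (# 3 , # 5) ∷ (# 2 , # 3) ∷ (# 2 , # 5) ∷ (# 3 , # 6) ∷ (# 1 , # 3) ∷ (# 1 , # 6) ∷ (# 5 , # 6) ∷ (# 4 , # 5) ∷ (# 4 , # 6) ∷ (# 1 , # 2) ∷ (# 1 , # 4) ∷ (# 2 , # 4) ∷ []

  pattern-edges : List PatternEdge
  pattern-edges =
    ((# 0 , # 3 , # 4) , (# 2 , # 3 , # 4)) ∷ ((# 0 , # 1 , # 5) , (# 5 , # 1 , # 6)) ∷ ((# 0 , # 2 , # 6) , (# 7 , # 0 , # 8)) ∷
    ((# 0 , # 3 , # 5) , (# 2 , # 1 , # 9)) ∷ ((# 2 , # 3 , # 5) , (# 10 , # 11 , # 9)) ∷
    ((# 0 , # 3 , # 6) , (# 2 , # 0 , # 12)) ∷ ((# 1 , # 3 , # 6) , (# 13 , # 14 , # 12)) ∷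
    ((# 0 , # 5 , # 6) , (# 1 , # 0 , # 15)) ∷ ((# 4 , # 5 , # 6) , (# 16 , # 17 , # 15)) ∷
    ((# 1 , # 2 , # 4) , (# 18 , # 19 , # 20)) ∷ []

  module _ {I : Set} {k : ℕ} (S : Str I k) where
    open Str S
    open Ops S

    edge-weight : Vec I 7 → Vec (Fin k) 21 → PatternEdge → ℚ
    edge-weight v ls ((i , j , l) , (α , β , γ)) = W (lookup v i) (lookup v j) (lookup v l) (lookup ls α) (lookup ls β) (lookup ls γ)

    edge-product : List PatternEdge → Vec I 7 → Vec (Fin k) 21 → ℚ
    edge-product [] v ls = 1ℚ
    edge-product (e ∷ es) v ls = edge-weight v ls e * edge-product es v ls

    pair-distributions : Vec I 7 → Vec (Fin k → ℚ) 21
    pair-distributions v = map (λ { (i , j) → d (lookup v i) (lookup v j) }) pattern-pairs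

    -- `pattern-pairs` starts with ad, ac, ab; the other pairs follow in consecutive groups, one
    -- group for each factor of `density`. Constants can therefore be pulled out from the innermost
    -- group outwards.
    nested-density : ∀ a y z i x l m → 𝔼ᵛ (pair-distributions (a ∷ y ∷ z ∷ i ∷ x ∷ l ∷ m ∷ [])) (edge-product pattern-edges (a ∷ y ∷ z ∷ i ∷ x ∷ l ∷ m ∷ [])) ≡ F7-density a y z i x l m
    nested-density a y z i x l m = 𝔼-cong λ c₀ → 𝔼-cong λ c₁ → 𝔼-cong λ c₂ → inner c₀ c₁ c₂
      where
      inner : ∀ c₀ c₁ c₂ → 𝔼₂ (d a x) (d i x) (λ c₃ c₄ → 𝔼₂ (d a y) (d y l) λ c₅ c₆ → 𝔼₂ (d a z) (d z m) λ c₇ c₈ →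
          𝔼₃ (d i l) (d z i) (d z l) λ c₉ c₁₀ c₁₁ → 𝔼₃ (d i m) (d y i) (d y m) λ c₁₂ c₁₃ c₁₄ → 𝔼₃ (d l m) (d x l) (d x m) λ c₁₅ c₁₆ c₁₇ →
          𝔼₃ (d y z) (d y x) (d z x) λ c₁₈ c₁₉ c₂₀ →
            W a i x c₂ c₃ c₄ * (W a y l c₅ c₁ c₆ * (W a z m c₇ c₀ c₈ * (W a i l c₂ c₁ c₉ * (W z i l c₁₀ c₁₁ c₉ * (W a i m c₂ c₀ c₁₂ * (W y i m c₁₃ c₁₄ c₁₂ *
              (W a l m c₁ c₀ c₁₅ * (W x l m c₁₆ c₁₇ c₁₅ * (W y z x c₁₈ c₁₉ c₂₀ * 1ℚ))))))))))
        ≡ density a y z i x l m c₀ c₁ c₂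
      inner c₀ c₁ c₂ = trans (cong₂ᴱ λ c₃ c₄ → trans (cong₂ᴱ λ c₅ c₆ → trans (cong₂ᴱ λ c₇ c₈ →
          trans (cong₃ᴱ λ c₉ c₁₀ c₁₁ → trans (cong₃ᴱ λ c₁₂ c₁₃ c₁₄ → trans (cong₃ᴱ λ c₁₅ c₁₆ c₁₇ → trans (cong₃ᴱ λ c₁₈ c₁₉ c₂₀ →
            assoc (W a i x c₂ c₃ c₄) (W a y l c₅ c₁ c₆) (W a z m c₇ c₀ c₈) (W a i l c₂ c₁ c₉) (W z i l c₁₀ c₁₁ c₉) (W a i m c₂ c₀ c₁₂) (W y i m c₁₃ c₁₄ c₁₂) (W a l m c₁ c₀ c₁₅) (W x l m c₁₆ c₁₇ c₁₅) (W y z x c₁₈ c₁₉ c₂₀))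
            (out₃ (W a i x c₂ c₃ c₄ * W a y l c₅ c₁ c₆ * W a z m c₇ c₀ c₈ * (W a i l c₂ c₁ c₉ * W z i l c₁₀ c₁₁ c₉) * (W a i m c₂ c₀ c₁₂ * W y i m c₁₃ c₁₄ c₁₂) * (W a l m c₁ c₀ c₁₅ * W x l m c₁₆ c₁₇ c₁₅)) (λ p q r → W y z x p q r)))
            (pull₃ (W a i x c₂ c₃ c₄ * W a y l c₅ c₁ c₆ * W a z m c₇ c₀ c₈ * (W a i l c₂ c₁ c₉ * W z i l c₁₀ c₁₁ c₉) * (W a i m c₂ c₀ c₁₂ * W y i m c₁₃ c₁₄ c₁₂)) (λ r → W a l m c₁ c₀ r) (λ r p q → W x l m p q r) (κ y z x)))
            (pull₃ (W a i x c₂ c₃ c₄ * W a y l c₅ c₁ c₆ * W a z m c₇ c₀ c₈ * (W a i l c₂ c₁ c₉ * W z i l c₁₀ c₁₁ c₉)) (λ r → W a i m c₂ c₀ r) (λ r p q → W y i m p q r) (Γ a l m c₁ c₀ x * κ y z x)))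
            (pull₃ (W a i x c₂ c₃ c₄ * W a y l c₅ c₁ c₆ * W a z m c₇ c₀ c₈) (λ r → W a i l c₂ c₁ r) (λ r p q → W z i l p q r) (Γ a i m c₂ c₀ y * (Γ a l m c₁ c₀ x * κ y z x))))
            (pull₂ (W a i x c₂ c₃ c₄ * W a y l c₅ c₁ c₆) (λ p r → W a z m p c₀ r) E))
            (pull₂ (W a i x c₂ c₃ c₄) (λ p r → W a y l p c₁ r) (between a z m c₀ * E)))
            (trans (cong₂ᴱ λ c₃ c₄ → cong (_* (between a y l c₁ * (between a z m c₀ * E))) (sym (*-identityˡ (W a i x c₂ c₃ c₄))))
              (trans (pull₂ 1ℚ (λ q r → W a i x c₂ q r) (between a y l c₁ * (between a z m c₀ * E))) (last (beyond a i x c₂) (between a y l c₁) (between a z m c₀) E)))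
        where
        E = Γ a i l c₂ c₁ z * (Γ a i m c₂ c₀ y * (Γ a l m c₁ c₀ x * κ y z x))
        assoc : ∀ a b c d e f g h i j → a * (b * (c * (d * (e * (f * (g * (h * (i * (j * 1ℚ))))))))) ≡ (a * b * c * (d * e) * (f * g) * (h * i)) * j
        assoc = solve 10 (λ a b c d e f g h i j →
          a :* (b :* (c :* (d :* (e :* (f :* (g :* (h :* (i :* (j :* (con 1ℚ))))))))))
          := (a :* b :* c :* (d :* e) :* (f :* g) :* (h :* i)) :* j) refl
        last : ∀ a b c e → 1ℚ * (a * (b * (c * e))) ≡ (a * (b * c)) * e
        last = solve 4 (λ a b c e → con 1ℚ :* (a :* (b :* (c :* e))) := (a :* (b :* c)) :* e) refl

-- From a regular partition to a reduced hypergraph on the vertices.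

module Transfer where
  open import Data.Fin using (opposite; #_)
  open import Data.Vec using (Vec; []; _∷_; lookup; map)
  open import Data.List as List using (List; []; _∷_)
  open import Data.List.Relation.Unary.All using (All; []; _∷_)
  open Field
  open Base
  open Count
  open Spaces
  open Regular
  open Counting
  open ColourCount
  open Structure
  open Nest

  𝔼ᵛ-*ˡ : ∀ {k s} (ws : Vec (Fin k → ℚ) s) c (G : Vec (Fin k) s → ℚ) → 𝔼ᵛ ws (λ ls → c * G ls) ≡ c * 𝔼ᵛ ws G
  𝔼ᵛ-*ˡ [] c G = refl
  𝔼ᵛ-*ˡ (w ∷ ws) c G = trans (𝔼-cong λ l → 𝔼ᵛ-*ˡ ws c _) (𝔼-*ˡ c _)

  mirror-pair : Fin 7 × Fin 7 → Fin 7 × Fin 7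
  mirror-pair (i , j) = opposite j , opposite i

  mirror-edge : PatternEdge → PatternEdge
  mirror-edge ((i , j , l) , (α , β , γ)) = (opposite l , opposite j , opposite i) , (γ , β , α)

  Edge : ℕ → ℕ → Set
  Edge r s = (Fin r × Fin r × Fin r) × (Fin s × Fin s × Fin s)

  positions : ∀ {r s} → List (Edge r s) → List (Fin r × Fin r × Fin r)
  positions = List.map proj₁

  at : ∀ {A B : Set} → (A → A → A → A → A → A → A → B) → Vec A 7 → B
  at f v = f (lookup v (# 0)) (lookup v (# 1)) (lookup v (# 2)) (lookup v (# 3)) (lookup v (# 4)) (lookup v (# 5)) (lookup v (# 6))

  mirrored-density : ∀ {A : Set} {k} → Str A k → A → A → A → A → A → A → A → ℚ
  mirrored-density S a b c d e f h = Ops.F7-density (reverse S) h f e d c b a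

  indicator³ : ∀ {A : Set} → (A → A → A → Bool) → A × A × A → ℚ
  indicator³ b (x , y , z) = ⟦ b x y z ⟧

  indicator³-Unit : ∀ {A : Set} (b : A → A → A → Bool) ω → Unit (indicator³ b ω)
  indicator³-Unit b (x , y , z) = Unit⟦⟧ (b x y z)

  module WithRegular (n' : ℕ) (b : V n' → V n' → V n' → Bool) {k' M : ℕ} (P : V n' → V n' → Fin (suc k')) (Q : V n' → Fin M) (ε₁ ε' : ℚ) (0≤ε₁ : 0ℚ ≤ ε₁)
    (creg : Colours.Colour-regular n' P ε' Q)
    (treg : Triples.Triangle-regular n' (indicator³ b) (indicator³-Unit b) ε₁ P Q) where

    A : Set
    A = V n'

    open Space (μ n')
    open Tuples (μ n')
    module C = Colours n' P

    g : A → A → A → ℚ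
    g x y z = ⟦ b x y z ⟧

    g-Unit : ∀ x y z → Unit (g x y z)
    g-Unit x y z = Unit⟦⟧ (b x y z)

    module R = Triples n' (indicator³ b) (indicator³-Unit b)

    Wc : R.Atom (suc k') M → ℚ
    Wc = R.W P Q

    Wc-Unit : ∀ j → Unit (Wc j)
    Wc-Unit = Conditional.condexp-Unit R.space R._≟_ (R.atom P Q) _ (indicator³-Unit b)

    dc : Fin M → Fin M → Fin (suc k') → ℚ
    dc a c l = C.d Q (a , c , l)

    dc-Unit : ∀ a c l → Unit (dc a c l)
    dc-Unit a c l = Conditional.condexp-Unit C.space C._≟_ (C.cell Q) C.has C.has-Unit (a , c , l)

    k-uniform : Space (Fin (suc k'))
    k-uniform = uniform k'

    ε : ℚ
    ε = nat (suc k') * ε'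

    average-over-colours : ∀ (h : Fin (suc k') → ℚ) → Space.∫ k-uniform h ≡ inv (0<nat k') * ∑ h
    average-over-colours h = ∑-*ˡ _ h

    -- Regularity is an average over the colours; a test supported on one colour isolates it at the
    -- price of a factor `suc k'`.
    colour-test : ∀ (u v : A → Bool) (τ : Fin M → Fin M → ℚ) → (∀ a c → τ a c * τ a c ≤ 1ℚ) → ∀ l →
      ∫ (λ x → ∫ λ y → (⟦ P x y ≡ᶠ l ⟧ - dc (Q x) (Q y) l) * (⟦ u x ⟧ * ⟦ v y ⟧ * τ (Q x) (Q y))) ≤ ε
    colour-test u v τ hτ l = ≤-trans (≤-reflexive scale) (*-monoʳ (nat (suc k')) (0≤nat (suc k')) (creg u v τ' hτ'))
      where
      τ' : C.Cell M → ℚ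
      τ' (a , c , l') = ⟦ l ≡ᶠ l' ⟧ * τ a c
      hτ' : ∀ j → τ' j * τ' j ≤ 1ℚ
      hτ' (a , c , l') = ≤-trans (≤-reflexive (r ⟦ l ≡ᶠ l' ⟧ (τ a c))) (≤-trans (*-mono (0≤sq _) (0≤sq _) (square≤1 (Unit⟦⟧ (l ≡ᶠ l'))) (hτ a c)) (≤-reflexive (*-identityˡ 1ℚ)))
        where
        r : ∀ a t → a * t * (a * t) ≡ a * a * (t * t)
        r = solve 2 (λ a t → a :* t :* (a :* t) := a :* a :* (t :* t)) refl
      i = inv (0<nat k')
      F : A → A → Fin (suc k') → ℚ
      F x y l' = (⟦ P x y ≡ᶠ l' ⟧ - dc (Q x) (Q y) l') * (⟦ u x ⟧ * ⟦ v y ⟧ * τ (Q x) (Q y))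
      colour-sum : ∀ x y → Space.∫ k-uniform (λ l' → (⟦ P x y ≡ᶠ l' ⟧ - dc (Q x) (Q y) l') * (⟦ u x ⟧ * ⟦ v y ⟧ * τ' (Q x , Q y , l'))) ≡ i * F x y l
      colour-sum x y = trans (average-over-colours _) (cong (i *_) (trans (∑-cong λ l' → r _ ⟦ u x ⟧ ⟦ v y ⟧ ⟦ l ≡ᶠ l' ⟧ (τ (Q x) (Q y))) (∑-≡ᶠ l (F x y))))
        where
        r : ∀ a u v e t → a * (u * v * (e * t)) ≡ e * (a * (u * v * t))
        r = solve 5 (λ a u v e t → a :* (u :* v :* (e :* t)) := e :* (a :* (u :* v :* t))) refl
      scale : ∫ (λ x → ∫ λ y → F x y l) ≡ nat (suc k') * Space.∫ C.space (λ { ω@(x , y , l') → (C.has ω - C.d Q (C.cell Q ω)) * (⟦ u x ⟧ * ⟦ v y ⟧ * τ' (C.cell Q ω)) })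
      scale = sym (trans (cong (nat (suc k') *_) (trans (∫-cong λ x → trans (∫-cong λ y → colour-sum x y) (∫-*ˡ i _)) (∫-*ˡ i _)))
        (trans (sym (*-assoc _ _ _)) (trans (cong (_* ∫ (λ x → ∫ λ y → F x y l)) (*-inv (0<nat k'))) (*-identityˡ _))))

    module Pr = Pairs (μ n') P Q dc dc-Unit ε colour-test

    -- The indices are the vertices themselves although the data depend on their cells; a sample
    -- then yields a structure on its positions by `pullback`.
    S : Str A (suc k')
    S = record
      { d = λ x y → dc (Q x) (Q y)
      ; W = λ x y z p q r → Wc ((p , q , r) , (Q x , Q y , Q z))
      ; d-Dist = λ x y → record { w≥0 = λ l → proj₁ (dc-Unit (Q x) (Q y) l) ; w∑1 = total x y }
      ; W-Unit = λ x y z p q r → Wc-Unit ((p , q , r) , (Q x , Q y , Q z)) }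
      where
      s : Fin M → Fin M → ℚ
      s a c = ∑ (dc a c) - 1ℚ
      unscale : ∀ (F : A → A → Fin (suc k') → ℚ) → nat (suc k') * Space.∫ C.space (λ { (x , y , l) → F x y l }) ≡ ∫ (λ x → ∫ λ y → ∑ (F x y))
      unscale F = trans (cong (nat (suc k') *_) (trans (∫-cong λ x → trans (∫-cong λ y → average-over-colours (F x y)) (∫-*ˡ i _)) (∫-*ˡ i _)))
        (trans (sym (*-assoc (nat (suc k')) i _)) (trans (cong (_* ∫ (λ x → ∫ λ y → ∑ (F x y))) (*-inv (0<nat k'))) (*-identityˡ _)))
        where
        i = inv (0<nat k')
      mean-s : ∫ (λ x → ∫ λ y → ∑ (dc (Q x) (Q y)) * s (Q x) (Q y)) ≡ ∫ (λ x → ∫ λ y → s (Q x) (Q y))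
      mean-s = trans (∫-cong λ x → ∫-cong λ y → sym (∑-*ʳ (s (Q x) (Q y)) (dc (Q x) (Q y))))
        (trans (sym (unscale λ x y l → dc (Q x) (Q y) l * s (Q x) (Q y)))
        (trans (cong (nat (suc k') *_) (Conditional.condexp-≡ C.space C._≟_ (C.cell Q) C.has (λ { (a , c , l) → s a c })))
        (trans (unscale λ x y l → ⟦ P x y ≡ᶠ l ⟧ * s (Q x) (Q y)) (∫-cong λ x → ∫-cong λ y → ∑-≡ᶠ (P x y) (λ _ → s (Q x) (Q y))))))
      expand : ∀ t s → (t - 1ℚ) * s ≡ t * s - s
      expand = solve 2 (λ t s → (t :- (con 1ℚ)) :* s := t :* s :- s) refl
      -- ∑ₗ d - 1 is orthogonal to every function of the two cells, in particular to itself.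
      orthogonal : ∫ (λ x → ∫ λ y → s (Q x) (Q y) * s (Q x) (Q y)) ≡ 0ℚ
      orthogonal = trans (∫-cong λ x → trans (∫-cong λ y → expand (∑ (dc (Q x) (Q y))) (s (Q x) (Q y))) (∫-- _ _))
        (trans (∫-- _ _) (trans (cong (_- ∫ (λ x → ∫ λ y → s (Q x) (Q y))) mean-s) (+-inverseʳ _)))
      total : ∀ x y → ∑ (dc (Q x) (Q y)) ≡ 1ℚ
      total x y = trans (lem (∑ (dc (Q x) (Q y)))) (trans (cong (_+ 1ℚ) (zero-square (s (Q x) (Q y)) (λ pos → <-irrefl (sym orthogonal)
          (∫-pos (λ x' → ∫-≥ 0ℚ λ y' → 0≤sq _) x (∫-pos (λ y' → 0≤sq _) y pos))))) (+-identityˡ 1ℚ))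
        where
        lem : ∀ t → t ≡ (t - 1ℚ) + 1ℚ
        lem = solve 1 (λ t → t := (t :- (con 1ℚ)) :+ (con 1ℚ)) refl
        zero-square : ∀ x → ¬ (0ℚ < x * x) → x ≡ 0ℚ
        zero-square x h = ≤-antisym (≮⇒≥ λ p → h (0<* p p)) (≮⇒≥ λ p → h (subst (0ℚ <_) (l x) (0<* (diff< p) (diff< p))))
          where
          l : ∀ x → (0ℚ - x) * (0ℚ - x) ≡ x * x
          l = solve 1 (λ x → ((con 0ℚ) :- x) :* ((con 0ℚ) :- x) := x :* x) refl

    w : A → A → A → ℚ
    w x y z = Wc (R.atom P Q (x , y , z))

    bounded : ∀ U V W → (∀ x y → Unit (U x y)) → (∀ x y → Unit (V x y)) → (∀ x y → Unit (W x y)) → Extreme.Bounded (λ x y z → w x y z - g x y z) ε₁ U V W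
    bounded = Extreme.extreme (λ x y z → w x y z - g x y z) ε₁ treg

    module Copies (r s : ℕ) where
      module H = Hypergraphs r
      module Rep = H.Replace w g (λ x y z → Wc-Unit _) g-Unit ε₁ 0≤ε₁ bounded

      pattern-weight : List (Edge r s) → Vec (Fin (suc k')) s → Vec (Fin M) r → ℚ
      pattern-weight [] ls c = 1ℚ
      pattern-weight (((i , j , l) , (α , β , γ)) ∷ es) ls c = Wc ((lookup ls α , lookup ls β , lookup ls γ) , (lookup c i , lookup c j , lookup c l)) * pattern-weight es ls c

      pattern-weight-Unit : ∀ es ls c → Unit (pattern-weight es ls c)
      pattern-weight-Unit [] ls c = 0≤1 , ≤-refl
      pattern-weight-Unit (e ∷ es) ls c = Unit* (Wc-Unit _) (pattern-weight-Unit es ls c)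

      product-zero : ∀ es v → ¬ All (λ { (i , j , l) → b (lookup v i) (lookup v j) (lookup v l) ≡ true }) es → H.product (Rep.tag g es) v ≡ 0ℚ
      product-zero [] v h = ⊥-elim (h [])
      product-zero ((i , j , l) ∷ es) v h = go (b (lookup v i) (lookup v j) (lookup v l)) refl
        where
        go : ∀ t → b (lookup v i) (lookup v j) (lookup v l) ≡ t → ⟦ b (lookup v i) (lookup v j) (lookup v l) ⟧ * H.product (Rep.tag g es) v ≡ 0ℚ
        go true e = trans (cong (⟦ b (lookup v i) (lookup v j) (lookup v l) ⟧ *_) (product-zero es v λ al → h (e ∷ al))) (zeroʳ _)
        go false e = trans (cong (λ t → ⟦ t ⟧ * H.product (Rep.tag g es) v) e) (zeroˡ _)

      -- Independence replaces the random colours by the actual ones, at which the pattern weight is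
      -- a product of conditional weights. `replace` exchanges these for edges, and the resulting
      -- product vanishes everywhere as there is no copy.
      copies : ∀ (ps : Vec (Fin r × Fin r) s) (es : List (Edge r s)) → Pr.distinct r ps ≡ true → Rep.ready (positions es) [] ≡ true →
        (∀ v → pattern-weight es (Pr.colours r ps v) (map Q v) ≡ H.product (Rep.tag w (positions es)) v) →
        (∀ v → ¬ All (λ { (i , j , l) → b (lookup v i) (lookup v j) (lookup v l) ≡ true }) (positions es List.ʳ++ [])) →
        ∫ᵛ r (λ v → 𝔼ᵛ (Pr.densities r ps (map Q v)) λ ls → pattern-weight es ls (map Q v)) ≤ nat (List.length (positions es)) * ε₁ + Pr.error r s
      copies ps es dis rd agree free = ≤-trans (le _ (diff indep) (l (∫ᵛ r (λ v → pattern-weight es (Pr.colours r ps v) (map Q v))) _ (Pr.error r s)))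
        (+-monoˡ-≤ (Pr.error r s) (≤-trans (≤-reflexive (T.∫-cong r λ v → trans (agree v) (sym (*-identityʳ _)))) (≤-trans (Rep.replace (positions es) [] rd)
          (≤-reflexive (trans (cong (_+ _) (trans (T.∫-cong r λ v → product-zero _ v (free v)) (T.∫-const r 0ℚ))) (+-identityˡ _))))))
        where
        l : ∀ c e r → c + r ≡ e + ((- 1ℚ) * e + r - (- 1ℚ) * c)
        l = solve 3 (λ c e r → c :+ r := e :+ ((:- (con 1ℚ)) :* e :+ r :- (:- (con 1ℚ)) :* c)) refl
        -- `independent` is an upper bound for the actual colours; applied to the negated weight it
        -- becomes the lower bound needed here.
        G : Vec (Fin (suc k')) s → Vec (Fin M) r → ℚ
        G ls c = (- 1ℚ) * pattern-weight es ls c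
        neg-square : ∀ x → (- 1ℚ) * x * ((- 1ℚ) * x) ≡ x * x
        neg-square = solve 1 (λ x → (:- (con 1ℚ)) :* x :* ((:- (con 1ℚ)) :* x) := x :* x) refl
        indep : (- 1ℚ) * ∫ᵛ r (λ v → pattern-weight es (Pr.colours r ps v) (map Q v)) ≤ (- 1ℚ) * ∫ᵛ r (λ v → 𝔼ᵛ (Pr.densities r ps (map Q v)) λ ls → pattern-weight es ls (map Q v)) + Pr.error r s
        indep = ≤-trans (≤-reflexive (sym (T.∫-*ˡ r (- 1ℚ) _))) (≤-trans (Pr.independent r ps dis G (λ ls c → ≤-trans (≤-reflexive (neg-square _)) (square≤1 (pattern-weight-Unit es ls c))))
          (+-monoˡ-≤ (Pr.error r s) (≤-reflexive (trans (T.∫-cong r λ v → 𝔼ᵛ-*ˡ (Pr.densities r ps (map Q v)) (- 1ℚ) λ ls → pattern-weight es ls (map Q v)) (T.∫-*ˡ r (- 1ℚ) _)))))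

    open Copies 7 21

    Free : Set
    Free = ∀ a y z i x l m → b a i x ≡ true → b a y l ≡ true → b a z m ≡ true → b a i l ≡ true → b z i l ≡ true → b a i m ≡ true → b y i m ≡ true →
      b a l m ≡ true → b x l m ≡ true → b y z x ≡ true → ⊥

    expected : Vec (Fin 7 × Fin 7) 21 → List PatternEdge → Vec A 7 → ℚ
    expected ps es v = 𝔼ᵛ (Pr.densities 7 ps (map Q v)) λ ls → pattern-weight es ls (map Q v)

    few-copies : Free → ∫ᵛ 7 (at (Ops.F7-density S)) ≤ nat 10 * ε₁ + Pr.error 7 21
    few-copies free = ≤-trans (≤-reflexive (T.∫-cong 7 {at (Ops.F7-density S)} {expected pattern-pairs pattern-edges} λ v → sym (straight v)))
      (copies pattern-pairs pattern-edges refl refl (λ { (_ ∷ _ ∷ _ ∷ _ ∷ _ ∷ _ ∷ _ ∷ []) → refl })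
        (λ { (a ∷ y ∷ z ∷ i ∷ x ∷ l ∷ m ∷ []) (e₁₀ ∷ e₉ ∷ e₈ ∷ e₇ ∷ e₆ ∷ e₅ ∷ e₄ ∷ e₃ ∷ e₂ ∷ e₁ ∷ []) → free a y z i x l m e₁ e₂ e₃ e₄ e₅ e₆ e₇ e₈ e₉ e₁₀ }))
      where
      straight : ∀ v → expected pattern-pairs pattern-edges v ≡ at (Ops.F7-density S) v
      straight (a ∷ y ∷ z ∷ i ∷ x ∷ l ∷ m ∷ []) = nested-density S a y z i x l m

    -- Read from the last vertex to the first, the mirrored layout is the same configuration,
    -- because the kernel is symmetric under reversal.
    few-mirrored-copies : Free → (∀ x y z → b x y z ≡ b z y x) → ∫ᵛ 7 (at (mirrored-density S)) ≤ nat 10 * ε₁ + Pr.error 7 21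
    few-mirrored-copies free flip = ≤-trans (≤-reflexive (T.∫-cong 7 {at (mirrored-density S)} {expected (map mirror-pair pattern-pairs) (List.map mirror-edge pattern-edges)} λ v → sym (mirrored v)))
      (copies (map mirror-pair pattern-pairs) (List.map mirror-edge pattern-edges) refl refl (λ { (_ ∷ _ ∷ _ ∷ _ ∷ _ ∷ _ ∷ _ ∷ []) → refl })
        (λ { (a ∷ y ∷ z ∷ i ∷ x ∷ l ∷ m ∷ []) (e₁₀ ∷ e₉ ∷ e₈ ∷ e₇ ∷ e₆ ∷ e₅ ∷ e₄ ∷ e₃ ∷ e₂ ∷ e₁ ∷ []) →
          free m l x i z y a (t e₁) (t e₂) (t e₃) (t e₄) (t e₅) (t e₆) (t e₇) (t e₈) (t e₉) (t e₁₀) }))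
      where
      t : ∀ {x y z} → b x y z ≡ true → b z y x ≡ true
      t e = trans (sym (flip _ _ _)) e
      mirrored : ∀ v → expected (map mirror-pair pattern-pairs) (List.map mirror-edge pattern-edges) v ≡ at (mirrored-density S) v
      mirrored (a ∷ y ∷ z ∷ i ∷ x ∷ l ∷ m ∷ []) = nested-density (reverse S) m l x i z y a

    private
      cells : A × A × A → R.Atom 1 M
      cells (x , y , z) = (zero , zero , zero) , (Q x , Q y , Q z)
      g³ : A × A × A → ℚ
      g³ (x , y , z) = g x y z

    -- Conditioning with a single trivial colour, so that only the cells matter: the true edge
    -- density between three cells.
    cell-density : Fin M → Fin M → Fin M → ℚ
    cell-density a c e = Conditional.condexp R.space R._≟_ cells g³ ((zero , zero , zero) , (a , c , e))

    cell-density-Unit : ∀ a c e → Unit (cell-density a c e)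
    cell-density-Unit a c e = Conditional.condexp-Unit R.space R._≟_ cells g³ (λ { (x , y , z) → Unit⟦⟧ (b x y z) }) _

    cell-density-≡ : ∀ (τ : Fin M → Fin M → Fin M → ℚ) →
      ∫ (λ x → ∫ λ y → ∫ λ z → cell-density (Q x) (Q y) (Q z) * τ (Q x) (Q y) (Q z)) ≡ ∫ (λ x → ∫ λ y → ∫ λ z → g x y z * τ (Q x) (Q y) (Q z))
    cell-density-≡ τ = Conditional.condexp-≡ R.space R._≟_ cells g³ (λ { (_ , (a , c , e)) → τ a c e })

    cell-κ : Fin M → Fin M → Fin M → ℚ
    cell-κ a c e = 𝔼 (dc a c) λ p → 𝔼 (dc a e) λ q → 𝔼 (dc c e) λ r → Wc ((p , q , r) , (a , c , e))

    triple-pairs : Vec (Fin 3 × Fin 3) 3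
    triple-pairs = (# 0 , # 1) ∷ (# 0 , # 2) ∷ (# 1 , # 2) ∷ []

    -- Against a function of cells, conditioning on the cells alone and on cells and colours give
    -- the same integral; in the latter the actual colours are then replaced by independent ones.
    densities-agree : ∀ (τ : Fin M → Fin M → Fin M → ℚ) → (∀ a c e → Unit (τ a c e)) →
      ∫ (λ x → ∫ λ y → ∫ λ z → cell-density (Q x) (Q y) (Q z) * τ (Q x) (Q y) (Q z)) ≤ ∫ (λ x → ∫ λ y → ∫ λ z → cell-κ (Q x) (Q y) (Q z) * τ (Q x) (Q y) (Q z)) + Pr.error 3 3
    densities-agree τ hτ = ≤-trans (≤-reflexive (trans (cell-density-≡ τ)
        (trans (sym (Conditional.condexp-≡ R.space R._≟_ (R.atom P Q) (λ { (x , y , z) → g x y z }) (λ { (_ , (a , c , e)) → τ a c e }))) (∫-cong λ x → ∫-cong λ y → ∫-cong λ z → *-comm _ _))))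
      (≤-trans (Pr.independent 3 triple-pairs refl G (λ ls c → square≤1 (G-Unit ls c)))
        (+-monoˡ-≤ (Pr.error 3 3) (≤-reflexive (∫-cong λ x → ∫-cong λ y → ∫-cong λ z → trans (𝔼ᵛ-*ˡ (Pr.densities 3 triple-pairs (Q x ∷ Q y ∷ Q z ∷ [])) (τ (Q x) (Q y) (Q z)) λ ls → Wc ((lookup ls (# 0) , lookup ls (# 1) , lookup ls (# 2)) , (Q x , Q y , Q z))) (*-comm _ _)))))
      where
      G : Vec (Fin (suc k')) 3 → Vec (Fin M) 3 → ℚ
      G ls c = τ (lookup c (# 0)) (lookup c (# 1)) (lookup c (# 2)) * Wc ((lookup ls (# 0) , lookup ls (# 1) , lookup ls (# 2)) , (lookup c (# 0) , lookup c (# 1) , lookup c (# 2)))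
      G-Unit : ∀ ls c → Unit (G ls c)
      G-Unit ls c = Unit* (hτ _ _ _) (Wc-Unit _)

-- Sums over increasing triples and the edge count.

module Sorted where
  open import Data.Nat.ListAction using (sum)
  open import Data.Nat.ListAction.Properties using (sum-++)
  open import Data.Nat.Combinatorics using (_C_; nCk+nC[k+1]≡[n+1]C[k+1])
  open import Data.Fin using (toℕ)
  open import Data.Fin.Subset using (Subset)
  import Data.Fin.Subset as Subset
  open import Data.Vec as Vec using (Vec; []; _∷_; lookup)
  open import Data.List using (List; []; _∷_; concatMap; tabulate)
  import Data.List as List
  open import Data.Bool using (if_then_else_)
  open import Defs using (Graph3; edgesIn)
  open Field
  open Base
  open Count

  module _ {n : ℕ} where
    sorted₂ : (Fin n → Fin n → ℚ) → ℚ
    sorted₂ h = ∑ λ x → ∑ λ y → ⟦ x ≺ y ⟧ * h x y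

    sorted₃ : (Fin n → Fin n → Fin n → ℚ) → ℚ
    sorted₃ h = ∑ λ x → ∑ λ y → ∑ λ z → ⟦ x ≺ y ⟧ * (⟦ y ≺ z ⟧ * h x y z)

    ∑₃ : (Fin n → Fin n → Fin n → ℚ) → ℚ
    ∑₃ h = ∑ λ x → ∑ λ y → ∑ λ z → h x y z

    ∑₃-cong : ∀ {g h} → (∀ x y z → g x y z ≡ h x y z) → ∑₃ g ≡ ∑₃ h
    ∑₃-cong e = ∑-cong λ x → ∑-cong λ y → ∑-cong λ z → e x y z

    ∑₃-mono : ∀ {g h} → (∀ x y z → g x y z ≤ h x y z) → ∑₃ g ≤ ∑₃ h
    ∑₃-mono e = ∑-mono λ x → ∑-mono λ y → ∑-mono λ z → e x y z

    ∑₃-+ : ∀ g h → ∑₃ (λ x y z → g x y z + h x y z) ≡ ∑₃ g + ∑₃ h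
    ∑₃-+ g h = trans (∑-cong λ x → trans (∑-cong λ y → ∑-+ _ _) (∑-+ _ _)) (∑-+ _ _)

    ∑₃-*ˡ : ∀ c g → ∑₃ (λ x y z → c * g x y z) ≡ c * ∑₃ g
    ∑₃-*ˡ c g = trans (∑-cong λ x → trans (∑-cong λ y → ∑-*ˡ _ _) (∑-*ˡ _ _)) (∑-*ˡ _ _)

    ∑₃-swap₁₂ : ∀ h → ∑₃ h ≡ ∑₃ (λ x y z → h y x z)
    ∑₃-swap₁₂ h = ∑-swap _

    ∑₃-swap₂₃ : ∀ h → ∑₃ h ≡ ∑₃ (λ x y z → h x z y)
    ∑₃-swap₂₃ h = ∑-cong λ x → ∑-swap _

    sorted₃-cong : ∀ {g h} → (∀ x y z → g x y z ≡ h x y z) → sorted₃ g ≡ sorted₃ h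
    sorted₃-cong e = ∑₃-cong λ x y z → cong (λ t → ⟦ x ≺ y ⟧ * (⟦ y ≺ z ⟧ * t)) (e x y z)

    sorted₃-+ : ∀ g h → sorted₃ (λ x y z → g x y z + h x y z) ≡ sorted₃ g + sorted₃ h
    sorted₃-+ g h = trans (∑₃-cong λ x y z → lem ⟦ x ≺ y ⟧ ⟦ y ≺ z ⟧ (g x y z) (h x y z)) (∑₃-+ _ _)
      where
      lem : ∀ a b g h → a * (b * (g + h)) ≡ a * (b * g) + a * (b * h)
      lem = solve 4 (λ a b g h → a :* (b :* (g :+ h)) := a :* (b :* g) :+ a :* (b :* h)) refl

    sorted₃-*ˡ : ∀ c g → sorted₃ (λ x y z → c * g x y z) ≡ c * sorted₃ g
    sorted₃-*ˡ c g = trans (∑₃-cong λ x y z → lem c ⟦ x ≺ y ⟧ ⟦ y ≺ z ⟧ (g x y z)) (∑₃-*ˡ c _)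
      where
      lem : ∀ c a b g → a * (b * (c * g)) ≡ c * (a * (b * g))
      lem = solve 4 (λ c a b g → a :* (b :* (c :* g)) := c :* (a :* (b :* g))) refl

    sorted₃-mono : ∀ {g h} → (∀ x y z → (x ≺ y) ≡ true → (y ≺ z) ≡ true → g x y z ≤ h x y z) → sorted₃ g ≤ sorted₃ h
    sorted₃-mono {g} {h} e = ∑₃-mono go
      where
      go : ∀ x y z → ⟦ x ≺ y ⟧ * (⟦ y ≺ z ⟧ * g x y z) ≤ ⟦ x ≺ y ⟧ * (⟦ y ≺ z ⟧ * h x y z)
      go x y z with x ≺ y in p | y ≺ z in q
      ... | true | true = *-monoʳ 1ℚ 0≤1 (*-monoʳ 1ℚ 0≤1 (e x y z p q))
      ... | false | t = ≤-reflexive (trans (zeroˡ _) (sym (zeroˡ _)))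
      ... | true | false = ≤-reflexive (cong (1ℚ *_) (trans (zeroˡ _) (sym (zeroˡ _))))

  peel : ∀ {n} (f : Fin (suc n) → ℚ) → f zero ≡ 0ℚ → ∑ f ≡ ∑ (λ i → f (suc i))
  peel f e = trans (∑-suc f) (trans (cong (_+ ∑ (λ i → f (suc i))) e) (+-identityˡ _))

  sorted₂-suc : ∀ {n} (h : Fin (suc n) → Fin (suc n) → ℚ) → sorted₂ h ≡ ∑ (λ y → h zero (suc y)) + sorted₂ (λ x y → h (suc x) (suc y))
  sorted₂-suc h = trans (∑-suc _) (cong₂ _+_ (trans (peel _ (zeroˡ _)) (∑-cong λ y → *-identityˡ _)) (∑-cong λ x → peel _ (zeroˡ _)))

  sorted₃-suc : ∀ {n} (h : Fin (suc n) → Fin (suc n) → Fin (suc n) → ℚ) →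
    sorted₃ h ≡ sorted₂ (λ y z → h zero (suc y) (suc z)) + sorted₃ (λ x y z → h (suc x) (suc y) (suc z))
  sorted₃-suc h = trans (∑-suc _) (cong₂ _+_
    (trans (peel _ (trans (∑-cong λ z → zeroˡ _) ∑-0)) (∑-cong λ y → trans (peel _ (trans (*-identityˡ _) (zeroˡ _))) (∑-cong λ z → *-identityˡ _)))
    (∑-cong λ x → trans (peel _ (trans (∑-cong λ z → zeroˡ _) ∑-0)) (∑-cong λ y → peel _ (trans (cong (⟦ x ≺ y ⟧ *_) (zeroˡ _)) (zeroʳ _)))))

  symmetrised : ∀ {n} → (Fin n → Fin n → Fin n → ℚ) → Fin n → Fin n → Fin n → ℚ
  symmetrised h x y z = h x y z + (h x z y + (h y x z + (h y z x + (h z x y + h z y x))))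

  degenerate : ∀ {n} → Fin n → Fin n → Fin n → Bool
  degenerate x y z = x ≡ᶠ y ∨ y ≡ᶠ z ∨ x ≡ᶠ z

  six-orders : ∀ {n} (x y z : Fin n) → symmetrised (λ x y z → ⟦ x ≺ y ⟧ * ⟦ y ≺ z ⟧) x y z + ⟦ degenerate x y z ⟧ ≡ 1ℚ
  six-orders {suc n} zero zero z = lem ⟦ zero {n} ≺ z ⟧
    where
    lem : ∀ a → 0ℚ * a + (a * 0ℚ + (0ℚ * a + (a * 0ℚ + (0ℚ * 0ℚ + 0ℚ * 0ℚ)))) + 1ℚ ≡ 1ℚ
    lem = solve 1 (λ a →
      con 0ℚ :* a :+ (a :* (con 0ℚ) :+ ((con 0ℚ) :* a :+ (a :* (con 0ℚ) :+ ((con 0ℚ) :* (con 0ℚ) :+ (con 0ℚ) :* (con 0ℚ))))) :+ (con 1ℚ)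
      := con 1ℚ) refl
  six-orders zero (suc y) zero = lem 0ℚ
    where
    lem : ∀ a → 1ℚ * 0ℚ + (0ℚ * 1ℚ + (0ℚ * 0ℚ + (0ℚ * 0ℚ + (0ℚ * 1ℚ + 1ℚ * 0ℚ)))) + 1ℚ ≡ 1ℚ
    lem = solve 1 (λ a →
      con 1ℚ :* (con 0ℚ) :+ ((con 0ℚ) :* (con 1ℚ) :+ ((con 0ℚ) :* (con 0ℚ) :+ ((con 0ℚ) :* (con 0ℚ) :+ ((con 0ℚ) :* (con 1ℚ) :+ (con 1ℚ) :* (con 0ℚ))))) :+ (con 1ℚ)
      := con 1ℚ) refl
  six-orders (suc x) zero zero = lem 0ℚ
    where
    lem : ∀ a → 0ℚ * 0ℚ + (0ℚ * 0ℚ + (1ℚ * 0ℚ + (0ℚ * 1ℚ + (1ℚ * 0ℚ + 0ℚ * 1ℚ)))) + 1ℚ ≡ 1ℚ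
    lem = solve 1 (λ a →
      con 0ℚ :* (con 0ℚ) :+ ((con 0ℚ) :* (con 0ℚ) :+ ((con 1ℚ) :* (con 0ℚ) :+ ((con 0ℚ) :* (con 1ℚ) :+ ((con 1ℚ) :* (con 0ℚ) :+ (con 0ℚ) :* (con 1ℚ))))) :+ (con 1ℚ)
      := con 1ℚ) refl
  six-orders zero (suc y) (suc z) = trans (lem ⟦ y ≺ z ⟧ ⟦ z ≺ y ⟧ ⟦ y ≡ᶠ z ∨ false ⟧) (trans (cong (λ t → ⟦ y ≺ z ⟧ + ⟦ z ≺ y ⟧ + ⟦ t ⟧) (∨-right (y ≡ᶠ z))) (trichotomy y z))
    where
    ∨-right : ∀ b → b ∨ false ≡ b
    ∨-right true = refl
    ∨-right false = refl
    lem : ∀ a b c → 1ℚ * a + (1ℚ * b + (0ℚ * 1ℚ + (a * 0ℚ + (0ℚ * 1ℚ + b * 0ℚ)))) + c ≡ a + b + c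
    lem = solve 3 (λ a b c →
      con 1ℚ :* a :+ ((con 1ℚ) :* b :+ ((con 0ℚ) :* (con 1ℚ) :+ (a :* (con 0ℚ) :+ ((con 0ℚ) :* (con 1ℚ) :+ b :* (con 0ℚ))))) :+ c
      := a :+ b :+ c) refl
  six-orders (suc x) zero (suc z) = trans (lem ⟦ x ≺ z ⟧ ⟦ z ≺ x ⟧ ⟦ x ≡ᶠ z ⟧) (trichotomy x z)
    where
    lem : ∀ a b c → 0ℚ * 1ℚ + (a * 0ℚ + (1ℚ * a + (1ℚ * b + (b * 0ℚ + 0ℚ * 1ℚ)))) + c ≡ a + b + c
    lem = solve 3 (λ a b c →
      con 0ℚ :* (con 1ℚ) :+ (a :* (con 0ℚ) :+ ((con 1ℚ) :* a :+ ((con 1ℚ) :* b :+ (b :* (con 0ℚ) :+ (con 0ℚ) :* (con 1ℚ))))) :+ c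
      := a :+ b :+ c) refl
  six-orders (suc x) (suc y) zero = trans (lem ⟦ x ≺ y ⟧ ⟦ y ≺ x ⟧ ⟦ x ≡ᶠ y ∨ false ⟧) (trans (cong (λ t → ⟦ x ≺ y ⟧ + ⟦ y ≺ x ⟧ + ⟦ t ⟧) (∨-right (x ≡ᶠ y))) (trichotomy x y))
    where
    ∨-right : ∀ b → b ∨ false ≡ b
    ∨-right true = refl
    ∨-right false = refl
    lem : ∀ a b c → a * 0ℚ + (0ℚ * 1ℚ + (b * 0ℚ + (0ℚ * 1ℚ + (1ℚ * a + 1ℚ * b)))) + c ≡ a + b + c
    lem = solve 3 (λ a b c →
      a :* (con 0ℚ) :+ ((con 0ℚ) :* (con 1ℚ) :+ (b :* (con 0ℚ) :+ ((con 0ℚ) :* (con 1ℚ) :+ ((con 1ℚ) :* a :+ (con 1ℚ) :* b)))) :+ c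
      := a :+ b :+ c) refl
  six-orders (suc x) (suc y) (suc z) = six-orders x y z

  module _ {n : ℕ} where
    -- The bridge between increasing triples, over which edges are counted, and all ordered triples,
    -- over which integrals and matrix norms are computed.
    sum-by-order : ∀ (h : Fin n → Fin n → Fin n → ℚ) → ∑₃ h ≡ sorted₃ (symmetrised h) + ∑₃ (λ x y z → ⟦ degenerate x y z ⟧ * h x y z)
    sum-by-order h = trans (∑₃-cong λ x y z → trans (sym (*-identityˡ _)) (trans (cong (_* h x y z) (sym (six-orders x y z)))
        (split (s x y z) (s x z y) (s y x z) (s y z x) (s z x y) (s z y x) ⟦ degenerate x y z ⟧ (h x y z))))
      (trans (∑₃-+ _ _) (cong (_+ ∑₃ (λ x y z → ⟦ degenerate x y z ⟧ * h x y z)) (trans separate (sym together))))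
      where
      s : Fin n → Fin n → Fin n → ℚ
      s x y z = ⟦ x ≺ y ⟧ * ⟦ y ≺ z ⟧
      split : ∀ a b c d e f g h → (a + (b + (c + (d + (e + f)))) + g) * h ≡ (a * h + (b * h + (c * h + (d * h + (e * h + f * h))))) + g * h
      split = solve 8 (λ a b c d e f g h →
        (a :+ (b :+ (c :+ (d :+ (e :+ f)))) :+ g) :* h
        := (a :* h :+ (b :* h :+ (c :* h :+ (d :* h :+ (e :* h :+ f :* h))))) :+ g :* h) refl
      S : (Fin n → Fin n → Fin n → ℚ) → ℚ
      S k = ∑₃ λ x y z → s x y z * k x y z
      s₁₂ : ∀ k → ∑₃ k ≡ ∑₃ (λ x y z → k y x z)
      s₁₂ = ∑₃-swap₁₂
      s₂₃ : ∀ k → ∑₃ k ≡ ∑₃ (λ x y z → k x z y)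
      s₂₃ = ∑₃-swap₂₃
      target : ℚ
      target = S h + (S (λ x y z → h x z y) + (S (λ x y z → h y x z) + (S (λ x y z → h z x y) + (S (λ x y z → h y z x) + S (λ x y z → h z y x)))))
      ∑₃-+₆ : ∀ a b c d e f → ∑₃ (λ x y z → a x y z + (b x y z + (c x y z + (d x y z + (e x y z + f x y z))))) ≡ ∑₃ a + (∑₃ b + (∑₃ c + (∑₃ d + (∑₃ e + ∑₃ f))))
      ∑₃-+₆ a b c d e f = trans (∑₃-+ _ _) (cong (∑₃ a +_) (trans (∑₃-+ _ _) (cong (∑₃ b +_) (trans (∑₃-+ _ _) (cong (∑₃ c +_) (trans (∑₃-+ _ _) (cong (∑₃ d +_) (∑₃-+ _ _))))))))
      separate : ∑₃ (λ x y z → s x y z * h x y z + (s x z y * h x y z + (s y x z * h x y z + (s y z x * h x y z + (s z x y * h x y z + s z y x * h x y z))))) ≡ target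
      separate = trans (∑₃-+₆ _ _ _ _ _ _) (cong (S h +_) (cong₂ _+_ (s₂₃ _) (cong₂ _+_ (s₁₂ _) (cong₂ _+_
          (trans (s₁₂ _) (s₂₃ (λ x y z → s x z y * h y x z)))
          (cong₂ _+_ (trans (s₂₃ _) (s₁₂ (λ x y z → s y x z * h x z y))) (trans (s₁₂ _) (trans (s₂₃ (λ x y z → s z x y * h y x z)) (s₁₂ (λ x y z → s y x z * h z x y)))))))))
      reassoc : ∀ a b c d e f g h → a * (b * (c + (d + (e + (f + (g + h)))))) ≡ a * b * c + (a * b * d + (a * b * e + (a * b * g + (a * b * f + a * b * h))))
      reassoc = solve 8 (λ a b c d e f g h →
        a :* (b :* (c :+ (d :+ (e :+ (f :+ (g :+ h))))))
        := a :* b :* c :+ (a :* b :* d :+ (a :* b :* e :+ (a :* b :* g :+ (a :* b :* f :+ a :* b :* h))))) refl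
      together : sorted₃ (symmetrised h) ≡ target
      together = trans (∑₃-cong λ x y z → reassoc ⟦ x ≺ y ⟧ ⟦ y ≺ z ⟧ (h x y z) (h x z y) (h y x z) (h y z x) (h z x y) (h z y x)) (∑₃-+₆ _ _ _ _ _ _)

  -- Counting inside a set, with weights in place of its indicator; the subscript is the number of
  -- vertices counted at a time.
  ∣_∩_∣₃ : ∀ {n} → (Fin n → Fin n → Fin n → ℚ) → Vec ℚ n → ℚ
  ∣ c ∩ v ∣₃ = sorted₃ λ x y z → c x y z * (lookup v x * (lookup v y * lookup v z))

  ∣_∩_∣₂ : ∀ {n} → (Fin n → Fin n → ℚ) → Vec ℚ n → ℚ
  ∣ c ∩ v ∣₂ = sorted₂ λ x y → c x y * (lookup v x * lookup v y)

  ∣_∩_∣₁ : ∀ {n} → (Fin n → ℚ) → Vec ℚ n → ℚ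
  ∣ c ∩ v ∣₁ = ∑ λ x → c x * lookup v x

  module _ {n : ℕ} where
    ∩-∷₁ : ∀ (c : Fin (suc n) → ℚ) t v → ∣ c ∩ t ∷ v ∣₁ ≡ t * c zero + ∣ (λ x → c (suc x)) ∩ v ∣₁
    ∩-∷₁ c t v = trans (∑-suc _) (cong (_+ ∣ (λ x → c (suc x)) ∩ v ∣₁) (*-comm _ _))

    ∩-∷₂ : ∀ (c : Fin (suc n) → Fin (suc n) → ℚ) t v → ∣ c ∩ t ∷ v ∣₂ ≡ t * ∣ (λ y → c zero (suc y)) ∩ v ∣₁ + ∣ (λ x y → c (suc x) (suc y)) ∩ v ∣₂
    ∩-∷₂ c t v = trans (sorted₂-suc _) (cong (_+ ∣ (λ x y → c (suc x) (suc y)) ∩ v ∣₂) (trans (∑-cong λ y → lem (c zero (suc y)) t (lookup v y)) (∑-*ˡ t _)))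
      where
      lem : ∀ c t v → c * (t * v) ≡ t * (c * v)
      lem = solve 3 (λ c t v → c :* (t :* v) := t :* (c :* v)) refl

    ∩-∷₃ : ∀ (c : Fin (suc n) → Fin (suc n) → Fin (suc n) → ℚ) t v →
      ∣ c ∩ t ∷ v ∣₃ ≡ t * ∣ (λ y z → c zero (suc y) (suc z)) ∩ v ∣₂ + ∣ (λ x y z → c (suc x) (suc y) (suc z)) ∩ v ∣₃
    ∩-∷₃ c t v = trans (sorted₃-suc _) (cong (_+ ∣ (λ x y z → c (suc x) (suc y) (suc z)) ∩ v ∣₃)
        (trans (∑-cong λ y → trans (∑-cong λ z → lem (c zero (suc y) (suc z)) t ⟦ y ≺ z ⟧ (lookup v y) (lookup v z)) (∑-*ˡ t _)) (∑-*ˡ t _)))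
      where
      lem : ∀ c t b v w → b * (c * (t * (v * w))) ≡ t * (b * (c * (v * w)))
      lem = solve 5 (λ c t b v w → b :* (c :* (t :* (v :* w))) := t :* (b :* (c :* (v :* w)))) refl

  indicator : ∀ {n} → Subset n → Vec ℚ n
  indicator = Vec.map ⟦_⟧

  private
    pascal : ∀ b u r → ⟦ b ⟧ * nat (u C r) + nat (u C suc r) ≡ nat ((if b then suc u else u) C suc r)
    pascal true u r = trans (cong (_+ nat (u C suc r)) (*-identityˡ _)) (trans (sym (nat-+ (u C r) (u C suc r))) (cong nat (nCk+nC[k+1]≡[n+1]C[k+1] u r)))
    pascal false u r = trans (cong (_+ nat (u C suc r)) (zeroˡ _)) (+-identityˡ _)

    count-∷ : ∀ {n} b (U : Subset n) → Subset.∣ b ∷ U ∣ ≡ (if b then suc Subset.∣ U ∣ else Subset.∣ U ∣)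
    count-∷ true U = refl
    count-∷ false U = refl

    nat-C0 : ∀ u → 1ℚ ≡ nat (u C 0)
    nat-C0 u = sym (trans (nat-suc 0) (trans (cong (1ℚ +_) nat-0) (+-identityʳ 1ℚ)))

    nat-0C : ∀ r → 0ℚ ≡ nat (0 C suc r)
    nat-0C r = sym nat-0

  -- Peeling off the first vertex is Pascal's rule; the same holds for pairs and triples.
  C₁ : ∀ {n} (U : Subset n) → ∣ (λ _ → 1ℚ) ∩ indicator U ∣₁ ≡ nat (Subset.∣ U ∣ C 1)
  C₁ [] = trans (∑-zero _) (nat-0C 0)
  C₁ (b ∷ U) = trans (∩-∷₁ _ ⟦ b ⟧ (indicator U)) (trans (cong₂ (λ s t → ⟦ b ⟧ * s + t) (nat-C0 Subset.∣ U ∣) (C₁ U)) (trans (pascal b Subset.∣ U ∣ 0) (cong (λ u → nat (u C 1)) (sym (count-∷ b U)))))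

  C₂ : ∀ {n} (U : Subset n) → ∣ (λ _ _ → 1ℚ) ∩ indicator U ∣₂ ≡ nat (Subset.∣ U ∣ C 2)
  C₂ [] = trans (∑-zero _) (nat-0C 1)
  C₂ (b ∷ U) = trans (∩-∷₂ _ ⟦ b ⟧ (indicator U)) (trans (cong₂ (λ s t → ⟦ b ⟧ * s + t) (C₁ U) (C₂ U)) (trans (pascal b Subset.∣ U ∣ 1) (cong (λ u → nat (u C 2)) (sym (count-∷ b U)))))

  C₃ : ∀ {n} (U : Subset n) → ∣ (λ _ _ _ → 1ℚ) ∩ indicator U ∣₃ ≡ nat (Subset.∣ U ∣ C 3)
  C₃ [] = trans (∑-zero _) (nat-0C 2)
  C₃ (b ∷ U) = trans (∩-∷₃ _ ⟦ b ⟧ (indicator U)) (trans (cong₂ (λ s t → ⟦ b ⟧ * s + t) (C₂ U) (C₃ U)) (trans (pascal b Subset.∣ U ∣ 2) (cong (λ u → nat (u C 3)) (sym (count-∷ b U)))))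

  private
    sum-concatMap : ∀ {n} {A : Set} (g : Fin n → A) (f : A → List ℕ) → nat (sum (concatMap f (tabulate g))) ≡ ∑ λ i → nat (sum (f (g i)))
    sum-concatMap {zero} g f = trans nat-0 (sym (∑-zero _))
    sum-concatMap {suc n} g f = trans (cong nat (sum-++ (f (g zero)) _)) (trans (nat-+ (sum (f (g zero))) _)
      (trans (cong (nat (sum (f (g zero))) +_) (sum-concatMap (λ i → g (suc i)) f)) (sym (∑-suc _))))

    sum-map : ∀ {n} {A : Set} (g : Fin n → A) (f : A → ℕ) → nat (sum (List.map f (tabulate g))) ≡ ∑ λ i → nat (f (g i))
    sum-map {zero} g f = trans nat-0 (sym (∑-zero _))
    sum-map {suc n} g f = trans (nat-+ (f (g zero)) _) (trans (cong (nat (f (g zero)) +_) (sum-map (λ i → g (suc i)) f)) (sym (∑-suc _)))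

    nat-if : ∀ b → nat (if b then 1 else 0) ≡ ⟦ b ⟧
    nat-if true = sym (nat-C0 0)
    nat-if false = nat-0

  edges : ∀ {n} → Graph3 n → Fin n → Fin n → Fin n → ℚ
  edges H x y z = ⟦ Graph3.E H x y z ⟧

  edgesIn-∩ : ∀ {n} (H : Graph3 n) (U : Subset n) → nat (edgesIn H U) ≡ ∣ edges H ∩ indicator U ∣₃
  edgesIn-∩ H U = trans (sum-concatMap _ _) (∑-cong λ x → trans (sum-concatMap _ _) (∑-cong λ y → trans (sum-map _ _) (∑-cong λ z → trans (nat-if _) (term x y z))))
    where
    lem : ∀ a b u v w e → a * (b * (u * (v * (w * e)))) ≡ a * (b * (e * (u * (v * w))))
    lem = solve 6 (λ a b u v w e → a :* (b :* (u :* (v :* (w :* e)))) := a :* (b :* (e :* (u :* (v :* w))))) refl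
    at : ∀ x → ⟦ lookup U x ⟧ ≡ lookup (indicator U) x
    at x = go U x
      where
      go : ∀ {n} (U : Subset n) x → ⟦ lookup U x ⟧ ≡ lookup (indicator U) x
      go (b ∷ U) zero = refl
      go (b ∷ U) (suc x) = go U x
    term : ∀ x y z → ⟦ (toℕ x ℕ.<ᵇ toℕ y) ∧ (toℕ y ℕ.<ᵇ toℕ z) ∧ lookup U x ∧ lookup U y ∧ lookup U z ∧ Graph3.E H x y z ⟧ ≡
      ⟦ x ≺ y ⟧ * (⟦ y ≺ z ⟧ * (edges H x y z * (lookup (indicator U) x * (lookup (indicator U) y * lookup (indicator U) z))))
    term x y z = trans (⟦∧⟧ (x ≺ y) _) (trans (cong (⟦ x ≺ y ⟧ *_) (trans (⟦∧⟧ (y ≺ z) _) (cong (⟦ y ≺ z ⟧ *_)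
      (trans (⟦∧⟧ (lookup U x) _) (cong₂ _*_ (at x) (trans (⟦∧⟧ (lookup U y) _) (cong₂ _*_ (at y) (trans (⟦∧⟧ (lookup U z) _) (cong₂ _*_ (at z) refl)))))))))
      (lem ⟦ x ≺ y ⟧ ⟦ y ≺ z ⟧ _ _ _ _))

-- Lower bound: cyclic triangles of skew Hadamard tournaments.

module Lower where
  open import Data.Nat.Combinatorics using (_C_)
  open import Data.Fin as Fin using (splitAt; _↑ˡ_; _↑ʳ_)
  open import Data.Fin.Subset using (Subset)
  import Data.Fin.Subset as Subset
  open import Data.Vec using (lookup)
  open import Data.Vec.Properties using (lookup-map)
  open import Data.Bool.Properties using (not-involutive; ∧-comm; ∨-comm)
  import Data.Rational as Rat
  open import Defs
  open Field
  open Base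
  open Count
  open Arith
  open Sorted

  excess-transparent : ∀ d a μ b → d * a - μ * b ≡ d Rat.* a Rat.- μ Rat.* b
  excess-transparent d a μ b = trans (+-transparent _ _) (cong₂ Rat._+_ (*-transparent d a) (trans (neg-transparent _) (cong Rat.-_ (*-transparent μ b))))

  dense-transparent : ∀ {n} d μ (H : Graph3 n) → (∀ U → d * nat (Subset.∣ U ∣ C 3) - μ * nat (n ℕ.^ 3) ≤ nat (edgesIn H U)) → Dense d μ H
  dense-transparent {n} d μ H h U = subst₂ _≤_ (trans (cong₂ (λ a b → d * a - μ * b) (nat-fromℕ (Subset.∣ U ∣ C 3)) (nat-fromℕ (n ℕ.^ 3))) (excess-transparent d _ μ _)) (nat-fromℕ (edgesIn H U)) (h U)

  dense-opaque : ∀ {n} d μ (H : Graph3 n) → Dense d μ H → ∀ U → d * nat (Subset.∣ U ∣ C 3) - μ * nat (n ℕ.^ 3) ≤ nat (edgesIn H U)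
  dense-opaque {n} d μ H h U = subst₂ _≤_ (sym (trans (cong₂ (λ a b → d * a - μ * b) (nat-fromℕ (Subset.∣ U ∣ C 3)) (nat-fromℕ (n ℕ.^ 3))) (excess-transparent d _ μ _))) (sym (nat-fromℕ (edgesIn H U))) (h U)

  degenerate-count : ∀ n → ∑₃ {n} (λ x y z → ⟦ degenerate x y z ⟧) ≤ nat 3 * (nat n * nat n)
  degenerate-count n = ≤-trans (∑₃-mono λ x y z → union (x ≡ᶠ y) (y ≡ᶠ z) (x ≡ᶠ z)) (≤-reflexive (trans (∑₃-+ _ _) (trans (cong₂ _+_ e₁ (trans (∑₃-+ _ _) (cong₂ _+_ e₂ e₃))) (three (nat n * nat n)))))
    where
    N = nat n
    union : ∀ a b c → ⟦ a ∨ b ∨ c ⟧ ≤ ⟦ a ⟧ + (⟦ b ⟧ + ⟦ c ⟧)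
    union true b c = le (⟦ b ⟧ + ⟦ c ⟧) (0≤+ (0≤⟦⟧ b) (0≤⟦⟧ c)) refl
    union false true c = le (0ℚ + ⟦ c ⟧) (0≤+ ≤-refl (0≤⟦⟧ c)) (lem 1ℚ ⟦ c ⟧)
      where
      lem : ∀ a c → 0ℚ + (a + c) ≡ a + (0ℚ + c)
      lem = solve 2 (λ a c → con 0ℚ :+ (a :+ c) := a :+ ((con 0ℚ) :+ c)) refl
    union false false c = ≤-reflexive (lem ⟦ c ⟧)
      where
      lem : ∀ c → c ≡ 0ℚ + (0ℚ + c)
      lem = solve 1 (λ c → c := con 0ℚ :+ ((con 0ℚ) :+ c)) refl
    total : ∀ x → ∑ (λ y → ⟦ x ≡ᶠ y ⟧) ≡ 1ℚ
    total x = trans (∑-cong λ y → sym (*-identityʳ _)) (∑-≡ᶠ x (λ _ → 1ℚ))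
    e₁ : ∑₃ (λ x y z → ⟦ x ≡ᶠ y ⟧) ≡ N * N
    e₁ = trans (∑-cong λ x → trans (∑-cong λ y → ∑-const _) (trans (∑-*ˡ _ _) (trans (cong (N *_) (total x)) (*-identityʳ N)))) (∑-const N)
    e₂ : ∑₃ (λ x y z → ⟦ y ≡ᶠ z ⟧) ≡ N * N
    e₂ = trans (∑-cong λ x → trans (∑-cong λ y → total y) refl) (∑-const N)
    e₃ : ∑₃ (λ x y z → ⟦ x ≡ᶠ z ⟧) ≡ N * N
    e₃ = trans (∑-cong λ x → trans (∑-cong λ y → total x) refl) (∑-const N)
    three : ∀ s → s + (s + s) ≡ nat 3 * s
    three s = trans (l s) (cong (_* s) (sym (trans (nat-suc 2) (cong (1ℚ +_) (trans (nat-suc 1) (cong (1ℚ +_) (trans (nat-suc 0) (cong (1ℚ +_) nat-0))))))))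
      where
      l : ∀ s → s + (s + s) ≡ (1ℚ + (1ℚ + (1ℚ + 0ℚ))) * s
      l = solve 1 (λ s → s :+ (s :+ s) := ((con 1ℚ) :+ ((con 1ℚ) :+ ((con 1ℚ) :+ (con 0ℚ)))) :* s) refl

  σ : Bool → ℚ
  σ true = 1ℚ
  σ false = - 1ℚ

  σ-not : ∀ b → σ (not b) ≡ - σ b
  σ-not true = refl
  σ-not false = lem 0ℚ
    where
    lem : ∀ x → 1ℚ ≡ - (- 1ℚ)
    lem = solve 1 (λ x → con 1ℚ := :- (:- (con 1ℚ))) refl

  order : ℕ → ℕ
  order zero = 1
  order (suc k) = order k ℕ.+ order k

  order≥ : ∀ k → k ℕ.≤ order k
  order≥ zero = ℕ.z≤n
  order≥ (suc k) = ℕₚ.≤-trans (ℕₚ.≤-reflexive (ℕₚ.+-comm 1 k)) (ℕₚ.+-mono-≤ (order≥ k) (1≤ k))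
    where
    1≤ : ∀ k → 1 ℕ.≤ order k
    1≤ zero = ℕₚ.≤-refl
    1≤ (suc k) = ℕₚ.≤-trans (1≤ k) (ℕₚ.m≤m+n _ _)

  -- The doubling of a skew Hadamard matrix H is the block matrix with rows (H , H) and (-Hᵀ , Hᵀ).
  double : ∀ {A : Set} → (A → A → Bool) → A ⊎ A → A ⊎ A → Bool
  double t (inj₁ x) (inj₁ y) = t x y
  double t (inj₁ x) (inj₂ y) = t x y
  double t (inj₂ x) (inj₁ y) = not (t y x)
  double t (inj₂ x) (inj₂ y) = t y x

  beats : ∀ k → Fin (order k) → Fin (order k) → Bool
  beats zero x y = true
  beats (suc k) x y = double (beats k) (splitAt (order k) x) (splitAt (order k) y)

  beats-antisym : ∀ k x y → x ≢ y → beats k x y ≡ not (beats k y x)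
  beats-antisym zero zero zero h = ⊥-elim (h refl)
  beats-antisym (suc k) x y h = go (splitAt (order k) x) (splitAt (order k) y) λ e →
      h (trans (sym (Finₚ.join-splitAt (order k) (order k) x)) (trans (cong (Fin.join (order k) (order k)) e) (Finₚ.join-splitAt (order k) (order k) y)))
    where
    go : ∀ p q → p ≢ q → double (beats k) p q ≡ not (double (beats k) q p)
    go (inj₁ x) (inj₁ y) h = beats-antisym k x y λ e → h (cong inj₁ e)
    go (inj₁ x) (inj₂ y) h = sym (not-involutive _)
    go (inj₂ x) (inj₁ y) h = refl
    go (inj₂ x) (inj₂ y) h = beats-antisym k y x λ e → h (cong inj₂ (sym e))

  ∑-splitAt : ∀ m {n} (f : Fin (m ℕ.+ n) → ℚ) → ∑ f ≡ ∑ (λ i → f (i ↑ˡ n)) + ∑ (λ j → f (m ↑ʳ j))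
  ∑-splitAt zero {n} f = sym (trans (cong (_+ ∑ f) (∑-zero _)) (+-identityˡ _))
  ∑-splitAt (suc m) {n} f = trans (∑-suc f) (trans (cong (f zero +_) (∑-splitAt m (λ i → f (suc i)))) (trans (sym (+-assoc _ _ _)) (cong (_+ ∑ (λ j → f (suc (m ↑ʳ j)))) (sym (∑-suc _)))))

  apply : ∀ {n} → (Fin n → Fin n → Bool) → (Fin n → ℚ) → Fin n → ℚ
  apply t a x = ∑ λ y → σ (t x y) * a y

  norm² : ∀ {n} → (Fin n → ℚ) → ℚ
  norm² a = ∑ λ x → a x * a x

  module _ {n : ℕ} where
    apply-+ : ∀ t (b c : Fin n → ℚ) x → apply t b x + apply t c x ≡ apply t (λ y → b y + c y) x
    apply-+ t b c x = sym (trans (∑-cong λ y → lem (σ (t x y)) (b y) (c y)) (∑-+ _ _))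
      where
      lem : ∀ s b c → s * (b + c) ≡ s * b + s * c
      lem = solve 3 (λ s b c → s :* (b :+ c) := s :* b :+ s :* c) refl

    apply-- : ∀ t (b c : Fin n → ℚ) x → apply t b x - apply t c x ≡ apply t (λ y → b y - c y) x
    apply-- t b c x = sym (trans (∑-cong λ y → lem (σ (t x y)) (b y) (c y)) (∑-- _ _))
      where
      lem : ∀ s b c → s * (b - c) ≡ s * b - s * c
      lem = solve 3 (λ s b c → s :* (b :- c) := s :* b :- s :* c) refl

    parallelogram : ∀ (b c : Fin n → ℚ) → norm² (λ y → b y + c y) + norm² (λ y → c y - b y) ≡ 2ᵣ * (norm² b + norm² c)
    parallelogram b c = trans (sym (∑-+ _ _)) (trans (∑-cong λ y → lem (b y) (c y)) (trans (∑-*ˡ 2ᵣ _) (cong (2ᵣ *_) (∑-+ _ _))))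
      where
      lem : ∀ b c → (b + c) * (b + c) + (c - b) * (c - b) ≡ 2ᵣ * (b * b + c * c)
      lem = solve 2 (λ b c → (b :+ c) :* (b :+ c) :+ (c :- b) :* (c :- b) := con 2ᵣ :* (b :* b :+ c :* c)) refl

  apply-neg : ∀ {n} (t : Fin n → Fin n → Bool) b x → apply (λ x y → not (t x y)) b x ≡ - apply t b x
  apply-neg t b x = trans (∑-cong λ y → trans (cong (_* b y) (σ-not (t x y))) (lem (σ (t x y)) (b y))) (∑-neg _)
    where
    lem : ∀ s b → (- s) * b ≡ - (s * b)
    lem = solve 2 (λ s b → (:- s) :* b := :- (s :* b)) refl

  -- Proved together with the transposed statement, since the doubled matrix contains both the
  -- matrix and its transpose; each step is the parallelogram identity for the two halves.
  isometry : ∀ k a → norm² (apply (beats k) a) ≡ nat (order k) * norm² a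
  isometryᵗ : ∀ k a → norm² (apply (λ x y → beats k y x) a) ≡ nat (order k) * norm² a

  private
    double-nat : ∀ n s t u → s + t ≡ 2ᵣ * u → nat n * s + nat n * t ≡ nat (n ℕ.+ n) * u
    double-nat n s t u e = trans (l₁ (nat n) s t) (trans (cong (nat n *_) e) (trans (l₂ (nat n) u) (cong (_* u) (sym (nat-+ n n)))))
      where
      l₁ : ∀ n s t → n * s + n * t ≡ n * (s + t)
      l₁ = solve 3 (λ n s t → n :* s :+ n :* t := n :* (s :+ t)) refl
      l₂ : ∀ n u → n * (2ᵣ * u) ≡ (n + n) * u
      l₂ = solve 2 (λ n u → n :* ((con 2ᵣ) :* u) := (n :+ n) :* u) refl

    unit-case : ∀ a → norm² (apply {1} (λ _ _ → true) a) ≡ nat 1 * norm² a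
    unit-case a = trans (one _) (trans (cong₂ _*_ e e) (trans (sym (one λ x → a x * a x)) (trans (sym (*-identityˡ _)) (cong (_* norm² a) (sym (trans (nat-suc 0) (trans (cong (1ℚ +_) nat-0) (+-identityʳ 1ℚ))))))))
      where
      one : (f : Fin 1 → ℚ) → ∑ f ≡ f zero
      one f = trans (∑-suc f) (trans (cong (f zero +_) (∑-zero _)) (+-identityʳ _))
      e : apply {1} (λ _ _ → true) a zero ≡ a zero
      e = trans (one _) (*-identityˡ _)

  module Doubling (k : ℕ) (a : Fin (order k ℕ.+ order k) → ℚ) where
    m : ℕ
    m = order k
    b c : Fin m → ℚ
    b y = a (y ↑ˡ m)
    c y = a (m ↑ʳ y)
    t tᵗ : Fin m → Fin m → Bool
    t = beats k
    tᵗ x y = beats k y x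

    splitˡ : ∀ x → splitAt m (x ↑ˡ m) ≡ inj₁ x
    splitˡ x = Finₚ.splitAt-↑ˡ m x m
    splitʳ : ∀ x → splitAt m (m ↑ʳ x) ≡ inj₂ x
    splitʳ x = Finₚ.splitAt-↑ʳ m m x

    halves : ∀ (s : Fin (m ℕ.+ m) → Bool) (p q : Fin m → Bool) → (∀ y → s (y ↑ˡ m) ≡ p y) → (∀ y → s (m ↑ʳ y) ≡ q y) →
      ∑ (λ y → σ (s y) * a y) ≡ ∑ (λ y → σ (p y) * b y) + ∑ (λ y → σ (q y) * c y)
    halves s p q hp hq = trans (∑-splitAt m _) (cong₂ _+_ (∑-cong λ y → cong (λ t → σ t * b y) (hp y)) (∑-cong λ y → cong (λ t → σ t * c y) (hq y)))

    norm-halves : ∀ (f : Fin (m ℕ.+ m) → ℚ) (p q : Fin m → ℚ) → (∀ y → f (y ↑ˡ m) ≡ p y) → (∀ y → f (m ↑ʳ y) ≡ q y) → norm² f ≡ norm² p + norm² q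
    norm-halves f p q hp hq = trans (∑-splitAt m _) (cong₂ _+_ (∑-cong λ y → cong (λ t → t * t) (hp y)) (∑-cong λ y → cong (λ t → t * t) (hq y)))

    rows : norm² (apply (beats (suc k)) a) ≡ norm² (apply t (λ y → b y + c y)) + norm² (apply tᵗ (λ y → c y - b y))
    rows = norm-halves _ _ _
      (λ x → trans (halves (beats (suc k) (x ↑ˡ m)) (t x) (t x) (λ y → cong₂ (double t) (splitˡ x) (splitˡ y)) (λ y → cong₂ (double t) (splitˡ x) (splitʳ y))) (apply-+ t b c x))
      (λ x → trans (halves (beats (suc k) (m ↑ʳ x)) (λ y → not (tᵗ x y)) (tᵗ x) (λ y → cong₂ (double t) (splitʳ x) (splitˡ y)) (λ y → cong₂ (double t) (splitʳ x) (splitʳ y)))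
        (trans (cong (_+ apply tᵗ c x) (apply-neg tᵗ b x)) (trans (lem (apply tᵗ b x) (apply tᵗ c x)) (apply-- tᵗ c b x))))
      where
      lem : ∀ p q → - p + q ≡ q - p
      lem = solve 2 (λ p q → :- p :+ q := q :- p) refl

    columns : norm² (apply (λ x y → beats (suc k) y x) a) ≡ norm² (λ x → apply t c x - apply tᵗ b x) + norm² (λ x → apply tᵗ b x + apply t c x)
    columns = trans (norm-halves _ (λ x → apply tᵗ b x - apply t c x) _
      (λ x → trans (halves (λ y → beats (suc k) y (x ↑ˡ m)) (tᵗ x) (λ y → not (t x y)) (λ y → cong₂ (double t) (splitˡ y) (splitˡ x)) (λ y → cong₂ (double t) (splitʳ y) (splitˡ x))) (cong (apply tᵗ b x +_) (apply-neg t c x)))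
      (λ x → halves (λ y → beats (suc k) y (m ↑ʳ x)) (tᵗ x) (t x) (λ y → cong₂ (double t) (splitˡ y) (splitʳ x)) (λ y → cong₂ (double t) (splitʳ y) (splitʳ x))))
      (cong (_+ norm² (λ x → apply tᵗ b x + apply t c x)) (∑-cong λ x → lem (apply tᵗ b x) (apply t c x)))
      where
      lem : ∀ p q → (p - q) * (p - q) ≡ (q - p) * (q - p)
      lem = solve 2 (λ p q → (p :- q) :* (p :- q) := (q :- p) :* (q :- p)) refl

  isometry zero a = unit-case a
  isometry (suc k) a = trans rows (trans (cong₂ _+_ (isometry k _) (isometryᵗ k _)) (double-nat m _ _ _ (trans (parallelogram b c) (cong (2ᵣ *_) (sym (∑-splitAt m _))))))
    where open Doubling k a

  isometryᵗ zero a = unit-case a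
  isometryᵗ (suc k) a = trans columns (trans (+-comm _ _) (trans (parallelogram (apply tᵗ b) (apply t c)) (trans (cong (2ᵣ *_) (cong₂ _+_ (isometryᵗ k b) (isometry k c)))
      (trans (lem (nat m) (norm² b) (norm² c)) (trans (cong (_* (norm² b + norm² c)) (sym (nat-+ m m))) (cong (nat (m ℕ.+ m) *_) (sym (∑-splitAt m _))))))))
    where
    open Doubling k a
    lem : ∀ n b c → 2ᵣ * (n * b + n * c) ≡ (n + n) * (b + c)
    lem = solve 3 (λ n b c → con 2ᵣ :* (n :* b :+ n :* c) := (n :+ n) :* (b :+ c)) refl

  module CyclicTriangles (k : ℕ) where
    n : ℕ
    n = order k
    t : Fin n → Fin n → Bool
    t = beats k

    cyclic : Bool → Bool → Bool → Bool → Bool → Bool → Bool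
    cyclic ab bc ca ba cb ac = (ab ∧ bc ∧ ca) ∨ (ba ∧ cb ∧ ac)

    H : Graph3 n
    H = record
      { E = λ a b c → cyclic (t a b) (t b c) (t c a) (t b a) (t c b) (t a c)
      ; sym₁₂ = λ a b c → trans (∨-comm (t a b ∧ t b c ∧ t c a) _) (cong₂ _∨_ (cong (t b a ∧_) (∧-comm (t c b) _)) (cong (t a b ∧_) (∧-comm (t b c) _)))
      ; sym₂₃ = λ a b c → trans (∨-comm (t a b ∧ t b c ∧ t c a) _) (cong₂ _∨_ (rev (t b a) (t c b) (t a c)) (rev (t a b) (t b c) (t c a))) }
      where
      rev : ∀ p q r → p ∧ q ∧ r ≡ r ∧ q ∧ p
      rev true true r = sym (∧-true' r)
        where
        ∧-true' : ∀ r → r ∧ true ≡ r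
        ∧-true' true = refl
        ∧-true' false = refl
      rev true false r = sym (∧-false' r)
        where
        ∧-false' : ∀ r → r ∧ false ≡ false
        ∧-false' true = refl
        ∧-false' false = refl
      rev false q true = sym (∧-false' q)
        where
        ∧-false' : ∀ r → r ∧ false ≡ false
        ∧-false' true = refl
        ∧-false' false = refl
      rev false q false = refl

    -- Two oriented triangles of K₄ through a common vertex force the third one to be transitive.
    no-K₄⁻ : ∀ a b c d → a ≢ b → a ≢ c → a ≢ d → Graph3.E H a b c ≡ true → Graph3.E H a b d ≡ true → Graph3.E H a c d ≡ true → ⊥
    no-K₄⁻ a b c d ab ac ad = go (t a b) (t b a) (t a c) (t c a) (t a d) (t d a) (t b c) (t c b) (t b d) (t d b) (t c d) (t d c)
        (beats-antisym k a b ab) (beats-antisym k a c ac) (beats-antisym k a d ad)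
      where
      go : ∀ ab ba ac ca ad da bc cb bd db cd dc → ab ≡ not ba → ac ≡ not ca → ad ≡ not da →
        cyclic ab bc ca ba cb ac ≡ true → cyclic ab bd da ba db ad ≡ true → cyclic ac cd da ca dc ad ≡ true → ⊥
      go _ true _ true _ _ true true _ _ _ _ refl refl refl () _ _
      go _ true _ true _ _ true false _ _ _ _ refl refl refl () _ _
      go _ true _ true _ _ false true _ _ _ _ refl refl refl () _ _
      go _ true _ true _ _ false false _ _ _ _ refl refl refl () _ _
      go _ false _ false _ _ true _ _ _ _ _ refl refl refl () _ _
      go _ false _ false _ _ false _ _ _ _ _ refl refl refl () _ _
      go _ true _ false _ true _ _ _ true _ _ refl refl refl _ () _
      go _ true _ false _ true _ _ _ false _ _ refl refl refl _ () _
      go _ true _ false _ false _ _ _ _ true _ refl refl refl _ _ ()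
      go _ true _ false _ false _ _ _ _ false _ refl refl refl _ _ ()
      go _ false _ true _ true _ _ _ _ _ true refl refl refl _ _ ()
      go _ false _ true _ true _ _ _ _ _ false refl refl refl _ _ ()
      go _ false _ true _ false _ _ true _ _ _ refl refl refl _ () _
      go _ false _ true _ false _ _ false _ _ _ refl refl refl _ () _

    -- The edges abc, abd, acd of the pattern form a K₄⁻.
    free : F7-free H
    free (φ , inj , e) = no-K₄⁻ (φ vA) (φ vB) (φ vC) (φ vD) (λ p → case-01 (inj p)) (λ p → case-02 (inj p)) (λ p → case-03 (inj p))
        (e vA vB vC here) (e vA vB vD (there here)) (e vA vC vD (there (there here)))
      where
      case-01 : vA ≡ vB → ⊥
      case-01 ()
      case-02 : vA ≡ vC → ⊥
      case-02 ()
      case-03 : vA ≡ vD → ⊥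
      case-03 ()

    centre : Fin n → Fin n → Fin n → ℚ
    centre x y z = σ (t x y) * σ (t x z)

    -- A transitive triple has centre sum 1, a cyclic one -3.
    centres : Fin n → Fin n → Fin n → ℚ
    centres x y z = centre x y z + (centre y x z + centre z x y)

    private
      values : ∀ xy yx xz zx yz zy → xy ≡ not yx → xz ≡ not zx → yz ≡ not zy →
        1ℚ ≡ 4ᵣ * ⟦ cyclic xy yz zx yx zy xz ⟧ + (σ xy * σ xz + (σ yx * σ yz + σ zx * σ zy))
      values _ true _ true _ true refl refl refl = v 0ℚ
        where
        v : ∀ x → 1ℚ ≡ 4ᵣ * 0ℚ + ((- 1ℚ) * (- 1ℚ) + (1ℚ * (- 1ℚ) + 1ℚ * 1ℚ))
        v = solve 1 (λ x →
          con 1ℚ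
          := con 4ᵣ :* (con 0ℚ) :+ ((:- (con 1ℚ)) :* (:- (con 1ℚ)) :+ ((con 1ℚ) :* (:- (con 1ℚ)) :+ (con 1ℚ) :* (con 1ℚ)))) refl
      values _ true _ true _ false refl refl refl = v 0ℚ
        where
        v : ∀ x → 1ℚ ≡ 4ᵣ * 0ℚ + ((- 1ℚ) * (- 1ℚ) + (1ℚ * 1ℚ + 1ℚ * (- 1ℚ)))
        v = solve 1 (λ x →
          con 1ℚ
          := con 4ᵣ :* (con 0ℚ) :+ ((:- (con 1ℚ)) :* (:- (con 1ℚ)) :+ ((con 1ℚ) :* (con 1ℚ) :+ (con 1ℚ) :* (:- (con 1ℚ))))) refl
      values _ true _ false _ true refl refl refl = v 0ℚ
        where
        v : ∀ x → 1ℚ ≡ 4ᵣ * 1ℚ + ((- 1ℚ) * 1ℚ + (1ℚ * (- 1ℚ) + (- 1ℚ) * 1ℚ))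
        v = solve 1 (λ x →
          con 1ℚ
          := con 4ᵣ :* (con 1ℚ) :+ ((:- (con 1ℚ)) :* (con 1ℚ) :+ ((con 1ℚ) :* (:- (con 1ℚ)) :+ (:- (con 1ℚ)) :* (con 1ℚ)))) refl
      values _ true _ false _ false refl refl refl = v 0ℚ
        where
        v : ∀ x → 1ℚ ≡ 4ᵣ * 0ℚ + ((- 1ℚ) * 1ℚ + (1ℚ * 1ℚ + (- 1ℚ) * (- 1ℚ)))
        v = solve 1 (λ x →
          con 1ℚ
          := con 4ᵣ :* (con 0ℚ) :+ ((:- (con 1ℚ)) :* (con 1ℚ) :+ ((con 1ℚ) :* (con 1ℚ) :+ (:- (con 1ℚ)) :* (:- (con 1ℚ))))) refl
      values _ false _ true _ true refl refl refl = v 0ℚ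
        where
        v : ∀ x → 1ℚ ≡ 4ᵣ * 0ℚ + (1ℚ * (- 1ℚ) + ((- 1ℚ) * (- 1ℚ) + 1ℚ * 1ℚ))
        v = solve 1 (λ x →
          con 1ℚ
          := con 4ᵣ :* (con 0ℚ) :+ ((con 1ℚ) :* (:- (con 1ℚ)) :+ ((:- (con 1ℚ)) :* (:- (con 1ℚ)) :+ (con 1ℚ) :* (con 1ℚ)))) refl
      values _ false _ true _ false refl refl refl = v 0ℚ
        where
        v : ∀ x → 1ℚ ≡ 4ᵣ * 1ℚ + (1ℚ * (- 1ℚ) + ((- 1ℚ) * 1ℚ + 1ℚ * (- 1ℚ)))
        v = solve 1 (λ x →
          con 1ℚ
          := con 4ᵣ :* (con 1ℚ) :+ ((con 1ℚ) :* (:- (con 1ℚ)) :+ ((:- (con 1ℚ)) :* (con 1ℚ) :+ (con 1ℚ) :* (:- (con 1ℚ))))) refl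
      values _ false _ false _ true refl refl refl = v 0ℚ
        where
        v : ∀ x → 1ℚ ≡ 4ᵣ * 0ℚ + (1ℚ * 1ℚ + ((- 1ℚ) * (- 1ℚ) + (- 1ℚ) * 1ℚ))
        v = solve 1 (λ x →
          con 1ℚ
          := con 4ᵣ :* (con 0ℚ) :+ ((con 1ℚ) :* (con 1ℚ) :+ ((:- (con 1ℚ)) :* (:- (con 1ℚ)) :+ (:- (con 1ℚ)) :* (con 1ℚ)))) refl
      values _ false _ false _ false refl refl refl = v 0ℚ
        where
        v : ∀ x → 1ℚ ≡ 4ᵣ * 0ℚ + (1ℚ * 1ℚ + ((- 1ℚ) * 1ℚ + (- 1ℚ) * (- 1ℚ)))
        v = solve 1 (λ x →
          con 1ℚ
          := con 4ᵣ :* (con 0ℚ) :+ ((con 1ℚ) :* (con 1ℚ) :+ ((:- (con 1ℚ)) :* (con 1ℚ) :+ (:- (con 1ℚ)) :* (:- (con 1ℚ))))) refl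

      apart : ∀ {m} {x y : Fin m} → (x ≺ y) ≡ true → x ≢ y
      apart {x = suc x} {suc y} h e = apart {x = x} {y} h (Finₚ.suc-injective e)
      apart {x = zero} {suc y} h ()

    module _ (U : Subset n) where
      v : Fin n → ℚ
      v = lookup (indicator U)

      v≡ : ∀ x → v x ≡ ⟦ lookup U x ⟧
      v≡ x = lookup-map x ⟦_⟧ U

      v-Unit : ∀ x → Unit (v x)
      v-Unit x = subst Unit (sym (v≡ x)) (Unit⟦⟧ (lookup U x))

      N C₃U : ℚ
      N = nat n
      C₃U = nat (Subset.∣ U ∣ C 3)

      h : Fin n → Fin n → Fin n → ℚ
      h x y z = centre x y z * (v x * (v y * v z))

      -- For fixed `x` the sum is `v x` times the squared imbalance between its out- and
      -- in-neighbours in the set. By the isometry, the squared imbalances sum to `N` times the size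
      -- of the set.
      ∑h≤ : ∑₃ h ≤ N * N
      ∑h≤ = ≤-trans (≤-reflexive (∑-cong row)) (≤-trans (∑-mono λ x → *-monoˡ _ (0≤sq (apply t v x)) (proj₂ (v-Unit x)))
        (≤-trans (≤-reflexive (trans (∑-cong λ x → *-identityˡ _) (isometry k v))) (*-monoʳ N (0≤nat n)
          (≤-trans (∑-mono λ x → proj₂ (Unit* (v-Unit x) (v-Unit x))) (≤-reflexive (trans (∑-const {n} 1ℚ) (*-identityʳ N)))))))
        where
        lem : ∀ s s' a b c → s * s' * (a * (b * c)) ≡ a * (s * b) * (s' * c)
        lem = solve 5 (λ s s' a b c → s :* s' :* (a :* (b :* c)) := a :* (s :* b) :* (s' :* c)) refl
        row : ∀ x → ∑ (λ y → ∑ λ z → h x y z) ≡ v x * (apply t v x * apply t v x)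
        row x = trans (∑-cong λ y → trans (∑-cong λ z → lem (σ (t x y)) (σ (t x z)) (v x) (v y) (v z)) (∑-*ˡ _ _))
          (trans (∑-*ʳ _ _) (trans (cong (_* apply t v x) (∑-*ˡ _ _)) (*-assoc _ _ _)))

      h≥-1 : ∀ x y z → - 1ℚ ≤ h x y z
      h≥-1 x y z = go (t x y) (t x z) (v x * (v y * v z)) (Unit* (v-Unit x) (Unit* (v-Unit y) (v-Unit z)))
        where
        -1≤0 : - 1ℚ ≤ 0ℚ
        -1≤0 = le 1ℚ 0≤1 (l 0ℚ)
          where
          l : ∀ x → 0ℚ ≡ - 1ℚ + 1ℚ
          l = solve 1 (λ x → con 0ℚ := :- (con 1ℚ) :+ (con 1ℚ)) refl
        pos : ∀ s p → s ≡ 1ℚ → Unit p → - 1ℚ ≤ s * p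
        pos s p refl h = ≤-trans -1≤0 (0≤* 0≤1 (proj₁ h))
        neg : ∀ s p → s ≡ - 1ℚ → Unit p → - 1ℚ ≤ s * p
        neg s p refl h = le (1ℚ - p) (diff (proj₂ h)) (l p)
          where
          l : ∀ p → (- 1ℚ) * p ≡ - 1ℚ + (1ℚ - p)
          l = solve 1 (λ p → (:- (con 1ℚ)) :* p := :- (con 1ℚ) :+ ((con 1ℚ) :- p)) refl
        go : ∀ a b p → Unit p → - 1ℚ ≤ σ a * σ b * p
        go true b p h = go' b (*-identityˡ (σ b))
          where
          go' : ∀ b → 1ℚ * σ b ≡ σ b → - 1ℚ ≤ 1ℚ * σ b * p
          go' true e = pos _ p e h
          go' false e = neg _ p e h
        go false true p h = neg _ p (*-identityʳ _) h
        go false false p h = pos _ p (l 0ℚ) h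
          where
          l : ∀ x → (- 1ℚ) * (- 1ℚ) ≡ 1ℚ
          l = solve 1 (λ x → (:- (con 1ℚ)) :* (:- (con 1ℚ)) := con 1ℚ) refl

      centre-sum : ℚ
      centre-sum = sorted₃ λ x y z → centres x y z * (v x * (v y * v z))

      -- Each increasing triple is seen twice from each centre. The degenerate triples, at most
      -- `3 N²` with value at least -1, account for the step from `N²` to `4 N²`.
      few-centres : 2ᵣ * centre-sum ≤ 4ᵣ * (N * N)
      few-centres = le ((N * N - ∑₃ h) + (∑₃ (λ x y z → ⟦ degenerate x y z ⟧ * h x y z) + nat 3 * (N * N)))
          (0≤+ (diff ∑h≤) small) (trans (cong (_* (N * N)) four) (trans (l (N * N) (nat 3) (∑₃ h) D) (cong (λ s → s + ((N * N - ∑₃ h) + (D + nat 3 * (N * N)))) (trans (cong (_- D) (sum-by-order h)) (trans (l' (sorted₃ (symmetrised h)) D) doubled)))))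
        where
        D : ℚ
        D = ∑₃ (λ x y z → ⟦ degenerate x y z ⟧ * h x y z)
        four : 4ᵣ ≡ 1ℚ + nat 3
        four = trans (l₀ 0ℚ) (cong (1ℚ +_) (sym (trans (nat-suc 2) (cong (1ℚ +_) (trans (nat-suc 1) (cong (1ℚ +_) (trans (nat-suc 0) (cong (1ℚ +_) nat-0))))))))
          where
          l₀ : ∀ x → 4ᵣ ≡ 1ℚ + (1ℚ + (1ℚ + (1ℚ + 0ℚ)))
          l₀ = solve 1 (λ x → con 4ᵣ := con 1ℚ :+ ((con 1ℚ) :+ ((con 1ℚ) :+ ((con 1ℚ) :+ (con 0ℚ))))) refl
        l : ∀ s t a d → (1ℚ + t) * s ≡ (a - d) + ((s - a) + (d + t * s))
        l = solve 4 (λ s t a d → ((con 1ℚ) :+ t) :* s := (a :- d) :+ ((s :- a) :+ (d :+ t :* s))) refl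
        l' : ∀ s d → s + d - d ≡ s
        l' = solve 2 (λ s d → s :+ d :- d := s) refl
        small : 0ℚ ≤ D + nat 3 * (N * N)
        small = ≤-trans (0≤+ (≤-trans (≤-reflexive (sym zero-sum)) (∑₃-mono pt)) (diff (degenerate-count n))) (≤-reflexive (trans (cong (_+ (nat 3 * (N * N) - ∑₃ (λ x y z → ⟦ degenerate x y z ⟧))) (∑₃-+ _ _)) (l₃ D (∑₃ (λ x y z → ⟦ degenerate x y z ⟧)) (nat 3 * (N * N)))))
          where
          zero-sum : ∑₃ {n} (λ x y z → 0ℚ) ≡ 0ℚ
          zero-sum = trans (∑-cong λ x → trans (∑-cong λ y → ∑-0) ∑-0) ∑-0
          pt : ∀ x y z → 0ℚ ≤ ⟦ degenerate x y z ⟧ * h x y z + ⟦ degenerate x y z ⟧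
          pt x y z = ≤-trans (0≤* (0≤⟦⟧ (degenerate x y z)) (diff (h≥-1 x y z))) (≤-reflexive (l₂ ⟦ degenerate x y z ⟧ (h x y z)))
            where
            l₂ : ∀ d h → d * (h - (- 1ℚ)) ≡ d * h + d
            l₂ = solve 2 (λ d h → d :* (h :- (:- (con 1ℚ))) := d :* h :+ d) refl
          l₃ : ∀ d s t → d + s + (t - s) ≡ d + t
          l₃ = solve 3 (λ d s t → d :+ s :+ (t :- s) := d :+ t) refl
        doubled : sorted₃ (symmetrised h) ≡ 2ᵣ * centre-sum
        doubled = trans (sorted₃-cong λ x y z → l₄ (σ (t x y)) (σ (t x z)) (σ (t y x)) (σ (t y z)) (σ (t z x)) (σ (t z y)) (v x) (v y) (v z)) (sorted₃-*ˡ 2ᵣ _)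
          where
          l₄ : ∀ a b c d e f p q r → a * b * (p * (q * r)) + (b * a * (p * (r * q)) + (c * d * (q * (p * r)) + (d * c * (q * (r * p)) + (e * f * (r * (p * q)) + f * e * (r * (q * p)))))) ≡ 2ᵣ * ((a * b + (c * d + e * f)) * (p * (q * r)))
          l₄ = solve 9 (λ a b c d e f p q r →
            a :* b :* (p :* (q :* r)) :+ (b :* a :* (p :* (r :* q)) :+ (c :* d :* (q :* (p :* r)) :+ (d :* c :* (q :* (r :* p)) :+ (e :* f :* (r :* (p :* q)) :+ f :* e :* (r :* (q :* p))))))
            := con 2ᵣ :* ((a :* b :+ (c :* d :+ e :* f)) :* (p :* (q :* r)))) refl

      -- The centre sum is 1 or -3, so on every triple it adds up to 1 with four times the indicator
      -- of a cyclic triangle.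
      many-edges : C₃U ≤ 4ᵣ * nat (edgesIn H U) + centre-sum
      many-edges = ≤-trans (≤-reflexive (sym (C₃ U))) (≤-trans (sorted₃-mono pt) (≤-reflexive (trans (sorted₃-+ _ _) (cong (_+ centre-sum) (trans (sorted₃-*ˡ 4ᵣ _) (cong (4ᵣ *_) (sym (edgesIn-∩ H U))))))))
        where
        pt : ∀ x y z → (x ≺ y) ≡ true → (y ≺ z) ≡ true → 1ℚ * (v x * (v y * v z)) ≤ 4ᵣ * (edges H x y z * (v x * (v y * v z))) + centres x y z * (v x * (v y * v z))
        pt x y z p q = ≤-reflexive (trans (cong (_* (v x * (v y * v z))) (values (t x y) (t y x) (t x z) (t z x) (t y z) (t z y)
            (beats-antisym k x y (apart {x = x} p)) (beats-antisym k x z (apart {x = x} (≺-trans {x = x} {y} {z} p q))) (beats-antisym k y z (apart {x = y} q))))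
            (l₅ (edges H x y z) (centres x y z) (v x * (v y * v z))))
          where
          l₅ : ∀ e c p → (4ᵣ * e + c) * p ≡ 4ᵣ * (e * p) + c * p
          l₅ = solve 3 (λ e c p → ((con 4ᵣ) :* e :+ c) :* p := con 4ᵣ :* (e :* p) :+ c :* p) refl

  quarter-achievable : ∀ d → 0ℚ ≤ d → d < ¼ → Achievable d
  quarter-achievable d 0≤d d<¼ μ 0<μ n₀ = order k , ℕₚ.≤-trans (ℕₚ.m≤m+n n₀ K) (order≥ k) , H , free , dense-transparent d μ H dense
    where
    K = proj₁ (archimedean 0<μ 1ℚ)
    -- `n₀` makes the vertex set large enough, and `K` brings the quadratic error below `μ n³`.
    k = n₀ ℕ.+ K
    open CyclicTriangles k
    N' = nat (order k)
    1≤Nμ : 1ℚ ≤ N' * μ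
    1≤Nμ = ≤-trans (proj₂ (archimedean 0<μ 1ℚ)) (*-monoˡ μ (<⇒≤ 0<μ) (nat-mono (ℕₚ.≤-trans (ℕₚ.m≤n+m K n₀) (order≥ k))))
    dense : ∀ U → d * nat (Subset.∣ U ∣ C 3) - μ * nat (order k ℕ.^ 3) ≤ nat (edgesIn H U)
    dense U = cancelˡ 4ᵣ 0<4 (le ((4ᵣ * e + s - c) + (½ * (4ᵣ * (N' * N') - 2ᵣ * s) + (4ᵣ * ((¼ - d) * c) + (4ᵣ * (N' * N' * (N' * μ - 1ℚ)) + 2ᵣ * (N' * N')))))
        (0≤+ (diff (many-edges U)) (0≤+ (0≤* (<⇒≤ 0<½) (diff (few-centres U))) (0≤+ (0≤* (<⇒≤ 0<4) (0≤* (diff (<⇒≤ d<¼)) (0≤nat (Subset.∣ U ∣ C 3))))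
          (0≤+ (0≤* (<⇒≤ 0<4) (0≤* (0≤* 0≤N 0≤N) (diff 1≤Nμ))) (0≤* (<⇒≤ 0<2) (0≤* 0≤N 0≤N))))))
        (trans (l d μ c N' e s) (cong (λ q → 4ᵣ * (d * c - μ * q) + R) (sym cube))))
      where
      e = nat (edgesIn H U)
      c = nat (Subset.∣ U ∣ C 3)
      s = centre-sum U
      0≤N = 0≤nat (order k)
      R = (4ᵣ * e + s - c) + (½ * (4ᵣ * (N' * N') - 2ᵣ * s) + (4ᵣ * ((¼ - d) * c) + (4ᵣ * (N' * N' * (N' * μ - 1ℚ)) + 2ᵣ * (N' * N'))))
      cube : nat (order k ℕ.^ 3) ≡ N' * (N' * (N' * 1ℚ))
      cube = trans (nat-* (order k) _) (cong (N' *_) (trans (nat-* (order k) _) (cong (N' *_) (trans (nat-* (order k) 1) (cong (N' *_) (trans (nat-suc 0) (trans (cong (1ℚ +_) nat-0) (+-identityʳ 1ℚ))))))))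
      l : ∀ d m c n e s → 4ᵣ * e ≡ 4ᵣ * (d * c - m * (n * (n * (n * 1ℚ)))) + ((4ᵣ * e + s - c) + (½ * (4ᵣ * (n * n) - 2ᵣ * s) + (4ᵣ * ((¼ - d) * c) + (4ᵣ * (n * n * (n * m - 1ℚ)) + 2ᵣ * (n * n)))))
      l = solve 6 (λ d m c n e s →
        con 4ᵣ :* e
        := con 4ᵣ :* (d :* c :- m :* (n :* (n :* (n :* (con 1ℚ))))) :+ (((con 4ᵣ) :* e :+ s :- c) :+ ((con ½) :* ((con 4ᵣ) :* (n :* n) :- (con 2ᵣ) :* s) :+ ((con 4ᵣ) :* (((con ¼) :- d) :* c) :+ ((con 4ᵣ) :* (n :* n :* (n :* m :- (con 1ℚ))) :+ (con 2ᵣ) :* (n :* n)))))) refl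

-- From sets to weights by multi-affinity.

module MultiAffine where
  open import Data.Vec using (Vec; []; _∷_; lookup)
  open import Data.Unit using (⊤; tt)
  open import Defs using (Graph3; Dense)
  open Field
  open Base
  open Sorted
  open Lower using (dense-opaque)

  MultiAffine : ∀ n → (Vec ℚ n → ℚ) → Set
  MultiAffine zero F = ⊤
  MultiAffine (suc n) F = Σ (Vec ℚ n → ℚ) λ A → Σ (Vec ℚ n → ℚ) λ B → MultiAffine n A × MultiAffine n B × (∀ t v → F (t ∷ v) ≡ t * A v + B v)

  multiAffine-+ : ∀ n {F G} → MultiAffine n F → MultiAffine n G → MultiAffine n (λ v → F v + G v)
  multiAffine-+ zero f g = tt
  multiAffine-+ (suc n) (A , B , mA , mB , e) (A' , B' , mA' , mB' , e') = (λ v → A v + A' v) , (λ v → B v + B' v) , multiAffine-+ n mA mA' , multiAffine-+ n mB mB' ,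
    λ t v → trans (cong₂ _+_ (e t v) (e' t v)) (lem t (A v) (B v) (A' v) (B' v))
    where
    lem : ∀ t a b c d → t * a + b + (t * c + d) ≡ t * (a + c) + (b + d)
    lem = solve 5 (λ t a b c d → t :* a :+ b :+ (t :* c :+ d) := t :* (a :+ c) :+ (b :+ d)) refl

  -- In each coordinate the value is a convex combination of those at 0 and 1, so a lower bound at
  -- the vertices of the cube extends to the cube one coordinate at a time.
  cube-vertices : ∀ n {F} → MultiAffine n F → ∀ m → (∀ U → m ≤ F (indicator U)) → ∀ v → (∀ i → Unit (lookup v i)) → m ≤ F v
  cube-vertices zero f m h [] u = h []
  cube-vertices (suc n) {F} (A , B , mA , mB , e) m h (t ∷ v) u = le (t * (A v + B v - m) + (1ℚ - t) * (B v - m))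
      (0≤+ (0≤* (proj₁ (u zero)) (diff top)) (0≤* (diff (proj₂ (u zero))) (diff bottom))) (trans (e t v) (l t (A v) (B v) m))
    where
    l : ∀ t a b m → t * a + b ≡ m + (t * (a + b - m) + (1ℚ - t) * (b - m))
    l = solve 4 (λ t a b m → t :* a :+ b := m :+ (t :* (a :+ b :- m) :+ ((con 1ℚ) :- t) :* (b :- m))) refl
    bottom : m ≤ B v
    bottom = cube-vertices n mB m (λ U → ≤-trans (h (false ∷ U)) (≤-reflexive (trans (e 0ℚ _) (trans (cong (_+ B (indicator U)) (zeroˡ _)) (+-identityˡ _))))) v (λ i → u (suc i))
    top : m ≤ A v + B v
    top = cube-vertices n {F = λ v → A v + B v} (multiAffine-+ n mA mB) m (λ U → ≤-trans (h (true ∷ U)) (≤-reflexive (trans (e 1ℚ _) (cong (_+ B (indicator U)) (*-identityˡ _))))) v (λ i → u (suc i))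

  multiAffine-const : ∀ n c → MultiAffine n (λ _ → c)
  multiAffine-const zero c = tt
  multiAffine-const (suc n) c = (λ _ → 0ℚ) , (λ _ → c) , multiAffine-const n 0ℚ , multiAffine-const n c , λ t v → sym (trans (cong (_+ c) (zeroʳ t)) (+-identityˡ c))

  multiAffine₁ : ∀ n c → MultiAffine n ∣ c ∩_∣₁
  multiAffine₁ zero c = tt
  multiAffine₁ (suc n) c = _ , _ , multiAffine-const n (c zero) , multiAffine₁ n _ , ∩-∷₁ c

  multiAffine₂ : ∀ n c → MultiAffine n ∣ c ∩_∣₂
  multiAffine₂ zero c = tt
  multiAffine₂ (suc n) c = _ , _ , multiAffine₁ n _ , multiAffine₂ n _ , ∩-∷₂ c

  multiAffine₃ : ∀ n c → MultiAffine n ∣ c ∩_∣₃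
  multiAffine₃ zero c = tt
  multiAffine₃ (suc n) c = _ , _ , multiAffine₂ n _ , multiAffine₃ n _ , ∩-∷₃ c

  -- Both sides are combined into one multi-affine function, the edges minus `d` times the triples;
  -- density bounds it from below at every vertex of the cube.
  weighted-dense : ∀ {n} d μ (H : Graph3 n) → Dense d μ H → ∀ v → (∀ i → Unit (lookup v i)) →
    d * ∣ (λ _ _ _ → 1ℚ) ∩ v ∣₃ - μ * nat (n ℕ.^ 3) ≤ ∣ edges H ∩ v ∣₃
  weighted-dense {n} d μ H dense v hv = ≤-trans (le _ (diff bound) (l₁ (d * ∣ (λ _ _ _ → 1ℚ) ∩ v ∣₃) (μ * nat (n ℕ.^ 3)) ∣ excess ∩ v ∣₃)) (≤-reflexive (sym (split v)))
    where
    excess : Fin n → Fin n → Fin n → ℚ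
    excess x y z = edges H x y z - d * 1ℚ
    split : ∀ v → ∣ edges H ∩ v ∣₃ ≡ ∣ excess ∩ v ∣₃ + d * ∣ (λ _ _ _ → 1ℚ) ∩ v ∣₃
    split v = trans (sorted₃-cong λ x y z → l (edges H x y z) d (lookup v x * (lookup v y * lookup v z))) (trans (sorted₃-+ _ _) (cong (∣ excess ∩ v ∣₃ +_) (sorted₃-*ˡ d _)))
      where
      l : ∀ e d p → e * p ≡ (e - d * 1ℚ) * p + d * (1ℚ * p)
      l = solve 3 (λ e d p → e :* p := (e :- d :* (con 1ℚ)) :* p :+ d :* ((con 1ℚ) :* p)) refl
    bound : - (μ * nat (n ℕ.^ 3)) ≤ ∣ excess ∩ v ∣₃
    bound = cube-vertices n (multiAffine₃ n excess) _ (λ U → le _ (diff (dense-opaque d μ H dense U))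
      (trans (l₂ ∣ excess ∩ indicator U ∣₃ (d * ∣ (λ _ _ _ → 1ℚ) ∩ indicator U ∣₃) (μ * nat (n ℕ.^ 3)))
        (cong₂ (λ a b → - (μ * nat (n ℕ.^ 3)) + (a - (d * b - μ * nat (n ℕ.^ 3)))) (trans (sym (split (indicator U))) (sym (edgesIn-∩ H U))) (C₃ U)))) v hv
      where
      l₂ : ∀ x c m → x ≡ - m + (x + c - (c - m))
      l₂ = solve 3 (λ x c m → x := :- m :+ (x :+ c :- (c :- m))) refl
    l₁ : ∀ c m x → x + c ≡ c - m + (x - (- m))
    l₁ = solve 3 (λ c m x → x :+ c := c :- m :+ (x :- (:- m))) refl

-- Random samples of vertices and the first moment method.

module Sample where
  open import Data.Vec using (Vec; []; _∷_; lookup; tabulate)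
  open Field
  open Base
  open Spaces
  open Thin
  open Counting

  ∑ᵗ : ∀ r m → (Thin r m → ℚ) → ℚ
  ∑ᵗ zero zero f = f done
  ∑ᵗ (suc r) zero f = 0ℚ
  ∑ᵗ zero (suc m) f = ∑ᵗ zero m λ θ → f (drop θ)
  ∑ᵗ (suc r) (suc m) f = ∑ᵗ r m (λ θ → f (keep θ)) + ∑ᵗ (suc r) m (λ θ → f (drop θ))

  thinnings : ℕ → ℕ → ℚ
  thinnings r m = ∑ᵗ r m λ _ → 1ℚ

  ∑ᵗ-nonneg : ∀ r m {f : Thin r m → ℚ} → (∀ θ → 0ℚ ≤ f θ) → 0ℚ ≤ ∑ᵗ r m f
  ∑ᵗ-nonneg zero zero h = h done
  ∑ᵗ-nonneg (suc r) zero h = ≤-refl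
  ∑ᵗ-nonneg zero (suc m) h = ∑ᵗ-nonneg zero m λ θ → h (drop θ)
  ∑ᵗ-nonneg (suc r) (suc m) h = 0≤+ (∑ᵗ-nonneg r m λ θ → h (keep θ)) (∑ᵗ-nonneg (suc r) m λ θ → h (drop θ))

  term≤∑ᵗ : ∀ {r m} {f : Thin r m → ℚ} → (∀ θ → 0ℚ ≤ f θ) → ∀ θ → f θ ≤ ∑ᵗ r m f
  term≤∑ᵗ h done = ≤-refl
  term≤∑ᵗ {f = f} h (keep θ) = ≤-trans (term≤∑ᵗ {f = λ θ → f (keep θ)} (λ θ → h (keep θ)) θ) (le _ (∑ᵗ-nonneg _ _ λ θ → h (drop θ)) refl)
  term≤∑ᵗ {zero} {f = f} h (drop θ) = term≤∑ᵗ {f = λ θ → f (drop θ)} (λ θ → h (drop θ)) θ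
  term≤∑ᵗ {suc r} {f = f} h (drop θ) = ≤-trans (term≤∑ᵗ {f = λ θ → f (drop θ)} (λ θ → h (drop θ)) θ) (le _ (∑ᵗ-nonneg _ _ λ θ → h (keep θ)) (+-comm _ _))

  ∑ᵗ-≡ : ∀ r m {f : Thin r m → ℚ} {c} → (∀ θ → f θ ≡ c) → ∑ᵗ r m f ≡ thinnings r m * c
  ∑ᵗ-≡ zero zero h = trans (h done) (sym (*-identityˡ _))
  ∑ᵗ-≡ (suc r) zero h = sym (zeroˡ _)
  ∑ᵗ-≡ zero (suc m) h = ∑ᵗ-≡ zero m λ θ → h (drop θ)
  ∑ᵗ-≡ (suc r) (suc m) {c = c} h = trans (cong₂ _+_ (∑ᵗ-≡ r m λ θ → h (keep θ)) (∑ᵗ-≡ (suc r) m λ θ → h (drop θ))) (lem (thinnings r m) (thinnings (suc r) m) c)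
    where
    lem : ∀ a b c → a * c + b * c ≡ (a + b) * c
    lem = solve 3 (λ a b c → a :* c :+ b :* c := (a :+ b) :* c) refl

  ∫-∑ᵗ : ∀ {Ω : Set} (μ : Space Ω) r m (f : Thin r m → Ω → ℚ) → Space.∫ μ (λ ω → ∑ᵗ r m λ θ → f θ ω) ≡ ∑ᵗ r m (λ θ → Space.∫ μ (f θ))
  ∫-∑ᵗ μ zero zero f = refl
  ∫-∑ᵗ μ (suc r) zero f = Space.∫-const μ 0ℚ
  ∫-∑ᵗ μ zero (suc m) f = ∫-∑ᵗ μ zero m λ θ → f (drop θ)
  ∫-∑ᵗ μ (suc r) (suc m) f = trans (Space.∫-+ μ _ _) (cong₂ _+_ (∫-∑ᵗ μ r m λ θ → f (keep θ)) (∫-∑ᵗ μ (suc r) m λ θ → f (drop θ)))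

  select : ∀ {A : Set} {r m} → Thin r m → Vec A m → Vec A r
  select done [] = []
  select (keep θ) (x ∷ v) = x ∷ select θ v
  select (drop θ) (x ∷ v) = select θ v

  select-tabulate : ∀ {A : Set} {r m} (θ : Thin r m) (v : Vec A m) → select θ v ≡ tabulate λ i → lookup v (embed θ i)
  select-tabulate done [] = refl
  select-tabulate (keep θ) (x ∷ v) = cong (x ∷_) (select-tabulate θ v)
  select-tabulate (drop θ) (x ∷ v) = select-tabulate θ v

  module Sampling {A : Set} (μ : Space A) where
    open Space μ
    open Tuples μ

    -- The coordinates are independent, so those that are dropped integrate out.
    ∫-select : ∀ {r m} (θ : Thin r m) (F : Vec A r → ℚ) → ∫ᵛ m (λ v → F (select θ v)) ≡ ∫ᵛ r F
    ∫-select done F = refl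
    ∫-select (keep θ) F = ∫-cong λ x → ∫-select θ λ v → F (x ∷ v)
    ∫-select (drop θ) F = trans (∫-const _) (∫-select θ F)

    ∫-lookup : ∀ {m} (i : Fin m) (h : A → ℚ) → ∫ᵛ m (λ v → h (lookup v i)) ≡ ∫ h
    ∫-lookup {suc m} zero h = ∫-cong λ x → T.∫-const m (h x)
    ∫-lookup (suc i) h = trans (∫-const _) (∫-lookup i h)

    -- If each sample failed one of the tests, the sum of all tests would be at least 1 everywhere,
    -- against an expectation below 1. No sample is exhibited, hence the double negation.
    first-moment : ∀ {r s} m (F : Vec A r → ℚ) (G : Vec A s → ℚ) (h : A → ℚ) → (∀ v → 0ℚ ≤ F v) → (∀ v → 0ℚ ≤ G v) → (∀ x → 0ℚ ≤ h x) →
      thinnings r m * ∫ᵛ r F + (thinnings s m * ∫ᵛ s G + nat m * ∫ h) < 1ℚ →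
      ¬ ¬ Σ (Vec A m) λ v → (∀ θ → F (select θ v) < 1ℚ) × (∀ θ → G (select θ v) < 1ℚ) × (∀ i → h (lookup v i) < 1ℚ)
    first-moment {r} {s} m F G h F≥0 G≥0 h≥0 small none = no< (T.∫-≥ m {f = total} 1ℚ λ v → ≮⇒≥ λ p → none (v ,
        (λ θ → ≤-<-trans (≤-trans (term≤∑ᵗ {f = λ θ → F (select θ v)} (λ θ → F≥0 _) θ) (le _ (0≤+ (bG v) (bh v)) refl)) p) ,
        (λ θ → ≤-<-trans (≤-trans (term≤∑ᵗ {f = λ θ → G (select θ v)} (λ θ → G≥0 _) θ) (le _ (0≤+ (bF v) (bh v)) (l₁ (tF v) (tG v) (th v)))) p) ,
        (λ i → ≤-<-trans (≤-trans (term≤∑ {f = λ i → h (lookup v i)} (λ i → h≥0 _) i) (le _ (0≤+ (bF v) (bG v)) (l₂ (tF v) (tG v) (th v)))) p)))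
      (≤-<-trans (≤-reflexive expectation) small)
      where
      tF tG th total : Vec A m → ℚ
      tF v = ∑ᵗ r m λ θ → F (select θ v)
      tG v = ∑ᵗ s m λ θ → G (select θ v)
      th v = ∑ λ i → h (lookup v i)
      total v = tF v + (tG v + th v)
      bF : ∀ v → 0ℚ ≤ tF v
      bF v = ∑ᵗ-nonneg r m λ θ → F≥0 _
      bG : ∀ v → 0ℚ ≤ tG v
      bG v = ∑ᵗ-nonneg s m λ θ → G≥0 _
      bh : ∀ v → 0ℚ ≤ th v
      bh v = ∑-nonneg λ i → h≥0 _
      l₁ : ∀ a b c → a + (b + c) ≡ b + (a + c)
      l₁ = solve 3 (λ a b c → a :+ (b :+ c) := b :+ (a :+ c)) refl
      l₂ : ∀ a b c → a + (b + c) ≡ c + (a + b)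
      l₂ = solve 3 (λ a b c → a :+ (b :+ c) := c :+ (a :+ b)) refl
      expectation : ∫ᵛ m total ≡ thinnings r m * ∫ᵛ r F + (thinnings s m * ∫ᵛ s G + nat m * ∫ h)
      expectation = trans (T.∫-+ m tF _) (cong₂ _+_ (trans (∫-∑ᵗ (tuples μ m) r m _) (∑ᵗ-≡ r m λ θ → ∫-select θ F))
        (trans (T.∫-+ m tG th) (cong₂ _+_ (trans (∫-∑ᵗ (tuples μ m) s m _) (∑ᵗ-≡ s m λ θ → ∫-select θ G))
          (trans (sym (linear-∑ (T.linear m) λ i v → h (lookup v i))) (trans (∑-cong λ i → ∫-lookup i h) (∑-const (∫ h)))))))

-- Weights supported on the sampled cells.

module Blowups where
  open Field
  open Base
  open Count
  open Spaces
  open Counting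
  open Sorted
  open Lower using (degenerate-count)

  symmetrised-mono : ∀ {n} (h : Fin n → Fin n → Fin n → ℚ) → (∀ x y z → h x y z ≡ h y x z) → (∀ x y z → h x y z ≡ h x z y) → ∀ x y z →
    symmetrised h x y z ≡ (4ᵣ + 2ᵣ) * h x y z
  symmetrised-mono h s₁₂ s₂₃ x y z = trans (cong₂ (λ a b → h x y z + (a + b)) (sym (s₂₃ x y z)) (cong₂ _+_ (sym (s₁₂ x y z))
      (cong₂ _+_ (sym (trans (s₁₂ x y z) (s₂₃ y x z))) (cong₂ _+_ (sym (trans (s₂₃ x y z) (s₁₂ x z y))) (sym (trans (s₁₂ x y z) (trans (s₂₃ y x z) (s₁₂ y z x)))))))) (six (h x y z))
    where
    six : ∀ h → h + (h + (h + (h + (h + h)))) ≡ (4ᵣ + 2ᵣ) * h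
    six = solve 1 (λ h → h :+ (h :+ (h :+ (h :+ (h :+ h)))) := ((con 4ᵣ) :+ (con 2ᵣ)) :* h) refl

  -- By symmetry, the bound on increasing triples holds on all triples without repetition; the at
  -- most `3n²` degenerate ones get the trivial bound `t`.
  symmetric-sum-≤ : ∀ {n} (h : Fin n → Fin n → Fin n → ℚ) → (∀ x y z → h x y z ≡ h y x z) → (∀ x y z → h x y z ≡ h x z y) → ∀ {r t} → 0ℚ ≤ r → 0ℚ ≤ t →
    (∀ x y z → (x ≺ y) ≡ true → (y ≺ z) ≡ true → h x y z ≤ r) → (∀ x y z → h x y z ≤ t) →
    ∑₃ h ≤ nat n * (nat n * nat n) * r + nat 3 * (nat n * nat n) * t
  symmetric-sum-≤ {n} h s₁₂ s₂₃ {r} {t} 0≤r 0≤t off diag = ≤-trans (≤-reflexive (sum-by-order h)) (+-mono-≤ part₁ part₂)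
    where
    N = nat n
    part₁ : sorted₃ (symmetrised h) ≤ N * (N * N) * r
    part₁ = ≤-trans (sorted₃-mono {h = symmetrised λ _ _ _ → r} λ x y z p q → ≤-trans (≤-reflexive (symmetrised-mono h s₁₂ s₂₃ x y z))
        (≤-trans (*-monoʳ _ (0≤+ (<⇒≤ 0<4) (<⇒≤ 0<2)) (off x y z p q)) (≤-reflexive (sym (symmetrised-mono {n} (λ _ _ _ → r) (λ _ _ _ → refl) (λ _ _ _ → refl) x y z)))))
      (≤-trans (le _ (∑-nonneg λ x → ∑-nonneg λ y → ∑-nonneg λ z → 0≤* (0≤⟦⟧ (degenerate x y z)) 0≤r) (sum-by-order (λ _ _ _ → r)))
        (≤-reflexive (trans (∑-cong λ x → trans (∑-cong λ y → ∑-const r) (∑-const (N * r))) (trans (∑-const (N * (N * r))) (l N r)))))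
      where
      l : ∀ N r → N * (N * (N * r)) ≡ N * (N * N) * r
      l = solve 2 (λ N r → N :* (N :* (N :* r)) := N :* (N :* N) :* r) refl
    part₂ : ∑₃ (λ x y z → ⟦ degenerate x y z ⟧ * h x y z) ≤ nat 3 * (N * N) * t
    part₂ = ≤-trans (∑₃-mono λ x y z → ≤-trans (*-monoʳ _ (0≤⟦⟧ (degenerate x y z)) (diag x y z)) (≤-reflexive (*-comm _ t)))
      (≤-trans (≤-reflexive (∑₃-*ˡ t _)) (≤-trans (*-monoʳ t 0≤t (degenerate-count n)) (≤-reflexive (*-comm t _))))

  module Blowup {A : Set} (μ : Space A) {M : ℕ} (Q : A → Fin M) (g : A → A → A → ℚ)
    (s₁₂ : ∀ x y z → g x y z ≡ g y x z) (s₂₃ : ∀ x y z → g x y z ≡ g x z y)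
    (c : Fin M → Fin M → Fin M → ℚ) (c-Unit : ∀ i j l → Unit (c i j l))
    (c-≡ : ∀ (τ : Fin M → Fin M → Fin M → ℚ) → Space.∫ μ (λ x → Space.∫ μ λ y → Space.∫ μ λ z → c (Q x) (Q y) (Q z) * τ (Q x) (Q y) (Q z)) ≡
      Space.∫ μ (λ x → Space.∫ μ λ y → Space.∫ μ λ z → g x y z * τ (Q x) (Q y) (Q z)))
    {L' : ℕ} (p : Fin (suc L') → A) {s ρ : ℚ} (0<s : 0ℚ < s) (0≤ρ : 0ℚ ≤ ρ) where

    open Space μ

    L : ℚ
    L = nat (suc L')
    1/L : ℚ
    1/L = inv (0<nat L')
    0≤1/L : 0ℚ ≤ 1/L
    0≤1/L = <⇒≤ (inv-pos (0<nat L'))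

    mass : Fin M → ℚ
    mass j = ∫ λ x → ⟦ Q x ≡ᶠ j ⟧

    module _ (large : ∀ i → s ≤ mass (Q (p i))) (sparse : ∀ i j l → (i ≺ j) ≡ true → (j ≺ l) ≡ true → c (Q (p i)) (Q (p j)) (Q (p l)) ≤ ρ) where

      0<mass : ∀ i → 0ℚ < mass (Q (p i))
      0<mass i = <-≤-trans 0<s (large i)

      -- Division by the mass of the cell gives every sampled index the same share `s / L` of the
      -- integral, also when indices share a cell; the lower bound `s` for the masses keeps the
      -- total weight at most 1.
      wt : Fin (suc L') → ℚ
      wt i = s * 1/L * inv (0<mass i)

      wt≥0 : ∀ i → 0ℚ ≤ wt i
      wt≥0 i = 0≤* (0≤* (<⇒≤ 0<s) 0≤1/L) (<⇒≤ (inv-pos (0<mass i)))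

      part : Fin (suc L') → Fin M → ℚ
      part i a = wt i * ⟦ a ≡ᶠ Q (p i) ⟧

      part≥0 : ∀ i a → 0ℚ ≤ part i a
      part≥0 i a = 0≤* (wt≥0 i) (0≤⟦⟧ (a ≡ᶠ Q (p i)))

      f : A → ℚ
      f x = ∑ λ i → part i (Q x)

      ∫-part : ∀ i → ∫ (λ x → part i (Q x)) ≡ s * 1/L
      ∫-part i = trans (∫-*ˡ (wt i) _) (trans (l (s * 1/L) (inv (0<mass i)) (mass (Q (p i)))) (trans (cong (s * 1/L *_) (*-inv (0<mass i))) (*-identityʳ _)))
        where
        l : ∀ a i m → a * i * m ≡ a * (m * i)
        l = solve 3 (λ a i m → a :* i :* m := a :* (m :* i)) refl

      L*s/L : L * (s * 1/L) ≡ s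
      L*s/L = trans (l L s 1/L) (trans (cong (s *_) (*-inv (0<nat L'))) (*-identityʳ s))
        where
        l : ∀ L s i → L * (s * i) ≡ s * (L * i)
        l = solve 3 (λ L s i → L :* (s :* i) := s :* (L :* i)) refl

      ∫-f : ∫ f ≡ s
      ∫-f = trans (sym (linear-∑ linear λ i x → part i (Q x))) (trans (∑-cong ∫-part) (trans (∑-const (s * 1/L)) L*s/L))

      f-Unit : ∀ x → Unit (f x)
      f-Unit x = ∑-nonneg (λ i → part≥0 i (Q x)) ,
        ≤-trans (∑-mono bound) (≤-reflexive (trans (∑-const 1/L) (*-inv (0<nat L'))))
        where
        bound : ∀ i → part i (Q x) ≤ 1/L
        bound i = ≤-trans (*-monoʳ (wt i) (wt≥0 i) (⟦⟧≤1 (Q x ≡ᶠ Q (p i)))) (≤-trans (≤-reflexive (l s 1/L (inv (0<mass i))))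
            (≤-trans (*-monoʳ 1/L 0≤1/L (≤-trans (*-monoˡ (inv (0<mass i)) (<⇒≤ (inv-pos (0<mass i))) (large i)) (≤-reflexive (*-inv (0<mass i))))) (≤-reflexive (*-identityʳ 1/L))))
          where
          l : ∀ s i m → s * i * m * 1ℚ ≡ i * (s * m)
          l = solve 3 (λ s i m → s :* i :* m :* (con 1ℚ) := i :* (s :* m)) refl

      T : Fin (suc L') → Fin (suc L') → Fin (suc L') → ℚ
      T i j l = ∫ λ x → ∫ λ y → ∫ λ z → g x y z * (part i (Q x) * (part j (Q y) * part l (Q z)))

      T-swap₁₂ : ∀ i j l → T i j l ≡ T j i l
      T-swap₁₂ i j l = trans (∫-comm ∫ linear _) (∫-cong λ y → ∫-cong λ x → ∫-cong λ z → cong₂ _*_ (s₁₂ x y z) (r (part i (Q x)) (part j (Q y)) (part l (Q z))))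
        where
        r : ∀ a b c → a * (b * c) ≡ b * (a * c)
        r = solve 3 (λ a b c → a :* (b :* c) := b :* (a :* c)) refl

      T-swap₂₃ : ∀ i j l → T i j l ≡ T i l j
      T-swap₂₃ i j l = ∫-cong λ x → trans (∫-comm ∫ linear _) (∫-cong λ z → ∫-cong λ y → cong₂ _*_ (s₂₃ x y z) (cong (part i (Q x) *_) (*-comm (part j (Q y)) (part l (Q z)))))

      q : ℚ
      q = s * 1/L
      q³ : ℚ
      q³ = q * (q * q)
      0≤q³ : 0ℚ ≤ q³
      0≤q³ = 0≤* 0≤q (0≤* 0≤q 0≤q)
        where
        0≤q = 0≤* (<⇒≤ 0<s) 0≤1/L

      -- The weights depend on the cells only, so the kernel may be replaced by its conditional
      -- density, which is constant on a product of three cells.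
      T-value : ∀ i j l → T i j l ≡ c (Q (p i)) (Q (p j)) (Q (p l)) * q³
      T-value i j l = trans (sym (c-≡ λ a b e → part i a * (part j b * part l e))) (trans (∫-cong λ x → ∫-cong λ y → ∫-cong λ z → point (Q x) (Q y) (Q z))
        (trans (∫-cong λ x → trans (∫-cong λ y → trans (∫-*ˡ C _) (cong (C *_) (trans (∫-*ˡ (part i (Q x)) _) (cong (part i (Q x) *_) (trans (∫-*ˡ (part j (Q y)) _) (cong (part j (Q y) *_) (∫-part l)))))))
            (trans (∫-*ˡ C _) (cong (C *_) (trans (∫-*ˡ (part i (Q x)) _) (cong (part i (Q x) *_) (trans (∫-*ʳ q _) (cong (_* q) (∫-part j))))))))
          (trans (∫-*ˡ C _) (cong (C *_) (trans (∫-*ʳ (q * q) _) (cong (_* (q * q)) (∫-part i)))))))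
        where
        C : ℚ
        C = c (Q (p i)) (Q (p j)) (Q (p l))
        point : ∀ a b e → c a b e * (part i a * (part j b * part l e)) ≡ C * (part i a * (part j b * part l e))
        point a b e with a ≡ᶠ Q (p i) in ea | b ≡ᶠ Q (p j) in eb | e ≡ᶠ Q (p l) in ee
        ... | true | true | true = cong (_* (wt i * 1ℚ * (wt j * 1ℚ * (wt l * 1ℚ)))) (cong₃ c (≡ᶠ-sound ea) (≡ᶠ-sound eb) (≡ᶠ-sound ee))
        ... | false | b₁ | b₂ = z (c a b e) C (wt i) (wt j * ⟦ b₁ ⟧ * (wt l * ⟦ b₂ ⟧))
          where
          z : ∀ c d w r → c * (w * 0ℚ * r) ≡ d * (w * 0ℚ * r)
          z = solve 4 (λ c d w r → c :* (w :* (con 0ℚ) :* r) := d :* (w :* (con 0ℚ) :* r)) refl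
        ... | true | false | b₂ = z (c a b e) C (wt i * 1ℚ) (wt j) (wt l * ⟦ b₂ ⟧)
          where
          z : ∀ c d v w r → c * (v * (w * 0ℚ * r)) ≡ d * (v * (w * 0ℚ * r))
          z = solve 5 (λ c d v w r → c :* (v :* (w :* (con 0ℚ) :* r)) := d :* (v :* (w :* (con 0ℚ) :* r))) refl
        ... | true | true | false = z (c a b e) C (wt i * 1ℚ) (wt j * 1ℚ) (wt l)
          where
          z : ∀ c d u v w → c * (u * (v * (w * 0ℚ))) ≡ d * (u * (v * (w * 0ℚ)))
          z = solve 5 (λ c d u v w → c :* (u :* (v :* (w :* (con 0ℚ)))) := d :* (u :* (v :* (w :* (con 0ℚ))))) refl

      ∫gfff : ∫ (λ x → ∫ λ y → ∫ λ z → g x y z * (f x * (f y * f z))) ≡ ∑₃ T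
      ∫gfff = trans (∫-cong λ x → ∫-cong λ y → ∫-cong λ z → trans (l (g x y z) (f x) (f y) (f z)) (sym (∑-*ʳ _ _)))
        (trans (∫-cong λ x → trans (∫-cong λ y → sym (linear-∑ linear _)) (sym (linear-∑ linear _)))
        (trans (sym (linear-∑ linear _)) (∑-cong λ i →
          trans (∫-cong λ x → ∫-cong λ y → ∫-cong λ z → trans (l₂ (g x y z) (part i (Q x)) (f y) (f z)) (sym (∑-*ʳ _ _)))
          (trans (∫-cong λ x → trans (∫-cong λ y → sym (linear-∑ linear _)) (sym (linear-∑ linear _)))
          (trans (sym (linear-∑ linear _)) (∑-cong λ j →
            trans (∫-cong λ x → ∫-cong λ y → ∫-cong λ z → trans (l₃ (g x y z) (part i (Q x)) (part j (Q y)) (f z)) (sym (∑-*ʳ _ _)))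
            (trans (∫-cong λ x → trans (∫-cong λ y → sym (linear-∑ linear _)) (sym (linear-∑ linear _)))
            (trans (sym (linear-∑ linear _)) (∑-cong λ k → ∫-cong λ x → ∫-cong λ y → ∫-cong λ z → l₄ (g x y z) (part i (Q x)) (part j (Q y)) (part k (Q z)))))))))))
        where
        l : ∀ g a b c → g * (a * (b * c)) ≡ a * (g * (b * c))
        l = solve 4 (λ g a b c → g :* (a :* (b :* c)) := a :* (g :* (b :* c))) refl
        l₂ : ∀ g a b c → a * (g * (b * c)) ≡ b * (g * a * c)
        l₂ = solve 4 (λ g a b c → a :* (g :* (b :* c)) := b :* (g :* a :* c)) refl
        l₃ : ∀ g a b c → b * (g * a * c) ≡ c * (g * a * b)
        l₃ = solve 4 (λ g a b c → b :* (g :* a :* c) := c :* (g :* a :* b)) refl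
        l₄ : ∀ g a b c → c * (g * a * b) ≡ g * (a * (b * c))
        l₄ = solve 4 (λ g a b c → c :* (g :* a :* b) := g :* (a :* (b :* c))) refl

      -- At most a fraction `3 / L` of the triples of indices is degenerate; on these the density is
      -- estimated by 1.
      few-triples : ∫ (λ x → ∫ λ y → ∫ λ z → g x y z * (f x * (f y * f z))) ≤ s * (s * s) * (ρ + nat 3 * 1/L)
      few-triples = ≤-trans (≤-reflexive ∫gfff) (≤-trans
        (symmetric-sum-≤ T T-swap₁₂ T-swap₂₃ (0≤* 0≤ρ 0≤q³) 0≤q³
          (λ i j l p q → ≤-trans (≤-reflexive (T-value i j l)) (*-monoˡ q³ 0≤q³ (sparse i j l p q)))
          (λ i j l → ≤-trans (≤-reflexive (T-value i j l)) (≤-trans (*-monoˡ q³ 0≤q³ (proj₂ (c-Unit (Q (p i)) (Q (p j)) (Q (p l))))) (≤-reflexive (*-identityˡ q³)))))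
        (≤-reflexive (trans (l L q ρ (nat 3)) (trans (cong (λ a → a * (a * a) * ρ + nat 3 * (a * a * q)) L*s/L) (l' s 1/L ρ (nat 3))))))
        where
        l : ∀ L q r t → L * (L * L) * (r * (q * (q * q))) + t * (L * L) * (q * (q * q)) ≡ L * q * (L * q * (L * q)) * r + t * (L * q * (L * q) * q)
        l = solve 4 (λ L q r t →
          L :* (L :* L) :* (r :* (q :* (q :* q))) :+ t :* (L :* L) :* (q :* (q :* q))
          := L :* q :* (L :* q :* (L :* q)) :* r :+ t :* (L :* q :* (L :* q) :* q)) refl
        l' : ∀ s i r t → s * (s * s) * r + t * (s * s * (s * i)) ≡ s * (s * s) * (r + t * i)
        l' = solve 4 (λ s i r t → s :* (s :* s) :* r :+ t :* (s :* s :* (s :* i)) := s :* (s :* s) :* (r :+ t :* i)) refl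

-- The hypergraph as a kernel, and its weighted edge count.

module Kernels where
  open import Data.Vec using (Vec; []; _∷_; lookup; tabulate)
  open import Data.Vec.Properties using (lookup∘tabulate)
  open import Data.Vec.Relation.Unary.All using ([]; _∷_)
  open import Data.Vec.Relation.Unary.AllPairs using ([]; _∷_)
  open import Data.Vec.Relation.Unary.Unique.Propositional using (Unique)
  open import Data.Vec.Relation.Unary.Unique.Propositional.Properties using (lookup-injective)
  open import Data.Bool.Properties using (∨-comm; ∨-assoc)
  open import Defs using (Graph3; Dense; F7-free; F7-edges; _∈T_; here; there)
  open Field
  open Base
  open Count
  open Spaces
  open Regular using (V; μ)
  open Counting
  open Sorted
  open Blowups using (symmetrised-mono)
  open Lower using (degenerate-count)
  open MultiAffine

  ≡ᶠ-sym : ∀ {n} (x y : Fin n) → (x ≡ᶠ y) ≡ (y ≡ᶠ x)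
  ≡ᶠ-sym zero zero = refl
  ≡ᶠ-sym zero (suc y) = refl
  ≡ᶠ-sym (suc x) zero = refl
  ≡ᶠ-sym (suc x) (suc y) = ≡ᶠ-sym x y

  ≺⇒≢ᶠ : ∀ {n} (x y : Fin n) → (x ≺ y) ≡ true → (x ≡ᶠ y) ≡ false
  ≺⇒≢ᶠ zero (suc y) h = refl
  ≺⇒≢ᶠ (suc x) (suc y) h = ≺⇒≢ᶠ x y h

  module Kernel {n : ℕ} (H : Graph3 n) where
    open Graph3 H

    -- `E` is arbitrary on triples with a repeated vertex; these are removed before integrating over
    -- all triples.
    kernel : Fin n → Fin n → Fin n → Bool
    kernel x y z = E x y z ∧ not (degenerate x y z)

    swap₁₂ : ∀ x y z → kernel x y z ≡ kernel y x z
    swap₁₂ x y z = cong₂ (λ e d → e ∧ not d) (sym₁₂ x y z) (cong₂ _∨_ (≡ᶠ-sym x y) (∨-comm (y ≡ᶠ z) (x ≡ᶠ z)))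

    swap₂₃ : ∀ x y z → kernel x y z ≡ kernel x z y
    swap₂₃ x y z = cong₂ (λ e d → e ∧ not d) (sym₂₃ x y z) (trans (rotate (x ≡ᶠ y) (y ≡ᶠ z) (x ≡ᶠ z)) (cong (λ d → x ≡ᶠ z ∨ d ∨ x ≡ᶠ y) (≡ᶠ-sym y z)))
      where
      rotate : ∀ a b c → a ∨ b ∨ c ≡ c ∨ b ∨ a
      rotate a b c = trans (∨-comm a (b ∨ c)) (trans (cong (_∨ a) (∨-comm b c)) (∨-assoc c b a))

    flip : ∀ x y z → kernel x y z ≡ kernel z y x
    flip x y z = trans (swap₁₂ x y z) (trans (swap₂₃ y x z) (swap₁₂ y z x))

    edge : ∀ {x y z} → kernel x y z ≡ true → E x y z ≡ true
    edge {x} {y} {z} h with E x y z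
    ... | true = refl

    distinct : ∀ {x y z} → kernel x y z ≡ true → x ≢ y × y ≢ z × x ≢ z
    distinct {x} {y} {z} h = ≡ᶠ-apart (proj₁ p) , ≡ᶠ-apart (proj₁ q) , ≡ᶠ-apart (proj₂ q)
      where
      both : ∀ a b → a ∧ not b ≡ true → b ≡ false
      both true b h = not-true h
      p = ∨-false {x ≡ᶠ y} (both (E x y z) _ h)
      q = ∨-false {y ≡ᶠ z} (proj₂ p)

    no-pattern : F7-free H → ∀ a y z i x l m → kernel a i x ≡ true → kernel a y l ≡ true → kernel a z m ≡ true → kernel a i l ≡ true → kernel z i l ≡ true →
      kernel a i m ≡ true → kernel y i m ≡ true → kernel a l m ≡ true → kernel x l m ≡ true → kernel y z x ≡ true → ⊥
    no-pattern free a y z i x l m aix ayl azm ail zil aim yim alm xlm yzx = free (lookup vertices , (λ {p} {q} → lookup-injective unique p q) , edges-present)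
      where
      vertices : Vec (Fin n) 7
      vertices = a ∷ i ∷ l ∷ m ∷ x ∷ y ∷ z ∷ []
      first : ∀ {p q r} → kernel p q r ≡ true → p ≢ q
      first h = proj₁ (distinct h)
      second : ∀ {p q r} → kernel p q r ≡ true → q ≢ r
      second h = proj₁ (proj₂ (distinct h))
      outer : ∀ {p q r} → kernel p q r ≡ true → p ≢ r
      outer h = proj₂ (proj₂ (distinct h))
      -- Any two of the seven vertices lie in a common edge of the pattern, and kernel triples have
      -- distinct entries.
      unique : Unique vertices
      unique = (first ail ∷ outer ail ∷ outer aim ∷ outer aix ∷ first ayl ∷ first azm ∷ [])
        ∷ (second ail ∷ second aim ∷ second aix ∷ ≢-sym (first yim) ∷ ≢-sym (first zil) ∷ [])
        ∷ (second alm ∷ ≢-sym (first xlm) ∷ ≢-sym (second ayl) ∷ ≢-sym (outer zil) ∷ [])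
        ∷ (≢-sym (outer xlm) ∷ ≢-sym (outer yim) ∷ ≢-sym (second azm) ∷ [])
        ∷ (≢-sym (outer yzx) ∷ ≢-sym (second yzx) ∷ [])
        ∷ (first yzx ∷ []) ∷ [] ∷ []
      edges-present : ∀ p q r → (p , q , r) ∈T F7-edges → E (lookup vertices p) (lookup vertices q) (lookup vertices r) ≡ true
      edges-present _ _ _ here = edge ail
      edges-present _ _ _ (there here) = edge aim
      edges-present _ _ _ (there (there here)) = edge alm
      edges-present _ _ _ (there (there (there here))) = trans (trans (sym₁₂ x a i) (sym₂₃ a x i)) (edge aix)
      edges-present _ _ _ (there (there (there (there here)))) = edge xlm
      edges-present _ _ _ (there (there (there (there (there here))))) = trans (sym₁₂ y a l) (edge ayl)
      edges-present _ _ _ (there (there (there (there (there (there here)))))) = edge yim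
      edges-present _ _ _ (there (there (there (there (there (there (there here))))))) = trans (sym₁₂ z a m) (edge azm)
      edges-present _ _ _ (there (there (there (there (there (there (there (there here)))))))) = edge zil
      edges-present _ _ _ (there (there (there (there (there (there (there (there (there here))))))))) = trans (trans (sym₁₂ x y z) (sym₂₃ y x z)) (edge yzx)

    kernel-sorted : ∀ x y z → (x ≺ y) ≡ true → (y ≺ z) ≡ true → kernel x y z ≡ E x y z
    kernel-sorted x y z p q = trans (cong (λ d → E x y z ∧ not d) (cong₂ _∨_ (≺⇒≢ᶠ x y p) (cong₂ _∨_ (≺⇒≢ᶠ y z q) (≺⇒≢ᶠ x z (≺-trans {x = x} {y} {z} p q))))) (∧-right (E x y z))
      where
      ∧-right : ∀ b → b ∧ true ≡ b
      ∧-right true = refl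
      ∧-right false = refl

  module Weighted {n' : ℕ} (H : Graph3 (suc n')) {d m : ℚ} (0≤d : 0ℚ ≤ d) (dense : Dense d m H) (f : V n' → ℚ) (f-Unit : ∀ x → Unit (f x)) where
    open Space (μ n')
    open Kernel H

    N : ℚ
    N = nat (suc n')

    product : V n' → V n' → V n' → ℚ
    product x y z = f x * (f y * f z)

    product-Unit : ∀ x y z → Unit (product x y z)
    product-Unit x y z = Unit* (f-Unit x) (Unit* (f-Unit y) (f-Unit z))

    N∫ : ∀ h → N * ∫ h ≡ ∑ h
    N∫ h = trans (cong (N *_) (∑-*ˡ _ h)) (trans (sym (*-assoc N _ _)) (trans (cong (_* ∑ h) (*-inv (0<nat n'))) (*-identityˡ _)))

    N³∫ : ∀ h → N * (N * N) * ∫ (λ x → ∫ λ y → ∫ λ z → h x y z) ≡ ∑₃ h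
    N³∫ h = trans (l N _) (trans (cong (λ t → N * (N * t)) (N∫ _)) (trans (cong (N *_) (trans (sym (∑-*ˡ N _)) (∑-cong λ x → N∫ _)))
      (trans (sym (∑-*ˡ N _)) (∑-cong λ x → trans (sym (∑-*ˡ N _)) (∑-cong λ y → N∫ _)))))
      where
      l : ∀ N t → N * (N * N) * t ≡ N * (N * (N * t))
      l = solve 2 (λ N t → N :* (N :* N) :* t := N :* (N :* (N :* t))) refl

    k : V n' → V n' → V n' → ℚ
    k x y z = ⟦ kernel x y z ⟧ * product x y z

    v : Vec ℚ (suc n')
    v = tabulate f

    sorted-product : ∀ c → ∣ c ∩ v ∣₃ ≡ sorted₃ λ x y z → c x y z * product x y z
    sorted-product c = sorted₃-cong λ x y z → cong (c x y z *_) (cong₂ _*_ (lookup∘tabulate f x) (cong₂ _*_ (lookup∘tabulate f y) (lookup∘tabulate f z)))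

    triples edges-weight : ℚ
    triples = ∣ (λ _ _ _ → 1ℚ) ∩ v ∣₃
    edges-weight = ∣ edges H ∩ v ∣₃

    product-swap₁₂ : ∀ x y z → product x y z ≡ product y x z
    product-swap₁₂ x y z = l (f x) (f y) (f z)
      where
      l : ∀ a b c → a * (b * c) ≡ b * (a * c)
      l = solve 3 (λ a b c → a :* (b :* c) := b :* (a :* c)) refl

    product-swap₂₃ : ∀ x y z → product x y z ≡ product x z y
    product-swap₂₃ x y z = cong (f x *_) (*-comm (f y) (f z))

    many-triples : ∑₃ product ≤ (4ᵣ + 2ᵣ) * triples + nat 3 * (N * N)
    many-triples = ≤-trans (≤-reflexive (sum-by-order product)) (+-mono-≤
      (≤-reflexive (trans (sorted₃-cong λ x y z → trans (symmetrised-mono product product-swap₁₂ product-swap₂₃ x y z) (cong ((4ᵣ + 2ᵣ) *_) (sym (*-identityˡ _))))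
        (trans (sorted₃-*ˡ (4ᵣ + 2ᵣ) _) (cong ((4ᵣ + 2ᵣ) *_) (sym (sorted-product λ _ _ _ → 1ℚ))))))
      (≤-trans (∑₃-mono λ x y z → ≤-trans (*-monoʳ ⟦ degenerate x y z ⟧ (0≤⟦⟧ (degenerate x y z)) (proj₂ (product-Unit x y z))) (≤-reflexive (*-identityʳ _))) (degenerate-count (suc n'))))

    few-edges : (4ᵣ + 2ᵣ) * edges-weight ≤ ∑₃ k
    few-edges = ≤-trans (≤-reflexive (trans (cong ((4ᵣ + 2ᵣ) *_) (sorted-product (edges H))) (sym (sorted₃-*ˡ (4ᵣ + 2ᵣ) _))))
      (≤-trans (sorted₃-mono λ x y z p q → ≤-reflexive (trans (cong (λ b → (4ᵣ + 2ᵣ) * (⟦ b ⟧ * product x y z)) (sym (kernel-sorted x y z p q)))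
          (sym (symmetrised-mono k (λ x y z → cong₂ _*_ (cong ⟦_⟧ (swap₁₂ x y z)) (product-swap₁₂ x y z)) (λ x y z → cong₂ _*_ (cong ⟦_⟧ (swap₂₃ x y z)) (product-swap₂₃ x y z)) x y z))))
        (le _ (∑-nonneg λ x → ∑-nonneg λ y → ∑-nonneg λ z → 0≤* (0≤⟦⟧ (degenerate x y z)) (0≤* (0≤⟦⟧ (kernel x y z)) (proj₁ (product-Unit x y z)))) (sum-by-order k)))

    -- Six times the weighted density condition on increasing triples, rewritten with integrals;
    -- degenerate triples cost the term with `nat 3`.
    dense-integral : d * (N * (N * N) * (∫ f * (∫ f * ∫ f)) - nat 3 * (N * N)) ≤
      N * (N * N) * ∫ (λ x → ∫ λ y → ∫ λ z → ⟦ kernel x y z ⟧ * (f x * (f y * f z))) + (4ᵣ + 2ᵣ) * (m * (N * (N * N)))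
    dense-integral = le (d * ((4ᵣ + 2ᵣ) * triples + nat 3 * (N * N) - ∑₃ product) + ((4ᵣ + 2ᵣ) * (edges-weight - (d * triples - m * nat (suc n' ℕ.^ 3))) + (∑₃ k - (4ᵣ + 2ᵣ) * edges-weight)))
      (0≤+ (0≤* 0≤d (diff many-triples)) (0≤+ (0≤* (0≤+ (<⇒≤ 0<4) (<⇒≤ 0<2)) (diff (weighted-dense d m H dense v λ i → subst Unit (sym (lookup∘tabulate f i)) (f-Unit i)))) (diff few-edges)))
      (trans (cong₂ (λ a b → a + (4ᵣ + 2ᵣ) * (m * b)) (N³∫ k) (sym cube))
        (trans (l d (nat 3) (N * N) triples (∑₃ product) edges-weight m (nat (suc n' ℕ.^ 3)) (∑₃ k))
          (cong (λ t → d * (t - nat 3 * (N * N)) + (d * ((4ᵣ + 2ᵣ) * triples + nat 3 * (N * N) - ∑₃ product) + ((4ᵣ + 2ᵣ) * (edges-weight - (d * triples - m * nat (suc n' ℕ.^ 3))) + (∑₃ k - (4ᵣ + 2ᵣ) * edges-weight))))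
            (sym cubed))))
      where
      one : nat 1 ≡ 1ℚ
      one = trans (nat-suc 0) (trans (cong (1ℚ +_) nat-0) (+-identityʳ 1ℚ))
      cube : nat (suc n' ℕ.^ 3) ≡ N * (N * N)
      cube = trans (nat-* (suc n') _) (cong (N *_) (trans (nat-* (suc n') _) (cong (N *_) (trans (nat-* (suc n') 1) (trans (cong (N *_) one) (*-identityʳ N))))))
      cubed : N * (N * N) * (∫ f * (∫ f * ∫ f)) ≡ ∑₃ product
      cubed = trans (l₁ N (∫ f)) (trans (cong (λ s → s * (s * s)) (N∫ f)) (sym (trans (∑-cong λ x → trans (∑-cong λ y → trans (∑-*ˡ _ _) (cong (f x *_) (∑-*ˡ _ _))) (trans (∑-*ˡ _ _) (cong (f x *_) (∑-*ʳ _ _)))) (∑-*ʳ _ _))))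
        where
        l₁ : ∀ N t → N * (N * N) * (t * (t * t)) ≡ N * t * (N * t * (N * t))
        l₁ = solve 2 (λ N t → N :* (N :* N) :* (t :* (t :* t)) := N :* t :* (N :* t :* (N :* t))) refl
      l : ∀ d t q A P B m c K → K + (4ᵣ + 2ᵣ) * (m * c) ≡ d * (P - t * q) + (d * ((4ᵣ + 2ᵣ) * A + t * q - P) + ((4ᵣ + 2ᵣ) * (B - (d * A - m * c)) + (K - (4ᵣ + 2ᵣ) * B)))
      l = solve 9 (λ d t q A P B m c K →
        K :+ ((con 4ᵣ) :+ (con 2ᵣ)) :* (m :* c)
        := d :* (P :- t :* q) :+ (d :* (((con 4ᵣ) :+ (con 2ᵣ)) :* A :+ t :* q :- P) :+ (((con 4ᵣ) :+ (con 2ᵣ)) :* (B :- (d :* A :- m :* c)) :+ (K :- ((con 4ᵣ) :+ (con 2ᵣ)) :* B)))) refl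

-- Upper bound: the choice of parameters and the final contradiction.

module Upper where
  open import Data.Fin using (#_)
  open import Data.Vec using (Vec; []; _∷_; lookup; tabulate)
  import Data.Rational as Rat
  open import Defs using (Graph3; Dense; F7-free; Achievable)
  open Field
  open Base
  open Count
  open Arith
  open Spaces
  open Regular
  open Counting using (module Tuples)
  open ColourCount
  open Structure
  open Thin
  open Reduced
  open RamseyStep
  open Transfer
  open Sample
  open Blowups
  open Kernels

  ⅛ : ℚ
  ⅛ = ℤ.+ 1 Rat./ 8

  0<⅛ : 0ℚ < ⅛
  0<⅛ = Ratₚ.positive⁻¹ ⅛ {{_}}

  1/256 : ℚ
  1/256 = ℤ.+ 1 Rat./ 256

  0<1/256 : 0ℚ < 1/256
  0<1/256 = Ratₚ.positive⁻¹ 1/256 {{_}}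

  -- Dividing by `1 + c` instead of `c` also covers c = 0.
  tiny : ∀ {c t} → 0ℚ ≤ c → 0ℚ < t → Σ ℚ λ ε → 0ℚ < ε × c * ε ≤ t
  tiny {c} {t} 0≤c 0<t = t * inv 0<1+c , 0<* 0<t (inv-pos 0<1+c) ,
    le (t * inv 0<1+c) (0≤* (<⇒≤ 0<t) (<⇒≤ (inv-pos 0<1+c))) (trans (sym (*-identityʳ t)) (trans (cong (t *_) (sym (*-inv 0<1+c))) (l c t (inv 0<1+c))))
    where
    0<1+c : 0ℚ < 1ℚ + c
    0<1+c = 0<+ 0<1 0≤c
    l : ∀ c t i → t * ((1ℚ + c) * i) ≡ c * (t * i) + t * i
    l = solve 3 (λ c t i → t :* (((con 1ℚ) :+ c) :* i) := c :* (t :* i) :+ t :* i) refl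

  opaque
    -- The factor by which the colour accuracy is multiplied in the error; it is sealed, so that the
    -- sum over colour vectors is not unfolded.
    error-rate : ℕ → ℕ → ℚ
    error-rate s k' = ∑ᵛ {suc k'} s λ _ → nat s * nat (suc k')

    0≤error-rate : ∀ s k' → 0ℚ ≤ error-rate s k'
    0≤error-rate s k' = ∑ᵛ-nonneg s (0≤* (0≤nat s) (0≤nat (suc k')))
      where
      ∑ᵛ-nonneg : ∀ r {c} → 0ℚ ≤ c → 0ℚ ≤ ∑ᵛ {suc k'} r λ _ → c
      ∑ᵛ-nonneg zero h = h
      ∑ᵛ-nonneg (suc r) h = ∑-nonneg λ l → ∑ᵛ-nonneg r h

    error-rate-≡ : ∀ s k' ε → ∑ᵛ {suc k'} s (λ _ → nat s * (nat (suc k') * ε)) ≡ error-rate s k' * ε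
    error-rate-≡ s k' ε = trans (J-cong (∑ᵛ-linear s) λ _ → l (nat s) (nat (suc k')) ε) (trans (J-*ˡ (∑ᵛ-linear s) ε _) (*-comm ε _))
      where
      l : ∀ a b e → a * (b * e) ≡ e * (a * b)
      l = solve 3 (λ a b e → a :* (b :* e) := e :* (a :* b)) refl

  F7-density≥0 : ∀ {I k} (S : Str I k) a y z i x l m → 0ℚ ≤ Ops.F7-density S a y z i x l m
  F7-density≥0 S a y z i x l m = 𝔼-≥ (Str.d-Dist S a m) 0ℚ λ p₀ → Ops.density₀≥0 S a y z i x l m p₀

  copies : ∀ {A : Set} {k} → Str A k → Vec A 7 → ℚ
  copies S v = at (Ops.F7-density S) v + at (mirrored-density S) v

  copies≥0 : ∀ {A : Set} {k} (S : Str A k) v → 0ℚ ≤ copies S v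
  copies≥0 S v = 0≤+ (F7-density≥0 S _ _ _ _ _ _ _) (F7-density≥0 (reverse S) _ _ _ _ _ _ _)

  few-copies⇒sparse : ∀ {A : Set} {k m} (S : Str A k) (v : Vec A m) {ζ} → (∀ θ → copies S (select θ v) ≤ ζ) → ∀ θ →
    at₇ (Ops.F7-density (pullback (lookup v) S)) θ ≤ ζ × at₇ (λ a b c d e f g → Ops.F7-density (reverse (pullback (lookup v) S)) g f e d c b a) θ ≤ ζ
  few-copies⇒sparse S v {ζ} few θ = ≤-trans (le _ (F7-density≥0 (reverse S) (p 6F) (p 5F) (p 4F) (p 3F) (p 2F) (p 1F) (p 0F)) refl) few' ,
      ≤-trans (le _ (F7-density≥0 S (p 0F) (p 1F) (p 2F) (p 3F) (p 4F) (p 5F) (p 6F)) (+-comm _ _)) few'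
    where
    p : Fin 7 → _
    p i = lookup v (embed θ i)
    few' : copies S (tabulate p) ≤ ζ
    few' = subst (λ w → copies S w ≤ ζ) (select-tabulate θ v) (few θ)

  κ-pullback : ∀ {I J k} (S : Str I k) (ι : J → I) i j l → Ops.κ (pullback ι S) i j l ≡ Ops.κ S (ι i) (ι j) (ι l)
  κ-pullback S ι i j l = refl

  module Exceeding {d : ℚ} (¼<d : ¼ < d) (d≤1 : d ≤ 1ℚ) where

    u : ℚ
    -- The sampled cells have density at most ¼ + 192u, and the passage to weights costs 8u more: 6u
    -- from the density error, u from degenerate indices, u from degenerate vertices. As d = ¼ +
    -- 256u, a surplus of 56u is left.
    u = 1/256 * (d - ¼)

    0<u : 0ℚ < u
    0<u = 0<* 0<1/256 (diff< ¼<d)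

    16u≤1 : 16ᵣ * u ≤ 1ℚ
    16u≤1 = le (16ᵣ * 1/256 * (1ℚ - d) + (1ℚ - 16ᵣ * 1/256 * (1ℚ - ¼))) (0≤+ (0≤* (0≤* (<⇒≤ 0<16) (<⇒≤ 0<1/256)) (diff d≤1)) rest) (l d)
      where
      l : ∀ d → 1ℚ ≡ 16ᵣ * (1/256 * (d - ¼)) + (16ᵣ * 1/256 * (1ℚ - d) + (1ℚ - 16ᵣ * 1/256 * (1ℚ - ¼)))
      l = solve 1 (λ d →
        con 1ℚ
        := con 16ᵣ :* ((con 1/256) :* (d :- (con ¼))) :+ ((con 16ᵣ) :* (con 1/256) :* ((con 1ℚ) :- d) :+ ((con 1ℚ) :- (con 16ᵣ) :* (con 1/256) :* ((con 1ℚ) :- (con ¼))))) refl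
      rest : 0ℚ ≤ 1ℚ - 16ᵣ * 1/256 * (1ℚ - ¼)
      rest = ≤-trans (0≤* (<⇒≤ 0<⅛) 0≤1) (le (⅛ * (⅛ * (32ᵣ + 16ᵣ + 4ᵣ + 1ℚ))) (0≤* (<⇒≤ 0<⅛) (0≤* (<⇒≤ 0<⅛) (0≤+ (0≤+ (0≤+ (<⇒≤ 0<32) (<⇒≤ 0<16)) (<⇒≤ 0<4)) 0≤1))) (l₁ 0ℚ))
        where
        l₁ : ∀ x → 1ℚ - 16ᵣ * 1/256 * (1ℚ - ¼) ≡ ⅛ * 1ℚ + ⅛ * (⅛ * (32ᵣ + 16ᵣ + 4ᵣ + 1ℚ))
        l₁ = solve 1 (λ x →
          con 1ℚ :- (con 16ᵣ) :* (con 1/256) :* ((con 1ℚ) :- (con ¼))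
          := con ⅛ :* (con 1ℚ) :+ (con ⅛) :* ((con ⅛) :* ((con 32ᵣ) :+ (con 16ᵣ) :+ (con 4ᵣ) :+ (con 1ℚ)))) refl

    0≤d : 0ℚ ≤ d
    0≤d = ≤-trans (<⇒≤ 0<¼) (<⇒≤ ¼<d)

    module RS = Main u 0<u 16u≤1
    open Constants u 0<u 16u≤1 using (ζ; 0<ζ)

    64u ρ : ℚ
    64u = 64ᵣ * u
    ρ = ¼ + (64u + 64u) + 64u

    0<64u : 0ℚ < 64u
    0<64u = 0<* 0<64 0<u

    0≤ρ : 0ℚ ≤ ρ
    0≤ρ = 0≤+ (0≤+ (<⇒≤ 0<¼) (0≤+ (<⇒≤ 0<64u) (<⇒≤ 0<64u))) (<⇒≤ 0<64u)

    -- `suc L'` cells make the degenerate share `3 / L` at most `u`; `m` is the sample size from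
    -- which Ramsey's theorem extracts them.
    L' m : ℕ
    L' = proj₁ (archimedean 0<u (nat 3))
    m = RS.sample-size (suc L')

    3≤Lu : nat 3 ≤ nat (suc L') * u
    3≤Lu = ≤-trans (proj₂ (archimedean 0<u (nat 3))) (*-monoˡ u (<⇒≤ 0<u) (nat-mono (ℕₚ.n≤1+n L')))

    K₇ K₃ Z Y : ℚ
    K₇ = thinnings 7 m
    K₃ = thinnings 3 m
    Z = inv 0<ζ
    Y = inv 0<64u

    0≤K₇ : 0ℚ ≤ K₇
    0≤K₇ = ∑ᵗ-nonneg 7 m λ _ → 0≤1
    0≤K₃ : 0ℚ ≤ K₃
    0≤K₃ = ∑ᵗ-nonneg 3 m λ _ → 0≤1
    0≤Z : 0ℚ ≤ Z
    0≤Z = <⇒≤ (inv-pos 0<ζ)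
    0≤Y : 0ℚ ≤ Y
    0≤Y = <⇒≤ (inv-pos 0<64u)

    triangle-cost colour-cost₇ colour-cost₃ : ℕ → ℚ
    triangle-cost _ = K₇ * (Z * (nat 10 + nat 10))
    colour-cost₇ k' = K₇ * (Z * (error-rate 21 k' + error-rate 21 k'))
    colour-cost₃ k' = K₃ * (Y * error-rate 3 k')

    0≤colour-cost₇ : ∀ k' → 0ℚ ≤ colour-cost₇ k'
    0≤colour-cost₇ k' = 0≤* 0≤K₇ (0≤* 0≤Z (0≤+ (0≤error-rate 21 k') (0≤error-rate 21 k')))
    0≤colour-cost₃ : ∀ k' → 0ℚ ≤ colour-cost₃ k'
    0≤colour-cost₃ k' = 0≤* 0≤K₃ (0≤* 0≤Y (0≤error-rate 3 k'))

    -- The expected number of failures of a sample has three sources, each brought to at most ⅛: the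
    -- triangle error, the colour errors and the small cells. The colour accuracy may depend on the
    -- number of colours, and the mass bound `s` is chosen after the bound on the number of cells.
    tiny₁ = tiny {triangle-cost 0} {⅛} (0≤* 0≤K₇ (0≤* 0≤Z (0≤+ (0≤nat 10) (0≤nat 10)))) 0<⅛
    ε₁ : ℚ
    ε₁ = proj₁ tiny₁
    0<ε₁ : 0ℚ < ε₁
    0<ε₁ = proj₁ (proj₂ tiny₁)

    tiny₂ : ∀ k' → Σ ℚ λ ε → 0ℚ < ε × (colour-cost₇ k' + colour-cost₃ k') * ε ≤ ⅛
    tiny₂ k' = tiny (0≤+ (0≤colour-cost₇ k') (0≤colour-cost₃ k')) 0<⅛
    ε₂ : ℕ → ℚ
    ε₂ k' = proj₁ (tiny₂ k')
    0<ε₂ : ∀ k' → 0ℚ < ε₂ k'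
    0<ε₂ k' = proj₁ (proj₂ (tiny₂ k'))

    Mmax : ℕ
    Mmax = Bound.max-cells ε₂ 0<ε₂ 0<ε₁

    tiny₃ = tiny {nat m * nat Mmax} {⅛} (0≤* (0≤nat m) (0≤nat Mmax)) 0<⅛
    s : ℚ
    s = proj₁ tiny₃
    0<s : 0ℚ < s
    0<s = proj₁ (proj₂ tiny₃)

    s³ : ℚ
    s³ = s * (s * s)
    0<s³ : 0ℚ < s³
    0<s³ = 0<* 0<s (0<* 0<s 0<s)

    0<us³ : 0ℚ < u * s³
    0<us³ = 0<* 0<u 0<s³

    -- A successor, so that the vertex set is nonempty and carries a uniform measure; its size makes
    -- the degenerate triples negligible against `u s³ N³`.
    n₀ : ℕ
    n₀ = suc (proj₁ (archimedean 0<us³ (nat 3)))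

    module Regularised {n' : ℕ} (large : nat 3 ≤ nat (suc n') * (u * s³)) (H : Graph3 (suc n')) (free : F7-free H) (dense : Dense d (u * s³) H)
      {k' M : ℕ} (M≤ : M ℕ.≤ Mmax) (P : V n' → V n' → Fin (suc k')) (Q : V n' → Fin M)
      (creg : Colours.Colour-regular n' P (ε₂ k') Q)
      (treg : Triples.Triangle-regular n' (indicator³ (Kernel.kernel H)) (indicator³-Unit (Kernel.kernel H)) ε₁ P Q) where

      open Kernel H using (kernel; swap₁₂; swap₂₃; flip; no-pattern)
      open WithRegular n' kernel P Q ε₁ (ε₂ k') (<⇒≤ 0<ε₁) creg treg using (S; few-copies; few-mirrored-copies; cell-density; cell-density-Unit; cell-density-≡; cell-κ; densities-agree; module Pr)
      open Space (μ n')
      open Tuples (μ n')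
      open Sampling (μ n')

      F : Vec (V n') 7 → ℚ
      F v = Z * copies S v

      bad : Fin M → Fin M → Fin M → Bool
      bad a c e = not (cell-density a c e ⊑ cell-κ a c e + 64u)

      G : Vec (V n') 3 → ℚ
      G v = ⟦ bad (Q (lookup v (# 0))) (Q (lookup v (# 1))) (Q (lookup v (# 2))) ⟧

      mass : Fin M → ℚ
      mass j = ∫ λ x → ⟦ Q x ≡ᶠ j ⟧

      small : Fin M → Bool
      small j = not (s ⊑ mass j)

      h : V n' → ℚ
      h x = ⟦ small (Q x) ⟧

      error-≡ : ∀ r t → Pr.error r t ≡ error-rate t k' * ε₂ k'
      error-≡ r t = error-rate-≡ t k' (ε₂ k')

      ∫F : ∫ᵛ 7 F ≤ Z * ((nat 10 * ε₁ + error-rate 21 k' * ε₂ k') + (nat 10 * ε₁ + error-rate 21 k' * ε₂ k'))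
      ∫F = ≤-trans (≤-reflexive (trans (T.∫-*ˡ 7 Z (copies S)) (cong (Z *_) (T.∫-+ 7 (at (Ops.F7-density S)) (at (mirrored-density S))))))
        (*-monoʳ Z 0≤Z (subst (λ e → ∫ᵛ 7 (at (Ops.F7-density S)) + ∫ᵛ 7 (at (mirrored-density S)) ≤ (nat 10 * ε₁ + e) + (nat 10 * ε₁ + e)) (error-≡ 7 21)
          (+-mono-≤ (few-copies (no-pattern free)) (few-mirrored-copies (no-pattern free) flip))))

      τ : Fin M → Fin M → Fin M → ℚ
      τ a c e = ⟦ bad a c e ⟧

      ∫∫∫ : (V n' → V n' → V n' → ℚ) → ℚ
      ∫∫∫ f = ∫ λ x → ∫ λ y → ∫ λ z → f x y z

      -- Markov's inequality: on a bad triple of cells the density exceeds `cell-κ` by more than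
      -- `64u`, whereas `densities-agree` bounds the integrated excess by the colour error.
      ∫G : ∫∫∫ (λ x y z → τ (Q x) (Q y) (Q z)) ≤ Y * (error-rate 3 k' * ε₂ k')
      ∫G = cancelˡ 64u 0<64u (≤-trans (le _ (diff markov) (l (64u * ∫∫∫ τQ) (∫∫∫ κQ) e)) (≤-reflexive (trans (sym (*-identityˡ e)) (trans (cong (_* e) (sym (*-inv 0<64u))) (*-assoc 64u Y e)))))
        where
        e : ℚ
        e = error-rate 3 k' * ε₂ k'
        τQ κQ : V n' → V n' → V n' → ℚ
        τQ x y z = τ (Q x) (Q y) (Q z)
        κQ x y z = cell-κ (Q x) (Q y) (Q z) * τ (Q x) (Q y) (Q z)
        l : ∀ t k e → e ≡ t + (k + e - (k + t))
        l = solve 3 (λ t k e → e := t :+ (k :+ e :- (k :+ t))) refl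
        pt : ∀ a c e → cell-κ a c e * τ a c e + 64u * τ a c e ≤ cell-density a c e * τ a c e
        pt a c e = go (cell-density a c e ⊑ cell-κ a c e + 64u) refl
          where
          l₂ : ∀ k s t → k * t + s * t ≡ (k + s) * t
          l₂ = solve 3 (λ k s t → k :* t :+ s :* t := (k :+ s) :* t) refl
          go : ∀ b → (cell-density a c e ⊑ cell-κ a c e + 64u) ≡ b → cell-κ a c e * ⟦ not b ⟧ + 64u * ⟦ not b ⟧ ≤ cell-density a c e * ⟦ not b ⟧
          go true eq = ≤-reflexive (l₁ (cell-κ a c e) 64u (cell-density a c e))
            where
            l₁ : ∀ k s c → k * 0ℚ + s * 0ℚ ≡ c * 0ℚ
            l₁ = solve 3 (λ k s c → k :* (con 0ℚ) :+ s :* (con 0ℚ) := c :* (con 0ℚ)) refl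
          go false eq = ≤-trans (≤-reflexive (l₂ (cell-κ a c e) 64u 1ℚ)) (*-monoˡ 1ℚ 0≤1 (<⇒≤ (⊑-false eq)))
        markov : ∫∫∫ κQ + 64u * ∫∫∫ τQ ≤ ∫∫∫ κQ + e
        markov = ≤-trans (≤-reflexive (sym (trans (∫-cong λ x → trans (∫-cong λ y → ∫-+ _ _) (∫-+ _ _)) (trans (∫-+ _ _)
            (cong (∫∫∫ κQ +_) (trans (∫-cong λ x → trans (∫-cong λ y → ∫-*ˡ 64u _) (∫-*ˡ 64u _)) (∫-*ˡ 64u _)))))))
          (≤-trans (∫-mono λ x → ∫-mono λ y → ∫-mono λ z → pt (Q x) (Q y) (Q z))
            (≤-trans (densities-agree τ λ a c e → Unit⟦⟧ (bad a c e)) (≤-reflexive (cong (∫∫∫ κQ +_) (error-≡ 3 3)))))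

      ∫h : ∫ h ≤ nat Mmax * s
      ∫h = ≤-trans (≤-reflexive (trans (∫-cong λ x → sym (∑-≡ᶠ (Q x) (λ j → ⟦ small j ⟧))) (trans (sym (linear-∑ linear λ j x → ⟦ Q x ≡ᶠ j ⟧ * ⟦ small j ⟧)) (∑-cong λ j → ∫-*ʳ ⟦ small j ⟧ _))))
        (≤-trans (∑-mono bound) (≤-trans (≤-reflexive (∑-const s)) (*-monoˡ s (<⇒≤ 0<s) (nat-mono M≤))))
        where
        bound : ∀ j → mass j * ⟦ small j ⟧ ≤ s
        bound j = go (s ⊑ mass j) refl
          where
          go : ∀ b → (s ⊑ mass j) ≡ b → mass j * ⟦ not b ⟧ ≤ s
          go true eq = ≤-trans (≤-reflexive (zeroʳ _)) (<⇒≤ 0<s)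
          go false eq = ≤-trans (≤-reflexive (*-identityʳ _)) (<⇒≤ (⊑-false eq))

      rare : K₇ * ∫ᵛ 7 F + (K₃ * ∫∫∫ (λ x y z → τ (Q x) (Q y) (Q z)) + nat m * ∫ h) < 1ℚ
      rare = ≤-<-trans (+-mono-≤ (*-monoʳ K₇ 0≤K₇ ∫F) (+-mono-≤ (*-monoʳ K₃ 0≤K₃ ∫G) (*-monoʳ (nat m) (0≤nat m) ∫h)))
        (≤-<-trans (≤-reflexive (l K₇ Z (nat 10) ε₁ (error-rate 21 k') (ε₂ k') K₃ Y (error-rate 3 k') (nat m) (nat Mmax) s))
          (≤-<-trans (+-mono-≤ (proj₂ (proj₂ tiny₁)) (+-mono-≤ (proj₂ (proj₂ (tiny₂ k'))) (proj₂ (proj₂ tiny₃)))) (lt (⅛ + (½ * 1ℚ)) (0<+ 0<⅛ (0≤* (<⇒≤ 0<½) 0≤1)) (l' 0ℚ))))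
        where
        l : ∀ K Z t e E f B Y D m M s → K * (Z * ((t * e + E * f) + (t * e + E * f))) + (B * (Y * (D * f)) + m * (M * s)) ≡
          K * (Z * (t + t)) * e + ((K * (Z * (E + E)) + B * (Y * D)) * f + m * M * s)
        l = solve 12 (λ K Z t e E f B Y D m M s →
          K :* (Z :* ((t :* e :+ E :* f) :+ (t :* e :+ E :* f))) :+ (B :* (Y :* (D :* f)) :+ m :* (M :* s))
          := K :* (Z :* (t :+ t)) :* e :+ ((K :* (Z :* (E :+ E)) :+ B :* (Y :* D)) :* f :+ m :* M :* s)) refl
        l' : ∀ x → 1ℚ ≡ ⅛ + (⅛ + ⅛) + (⅛ + (½ * 1ℚ))
        l' = solve 1 (λ x → con 1ℚ := con ⅛ :+ ((con ⅛) :+ (con ⅛)) :+ ((con ⅛) :+ ((con ½) :* (con 1ℚ)))) refl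

      module Sampled (v : Vec (V n') m) (hF : ∀ θ → F (select θ v) < 1ℚ) (hG : ∀ θ → G (select θ v) < 1ℚ) (hh : ∀ i → h (lookup v i) < 1ℚ) where

        S' : Str (Fin m) (suc k')
        S' = pullback (lookup v) S

        few : ∀ θ → copies S (select θ v) ≤ ζ
        few θ = ≤-trans (≤-reflexive (trans (sym (*-identityˡ _)) (trans (cong (_* copies S (select θ v)) (sym (*-inv 0<ζ))) (*-assoc ζ Z _))))
          (≤-trans (*-monoʳ ζ (<⇒≤ 0<ζ) (<⇒≤ (hF θ))) (≤-reflexive (*-identityʳ ζ)))

        sparse : RS.F7-sparse S'
        sparse = few-copies⇒sparse S v few

        low : Σ (Thin (suc L') m) λ Θ → ∀ χ → at₃ (Ops.κ S') (χ ⨟ Θ) < ¼ + (64u + 64u)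
        low = RS.low-density (suc L') S' sparse

        Θ : Thin (suc L') m
        Θ = proj₁ low

        p : Fin (suc L') → V n'
        p i = lookup v (embed Θ i)

        mass-large : ∀ i → s ≤ mass (Q (p i))
        mass-large i = ⊑-true (go (s ⊑ mass (Q (p i))) (hh (embed Θ i)))
          where
          go : ∀ b → ⟦ not b ⟧ < 1ℚ → b ≡ true
          go true _ = refl
          go false h = ⊥-elim (<-irrefl refl h)

        -- `low-density` puts `κ` below ¼ + 128u, and since no sampled triple of cells is bad, the
        -- true density is larger by at most `64u`.
        cells-sparse : ∀ i j l → (i ≺ j) ≡ true → (j ≺ l) ≡ true → cell-density (Q (p i)) (Q (p j)) (Q (p l)) ≤ ρ
        cells-sparse i j l ij jl = ≤-trans (⊑-true (go (c ⊑ κ + 64u) good)) (+-monoˡ-≤ 64u (<⇒≤ κ-small))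
          where
          c κ : ℚ
          c = cell-density (Q (p i)) (Q (p j)) (Q (p l))
          κ = cell-κ (Q (p i)) (Q (p j)) (Q (p l))
          indices : Fin 3 → Fin (suc L')
          indices = lookup (i ∷ j ∷ l ∷ [])
          χ : Thin 3 (suc L')
          χ = proj₁ (sub Θ {indices} (step ij (step jl last)))
          χ-≡ : ∀ t → embed (χ ⨟ Θ) t ≡ embed Θ (indices t)
          χ-≡ = proj₂ (sub Θ {indices} (step ij (step jl last)))
          κ-small : κ < ¼ + (64u + 64u)
          κ-small = subst (_< ¼ + (64u + 64u)) (trans (at₃-≡ (Ops.κ S') {χ ⨟ Θ} (χ-≡ 0F) (χ-≡ 1F) (χ-≡ 2F)) (κ-pullback S (lookup v) (embed Θ i) (embed Θ j) (embed Θ l))) (proj₂ low χ)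
          good : ⟦ not (c ⊑ κ + 64u) ⟧ < 1ℚ
          good = subst (_< 1ℚ) (at₃-≡ (λ a b e → ⟦ bad (Q (lookup v a)) (Q (lookup v b)) (Q (lookup v e)) ⟧) {χ ⨟ Θ} (χ-≡ 0F) (χ-≡ 1F) (χ-≡ 2F))
            (subst (λ w → G w < 1ℚ) (select-tabulate (χ ⨟ Θ) v) (hG (χ ⨟ Θ)))
          go : ∀ b → ⟦ not b ⟧ < 1ℚ → b ≡ true
          go true _ = refl
          go false h = ⊥-elim (<-irrefl refl h)

        module B = Blowup (μ n') Q (λ x y z → ⟦ kernel x y z ⟧) (λ x y z → cong ⟦_⟧ (swap₁₂ x y z)) (λ x y z → cong ⟦_⟧ (swap₂₃ x y z))
          cell-density cell-density-Unit cell-density-≡ p 0<s 0≤ρ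

        f : V n' → ℚ
        f = B.f mass-large cells-sparse

        N I t X : ℚ
        N = nat (suc n')
        I = ∫∫∫ λ x y z → ⟦ kernel x y z ⟧ * (f x * (f y * f z))
        t = nat 3 * B.1/L
        X = N * (N * N) * s³

        0<N : 0ℚ < N
        0<N = 0<nat n'

        sparse-integral : I ≤ s³ * (ρ + t)
        sparse-integral = B.few-triples mass-large cells-sparse

        dense-integral : d * (X - nat 3 * (N * N)) ≤ N * (N * N) * I + (4ᵣ + 2ᵣ) * (u * s³ * (N * (N * N)))
        dense-integral = subst (λ a → d * (N * (N * N) * (a * (a * a)) - nat 3 * (N * N)) ≤ N * (N * N) * I + (4ᵣ + 2ᵣ) * (u * s³ * (N * (N * N)))) (B.∫-f mass-large cells-sparse)
          (Weighted.dense-integral H 0≤d dense f (B.f-Unit mass-large cells-sparse))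

        t≤u : t ≤ u
        t≤u = ≤-trans (*-monoˡ B.1/L B.0≤1/L 3≤Lu) (≤-reflexive (trans (l B.L u B.1/L) (trans (cong (_* u) (*-inv (0<nat L'))) (*-identityˡ u))))
          where
          l : ∀ a u i → a * u * i ≡ a * i * u
          l = solve 3 (λ a u i → a :* u :* i := a :* i :* u) refl

        contradiction : ⊥
        -- `total` is a sum of nonnegative terms, yet by the ring identities it equals
        -- `X (8u + ρ - d) = -56 u X`.
        contradiction = no< total≥0 (lt ((32ᵣ + 16ᵣ + 8ᵣ) * u * X) positive (sym (trans (cong (_+ (32ᵣ + 16ᵣ + 8ᵣ) * u * X) (l₁ d (nat 3) N s³ I u t ρ)) (trans (cong (λ e → X * e + (32ᵣ + 16ᵣ + 8ᵣ) * u * X) (l₂ d)) (l₃ X u)))))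
          where
          total : ℚ
          total = (N * (N * N) * I + (4ᵣ + 2ᵣ) * (u * s³ * (N * (N * N))) - d * (X - nat 3 * (N * N))) + (N * (N * N) * (s³ * (ρ + t) - I) +
            (X * (u - t) + ((1ℚ - d) * (nat 3 * (N * N)) + N * N * (N * (u * s³) - nat 3))))
          0≤NN : 0ℚ ≤ N * N
          0≤NN = 0≤sq N
          0<NNN : 0ℚ < N * (N * N)
          0<NNN = 0<* 0<N (0<* 0<N 0<N)
          0<X : 0ℚ < X
          0<X = 0<* 0<NNN 0<s³
          positive : 0ℚ < (32ᵣ + 16ᵣ + 8ᵣ) * u * X
          positive = 0<* (0<* (0<+ (0<+ 0<32 (<⇒≤ 0<16)) (<⇒≤ 0<8)) 0<u) 0<X
          total≥0 : 0ℚ ≤ total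
          total≥0 = 0≤+ (diff dense-integral) (0≤+ (0≤* (<⇒≤ 0<NNN) (diff sparse-integral)) (0≤+ (0≤* (<⇒≤ 0<X) (diff t≤u))
            (0≤+ (0≤* (diff d≤1) (0≤* (0≤nat 3) 0≤NN)) (0≤* 0≤NN (diff large)))))
          l₁ : ∀ d c N s I u t r → (N * (N * N) * I + (4ᵣ + 2ᵣ) * (u * s * (N * (N * N))) - d * (N * (N * N) * s - c * (N * N))) + (N * (N * N) * (s * (r + t) - I) +
            (N * (N * N) * s * (u - t) + ((1ℚ - d) * (c * (N * N)) + N * N * (N * (u * s) - c)))) ≡ N * (N * N) * s * (8ᵣ * u + r - d)
          l₁ = solve 8 (λ d c N s I u t r →
            (N :* (N :* N) :* I :+ ((con 4ᵣ) :+ (con 2ᵣ)) :* (u :* s :* (N :* (N :* N))) :- d :* (N :* (N :* N) :* s :- c :* (N :* N))) :+ (N :* (N :* N) :* (s :* (r :+ t) :- I) :+ (N :* (N :* N) :* s :* (u :- t) :+ (((con 1ℚ) :- d) :* (c :* (N :* N)) :+ N :* N :* (N :* (u :* s) :- c))))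
            := N :* (N :* N) :* s :* ((con 8ᵣ) :* u :+ r :- d)) refl
          l₂ : ∀ d → 8ᵣ * (1/256 * (d - ¼)) + (¼ + (64ᵣ * (1/256 * (d - ¼)) + 64ᵣ * (1/256 * (d - ¼))) + 64ᵣ * (1/256 * (d - ¼))) - d ≡ - ((32ᵣ + 16ᵣ + 8ᵣ) * (1/256 * (d - ¼)))
          l₂ = solve 1 (λ d →
            con 8ᵣ :* ((con 1/256) :* (d :- (con ¼))) :+ ((con ¼) :+ ((con 64ᵣ) :* ((con 1/256) :* (d :- (con ¼))) :+ (con 64ᵣ) :* ((con 1/256) :* (d :- (con ¼)))) :+ (con 64ᵣ) :* ((con 1/256) :* (d :- (con ¼)))) :- d
            := :- (((con 32ᵣ) :+ (con 16ᵣ) :+ (con 8ᵣ)) :* ((con 1/256) :* (d :- (con ¼))))) refl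
          l₃ : ∀ X u → X * (- ((32ᵣ + 16ᵣ + 8ᵣ) * u)) + (32ᵣ + 16ᵣ + 8ᵣ) * u * X ≡ 0ℚ
          l₃ = solve 2 (λ X u →
            X :* (:- (((con 32ᵣ) :+ (con 16ᵣ) :+ (con 8ᵣ)) :* u)) :+ ((con 32ᵣ) :+ (con 16ᵣ) :+ (con 8ᵣ)) :* u :* X
            := con 0ℚ) refl

      contradiction : ⊥
      contradiction = first-moment {7} {3} m F G h (λ v → 0≤* 0≤Z (copies≥0 S v)) (λ v → 0≤⟦⟧ (bad _ _ _)) (λ x → 0≤⟦⟧ (small (Q x))) rare
        λ { (v , hF , hG , hh) → Sampled.contradiction v hF hG hh }

    not-achievable : ¬ Achievable d
    not-achievable achievable = go (achievable (u * s³) 0<us³ n₀)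
      where
      finish : ∀ n → n ℕ.≥ n₀ → (H : Graph3 n) → F7-free H → Dense d (u * s³) H → ⊥
      finish (suc n') (ℕ.s≤s n≥) H free dense = Triples.regularity n' (indicator³ (Kernel.kernel H)) (indicator³-Unit (Kernel.kernel H)) ε₂ 0<ε₂ 0<ε₁
        λ { (k' , M , M≤ , P , Q , creg , treg) → Regularised.contradiction large H free dense M≤ P Q creg treg }
        where
        large : nat 3 ≤ nat (suc n') * (u * s³)
        large = ≤-trans (proj₂ (archimedean 0<us³ (nat 3))) (*-monoˡ (u * s³) (<⇒≤ 0<us³) (nat-mono (ℕₚ.m≤n⇒m≤1+n n≥)))
      go : Σ ℕ (λ n → n ℕ.≥ n₀ × Σ (Graph3 n) λ H → F7-free H × Dense d (u * s³) H) → ⊥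
      go (n , n≥ , H , free , dense) = finish n n≥ H free dense

open import Defs
open import Data.Integer using (+_)
open import Data.Rational using (ℚ; _/_)

theorem1p5 : πu-F7-is (+ 1 / 4)
theorem1p5 = Lower.quarter-achievable , λ d ¼<d d≤1 → Upper.Exceeding.not-achievable ¼<d d≤1
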